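{- Let $D<-4$ be the discriminant of an imaginary quadratic field with $D\equiv1\pmod4$ and $3\nmid D$. Let $N=|D|$, $\chi=\chi_D$, $h=h(D)$, and for $0\le k\le5$ let $$E_k(12)=\sum_{\frac{kN}{12}<x<\frac{(k+1)N}{12}}\chi(x),\qquad E_0=E_0(12).$$ Then: - if $N\equiv23\pmod{24}$: $E_1(12)=h-E_0$, $E_2(12)=0$, $E_3(12)=0$, $E_4(12)=h-E_0$, $E_5(12)=-h+E_0$; - if $N\equiv11\pmod{24}$: $E_1(12)=h-E_0$, $E_2(12)=-h$, $E_3(12)=h$, $E_4(12)=h-E_0$, $E_5(12)=h+E_0$; - if $N\equiv7\pmod{24}$: $E_1(12)=h-E_0$, $E_2(12)=0$, $E_3(12)=h$, $E_4(12)=-E_0$, $E_5(12)=-h+E_0$; - if $N\equiv19\pmod{24}$: $E_1(12)=-h-E_0$, $E_2(12)=h$, $E_3(12)=2h$, $E_4(12)=2h-E_0$, $E_5(12)=-h+E_0$.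
   Context: Here $D\equiv 1\pmod 4$ is a negative square-free integer, the discriminant of $K=\mathbb{Q}(\sqrt D)$; $h(D)$ is the order of the ideal class group of $K$; and $\chi_D(x)=\left(\frac{x}{N}\right)$ is the Jacobi symbol (equal to $0$ when $\gcd(x,N)>1$). Sums are over integers $x$ with $1\le x\le N$ and $\gcd(x,N)=1$ in the indicated open intervals. -}

module Defs where

open import Data.Bool.Base using (if_then_else_)
open import Data.Fin.Base using (Fin; toℕ)
open import Data.Fin.Properties using (any?)
open import Data.Integer.Base as ℤ using (ℤ; 0ℤ; 1ℤ; -1ℤ; ∣_∣)
open import Data.List.Base using (List; []; _∷_; map; filter; foldr; upTo)
open import Data.List.Relation.Unary.Any using (Any)
open import Data.Nat.Base using (ℕ; zero; suc; _*_; ∣_-_∣)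
open import Data.Nat.Coprimality using (coprime?)
open import Data.Nat.Divisibility using (_∣_; _∣?_)
open import Data.Nat.Primality.Factorisation using (factors; factorise)
open import Data.Nat.Properties using (_<?_)
open import Data.Product.Base using (∃-syntax; _×_; _,_)
open import Data.Rational.Base as ℚ using (ℚ; 0ℚ; 1ℚ)
open import Data.Rational.Solver using (module +-*-Solver)
open import Function.Bundles using (Bijection; _⇔_; mk⇔; Equivalence)
open import Level using (0ℓ)
open import Relation.Binary.Bundles using (Setoid)
open import Relation.Binary.PropositionalEquality
  using (_≡_; _≢_; refl; sym; trans; cong; cong₂; subst; setoid)
open import Relation.Nullary.Decidable using (⌊_⌋; _×-dec_)

------------------------------------------------------------------------
-- Arithmetic

SquareFree : ℤ → Set
SquareFree n = ∀ d → d * d ∣ ∣ n ∣ → d ≡ 1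

-- Only meaningful for odd primes p.
legendre : ℕ → ℕ → ℤ
legendre x p =
  if ⌊ p ∣? x ⌋ then 0ℤ
  else if ⌊ any? (λ (y : Fin p) → p ∣? ∣ toℕ y * toℕ y - x ∣) ⌋ then 1ℤ
  else -1ℤ

productℤ : List ℤ → ℤ
productℤ = foldr ℤ._*_ 1ℤ

sumℤ : List ℤ → ℤ
sumℤ = foldr ℤ._+_ 0ℤ

-- Only meaningful for odd n; the value at n = 0 is a dummy.  The prime
-- factors are listed with multiplicity.
jacobi : ℕ → ℕ → ℤ
jacobi x zero      = 0ℤ
jacobi x n@(suc _) = productℤ (map (legendre x) (factors (factorise n)))

χ : ℤ → ℕ → ℤ
χ D x = jacobi x ∣ D ∣

-- The x with 1 ≤ x ≤ N, gcd(x, N) = 1 and kN/m < x < (k+1)N/m, the last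
-- condition being cleared of denominators.
coprimesInInterval : (N m k : ℕ) → List ℕ
coprimesInInterval N m k =
  filter (λ x → coprime? x N ×-dec (k * N <? m * x) ×-dec (m * x <? suc k * N))
         (map suc (upTo N))

-- E D m k is E_k(m), formed with N = |D| and χ_D.
E : (D : ℤ) (m k : ℕ) → ℤ
E D m k = sumℤ (map (χ D) (coprimesInInterval ∣ D ∣ m k))

------------------------------------------------------------------------
-- The field ℚ(√D) and its ideal class group

-- The definitions make sense for every D, but K is a field (and the names
-- below are justified) only when D is not a square.
module QuadraticField (D : ℤ) where

  infixl 7 _*K_
  infixl 6 _+K_

  -- a +√D b stands for a + b√D.
  record K : Set where
    constructor _+√D_
    field
      re im : ℚ

  fromℚ : ℚ → K
  fromℚ a = a +√D 0ℚ

  fromℤ : ℤ → K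
  fromℤ n = fromℚ (n ℚ./ 1)

  0K 1K : K
  0K = fromℚ 0ℚ
  1K = fromℚ 1ℚ

  _+K_ : K → K → K
  (a +√D b) +K (c +√D d) = (a ℚ.+ c) +√D (b ℚ.+ d)

  _*K_ : K → K → K
  (a +√D b) *K (c +√D d) =
    (a ℚ.* c ℚ.+ (D ℚ./ 1) ℚ.* (b ℚ.* d)) +√D (a ℚ.* d ℚ.+ b ℚ.* c)

  -- evalMonic (c₀ ∷ … ∷ cₙ₋₁ ∷ []) x = c₀ + c₁ x + … + cₙ₋₁ xⁿ⁻¹ + xⁿ
  evalMonic : List ℤ → K → K
  evalMonic []       x = 1K
  evalMonic (c ∷ cs) x = fromℤ c +K x *K evalMonic cs x

  -- Membership in the ring of integers of K.
  IsIntegral : K → Set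
  IsIntegral x = ∃[ cs ] evalMonic cs x ≡ 0K

  -- x lies in the submodule over the ring of integers spanned by the list.
  _∈Span_ : K → List K → Set
  x ∈Span []       = x ≡ 0K
  x ∈Span (g ∷ gs) =
    ∃[ r ] ∃[ y ] IsIntegral r × y ∈Span gs × x ≡ r *K g +K y

  -- A fractional ideal is a nonzero finitely generated submodule of K over
  -- the ring of integers, presented by a finite generating list.  Different
  -- lists may present the same ideal; _∼_ below depends only on the span.
  record FractionalIdeal : Set where
    field
      generators : List K
      nonzero    : Any (_≢ 0K) generators

  open FractionalIdeal public

  _∈I_ : K → FractionalIdeal → Set
  x ∈I I = x ∈Span generators I

  -- Equality of ideal classes: J = u I for some u ∈ K^× with inverse v,
  -- i.e. I and J differ by the principal fractional ideal (u).
  _∼_ : FractionalIdeal → FractionalIdeal → Set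
  I ∼ J = ∃[ u ] ∃[ v ] u *K v ≡ 1K × (∀ x → x ∈I I ⇔ (u *K x) ∈I J)

  open +-*-Solver using (solve; con; _:+_; _:*_; _:=_)

  *K-assoc : ∀ x y z → (x *K y) *K z ≡ x *K (y *K z)
  *K-assoc (a +√D b) (c +√D d) (e +√D f) = cong₂ _+√D_
    (solve 7 (λ a b c d e f δ →
        (a :* c :+ δ :* (b :* d)) :* e :+ δ :* ((a :* d :+ b :* c) :* f)
        := a :* (c :* e :+ δ :* (d :* f)) :+ δ :* (b :* (c :* f :+ d :* e)))
      refl a b c d e f (D ℚ./ 1))
    (solve 7 (λ a b c d e f δ →
        (a :* c :+ δ :* (b :* d)) :* f :+ (a :* d :+ b :* c) :* e
        := a :* (c :* f :+ d :* e) :+ b :* (c :* e :+ δ :* (d :* f)))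
      refl a b c d e f (D ℚ./ 1))

  *K-comm : ∀ x y → x *K y ≡ y *K x
  *K-comm (a +√D b) (c +√D d) = cong₂ _+√D_
    (solve 5 (λ a b c d δ →
        a :* c :+ δ :* (b :* d) := c :* a :+ δ :* (d :* b))
      refl a b c d (D ℚ./ 1))
    (solve 4 (λ a b c d → a :* d :+ b :* c := c :* b :+ d :* a)
      refl a b c d)

  *K-identityˡ : ∀ x → 1K *K x ≡ x
  *K-identityˡ (a +√D b) = cong₂ _+√D_
    (solve 3 (λ a b δ → con 1ℚ :* a :+ δ :* (con 0ℚ :* b) := a)
      refl a b (D ℚ./ 1))
    (solve 2 (λ a b → con 1ℚ :* b :+ con 0ℚ :* a := b) refl a b)

  cancel : ∀ u v → u *K v ≡ 1K → ∀ x → u *K (v *K x) ≡ x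
  cancel u v uv≡1 x =
    trans (sym (*K-assoc u v x)) (trans (cong (_*K x) uv≡1) (*K-identityˡ x))

  ∼-refl : ∀ {I} → I ∼ I
  ∼-refl {I} = 1K , 1K , *K-identityˡ 1K , λ x →
    mk⇔ (subst (_∈I I) (sym (*K-identityˡ x))) (subst (_∈I I) (*K-identityˡ x))

  ∼-sym : ∀ {I J} → I ∼ J → J ∼ I
  ∼-sym {I} {J} (u , v , uv≡1 , I⇔J) = v , u , trans (*K-comm v u) uv≡1 , λ x →
    mk⇔ (λ x∈J → Equivalence.from (I⇔J (v *K x))
                   (subst (_∈I J) (sym (cancel u v uv≡1 x)) x∈J))
        (λ vx∈I → subst (_∈I J) (cancel u v uv≡1 x) (Equivalence.to (I⇔J (v *K x)) vx∈I))

  ∼-trans : ∀ {I J L} → I ∼ J → J ∼ L → I ∼ L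
  ∼-trans {I} {J} {L} (u , v , uv≡1 , I⇔J) (s , t , st≡1 , J⇔L) =
    s *K u , v *K t , su*vt≡1 , λ x →
      mk⇔ (λ x∈I → subst (_∈I L) (sym (*K-assoc s u x))
                     (Equivalence.to (J⇔L (u *K x)) (Equivalence.to (I⇔J x) x∈I)))
          (λ sux∈L → Equivalence.from (I⇔J x) (Equivalence.from (J⇔L (u *K x))
                       (subst (_∈I L) (*K-assoc s u x) sux∈L)))
    where
    su*vt≡1 : (s *K u) *K (v *K t) ≡ 1K
    su*vt≡1 = trans (*K-assoc s u (v *K t))
                    (trans (cong (s *K_) (cancel u v uv≡1 t)) st≡1)

  -- The underlying set of the ideal class group.
  idealClasses : Setoid 0ℓ 0ℓ
  idealClasses = record
    { Carrier       = FractionalIdeal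
    ; _≈_           = _∼_
    ; isEquivalence = record
      { refl  = λ {I} → ∼-refl {I}
      ; sym   = λ {I} {J} → ∼-sym {I} {J}
      ; trans = λ {I} {J} {L} → ∼-trans {I} {J} {L}
      }
    }

-- h is the order of the ideal class group of ℚ(√D).
IsClassNumber : ℤ → ℕ → Set
IsClassNumber D h = Bijection (setoid (Fin h)) (QuadraticField.idealClasses D)

{-# OPTIONS --safe #-}
module Submission where

-- Let ε = χ(2), let r(n) = Σ_{d ∣ n} χ(d) be the number of ideals of norm n, and let Q₁, …, Q_h be the norm forms of
-- representatives of the ideal classes.  Counting lattice vectors by their values gives, for w of finite support,
-- Σ_j Σ_{v ∈ ℤ²} w(Q_j(v)) = h w(0) + 2 Σ_n r(n) w(n).  Take w(n) = g(n) max(Y - n, 0)² with g(n) = 2 - ε for even n and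
-- - 2 - ε for odd n.  The signs then alternate along the lines of ℤ², so the left side is O(Y^{3/2}); and
-- g(n) r(n) = Σ_{de = n} a(d) (-1)ᵉ with a periodic of mean zero, so by Dirichlet's hyperbola method the sum on the right
-- is a multiple of Y² up to O(Y^{3/2}).  Comparing the coefficients of Y² gives N h = - Σ_{x < N} x χ(x) without analysis.
--
-- Multiplication by m permutes the residues modulo N, so Σ ⌊mx/N⌋ χ(x) = - (m - χ(m)) h.  Since χ is odd, for
-- m = 2, 3, 4, 6, 12 these are five linear equations in E₀, …, E₅, and their coefficients depend only on χ(2) and χ(3),
-- that is, on N modulo 24.

open import Data.Bool.Base using (if_then_else_)
open import Data.Empty using (⊥; ⊥-elim)
open import Data.Fin.Base as Fin using (Fin; toℕ; fromℕ<)
open import Data.Integer.Base using (ℤ; +_; -[1+_]; -_; _+_; _-_; _*_; _^_; _≤_; _<_; ∣_∣; _%ℕ_; +≤+; +<+; -≤+; -<+; -1ℤ; _/ℕ_)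
import Data.Integer.Base as ℤ
open import Data.Integer.Divisibility using (_∣_)
open import Data.Integer.Divisibility.Signed using (divides; ∣⇒∣ᵤ; ∣ᵤ⇒∣) renaming (_∣_ to _∣ₛ_; _∣?_ to _∣ₛ?_)
import Data.Integer.Divisibility.Signed as Signed
import Data.Integer.DivMod as ℤ
import Data.Integer.Properties as ℤ
open import Data.Integer.Tactic.RingSolver using (solve-∀)
open import Data.List.Base using (applyUpTo; List; []; _∷_; _++_; map; filter; downFrom; upTo; cartesianProduct; allFin; length)
open import Data.List.Membership.Propositional using (_∈_)
open import Data.List.Membership.Propositional.Properties using (∈-map⁺; ∈-map⁻; ∈-downFrom⁺; ∈-downFrom⁻; ∈-cartesianProduct⁺; ∈-allFin; ∈-++⁺ˡ; ∈-++⁺ʳ)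
open import Data.List.Membership.Propositional.Properties.WithK using (unique∧set⇒bag)
open import Data.List.Properties using (length-downFrom; length-map; length-tabulate; length-++)
open import Data.List.Relation.Binary.BagAndSetEquality using (∼bag⇒↭)
import Data.List.Relation.Binary.Permutation.Propositional as Perm
open import Data.List.Relation.Binary.Permutation.Propositional using (_↭_)
open import Data.List.Relation.Unary.All using (All; []; _∷_)
import Data.List.Relation.Unary.All as All
import Data.List.Relation.Unary.All.Properties as All
open import Data.List.Relation.Unary.AllPairs using ([]; _∷_)
open import Data.List.Relation.Unary.Any using (Any; here; there)
open import Data.List.Relation.Unary.Unique.Propositional using (Unique)
import Data.List.Relation.Unary.Unique.Propositional.Properties as Unique
open import Data.Nat.Base as ℕ using (ℕ; zero; suc; NonZero; z≤n; s≤s; _%_)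
open import Data.Nat.Coprimality as Coprimality using (Coprime; coprime?; coprime-Bézout)
open import Data.Nat.DivMod using (m≡m%n+[m/n]*n; m%n<n)
import Data.Nat.DivMod as ℕ
import Data.Nat.Divisibility as ℕ
open import Data.Nat.Tactic.RingSolver using () renaming (solve-∀ to ℕ-solve-∀)
open import Data.Nat.GCD using (module Bézout)
open import Data.Nat.ListAction using (product)
open import Data.Nat.Induction using (<-rec)
open import Data.Nat.Primality as Primality using (Prime)
open import Data.Nat.Primality.Factorisation using (factorise; factors; PrimeFactorisation)
open import Data.Fin.Properties using (any?; toℕ-fromℕ<)
import Data.Nat.Properties as ℕ
open import Data.Rational.Base as ℚ using (ℚ; 0ℚ; 1ℚ; ½; mkℚ)
import Data.Rational.Properties as ℚ
import Data.Rational.Solver as ℚSolver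
open import Data.Rational.Unnormalised.Base using (mkℚᵘ; *≡*)
import Data.Rational.Unnormalised.Properties as ℚᵘ
open import Data.Product.Base using (Σ; ∃-syntax; _×_; _,_; proj₁; proj₂)
open import Data.Sum.Base using (_⊎_; inj₁; inj₂; [_,_]′)
open import Data.Unit.Base using (tt)
open import Data.Vec.Base as Vec using (Vec; []; _∷_)
open import Function.Base using (_∘_; id; case_of_)
open import Function.Bundles using (Equivalence; _⇔_; mk⇔; Bijection)
open import Relation.Binary.PropositionalEquality using (_≡_; _≢_; refl; sym; trans; cong; cong₂; subst; subst₂; module ≡-Reasoning)
open import Relation.Binary.Definitions using (tri<; tri≈; tri>)
open import Relation.Nullary.Decidable using (toWitness; Dec; yes; no; does; _×-dec_; map′)
open import Relation.Nullary.Negation using (¬_; contradiction)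
open import Defs hiding (χ)

infix 6 ∑ ∑<

∑ : {A : Set} → List A → (A → ℤ) → ℤ
∑ []       f = + 0
∑ (x ∷ xs) f = f x + ∑ xs f

∑< : ℕ → (ℕ → ℤ) → ℤ
∑< n = ∑ (downFrom n)

module _ {A : Set} where

  ∑-cong : ∀ {f g : A → ℤ} (xs : List A) → (∀ {x} → x ∈ xs → f x ≡ g x) → ∑ xs f ≡ ∑ xs g
  ∑-cong []       eq = refl
  ∑-cong (x ∷ xs) eq = cong₂ _+_ (eq (here refl)) (∑-cong xs (eq ∘ there))

  ∑-ext : ∀ {f g : A → ℤ} (xs : List A) → (∀ x → f x ≡ g x) → ∑ xs f ≡ ∑ xs g
  ∑-ext xs eq = ∑-cong xs (λ {x} _ → eq x)

  ∑-zero : ∀ {f : A → ℤ} (xs : List A) → (∀ {x} → x ∈ xs → f x ≡ + 0) → ∑ xs f ≡ + 0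
  ∑-zero []       eq = refl
  ∑-zero (x ∷ xs) eq = cong₂ _+_ (eq (here refl)) (∑-zero xs (eq ∘ there))

  ∑-+ : ∀ (xs : List A) (f g : A → ℤ) → ∑ xs (λ x → f x + g x) ≡ ∑ xs f + ∑ xs g
  ∑-+ []       f g = refl
  ∑-+ (x ∷ xs) f g = trans (cong (_+_ ((f x + g x))) (∑-+ xs f g)) (lemma (f x) (g x) (∑ xs f) (∑ xs g))
    where
    lemma : ∀ a b c d → (a + b) + (c + d) ≡ (a + c) + (b + d)
    lemma = solve-∀

  ∑-*ˡ : ∀ (xs : List A) c (f : A → ℤ) → ∑ xs (λ x → c * f x) ≡ c * ∑ xs f
  ∑-*ˡ []       c f = sym (ℤ.*-zeroʳ c)
  ∑-*ˡ (x ∷ xs) c f = trans (cong (_+_ (c * f x)) (∑-*ˡ xs c f)) (sym (ℤ.*-distribˡ-+ c (f x) _))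

  ∑-*ʳ : ∀ (xs : List A) c (f : A → ℤ) → ∑ xs (λ x → f x * c) ≡ ∑ xs f * c
  ∑-*ʳ xs c f = trans (∑-ext xs (λ x → ℤ.*-comm (f x) c)) (trans (∑-*ˡ xs c f) (ℤ.*-comm c _))

  ∑-neg : ∀ (xs : List A) (f : A → ℤ) → ∑ xs (λ x → - f x) ≡ - ∑ xs f
  ∑-neg []       f = refl
  ∑-neg (x ∷ xs) f = trans (cong (_+_ (- f x)) (∑-neg xs f)) (sym (ℤ.neg-distrib-+ (f x) _))

  ∑-- : ∀ (xs : List A) (f g : A → ℤ) → ∑ xs (λ x → f x - g x) ≡ ∑ xs f - ∑ xs g
  ∑-- xs f g = trans (∑-+ xs f (λ x → - g x)) (cong (_+_ (∑ xs f)) (∑-neg xs g))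

  ∑-++ : ∀ (xs ys : List A) (f : A → ℤ) → ∑ (xs ++ ys) f ≡ ∑ xs f + ∑ ys f
  ∑-++ []       ys f = sym (ℤ.+-identityˡ _)
  ∑-++ (x ∷ xs) ys f = trans (cong (_+_ (f x)) (∑-++ xs ys f)) (sym (ℤ.+-assoc (f x) _ _))

  ∑-↭ : ∀ {xs ys : List A} (f : A → ℤ) → xs ↭ ys → ∑ xs f ≡ ∑ ys f
  ∑-↭ f Perm.refl         = refl
  ∑-↭ f (Perm.prep x p)   = cong (_+_ (f x)) (∑-↭ f p)
  ∑-↭ f (Perm.swap x y p) = trans (cong (λ z → f x + (f y + z)) (∑-↭ f p)) (lemma (f x) (f y) _)
    where
    lemma : ∀ a b c → a + (b + c) ≡ b + (a + c)
    lemma = solve-∀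
  ∑-↭ f (Perm.trans p q)  = trans (∑-↭ f p) (∑-↭ f q)

  ∑-single : ∀ {xs : List A} {x} (f : A → ℤ) → Unique xs → x ∈ xs →
             (∀ {y} → y ∈ xs → y ≢ x → f y ≡ + 0) → ∑ xs f ≡ f x
  ∑-single {x ∷ xs} f (x∉ ∷ uniq) (here refl) off =
    trans (cong (_+_ (f x)) (∑-zero xs (λ y∈ → off (there y∈) (All.lookup x∉ y∈ ∘ sym))))
          (ℤ.+-identityʳ (f x))
  ∑-single {x ∷ xs} f (x∉ ∷ uniq) (there x∈) off =
    trans (cong₂ _+_ (off (here refl) (All.lookup x∉ x∈))
                     (∑-single f uniq x∈ (off ∘ there)))
          (ℤ.+-identityˡ _)

  ∑-pair : ∀ {xs : List A} {x y} (f : A → ℤ) → Unique xs → x ∈ xs → y ∈ xs → x ≢ y →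
           (∀ {z} → z ∈ xs → z ≢ x → z ≢ y → f z ≡ + 0) → ∑ xs f ≡ f x + f y
  ∑-pair f uniq (here refl) (here refl) x≢y off = contradiction refl x≢y
  ∑-pair {x ∷ xs} f (x∉ ∷ uniq) (here refl) (there y∈) x≢y off =
    cong (_+_ (f x)) (∑-single f uniq y∈ (λ z∈ → off (there z∈) (All.lookup x∉ z∈ ∘ sym)))
  ∑-pair {y ∷ xs} {x} f (y∉ ∷ uniq) (there x∈) (here refl) x≢y off =
    trans (cong (_+_ (f y)) (∑-single f uniq x∈ (λ z∈ z≢x → off (there z∈) z≢x (All.lookup y∉ z∈ ∘ sym))))
          (ℤ.+-comm (f y) (f x))
  ∑-pair {z ∷ xs} {x} {y} f (z∉ ∷ uniq) (there x∈) (there y∈) x≢y off =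
    trans (cong₂ _+_ (off (here refl) (All.lookup z∉ x∈) (All.lookup z∉ y∈))
                     (∑-pair f uniq x∈ y∈ x≢y (off ∘ there)))
          (ℤ.+-identityˡ _)

  ∑-abs-≤ : ∀ (xs : List A) (f : A → ℤ) c → (∀ {x} → x ∈ xs → ∣ f x ∣ ℕ.≤ c) →
            ∣ ∑ xs f ∣ ℕ.≤ length xs ℕ.* c
  ∑-abs-≤ []       f c bound = z≤n
  ∑-abs-≤ (x ∷ xs) f c bound =
    ℕ.≤-trans (ℤ.∣i+j∣≤∣i∣+∣j∣ (f x) _) (ℕ.+-mono-≤ (bound (here refl)) (∑-abs-≤ xs f c (bound ∘ there)))

∑-map : ∀ {A B : Set} (xs : List A) (φ : A → B) (f : B → ℤ) → ∑ (map φ xs) f ≡ ∑ xs (f ∘ φ)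
∑-map []       φ f = refl
∑-map (x ∷ xs) φ f = cong (_+_ (f (φ x))) (∑-map xs φ f)

module _ {A B : Set} where

  ∑-swap : ∀ (xs : List A) (ys : List B) (f : A → B → ℤ) →
           ∑ xs (λ x → ∑ ys (f x)) ≡ ∑ ys (λ y → ∑ xs (λ x → f x y))
  ∑-swap []       ys f = sym (∑-zero ys (λ _ → refl))
  ∑-swap (x ∷ xs) ys f = trans (cong (_+_ (∑ ys (f x))) (∑-swap xs ys f))
                               (sym (∑-+ ys (f x) (λ y → ∑ xs (λ x → f x y))))

  ∑-cartesianProduct : ∀ (xs : List A) (ys : List B) (f : A × B → ℤ) →
    ∑ (cartesianProduct xs ys) f ≡ ∑ xs (λ x → ∑ ys (λ y → f (x , y)))
  ∑-cartesianProduct []       ys f = refl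
  ∑-cartesianProduct (x ∷ xs) ys f =
    trans (∑-++ (map (x ,_) ys) _ f)
          (cong₂ _+_ (∑-map ys (x ,_) f) (∑-cartesianProduct xs ys f))

  map-unique : ∀ {xs : List A} (φ : A → B) →
    (∀ {x y} → x ∈ xs → y ∈ xs → φ x ≡ φ y → x ≡ y) → Unique xs → Unique (map φ xs)
  map-unique φ inj [] = []
  map-unique {x ∷ xs} φ inj (x∉ ∷ uniq) =
    All.map⁺ (All.tabulate (λ y∈ eq → All.lookup x∉ y∈ (inj (here refl) (there y∈) eq)))
    ∷ map-unique φ (λ x∈ y∈ → inj (there x∈) (there y∈)) uniq

  map-↭ : ∀ {xs : List A} {ys : List B} (φ : A → B) → Unique xs → Unique ys →
    (∀ {x} → x ∈ xs → φ x ∈ ys) →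
    (∀ {x y} → x ∈ xs → y ∈ xs → φ x ≡ φ y → x ≡ y) →
    (∀ {y} → y ∈ ys → ∃[ x ] x ∈ xs × φ x ≡ y) → map φ xs ↭ ys
  map-↭ {xs} {ys} φ uxs uys into inj onto = ∼bag⇒↭ (unique∧set⇒bag (map-unique φ inj uxs) uys
    (mk⇔ (λ y∈ → case ∈-map⁻ φ y∈ of λ { (x , x∈ , refl) → into x∈ })
         (λ y∈ → case onto y∈ of λ { (x , x∈ , refl) → ∈-map⁺ φ x∈ })))

∑<-split : ∀ m n f → ∑< (m ℕ.+ n) f ≡ ∑< m f + ∑< n (λ i → f (m ℕ.+ i))
∑<-split m zero    f = trans (cong (λ k → ∑< k f) (ℕ.+-identityʳ m)) (sym (ℤ.+-identityʳ _))
∑<-split m (suc n) f =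
  trans (cong (λ k → ∑< k f) (ℕ.+-suc m n))
  (trans (cong (_+_ (f (m ℕ.+ n))) (∑<-split m n f)) (lemma (f (m ℕ.+ n)) (∑< m f) _))
  where
  lemma : ∀ a b c → a + (b + c) ≡ b + (a + c)
  lemma = solve-∀

∑<-blocks : ∀ k n f → ∑< (k ℕ.* n) f ≡ ∑< k (λ q → ∑< n (λ i → f (q ℕ.* n ℕ.+ i)))
∑<-blocks zero    n f = refl
∑<-blocks (suc k) n f =
  trans (cong (λ m → ∑< m f) (ℕ.+-comm n (k ℕ.* n)))
  (trans (∑<-split (k ℕ.* n) n f)
  (trans (ℤ.+-comm (∑< (k ℕ.* n) f) _)
         (cong (_+_ (∑< n (λ i → f (k ℕ.* n ℕ.+ i)))) (∑<-blocks k n f))))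

∑<-cong : ∀ {f g} n → (∀ {i} → i ℕ.< n → f i ≡ g i) → ∑< n f ≡ ∑< n g
∑<-cong n eq = ∑-cong (downFrom n) (eq ∘ ∈-downFrom⁻)

-- The Iverson bracket, abstract so that it does not unfold during unification.
abstract
  𝟙 : ∀ {P : Set} → Dec P → ℤ
  𝟙 p? = if does p? then + 1 else + 0

  𝟙-yes : ∀ {P : Set} (p? : Dec P) → P → 𝟙 p? ≡ + 1
  𝟙-yes (yes _) p = refl
  𝟙-yes (no ¬p) p = contradiction p ¬p

  𝟙-no : ∀ {P : Set} (p? : Dec P) → ¬ P → 𝟙 p? ≡ + 0
  𝟙-no (yes p) ¬p = contradiction p ¬p
  𝟙-no (no _)  ¬p = refl

  𝟙-⇔ : ∀ {P Q : Set} (p? : Dec P) (q? : Dec Q) → (P → Q) → (Q → P) → 𝟙 p? ≡ 𝟙 q?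
  𝟙-⇔ (yes p) q? to from = sym (𝟙-yes q? (to p))
  𝟙-⇔ (no ¬p) q? to from = sym (𝟙-no q? (¬p ∘ from))

-- Congruences, parity and finite products

residue-unique : ∀ {n i j} → i ℕ.< n → j ℕ.< n → + n ∣ₛ + i - + j → i ≡ j
residue-unique {n} {i} {j} i<n j<n n∣ = ℤ.+-injective (ℤ.i-j≡0⇒i≡j (+ i) (+ j) (ℤ.∣i∣≡0⇒i≡0 (zero-if-small (∣⇒∣ᵤ n∣) small)))
  where
  zero-if-small : ∀ {m} → n ℕ.∣ m → m ℕ.< n → m ≡ 0
  zero-if-small {zero}  _   _   = refl
  zero-if-small {suc m} n∣m m<n = contradiction n∣m (ℕ.>⇒∤ m<n)
  small : ∣ + i - + j ∣ ℕ.< n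
  small = subst (ℕ._< n) (cong ∣_∣ (sym (ℤ.m-n≡m⊖n i j)))
    (ℕ.≤-<-trans (ℤ.∣m⊝n∣≤m⊔n i j) (ℕ.⊔-lub i<n j<n))

∣%ℕ- : ∀ z n .{{_ : NonZero n}} → + n ∣ₛ + (z %ℕ n) - z
∣%ℕ- z n = divides (- (z /ℕ n)) (trans (cong (λ v → + (z %ℕ n) - v) (ℤ.a≡a%ℕn+[a/ℕn]*n z n)) (lemma (+ (z %ℕ n)) (z /ℕ n) (+ n)))
  where
  lemma : ∀ r q d → r - (r + q * d) ≡ - q * d
  lemma = solve-∀

coprime-inverse : ∀ {a n} → Coprime a n → ∃[ s ] + n ∣ₛ s * + a - + 1
coprime-inverse {a} {n} c with coprime-Bézout c
... | Bézout.Identity.+- x y eq = + x , divides (+ y) (lemma (+ x * + a) (+ y * + n)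
        (trans (cong (λ z → + 1 + z) (sym (ℤ.pos-* y n))) (trans (cong +_ eq) (ℤ.pos-* x a))))
  where
  lemma : ∀ u v → + 1 + v ≡ u → u - + 1 ≡ v
  lemma u v refl = ℤlemma v
    where
    ℤlemma : ∀ v → + 1 + v - + 1 ≡ v
    ℤlemma = solve-∀
... | Bézout.Identity.-+ x y eq = - + x , divides (- + y) (trans (cong (λ v → v - + 1) (sym (ℤ.neg-distribˡ-* (+ x) (+ a))))
        (trans (lemma (+ x * + a) (+ y * + n)
          (trans (cong (λ z → + 1 + z) (sym (ℤ.pos-* x a))) (trans (cong +_ eq) (ℤ.pos-* y n))))
          (ℤ.neg-distribˡ-* (+ y) (+ n))))
  where
  lemma : ∀ u v → + 1 + u ≡ v → - u - + 1 ≡ - v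
  lemma u v refl = ℤlemma u
    where
    ℤlemma : ∀ u → - u - + 1 ≡ - (+ 1 + u)
    ℤlemma = solve-∀

coprime-∣-cancel : ∀ {a n x} → Coprime a n → + n ∣ₛ + a * x → + n ∣ₛ x
coprime-∣-cancel {a} {n} {x} c n∣ax = ∣ᵤ⇒∣ (Coprimality.coprime-divisor (Coprimality.sym c)
  (subst (n ℕ.∣_) (ℤ.abs-* (+ a) x) (∣⇒∣ᵤ n∣ax)))

∣-by : ∀ {n x y} → x ≡ y → n ∣ₛ x → n ∣ₛ y
∣-by {n} eq = subst (n ∣ₛ_) eq

∑<-affine : ∀ n .{{_ : NonZero n}} {a} c (f : ℕ → ℤ) → Coprime a n →
            ∑< n (λ i → f ((c + + a * + i) %ℕ n)) ≡ ∑< n f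
∑<-affine n {a} c f cop = trans (sym (∑-map (downFrom n) φ f)) (∑-↭ f
  (map-↭ φ (Unique.downFrom⁺ n) (Unique.downFrom⁺ n) (λ {i} _ → ∈-downFrom⁺ (ℤ.n%ℕd<d (c + + a * + i) n)) inj onto))
  where
  φ : ℕ → ℕ
  φ i = (c + + a * + i) %ℕ n
  inj : ∀ {x y} → x ∈ downFrom n → y ∈ downFrom n → φ x ≡ φ y → x ≡ y
  inj {x} {y} x∈ y∈ eq = residue-unique (∈-downFrom⁻ x∈) (∈-downFrom⁻ y∈) (coprime-∣-cancel cop
    (∣-by (trans (cong (λ z → + z - (c + + a * + y) - (+ φ x - (c + + a * + x))) (sym eq)) (lemma c (+ a) (+ x) (+ y) (+ φ x)))
      (Signed.∣m∣n⇒∣m-n (∣%ℕ- (c + + a * + y) n) (∣%ℕ- (c + + a * + x) n))))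
    where
    lemma : ∀ c a x y z → z - (c + a * y) - (z - (c + a * x)) ≡ a * (x - y)
    lemma = solve-∀
  onto : ∀ {y} → y ∈ downFrom n → ∃[ x ] x ∈ downFrom n × φ x ≡ y
  onto {y} y∈ with coprime-inverse cop
  ... | s , n∣ = x , ∈-downFrom⁺ (ℤ.n%ℕd<d (s * (+ y - c)) n) , residue-unique (ℤ.n%ℕd<d (c + + a * + x) n) (∈-downFrom⁻ y∈)
      (∣-by (lemma c (+ a) (+ x) (+ y) s (+ φ x))
        (Signed.∣m∣n⇒∣m+n (Signed.∣m∣n⇒∣m+n (∣%ℕ- (c + + a * + x) n) (Signed.∣n⇒∣m*n (+ a) (∣%ℕ- (s * (+ y - c)) n))) (Signed.∣n⇒∣m*n (+ y - c) n∣)))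
    where
    x = (s * (+ y - c)) %ℕ n
    lemma : ∀ c a x y s z → (z - (c + a * x)) + a * (x - s * (y - c)) + (y - c) * (s * a - + 1) ≡ z - y
    lemma = solve-∀

move-+ : ∀ {x y z} → x ≡ y + z → z ≡ x - y
move-+ {y = y} {z} refl = lemma y z
  where
  lemma : ∀ y z → z ≡ y + z - y
  lemma = solve-∀

infix 4 _≈[_]_

-- A record rather than a synonym, so that x and y can be inferred.
record _≈[_]_ (x : ℤ) (n : ℕ) (y : ℤ) : Set where
  constructor ≈-by
  field ≈⇒∣ : + n ∣ₛ x - y

open _≈[_]_ public

module _ {n : ℕ} where

  ≈-reflexive : ∀ {x y} → x ≡ y → x ≈[ n ] y
  ≈-reflexive {x} refl = ≈-by (divides (+ 0) (ℤ.+-inverseʳ x))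

  ≈-refl : ∀ {x} → x ≈[ n ] x
  ≈-refl = ≈-reflexive refl

  ≈-sym : ∀ {x y} → x ≈[ n ] y → y ≈[ n ] x
  ≈-sym {x} {y} (≈-by p) = ≈-by (∣-by (lemma x y) (Signed.∣m⇒∣-m p))
    where
    lemma : ∀ x y → - (x - y) ≡ y - x
    lemma = solve-∀

  ≈-trans : ∀ {x y z} → x ≈[ n ] y → y ≈[ n ] z → x ≈[ n ] z
  ≈-trans {x} {y} {z} (≈-by p) (≈-by q) = ≈-by (∣-by (ℤ.+-minus-telescope x y z) (Signed.∣m∣n⇒∣m+n p q))

  ≈-+ : ∀ {x y u v} → x ≈[ n ] y → u ≈[ n ] v → x + u ≈[ n ] y + v
  ≈-+ {x} {y} {u} {v} (≈-by p) (≈-by q) = ≈-by (∣-by (lemma x y u v) (Signed.∣m∣n⇒∣m+n p q))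
    where
    lemma : ∀ x y u v → x - y + (u - v) ≡ x + u - (y + v)
    lemma = solve-∀

  ≈-neg : ∀ {x y} → x ≈[ n ] y → - x ≈[ n ] - y
  ≈-neg {x} {y} (≈-by p) = ≈-by (∣-by (lemma x y) (Signed.∣m⇒∣-m p))
    where
    lemma : ∀ x y → - (x - y) ≡ - x - - y
    lemma = solve-∀

  ≈-* : ∀ {x y u v} → x ≈[ n ] y → u ≈[ n ] v → x * u ≈[ n ] y * v
  ≈-* {x} {y} {u} {v} (≈-by p) (≈-by q) =
    ≈-by (∣-by (lemma x y u v) (Signed.∣m∣n⇒∣m+n (Signed.∣m⇒∣m*n u p) (Signed.∣n⇒∣m*n y q)))
    where
    lemma : ∀ x y u v → (x - y) * u + y * (u - v) ≡ x * u - y * v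
    lemma = solve-∀

  ≈-*ˡ : ∀ x {u v} → u ≈[ n ] v → x * u ≈[ n ] x * v
  ≈-*ˡ x = ≈-* (≈-refl {x})

  ≈-*ʳ : ∀ x {u v} → u ≈[ n ] v → u * x ≈[ n ] v * x
  ≈-*ʳ x p = ≈-* p (≈-refl {x})

  ≈-^ : ∀ {x y} k → x ≈[ n ] y → x ^ k ≈[ n ] y ^ k
  ≈-^ zero    p = ≈-refl
  ≈-^ (suc k) p = ≈-* p (≈-^ k p)

  ∣⇒≈0 : ∀ {x} → + n ∣ₛ x → x ≈[ n ] + 0
  ∣⇒≈0 {x} = ≈-by ∘ ∣-by (sym (ℤ.+-identityʳ x))

  ≈0⇒∣ : ∀ {x} → x ≈[ n ] + 0 → + n ∣ₛ x
  ≈0⇒∣ {x} = ∣-by (ℤ.+-identityʳ x) ∘ ≈⇒∣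

  ∣-≈ : ∀ {x y} → x ≈[ n ] y → + n ∣ₛ y → + n ∣ₛ x
  ∣-≈ p n∣y = ≈0⇒∣ (≈-trans p (∣⇒≈0 n∣y))

%ℕ-≈ : ∀ z n .{{_ : NonZero n}} → + (z %ℕ n) ≈[ n ] z
%ℕ-≈ z n = ≈-by (∣%ℕ- z n)

≈⇒≡ : ∀ {n i j} → i ℕ.< n → j ℕ.< n → + i ≈[ n ] + j → i ≡ j
≈⇒≡ i<n j<n (≈-by d) = residue-unique i<n j<n d

∣ₛ⇒≤ : ∀ {n m} → + n ∣ₛ + suc m → n ℕ.≤ suc m
∣ₛ⇒≤ n∣ = ℕ.∣⇒≤ (∣⇒∣ᵤ n∣)

prime-∣-* : ∀ {p} → Prime p → ∀ x y → + p ∣ₛ x * y → + p ∣ₛ x ⊎ + p ∣ₛ y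
prime-∣-* {p} pr x y p∣ with Primality.euclidsLemma ∣ x ∣ ∣ y ∣ pr (subst (p ℕ.∣_) (ℤ.abs-* x y) (∣⇒∣ᵤ p∣))
... | inj₁ d = inj₁ (∣ᵤ⇒∣ d)
... | inj₂ d = inj₂ (∣ᵤ⇒∣ d)

prime-∤1 : ∀ {p} → Prime p → ¬ + p ∣ₛ + 1
prime-∤1 pr p∣1 with ℕ.∣1⇒≡1 (∣⇒∣ᵤ p∣1)
... | refl = Primality.¬prime[1] pr

n+n≡n*2 : ∀ n → n ℕ.+ n ≡ n ℕ.* 2
n+n≡n*2 = ℕ-solve-∀

2∤1+n+n : ∀ n → ¬ 2 ℕ.∣ suc (n ℕ.+ n)
2∤1+n+n n 2∣ with ℕ.∣1⇒≡1 (ℕ.∣m+n∣m⇒∣n (subst (2 ℕ.∣_) (ℕ.+-comm 1 (n ℕ.+ n)) 2∣) (ℕ.divides n (n+n≡n*2 n)))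
... | ()

double-injective : ∀ m n → m ℕ.+ m ≡ n ℕ.+ n → m ≡ n
double-injective m n eq = ℕ.*-cancelʳ-≡ m n 2 (trans (sym (n+n≡n*2 m)) (trans eq (n+n≡n*2 n)))

pos-1+n+n : ∀ n → + suc (n ℕ.+ n) ≡ + 2 * + n + + 1
pos-1+n+n n = trans (ℤ.pos-+ 1 (n ℕ.+ n)) (trans (cong (_+_ (+ 1)) (ℤ.pos-+ n n)) (lemma (+ n)))
  where
  lemma : ∀ n → + 1 + (n + n) ≡ + 2 * n + + 1
  lemma = solve-∀

parity : ∀ z → (∃[ q ] z ≡ q + q) ⊎ (∃[ q ] z ≡ q + q + + 1)
parity z with z %ℕ 2 | ℤ.n%ℕd<d z 2 | ℤ.a≡a%ℕn+[a/ℕn]*n z 2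
... | 0 | _ | eq = inj₁ (z /ℕ 2 , trans eq (lemma (z /ℕ 2)))
  where
  lemma : ∀ q → + 0 + q * + 2 ≡ q + q
  lemma = solve-∀
... | 1 | _ | eq = inj₂ (z /ℕ 2 , trans eq (lemma (z /ℕ 2)))
  where
  lemma : ∀ q → + 1 + q * + 2 ≡ q + q + + 1
  lemma = solve-∀
... | suc (suc r) | s≤s (s≤s ()) | _

%ℕ-unique : ∀ z {n} .{{_ : NonZero n}} {r} → r ℕ.< n → z ≈[ n ] + r → z %ℕ n ≡ r
%ℕ-unique z {n} r<n p = ≈⇒≡ (ℤ.n%ℕd<d z n) r<n (≈-trans (%ℕ-≈ z n) p)

parOf : ℕ → ℤ
parOf zero    = + 1
parOf (suc _) = -1ℤ

sgn : ℤ → ℤ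
sgn z = parOf (z %ℕ 2)

sgn-even : ∀ q → sgn (q + q) ≡ + 1
sgn-even q = cong parOf (%ℕ-unique (q + q) {2} {0} (s≤s z≤n) (≈-by (divides q (lemma q))))
  where
  lemma : ∀ q → q + q - + 0 ≡ q * + 2
  lemma = solve-∀

sgn-odd : ∀ q → sgn (q + q + + 1) ≡ -1ℤ
sgn-odd q = cong parOf (%ℕ-unique (q + q + + 1) {2} {1} (s≤s (s≤s z≤n)) (≈-by (divides q (lemma q))))
  where
  lemma : ∀ q → q + q + + 1 - + 1 ≡ q * + 2
  lemma = solve-∀

sgn-+ : ∀ x y → sgn (x + y) ≡ sgn x * sgn y
sgn-+ x y with parity x | parity y
... | inj₁ (a , refl) | inj₁ (b , refl) = trans (trans (cong sgn (lemma a b)) (sgn-even (a + b))) (sym (cong₂ _*_ (sgn-even a) (sgn-even b)))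
  where
  lemma : ∀ a b → a + a + (b + b) ≡ a + b + (a + b)
  lemma = solve-∀
... | inj₁ (a , refl) | inj₂ (b , refl) = trans (trans (cong sgn (lemma a b)) (sgn-odd (a + b))) (sym (cong₂ _*_ (sgn-even a) (sgn-odd b)))
  where
  lemma : ∀ a b → a + a + (b + b + + 1) ≡ a + b + (a + b) + + 1
  lemma = solve-∀
... | inj₂ (a , refl) | inj₁ (b , refl) = trans (trans (cong sgn (lemma a b)) (sgn-odd (a + b))) (sym (cong₂ _*_ (sgn-odd a) (sgn-even b)))
  where
  lemma : ∀ a b → a + a + + 1 + (b + b) ≡ a + b + (a + b) + + 1
  lemma = solve-∀
... | inj₂ (a , refl) | inj₂ (b , refl) = trans (trans (cong sgn (lemma a b)) (sgn-even (a + b + + 1))) (sym (cong₂ _*_ (sgn-odd a) (sgn-odd b)))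
  where
  lemma : ∀ a b → a + a + + 1 + (b + b + + 1) ≡ a + b + + 1 + (a + b + + 1)
  lemma = solve-∀

Unit : ℤ → Set
Unit ε = ε ≡ + 1 ⊎ ε ≡ -1ℤ

unit-square : ∀ {ε} → Unit ε → ε * ε ≡ + 1
unit-square (inj₁ refl) = refl
unit-square (inj₂ refl) = refl

unit-* : ∀ {ε η} → Unit ε → Unit η → Unit (ε * η)
unit-* (inj₁ refl) (inj₁ refl) = inj₁ refl
unit-* (inj₁ refl) (inj₂ refl) = inj₂ refl
unit-* (inj₂ refl) (inj₁ refl) = inj₂ refl
unit-* (inj₂ refl) (inj₂ refl) = inj₁ refl

unit-move : ∀ {ε x y} → Unit ε → x ≡ ε * y → y ≡ ε * x
unit-move {ε} {x} {y} u refl = trans (sym (trans (cong (_* y) (unit-square u)) (ℤ.*-identityˡ y))) (ℤ.*-assoc ε ε y)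

sgn-unit : ∀ z → Unit (sgn z)
sgn-unit z with z %ℕ 2
... | zero  = inj₁ refl
... | suc _ = inj₂ refl

∏ : {A : Set} → List A → (A → ℤ) → ℤ
∏ []       f = + 1
∏ (x ∷ xs) f = f x * ∏ xs f

module _ {A : Set} where

  ∏-↭ : ∀ {xs ys : List A} (f : A → ℤ) → xs ↭ ys → ∏ xs f ≡ ∏ ys f
  ∏-↭ f Perm.refl         = refl
  ∏-↭ f (Perm.prep x p)   = cong (f x *_) (∏-↭ f p)
  ∏-↭ f (Perm.swap x y p) = trans (cong (λ z → f x * (f y * z)) (∏-↭ f p)) (lemma (f x) (f y) _)
    where
    lemma : ∀ a b c → a * (b * c) ≡ b * (a * c)
    lemma = solve-∀
  ∏-↭ f (Perm.trans p q)  = trans (∏-↭ f p) (∏-↭ f q)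

  ∏-* : ∀ (xs : List A) (f g : A → ℤ) → ∏ xs (λ x → f x * g x) ≡ ∏ xs f * ∏ xs g
  ∏-* []       f g = refl
  ∏-* (x ∷ xs) f g = trans (cong (f x * g x *_) (∏-* xs f g)) (lemma (f x) (g x) (∏ xs f) (∏ xs g))
    where
    lemma : ∀ a b c d → (a * b) * (c * d) ≡ (a * c) * (b * d)
    lemma = solve-∀

  ∏-const : ∀ (xs : List A) c → ∏ xs (λ _ → c) ≡ c ^ length xs
  ∏-const []       c = refl
  ∏-const (x ∷ xs) c = cong (c *_) (∏-const xs c)

  ∏-≈ : ∀ {n} (xs : List A) {f g : A → ℤ} → (∀ {x} → x ∈ xs → f x ≈[ n ] g x) → ∏ xs f ≈[ n ] ∏ xs g
  ∏-≈ []       eq = ≈-refl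
  ∏-≈ (x ∷ xs) eq = ≈-* (eq (here refl)) (∏-≈ xs (eq ∘ there))

  ∏-∤ : ∀ {p} → Prime p → (xs : List A) {f : A → ℤ} → (∀ {x} → x ∈ xs → ¬ + p ∣ₛ f x) → ¬ + p ∣ₛ ∏ xs f
  ∏-∤ pr []           ∤ p∣ = prime-∤1 pr p∣
  ∏-∤ pr (x ∷ xs) {f} ∤ p∣ with prime-∣-* pr (f x) _ p∣
  ... | inj₁ d = ∤ (here refl) d
  ... | inj₂ d = ∏-∤ pr xs (∤ ∘ there) d

  ∏-unit : ∀ (xs : List A) {f : A → ℤ} → (∀ {x} → x ∈ xs → Unit (f x)) → Unit (∏ xs f)
  ∏-unit []       u = inj₁ refl
  ∏-unit (x ∷ xs) u = unit-* (u (here refl)) (∏-unit xs (u ∘ there))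

  ∏-sgn : ∀ (xs : List A) (f : A → ℤ) → ∏ xs (λ x → sgn (f x)) ≡ sgn (∑ xs f)
  ∏-sgn []       f = refl
  ∏-sgn (x ∷ xs) f = trans (cong (sgn (f x) *_) (∏-sgn xs f)) (sym (sgn-+ (f x) _))

∏-map : ∀ {A B : Set} (xs : List A) (φ : A → B) (f : B → ℤ) → ∏ (map φ xs) f ≡ ∏ xs (f ∘ φ)
∏-map []       φ f = refl
∏-map (x ∷ xs) φ f = cong (f (φ x) *_) (∏-map xs φ f)

-- Lagrange's theorem on the number of roots of a monic polynomial modulo p

⟦_⟧ : ∀ {m} → Vec ℤ m → ℤ → ℤ
⟦ [] ⟧     x = + 1
⟦ c ∷ cs ⟧ x = c + x * ⟦ cs ⟧ x

addScaled : ∀ {m} → Vec ℤ (suc m) → ℤ → Vec ℤ m → Vec ℤ (suc m)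
addScaled (a ∷ []) c []       = a + c ∷ []
addScaled (a ∷ as) c (b ∷ bs) = a + c * b ∷ addScaled as c bs

⟦addScaled⟧ : ∀ {m} (as : Vec ℤ (suc m)) c (bs : Vec ℤ m) x →
              ⟦ addScaled as c bs ⟧ x ≡ ⟦ as ⟧ x + c * ⟦ bs ⟧ x
⟦addScaled⟧ (a ∷ []) c [] x = lemma a c x
  where
  lemma : ∀ a c x → a + c + x * + 1 ≡ a + x * + 1 + c * + 1
  lemma = solve-∀
⟦addScaled⟧ (a ∷ as@(_ ∷ _)) c (b ∷ bs) x =
  trans (cong (λ t → a + c * b + x * t) (⟦addScaled⟧ as c bs x)) (lemma a b c x (⟦ as ⟧ x) (⟦ bs ⟧ x))
  where
  lemma : ∀ a b c x u v → a + c * b + x * (u + c * v) ≡ a + x * u + c * (b + x * v)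
  lemma = solve-∀

quotientBy : ∀ {m} → ℤ → Vec ℤ (suc m) → Vec ℤ m
quotientBy c (a ∷ [])          = []
quotientBy c (a ∷ as@(_ ∷ _))  = addScaled as c (quotientBy c as)

⟦quotientBy⟧ : ∀ {m} c (as : Vec ℤ (suc m)) x →
               ⟦ as ⟧ x - ⟦ as ⟧ c ≡ (x - c) * ⟦ quotientBy c as ⟧ x
⟦quotientBy⟧ c (a ∷ []) x = lemma a c x
  where
  lemma : ∀ a c x → a + x * + 1 - (a + c * + 1) ≡ (x - c) * + 1
  lemma = solve-∀
⟦quotientBy⟧ c (a ∷ as@(_ ∷ _)) x = begin
  a + x * u - (a + c * v)             ≡⟨ lemma₁ a c x u v ⟩
  (x - c) * u + c * (u - v)           ≡⟨ cong (λ t → (x - c) * u + c * t) (⟦quotientBy⟧ c as x) ⟩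
  (x - c) * u + c * ((x - c) * w)     ≡⟨ lemma₂ (x - c) u c w ⟩
  (x - c) * (u + c * w)               ≡⟨ cong ((x - c) *_) (sym (⟦addScaled⟧ as c (quotientBy c as) x)) ⟩
  (x - c) * ⟦ quotientBy c (a ∷ as) ⟧ x ∎
  where
  open ≡-Reasoning
  u = ⟦ as ⟧ x
  v = ⟦ as ⟧ c
  w = ⟦ quotientBy c as ⟧ x
  lemma₁ : ∀ a c x u v → a + x * u - (a + c * v) ≡ (x - c) * u + c * (u - v)
  lemma₁ = solve-∀
  lemma₂ : ∀ d u c w → d * u + c * (d * w) ≡ d * (u + c * w)
  lemma₂ = solve-∀

lagrange : ∀ {p} → Prime p → ∀ {m} (f : Vec ℤ m) (r : ℕ → ℤ) →
           (∀ i → i ℕ.≤ m → + p ∣ₛ ⟦ f ⟧ (r i)) →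
           (∀ {i j} → i ℕ.< j → j ℕ.≤ m → ¬ + p ∣ₛ r i - r j) → ⊥
lagrange pr []           r root distinct = prime-∤1 pr (root 0 z≤n)
lagrange pr {suc m} f r root distinct = lagrange pr (quotientBy c f) r root′ (λ i<j j≤m → distinct i<j (ℕ.m≤n⇒m≤1+n j≤m))
  where
  c = r (suc m)
  root′ : ∀ i → i ℕ.≤ m → _
  root′ i i≤m with prime-∣-* pr (r i - c) _ (∣-by (⟦quotientBy⟧ c f (r i))
                     (Signed.∣m∣n⇒∣m-n (root i (ℕ.m≤n⇒m≤1+n i≤m)) (root (suc m) ℕ.≤-refl)))
  ... | inj₁ d = contradiction d (distinct (s≤s i≤m) ℕ.≤-refl)
  ... | inj₂ d = d

powerMinusOne : ∀ m → Vec ℤ (suc m)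
powerMinusOne m = -1ℤ ∷ Vec.replicate m (+ 0)

⟦powerMinusOne⟧ : ∀ m x → ⟦ powerMinusOne m ⟧ x ≡ x ^ suc m - + 1
⟦powerMinusOne⟧ m x = trans (cong (λ t → -1ℤ + x * t) (power m)) (ℤ.+-comm -1ℤ (x * x ^ m))
  where
  power : ∀ m → ⟦ Vec.replicate m (+ 0) ⟧ x ≡ x ^ m
  power zero    = refl
  power (suc m) = trans (ℤ.+-identityˡ _) (cong (x *_) (power m))

-- Euler's criterion and Gauss's lemma

1⋯ : ℕ → List ℕ
1⋯ n = map suc (downFrom n)

∈-1⋯⁺ : ∀ {n k} → k ℕ.< n → suc k ∈ 1⋯ n
∈-1⋯⁺ k<n = ∈-map⁺ suc (∈-downFrom⁺ k<n)

∈-1⋯⁻ : ∀ {n k} → k ∈ 1⋯ n → ∃[ i ] k ≡ suc i × i ℕ.< n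
∈-1⋯⁻ k∈ with ∈-map⁻ suc k∈
... | i , i∈ , eq = i , eq , ∈-downFrom⁻ i∈

1⋯-unique : ∀ n → Unique (1⋯ n)
1⋯-unique n = Unique.map⁺ ℕ.suc-injective (Unique.downFrom⁺ n)

length-1⋯ : ∀ n → length (1⋯ n) ≡ n
length-1⋯ n = trans (length-map suc (downFrom n)) (length-downFrom n)

∣distance∣ : ∀ a b → ℕ.∣ a - b ∣ ≡ ∣ + a - + b ∣
∣distance∣ a b with ℕ.≤-total a b
... | inj₁ a≤b = trans (ℕ.m≤n⇒∣m-n∣≡n∸m a≤b) (sym (trans (cong ∣_∣ (ℤ.m-n≡m⊖n a b)) (ℤ.∣⊖∣-≤ a≤b)))
... | inj₂ b≤a = trans (ℕ.m≤n⇒∣n-m∣≡n∸m b≤a) (sym (trans (cong ∣_∣ (ℤ.m-n≡m⊖n a b)) (trans (ℤ.∣m⊖n∣≡∣n⊖m∣ a b) (ℤ.∣⊖∣-≤ b≤a))))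

data Legendre (x p : ℕ) : ℤ → Set where
  zeroᴸ  : + p ∣ₛ + x → Legendre x p (+ 0)
  square : ¬ + p ∣ₛ + x → ∀ y → + y * + y ≈[ p ] + x → Legendre x p (+ 1)
  non    : ¬ + p ∣ₛ + x → (∀ y → y ℕ.< p → ¬ + y * + y ≈[ p ] + x) → Legendre x p -1ℤ

legendre-spec : ∀ x p → Legendre x p (legendre x p)
legendre-spec x p with p ℕ.∣? x
... | yes d = zeroᴸ (∣ᵤ⇒∣ d)
... | no ∤  with any? (λ (y : Fin p) → p ℕ.∣? ℕ.∣ toℕ y ℕ.* toℕ y - x ∣)
...   | yes (y , d) = square (∤ ∘ ∣⇒∣ᵤ) (toℕ y) (≈-by (∣-by (cong (λ t → t - + x) (ℤ.pos-* (toℕ y) (toℕ y)))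
                        (∣ᵤ⇒∣ (subst (p ℕ.∣_) (∣distance∣ (toℕ y ℕ.* toℕ y) x) d))))
...   | no ∄ = non (∤ ∘ ∣⇒∣ᵤ) (λ y y<p y² → ∄ (fromℕ< y<p ,
                 subst (λ z → p ℕ.∣ ℕ.∣ z ℕ.* z - x ∣) (sym (toℕ-fromℕ< y<p))
                   (subst (p ℕ.∣_) (sym (∣distance∣ (y ℕ.* y) x))
                     (∣⇒∣ᵤ (∣-by (cong (λ t → t - + x) (sym (ℤ.pos-* y y))) (≈⇒∣ y²))))))

module OddPrime (m : ℕ) (pr : Prime (suc (m ℕ.+ m))) where

  p : ℕ
  p = suc (m ℕ.+ m)

  m<p : m ℕ.< p
  m<p = s≤s (ℕ.m≤m+n m m)

  small-∤ : ∀ {k} → suc k ℕ.< p → ¬ + p ∣ₛ + suc k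
  small-∤ k<p d = ℕ.<⇒≱ k<p (∣ₛ⇒≤ d)

  0<m : 0 ℕ.< m
  0<m = aux m pr
    where
    aux : ∀ m → Prime (suc (m ℕ.+ m)) → 0 ℕ.< m
    aux zero    pr = contradiction pr Primality.¬prime[1]
    aux (suc m) pr = s≤s z≤n

  1≉-1 : ¬ + 1 ≈[ p ] -1ℤ
  1≉-1 (≈-by d) = small-∤ {1} (s≤s (ℕ.+-mono-≤ 0<m 0<m)) d

  unit-≈ : ∀ {ε η} → Unit ε → Unit η → ε ≈[ p ] η → ε ≡ η
  unit-≈ (inj₁ refl) (inj₁ refl) e = refl
  unit-≈ (inj₁ refl) (inj₂ refl) e = contradiction e 1≉-1
  unit-≈ (inj₂ refl) (inj₁ refl) e = contradiction (≈-sym e) 1≉-1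
  unit-≈ (inj₂ refl) (inj₂ refl) e = refl

  residue : ℤ → ℕ
  residue z = z %ℕ p

  half : ℕ → ℕ
  half r with r ℕ.≤? m
  ... | yes _ = r
  ... | no  _ = p ℕ.∸ r

  halfNeg : ℕ → ℤ
  halfNeg r = 𝟙 (suc m ℕ.≤? r)

  Half : ℕ → Set
  Half k = ∃[ i ] k ≡ suc i × i ℕ.< m

  half-sign : ∀ r → r ℕ.< p → + r ≈[ p ] sgn (halfNeg r) * + half r
  half-sign r r<p with r ℕ.≤? m
  ... | yes r≤m rewrite 𝟙-no (suc m ℕ.≤? r) (ℕ.≤⇒≯ r≤m) = ≈-reflexive (sym (ℤ.*-identityˡ (+ r)))
  ... | no r≰m rewrite 𝟙-yes (suc m ℕ.≤? r) (ℕ.≰⇒> r≰m) =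
    ≈-by (divides (+ 1) (trans (cong (λ t → + r - -1ℤ * t) (trans (sym (ℤ.⊖-≥ (ℕ.<⇒≤ r<p))) (sym (ℤ.m-n≡m⊖n p r)))) (lemma (+ r) (+ p))))
    where
    lemma : ∀ r p → r - -1ℤ * (p - r) ≡ + 1 * p
    lemma = solve-∀

  half-range : ∀ r → r ≢ 0 → r ℕ.< p → Half (half r)
  half-range zero    r≢0 r<p = contradiction refl r≢0
  half-range (suc r) r≢0 r<p with suc r ℕ.≤? m
  ... | yes r≤m = r , refl , r≤m
  ... | no r≰m  = positive _ (ℕ.m<n⇒0<n∸m r<p) (ℕ.+-cancelʳ-≤ (suc r) _ m
          (subst (ℕ._≤ m ℕ.+ suc r) (sym (ℕ.m∸n+n≡m (ℕ.<⇒≤ r<p)))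
            (subst (ℕ._≤ m ℕ.+ suc r) (ℕ.+-suc m m) (ℕ.+-monoʳ-≤ m (ℕ.≰⇒> r≰m)))))
    where
    positive : ∀ k → 0 ℕ.< k → k ℕ.≤ m → Half k
    positive (suc i) _ i<m = i , refl , i<m

  residue-≢0 : ∀ {z} → ¬ + p ∣ₛ z → residue z ≢ 0
  residue-≢0 {z} ∤ eq = ∤ (≈0⇒∣ (≈-sym (subst (λ r → + r ≈[ p ] z) eq (%ℕ-≈ z p))))

  half-unique : ∀ {k k′ ε ε′} → Half k → Half k′ → Unit ε → Unit ε′ →
                ε * + k ≈[ p ] ε′ * + k′ → k ≡ k′
  half-unique {k} {k′} (i , refl , i<m) (i′ , refl , i′<m) u u′ e = case (u , u′)
    where
    k<p : k ℕ.< p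
    k<p = ℕ.≤-<-trans i<m m<p
    k′<p : k′ ℕ.< p
    k′<p = ℕ.≤-<-trans i′<m m<p
    opposite : ¬ + k ≈[ p ] - + k′
    opposite (≈-by d) = small-∤ (s≤s (ℕ.+-mono-≤ i<m i′<m)) (∣-by (cong (λ t → + k + t) (ℤ.neg-involutive (+ k′))) d)
    case : Unit _ × Unit _ → k ≡ k′
    case (inj₁ refl , inj₁ refl) = ≈⇒≡ k<p k′<p (subst₂ (λ a b → a ≈[ p ] b) (ℤ.*-identityˡ (+ k)) (ℤ.*-identityˡ (+ k′)) e)
    case (inj₂ refl , inj₂ refl) = ≈⇒≡ k<p k′<p (subst₂ (λ a b → a ≈[ p ] b) (lemma (+ k)) (lemma (+ k′)) (≈-neg e))
      where
      lemma : ∀ k → - (-1ℤ * k) ≡ k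
      lemma = solve-∀
    case (inj₁ refl , inj₂ refl) = contradiction (subst₂ (λ a b → a ≈[ p ] b) (ℤ.*-identityˡ (+ k)) (ℤ.-1*i≡-i (+ k′)) e) opposite
    case (inj₂ refl , inj₁ refl) = contradiction (subst₂ (λ a b → a ≈[ p ] b) (lemma (+ k)) (cong -_ (ℤ.*-identityˡ (+ k′))) (≈-neg e)) opposite
      where
      lemma : ∀ k → - (-1ℤ * k) ≡ k
      lemma = solve-∀

  wraps : ℤ → ℕ → ℤ
  wraps x k = halfNeg (residue (x * + k))

  gaussSign : ℤ → ℤ
  gaussSign x = sgn (∑ (1⋯ m) (wraps x))

  wrapped : ℤ → ℕ → ℕ
  wrapped x k = half (residue (x * + k))

  ∈-half : ∀ {k} → k ∈ 1⋯ m → Half k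
  ∈-half = ∈-1⋯⁻

  half-∤ : ∀ {k} → Half k → ¬ + p ∣ₛ + k
  half-∤ (i , refl , i<m) = small-∤ (ℕ.≤-<-trans i<m m<p)

  ∤-* : ∀ {x y} → ¬ + p ∣ₛ x → ¬ + p ∣ₛ y → ¬ + p ∣ₛ x * y
  ∤-* {x} {y} ∤x ∤y d with prime-∣-* pr x y d
  ... | inj₁ e = ∤x e
  ... | inj₂ e = ∤y e

  cancel-≈ : ∀ {z x y} → ¬ + p ∣ₛ z → x * z ≈[ p ] y * z → x ≈[ p ] y
  cancel-≈ {z} {x} {y} ∤z (≈-by d) = [ ≈-by , (λ e → contradiction e ∤z) ]′ (prime-∣-* pr (x - y) z (∣-by (lemma x y z) d))
    where
    lemma : ∀ x y z → x * z - y * z ≡ (x - y) * z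
    lemma = solve-∀

  prime-coprime : ∀ {x} → ¬ + p ∣ₛ x → Coprime ∣ x ∣ p
  prime-coprime {x} ∤x = Coprimality.sym (λ { {d} (d∣p , d∣x) → divisor {d} d∣p d∣x (Primality.prime⇒irreducible pr d∣p) })
    where
    divisor : ∀ {d} → d ℕ.∣ p → d ℕ.∣ ∣ x ∣ → d ≡ 1 ⊎ d ≡ p → d ≡ 1
    divisor _ _   (inj₁ eq)   = eq
    divisor _ d∣x (inj₂ refl) = contradiction (∣ᵤ⇒∣ d∣x) ∤x

  wrapped-spec : ∀ x k → x * + k ≈[ p ] sgn (wraps x k) * + wrapped x k
  wrapped-spec x k = ≈-trans (≈-sym (%ℕ-≈ (x * + k) p)) (half-sign (residue (x * + k)) (ℤ.n%ℕd<d (x * + k) p))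

  inverse : ∀ {x} → ¬ + p ∣ₛ x → ∃[ s ] s * x ≈[ p ] + 1
  inverse {x} ∤x with coprime-inverse (prime-coprime ∤x) | ℤ.+∣i∣≡i⊎+∣i∣≡-i x
  ... | s , d | inj₁ eq = s , ≈-by (∣-by (cong (λ t → s * t - + 1) eq) d)
  ... | s , d | inj₂ eq = - s , ≈-by (∣-by (trans (cong (λ t → s * t - + 1) eq) (lemma s x)) d)
    where
    lemma : ∀ s x → s * - x - + 1 ≡ - s * x - + 1
    lemma = solve-∀

  module _ {x : ℤ} (∤x : ¬ + p ∣ₛ x) where

    wrapped-half : ∀ {k} → Half k → Half (wrapped x k)
    wrapped-half {k} h = half-range _ (residue-≢0 (∤-* ∤x (half-∤ h))) (ℤ.n%ℕd<d (x * + k) p)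

    wrapped-↭ : map (wrapped x) (1⋯ m) ↭ 1⋯ m
    wrapped-↭ = map-↭ (wrapped x) (1⋯-unique m) (1⋯-unique m)
      (λ k∈ → half-∈ (wrapped-half (∈-half k∈))) inj onto
      where
      half-∈ : ∀ {k} → Half k → k ∈ 1⋯ m
      half-∈ (i , refl , i<m) = ∈-1⋯⁺ i<m
      inj : ∀ {k l} → k ∈ 1⋯ m → l ∈ 1⋯ m → wrapped x k ≡ wrapped x l → k ≡ l
      inj {k} {l} k∈ l∈ eq = half-unique (∈-half k∈) (∈-half l∈) (sgn-unit (wraps x k)) (sgn-unit (wraps x l))
        (cancel-≈ ∤x (≈-trans (≈-reflexive (lemma (sgn (wraps x k)) (+ k) x)) (≈-trans (signed k)
          (≈-trans (≈-reflexive (cong +_ eq)) (≈-trans (≈-sym (signed l)) (≈-reflexive (sym (lemma (sgn (wraps x l)) (+ l) x))))))))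
        where
        lemma : ∀ s k x → s * k * x ≡ s * (x * k)
        lemma = solve-∀
        signed : ∀ k → sgn (wraps x k) * (x * + k) ≈[ p ] + wrapped x k
        signed k = ≈-trans (≈-*ˡ (sgn (wraps x k)) (wrapped-spec x k))
          (≈-reflexive (sym (unit-move {y = + wrapped x k} (sgn-unit (wraps x k)) refl)))
      onto : ∀ {l} → l ∈ 1⋯ m → ∃[ k ] k ∈ 1⋯ m × wrapped x k ≡ l
      onto {l} l∈ = k , half-∈ hk , half-unique (wrapped-half hk) (∈-half l∈) (sgn-unit (wraps x k)) (unit-* u (inj₁ refl))
          (≈-trans (≈-sym (wrapped-spec x k)) (≈-trans (≈-*ˡ x (≈-reflexive (unit-move u refl)))
          (≈-trans (≈-*ˡ x (≈-*ˡ ε (≈-sym zk))) (≈-trans (≈-reflexive (lemma x ε s (+ l)))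
            (≈-trans (≈-*ʳ (ε * + l) sx) (≈-reflexive (lemma′ ε (+ l))))))))
        where
        s = proj₁ (inverse ∤x)
        sx = proj₂ (inverse ∤x)
        ∤s : ¬ + p ∣ₛ s
        ∤s d = prime-∤1 pr (∣-≈ (≈-sym sx) (Signed.∣m⇒∣m*n x d))
        r = residue (s * + l)
        k = half r
        ε = sgn (halfNeg r)
        u : Unit ε
        u = sgn-unit (halfNeg r)
        hk : Half k
        hk = half-range r (residue-≢0 (∤-* ∤s (half-∤ (∈-half l∈)))) (ℤ.n%ℕd<d (s * + l) p)
        zk : s * + l ≈[ p ] ε * + k
        zk = ≈-trans (≈-sym (%ℕ-≈ (s * + l) p)) (half-sign r (ℤ.n%ℕd<d (s * + l) p))
        lemma : ∀ x ε s l → x * (ε * (s * l)) ≡ s * x * (ε * l)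
        lemma = solve-∀
        lemma′ : ∀ ε l → + 1 * (ε * l) ≡ ε * + 1 * l
        lemma′ = solve-∀

    gauss : x ^ m ≈[ p ] gaussSign x
    gauss = cancel-≈ (∏-∤ pr (1⋯ m) {λ k → + k} (λ k∈ → half-∤ (∈-half k∈)))
      (≈-trans (≈-reflexive powers) (≈-trans (∏-≈ (1⋯ m) (λ {k} _ → wrapped-spec x k)) (≈-reflexive signs)))
      where
      powers : x ^ m * ∏ (1⋯ m) (λ k → + k) ≡ ∏ (1⋯ m) (λ k → x * + k)
      powers = trans (cong (_* ∏ (1⋯ m) (λ k → + k)) (trans (cong (x ^_) (sym (length-1⋯ m))) (sym (∏-const (1⋯ m) x))))
                     (sym (∏-* (1⋯ m) (λ _ → x) (λ k → + k)))
      signs : ∏ (1⋯ m) (λ k → sgn (wraps x k) * + wrapped x k) ≡ gaussSign x * ∏ (1⋯ m) (λ k → + k)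
      signs = trans (∏-* (1⋯ m) (λ k → sgn (wraps x k)) (λ k → + wrapped x k))
        (cong₂ _*_ (∏-sgn (1⋯ m) (wraps x)) (trans (sym (∏-map (1⋯ m) (wrapped x) (λ k → + k))) (∏-↭ (λ k → + k) wrapped-↭)))

  fermat : ∀ {x} → ¬ + p ∣ₛ x → x ^ m * x ^ m ≈[ p ] + 1
  fermat {x} ∤x = ≈-trans (≈-* (gauss ∤x) (gauss ∤x)) (≈-reflexive (unit-square (sgn-unit (∑ (1⋯ m) (wraps x)))))

  ^-*-distrib : ∀ x y k → (x * y) ^ k ≡ x ^ k * y ^ k
  ^-*-distrib x y zero    = refl
  ^-*-distrib x y (suc k) = trans (cong (x * y *_) (^-*-distrib x y k)) (lemma x y (x ^ k) (y ^ k))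
    where
    lemma : ∀ x y u v → x * y * (u * v) ≡ x * u * (y * v)
    lemma = solve-∀

  -- A nonresidue x together with 1², …, m² would give m + 1 roots of Xᵐ − 1.
  nonresidue-power : ∀ x → (∀ y → y ℕ.< p → ¬ + y * + y ≈[ p ] x) → ¬ x ^ m ≈[ p ] + 1
  nonresidue-power x nonres x^m≈1 = aux m refl 0<m
    where
    roots : ℕ → ℤ
    roots zero      = x
    roots k@(suc _) = + k * + k
    aux : ∀ n → n ≡ m → 0 ℕ.< n → ⊥
    aux (suc n) refl _ = lagrange pr (powerMinusOne n) roots root distinct
      where
      root : ∀ i → i ℕ.≤ m → + p ∣ₛ ⟦ powerMinusOne n ⟧ (roots i)
      root zero    _   = ∣-by (sym (⟦powerMinusOne⟧ n x)) (≈⇒∣ x^m≈1)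
      root (suc i) i≤m = ∣-by (sym (⟦powerMinusOne⟧ n (roots (suc i)))) (≈⇒∣
        (≈-trans (≈-reflexive (^-*-distrib (+ suc i) (+ suc i) m)) (fermat (half-∤ (i , refl , i≤m)))))
      distinct : ∀ {i j} → i ℕ.< j → j ℕ.≤ m → ¬ + p ∣ₛ roots i - roots j
      distinct {zero}  {suc j} _ j≤m d = nonres (suc j) (ℕ.≤-<-trans j≤m m<p) (≈-sym (≈-by d))
      distinct {suc i} {suc j} i<j j≤m d =
        [ (λ e → ℕ.<⇒≢ i<j (residue-unique (ℕ.<-trans i<j (ℕ.≤-<-trans j≤m m<p)) (ℕ.≤-<-trans j≤m m<p) e))
        , small-∤ (s≤s (ℕ.+-mono-≤ (ℕ.≤-trans (ℕ.<⇒≤ i<j) j≤m) j≤m)) ]′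
        (prime-∣-* pr (+ suc i - + suc j) (+ suc i + + suc j) (∣-by (lemma (+ suc i) (+ suc j)) d))
        where
        lemma : ∀ a b → a * a - b * b ≡ (a - b) * (a + b)
        lemma = solve-∀

  gauss-lemma : ∀ x → ¬ + p ∣ₛ + x → legendre x p ≡ gaussSign (+ x)
  gauss-lemma x ∤x with legendre x p | legendre-spec x p
  ... | _ | zeroᴸ d = contradiction d ∤x
  ... | _ | square _ y y² = unit-≈ (inj₁ refl) (sgn-unit (∑ (1⋯ m) (wraps (+ x)))) (≈-trans (≈-sym (≈-trans (≈-^ m (≈-sym y²))
            (≈-trans (≈-reflexive (^-*-distrib (+ y) (+ y) m)) (fermat ∤y)))) (gauss ∤x))
    where
    ∤y : ¬ + p ∣ₛ + y
    ∤y d = ∤x (∣-≈ (≈-sym y²) (Signed.∣m⇒∣m*n (+ y) d))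
  ... | _ | non _ nonres with sgn-unit (∑ (1⋯ m) (wraps (+ x)))
  ...   | inj₁ eq = contradiction (≈-trans (gauss ∤x) (≈-reflexive eq)) (nonresidue-power (+ x) nonres)
  ...   | inj₂ eq = sym eq

  euler : ∀ x → legendre x p ≈[ p ] (+ x) ^ m
  euler x with + p ∣ₛ? + x
  ... | no ∤x  = ≈-trans (≈-reflexive (gauss-lemma x ∤x)) (≈-sym (gauss ∤x))
  ... | yes d with legendre x p | legendre-spec x p
  ...   | _ | zeroᴸ _     = ≈-sym (∣⇒≈0 (power m 0<m))
    where
    power : ∀ k → 0 ℕ.< k → + p ∣ₛ (+ x) ^ k
    power (suc k) _ = Signed.∣m⇒∣m*n _ d
  ...   | _ | square ∤ _ _ = contradiction d ∤
  ...   | _ | non ∤ _     = contradiction d ∤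

-- Quadratic reciprocity

sgn-cong : ∀ {A : Set} (xs : List A) (f g : A → ℤ) →
           (∀ {x} → x ∈ xs → sgn (f x) ≡ sgn (g x)) → sgn (∑ xs f) ≡ sgn (∑ xs g)
sgn-cong []       f g eq = refl
sgn-cong (x ∷ xs) f g eq = trans (sgn-+ (f x) (∑ xs f))
  (trans (cong₂ _*_ (eq (here refl)) (sgn-cong xs f g (eq ∘ there))) (sym (sgn-+ (g x) (∑ xs g))))

∑-count-≤ : ∀ n t → t ℕ.≤ n → ∑ (1⋯ n) (λ l → 𝟙 (l ℕ.≤? t)) ≡ + t
∑-count-≤ zero    .0 z≤n = refl
∑-count-≤ (suc n) t t≤ with suc n ℕ.≤? t
... | yes n<t with refl ← ℕ.≤-antisym t≤ n<t =
      cong₂ _+_ (𝟙-yes (yes n<t) n<t) (trans (∑-cong (1⋯ n) (λ {l} l∈ → trans (𝟙-yes (l ℕ.≤? suc n) (bound l∈)) (sym (𝟙-yes (l ℕ.≤? n) (bound′ l∈))))) (∑-count-≤ n n ℕ.≤-refl))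
  where
  bound′ : ∀ {l} → l ∈ 1⋯ n → l ℕ.≤ n
  bound′ l∈ with ∈-1⋯⁻ l∈
  ... | i , refl , i<n = i<n
  bound : ∀ {l} → l ∈ 1⋯ n → l ℕ.≤ suc n
  bound l∈ = ℕ.m≤n⇒m≤1+n (bound′ l∈)
... | no n≮t = trans (cong₂ _+_ (𝟙-no (no n≮t) n≮t) (∑-count-≤ n t (ℕ.≤-pred (ℕ.≰⇒> n≮t)))) (ℤ.+-identityˡ (+ t))

data Ternary : ℤ → Set where
  neg1 : Ternary -1ℤ
  zer0 : Ternary (+ 0)
  pos1 : Ternary (+ 1)

ternary-* : ∀ {x y} → Ternary x → Ternary y → Ternary (x * y)
ternary-* neg1 neg1 = pos1
ternary-* neg1 zer0 = zer0
ternary-* neg1 pos1 = neg1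
ternary-* zer0 y    = zer0
ternary-* pos1 neg1 = neg1
ternary-* pos1 zer0 = zer0
ternary-* pos1 pos1 = pos1

legendre-ternary : ∀ x p → Ternary (legendre x p)
legendre-ternary x p with legendre x p | legendre-spec x p
... | _ | zeroᴸ _      = zer0
... | _ | square _ _ _ = pos1
... | _ | non _ _      = neg1

parity-ℕ : ∀ n → (∃[ k ] n ≡ k ℕ.+ k) ⊎ (∃[ k ] n ≡ suc (k ℕ.+ k))
parity-ℕ zero = inj₁ (0 , refl)
parity-ℕ (suc n) with parity-ℕ n
... | inj₁ (k , refl) = inj₂ (k , refl)
... | inj₂ (k , refl) = inj₁ (suc k , cong suc (sym (ℕ.+-suc k k)))

module Supplements (m : ℕ) (pr : Prime (suc (m ℕ.+ m))) where

  open OddPrime m pr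

  ternary-≈ : ∀ {x y} → Ternary x → Ternary y → x ≈[ p ] y → x ≡ y
  ternary-≈ neg1 neg1 e = refl
  ternary-≈ zer0 zer0 e = refl
  ternary-≈ pos1 pos1 e = refl
  ternary-≈ neg1 zer0 e = contradiction (≈⇒∣ (≈-sym e)) (prime-∤1 pr)
  ternary-≈ neg1 pos1 e = contradiction (≈-sym e) 1≉-1
  ternary-≈ zer0 neg1 e = contradiction (≈⇒∣ e) (prime-∤1 pr)
  ternary-≈ zer0 pos1 e = contradiction (≈⇒∣ (≈-sym e)) (prime-∤1 pr)
  ternary-≈ pos1 neg1 e = contradiction e 1≉-1
  ternary-≈ pos1 zer0 e = contradiction (≈⇒∣ e) (prime-∤1 pr)

  legendre-* : ∀ x y → legendre (x ℕ.* y) p ≡ legendre x p * legendre y p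
  legendre-* x y = ternary-≈ (legendre-ternary (x ℕ.* y) p) (ternary-* (legendre-ternary x p) (legendre-ternary y p))
    (≈-trans (euler (x ℕ.* y)) (≈-trans (≈-reflexive (trans (cong (_^ m) (ℤ.pos-* x y)) (^-*-distrib (+ x) (+ y) m)))
      (≈-sym (≈-* (euler x) (euler y)))))

  legendre-cong : ∀ {x y} → + x ≈[ p ] + y → legendre x p ≡ legendre y p
  legendre-cong {x} {y} e = ternary-≈ (legendre-ternary x p) (legendre-ternary y p)
    (≈-trans (euler x) (≈-trans (≈-^ m e) (≈-sym (euler y))))

  legendre-minus1 : ∀ {x} → + x ≈[ p ] -1ℤ → legendre x p ≡ sgn (+ m)
  legendre-minus1 {x} e = ternary-≈ (legendre-ternary x p) (unit-ternary (sgn-unit (+ m)))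
    (≈-trans (euler x) (≈-trans (≈-^ m e) (≈-reflexive (power m))))
    where
    unit-ternary : ∀ {ε} → Unit ε → Ternary ε
    unit-ternary (inj₁ refl) = pos1
    unit-ternary (inj₂ refl) = neg1
    power : ∀ k → -1ℤ ^ k ≡ sgn (+ k)
    power zero    = refl
    power (suc k) = trans (cong (-1ℤ *_) (power k)) (sym (sgn-+ (+ 1) (+ k)))

  legendre-two : legendre 2 p ≡ sgn (∑ (1⋯ m) (λ k → 𝟙 (suc m ℕ.≤? k ℕ.+ k)))
  legendre-two = trans (gauss-lemma 2 (small-∤ {1} (s≤s (ℕ.+-mono-≤ 0<m 0<m))))
    (cong sgn (∑-cong (1⋯ m) (λ k∈ → cong halfNeg (double (∈-1⋯⁻ k∈)))))
    where
    double : ∀ {k} → Half k → residue (+ 2 * + k) ≡ k ℕ.+ k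
    double {k} (i , refl , i<m) = %ℕ-unique (+ 2 * + k) (s≤s (ℕ.+-mono-≤ i<m i<m)) (≈-reflexive (lemma (+ k)))
      where
      lemma : ∀ k → + 2 * k ≡ k + k
      lemma = solve-∀

  sgn-p : ∀ x → sgn (+ p * x) ≡ sgn x
  sgn-p x = trans (cong sgn (trans (cong (_* x) (ℤ.pos-+ 1 (m ℕ.+ m))) (trans (cong (λ t → (+ 1 + t) * x) (ℤ.pos-+ m m)) (lemma (+ m) x))))
    (trans (sgn-+ (+ m * x + + m * x) x) (trans (cong (_* sgn x) (sgn-even (+ m * x))) (ℤ.*-identityˡ (sgn x))))
    where
    lemma : ∀ m x → (+ 1 + (m + m)) * x ≡ m * x + m * x + x
    lemma = solve-∀

  sgn-half : ∀ r → r ℕ.< p → sgn (halfNeg r) ≡ sgn (+ r) * sgn (+ half r)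
  sgn-half r r<p with r ℕ.≤? m
  ... | yes r≤m rewrite 𝟙-no (suc m ℕ.≤? r) (ℕ.≤⇒≯ r≤m) = sym (unit-square (sgn-unit (+ r)))
  ... | no r≰m rewrite 𝟙-yes (suc m ℕ.≤? r) (ℕ.≰⇒> r≰m) = sym (trans (sym (sgn-+ (+ r) (+ (p ℕ.∸ r))))
        (trans (cong (λ t → sgn (+ t)) (ℕ.m+[n∸m]≡n (ℕ.<⇒≤ r<p))) (trans (cong sgn (sym (ℤ.*-identityʳ (+ p)))) (sgn-p (+ 1)))))

  module Eisenstein (n : ℕ) (p∤q : ¬ + p ∣ₛ + suc (n ℕ.+ n)) where

    q : ℕ
    q = suc (n ℕ.+ n)

    quot : ℕ → ℕ
    quot k = (q ℕ.* k) ℕ./ p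

    rem : ℕ → ℕ
    rem k = (q ℕ.* k) % p

    division : ∀ k → q ℕ.* k ≡ rem k ℕ.+ quot k ℕ.* p
    division k = m≡m%n+[m/n]*n (q ℕ.* k) p

    residue-rem : ∀ k → residue (+ q * + k) ≡ rem k
    residue-rem k = cong (_%ℕ p) (sym (ℤ.pos-* q k))

    sgn-q : ∀ x → sgn (+ q * x) ≡ sgn x
    sgn-q x = trans (cong sgn (trans (cong (_* x) (ℤ.pos-+ 1 (n ℕ.+ n))) (trans (cong (λ t → (+ 1 + t) * x) (ℤ.pos-+ n n)) (lemma (+ n) x))))
      (trans (sgn-+ (+ n * x + + n * x) x) (trans (cong (_* sgn x) (sgn-even (+ n * x))) (ℤ.*-identityˡ (sgn x))))
      where
      lemma : ∀ m x → (+ 1 + (m + m)) * x ≡ m * x + m * x + x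
      lemma = solve-∀

    sgn-k : ∀ k → sgn (+ k) ≡ sgn (+ rem k) * sgn (+ quot k)
    sgn-k k = trans (sym (sgn-q (+ k))) (trans (cong sgn (trans (sym (ℤ.pos-* q k)) (trans (cong (λ t → + t) (division k))
      (cong (_+_ (+ rem k)) (trans (ℤ.pos-* (quot k) p) (ℤ.*-comm (+ quot k) (+ p)))))))
      (trans (sgn-+ (+ rem k) (+ p * + quot k)) (cong (sgn (+ rem k) *_) (sgn-p (+ quot k)))))

    sgn-wraps : ∀ k → sgn (wraps (+ q) k) ≡ sgn (+ quot k + (+ k + + wrapped (+ q) k))
    sgn-wraps k rewrite residue-rem k = trans (sgn-half (rem k) (m%n<n (q ℕ.* k) p))
      (sym (trans (sgn-+ (+ quot k) (+ k + + half (rem k))) (trans (cong (sgn (+ quot k) *_) (sgn-+ (+ k) (+ half (rem k))))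
        (trans (cong (λ t → sgn (+ quot k) * (t * sgn (+ half (rem k)))) (sgn-k k))
          (trans (lemma (sgn (+ quot k)) (sgn (+ rem k)) (sgn (+ half (rem k))))
            (trans (cong (_* (sgn (+ rem k) * sgn (+ half (rem k)))) (unit-square (sgn-unit (+ quot k)))) (ℤ.*-identityˡ _)))))))
      where
      lemma : ∀ a b c → a * (b * a * c) ≡ a * a * (b * c)
      lemma = solve-∀

    eisenstein : legendre q p ≡ sgn (∑ (1⋯ m) (λ k → + quot k))
    eisenstein = trans (gauss-lemma q p∤q) (trans (sgn-cong (1⋯ m) (wraps (+ q)) _ (λ {k} _ → sgn-wraps k))
      (trans (cong sgn (trans (∑-+ (1⋯ m) (λ k → + quot k) (λ k → + k + + wrapped (+ q) k))
        (trans (cong (_+_ (∑ (1⋯ m) (λ k → + quot k))) (trans (∑-+ (1⋯ m) (λ k → + k) (λ k → + wrapped (+ q) k))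
          (cong (_+_ (∑ (1⋯ m) (λ k → + k))) (trans (sym (∑-map (1⋯ m) (wrapped (+ q)) (λ k → + k))) (∑-↭ (λ k → + k) (wrapped-↭ p∤q)))))) refl)))
        (trans (sgn-+ (∑ (1⋯ m) (λ k → + quot k)) _)
          (trans (cong (sgn (∑ (1⋯ m) (λ k → + quot k)) *_) (sgn-even (∑ (1⋯ m) (λ k → + k)))) (ℤ.*-identityʳ _)))))

    quot-bound : ∀ k → k ℕ.≤ m → quot k ℕ.≤ n
    quot-bound k k≤m = ℕ.≤-pred (ℕ.*-cancelʳ-< (p ℕ.+ p) (quot k) (suc n)
      (ℕ.≤-<-trans (ℕ.≤-reflexive (twice (quot k) p)) (ℕ.≤-<-trans (ℕ.+-mono-≤ below below)
        (ℕ.<-≤-trans (subst (ℕ._< q ℕ.* p) (twiceˡ q m) (ℕ.*-monoʳ-< q (ℕ.n<1+n (m ℕ.+ m)))) above))))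
      where
      twice : ∀ a b → a ℕ.* (b ℕ.+ b) ≡ a ℕ.* b ℕ.+ a ℕ.* b
      twice a b = ℕ.*-distribˡ-+ a b b
      twiceˡ : ∀ a b → a ℕ.* (b ℕ.+ b) ≡ a ℕ.* b ℕ.+ a ℕ.* b
      twiceˡ = twice
      below : quot k ℕ.* p ℕ.≤ q ℕ.* m
      below = ℕ.≤-trans (ℕ.m/n*n≤m (q ℕ.* k) p) (ℕ.*-monoʳ-≤ q k≤m)
      above : q ℕ.* p ℕ.≤ suc n ℕ.* (p ℕ.+ p)
      above = subst (q ℕ.* p ℕ.≤_) (trans (ℕ.*-distribʳ-+ p (suc n) (suc n)) (sym (twice (suc n) p)))
                (ℕ.*-monoˡ-≤ p (s≤s (ℕ.+-monoʳ-≤ n (ℕ.n≤1+n n))))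

    quot-count : ∀ {k} → Half k → + quot k ≡ ∑ (1⋯ n) (λ l → 𝟙 (p ℕ.* l ℕ.<? q ℕ.* k))
    quot-count {k} h@(i , refl , i<m) = trans (sym (∑-count-≤ n (quot k) (quot-bound k i<m)))
      (∑-ext (1⋯ n) (λ l → 𝟙-⇔ (l ℕ.≤? quot k) (p ℕ.* l ℕ.<? q ℕ.* k) (to l) (from l)))
      where
      to : ∀ l → l ℕ.≤ quot k → p ℕ.* l ℕ.< q ℕ.* k
      to l l≤ = subst (p ℕ.* l ℕ.<_) (sym (division k)) (ℕ.≤-<-trans (ℕ.*-monoʳ-≤ p l≤)
        (subst (ℕ._< rem k ℕ.+ quot k ℕ.* p) (ℕ.*-comm (quot k) p)
          (ℕ.m<n+m (quot k ℕ.* p) (ℕ.n≢0⇒n>0 λ eq → residue-≢0 (∤-* p∤q (half-∤ h)) (trans (residue-rem k) eq)))))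
      from : ∀ l → p ℕ.* l ℕ.< q ℕ.* k → l ℕ.≤ quot k
      from l lt = ℕ.≤-pred (ℕ.*-cancelˡ-< p l (suc (quot k)) (ℕ.<-trans lt (subst₂ ℕ._<_ (sym (division k))
        (ℕ.*-comm (suc (quot k)) p) (ℕ.+-monoˡ-< (quot k ℕ.* p) (m%n<n (q ℕ.* k) p)))))

reciprocity : ∀ m n (p-prime : Prime (suc (m ℕ.+ m))) (q-prime : Prime (suc (n ℕ.+ n))) → m ≢ n →
  legendre (suc (n ℕ.+ n)) (suc (m ℕ.+ m)) * legendre (suc (m ℕ.+ m)) (suc (n ℕ.+ n)) ≡ sgn (+ m * + n)
reciprocity m n p-prime q-prime m≢n = begin
  legendre q p * legendre p q
    ≡⟨ cong₂ _*_ (trans eisensteinᵖ (cong sgn (∑-cong (1⋯ m) (λ k∈ → Sᵖ.Eisenstein.quot-count n (prime-∤ p-prime q-prime p≢q) (∈-1⋯⁻ k∈)))))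
                 (trans eisensteinᵠ (cong sgn (∑-cong (1⋯ n) (λ l∈ → Sᵠ.Eisenstein.quot-count m (prime-∤ q-prime p-prime (p≢q ∘ sym)) (∈-1⋯⁻ l∈))))) ⟩
  sgn below * sgn above
    ≡⟨ sym (sgn-+ below above) ⟩
  sgn (below + above)
    ≡⟨ cong sgn (trans (cong (_+_ below) (∑-swap (1⋯ n) (1⋯ m) _))
        (trans (sym (∑-+ (1⋯ m) (λ k → ∑ (1⋯ n) (λ l → 𝟙 (p ℕ.* l ℕ.<? q ℕ.* k))) _))
          (trans (∑-cong (1⋯ m) (λ {k} k∈ → trans (sym (∑-+ (1⋯ n) (λ l → 𝟙 (p ℕ.* l ℕ.<? q ℕ.* k)) _))
                    (trans (∑-cong (1⋯ n) (λ {l} _ → exclusive (∈-1⋯⁻ k∈) l)) (ones n))))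
            (trans (∑-const m (+ n)) refl)))) ⟩
  sgn (+ m * + n) ∎
  where
  open ≡-Reasoning
  p = suc (m ℕ.+ m)
  q = suc (n ℕ.+ n)
  below = ∑ (1⋯ m) (λ k → ∑ (1⋯ n) (λ l → 𝟙 (p ℕ.* l ℕ.<? q ℕ.* k)))
  above = ∑ (1⋯ n) (λ l → ∑ (1⋯ m) (λ k → 𝟙 (q ℕ.* k ℕ.<? p ℕ.* l)))
  module Sᵖ = Supplements m p-prime
  module Sᵠ = Supplements n q-prime
  p≢q : p ≢ q
  p≢q eq = m≢n (double-injective m n (ℕ.suc-injective eq))
  prime-∤ : ∀ {a b} → Prime a → Prime b → a ≢ b → ¬ + a ∣ₛ + b
  prime-∤ {a} a-prime b-prime a≢b d with Primality.prime⇒irreducible b-prime (∣⇒∣ᵤ d)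
  ... | inj₁ refl = Primality.¬prime[1] a-prime
  ... | inj₂ eq   = a≢b eq
  eisensteinᵖ = Sᵖ.Eisenstein.eisenstein n (prime-∤ p-prime q-prime p≢q)
  eisensteinᵠ = Sᵠ.Eisenstein.eisenstein m (prime-∤ q-prime p-prime (p≢q ∘ sym))
  ∑-const : ∀ n c → ∑ (1⋯ n) (λ _ → c) ≡ + n * c
  ∑-const zero    c = refl
  ∑-const (suc n) c = trans (cong (_+_ c) (∑-const n c)) (sym (trans (cong (_* c) (ℤ.pos-+ 1 n)) (lemma (+ n) c)))
    where
    lemma : ∀ n c → (+ 1 + n) * c ≡ c + n * c
    lemma = solve-∀
  ones : ∀ n → ∑ (1⋯ n) (λ _ → + 1) ≡ + n
  ones n = trans (∑-const n (+ 1)) (ℤ.*-identityʳ (+ n))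
  exclusive : ∀ {k} → ∃[ i ] k ≡ suc i × i ℕ.< m → ∀ l → 𝟙 (p ℕ.* l ℕ.<? q ℕ.* k) + 𝟙 (q ℕ.* k ℕ.<? p ℕ.* l) ≡ + 1
  exclusive {k} h l with ℕ.<-cmp (p ℕ.* l) (q ℕ.* k)
  ... | tri< a _ c = cong₂ _+_ (𝟙-yes (p ℕ.* l ℕ.<? q ℕ.* k) a) (𝟙-no (q ℕ.* k ℕ.<? p ℕ.* l) c)
  ... | tri> a _ c = cong₂ _+_ (𝟙-no (p ℕ.* l ℕ.<? q ℕ.* k) a) (𝟙-yes (q ℕ.* k ℕ.<? p ℕ.* l) c)
  ... | tri≈ _ eq _ = contradiction (divides (+ l) (trans (sym (ℤ.pos-* q k)) (trans (cong (λ t → + t) (sym eq))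
          (trans (ℤ.pos-* p l) (ℤ.*-comm (+ p) (+ l))))))
        (OddPrime.∤-* m p-prime (prime-∤ p-prime q-prime p≢q) (OddPrime.half-∤ m p-prime h))

-- Jacobi symbols

OddPrime⁺ : ℕ → Set
OddPrime⁺ p = ∃[ m ] p ≡ suc (m ℕ.+ m) × Prime p

jac : ℕ → List ℕ → ℤ
jac x ps = productℤ (map (legendre x) ps)

jac-* : ∀ {ps} → All OddPrime⁺ ps → ∀ x y → jac (x ℕ.* y) ps ≡ jac x ps * jac y ps
jac-* [] x y = refl
jac-* {p ∷ ps} ((m , refl , pr) ∷ odd) x y =
  trans (cong₂ _*_ (Supplements.legendre-* m pr x y) (jac-* odd x y))
        (lemma (legendre x p) (legendre y p) (jac x ps) (jac y ps))
  where
  lemma : ∀ a b c d → a * b * (c * d) ≡ a * c * (b * d)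
  lemma = solve-∀

≈-∣ : ∀ {m n x y} → m ℕ.∣ n → x ≈[ n ] y → x ≈[ m ] y
≈-∣ m∣n (≈-by d) = ≈-by (∣ᵤ⇒∣ (ℕ.∣-trans m∣n (∣⇒∣ᵤ d)))

jac-cong : ∀ {ps} → All OddPrime⁺ ps → ∀ {x y} → + x ≈[ product ps ] + y → jac x ps ≡ jac y ps
jac-cong [] e = refl
jac-cong {p ∷ ps} ((m , refl , pr) ∷ odd) e =
  cong₂ _*_ (Supplements.legendre-cong m pr (≈-∣ (ℕ.m∣m*n (product ps)) e)) (jac-cong odd (≈-∣ (ℕ.n∣m*n p) e))

jac-ternary : ∀ x ps → Ternary (jac x ps)
jac-ternary x []       = pos1
jac-ternary x (p ∷ ps) = ternary-* (legendre-ternary x p) (jac-ternary x ps)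

coprime-* : ∀ {x m n} → Coprime x m → Coprime x n → Coprime x (m ℕ.* n)
coprime-* cm cn {d} (d∣x , d∣mn) =
  cn (d∣x , Coprimality.coprime-divisor (λ { (e∣d , e∣m) → cm (ℕ.∣-trans e∣d d∣x , e∣m) }) d∣mn)

jac-dichotomy : ∀ {ps} → All OddPrime⁺ ps → ∀ x →
  (Coprime x (product ps) × Unit (jac x ps)) ⊎ (¬ Coprime x (product ps) × jac x ps ≡ + 0)
jac-dichotomy [] x = inj₁ ((λ (_ , d∣1) → ℕ.∣1⇒≡1 d∣1) , inj₁ refl)
jac-dichotomy {p ∷ ps} ((m , refl , pr) ∷ odd) x with legendre x p | legendre-spec x p | jac-dichotomy odd x
... | _ | zeroᴸ d      | _ = inj₂ ((λ c → Primality.¬prime[1] (subst Prime (c (∣⇒∣ᵤ d , ℕ.m∣m*n (product ps))) pr)) , refl)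
... | _ | square ∤ _ _ | inj₁ (c , u) = inj₁ (coprime-* (coprime ∤) c , unit-* (inj₁ refl) u)
  where
  coprime : ¬ + p ∣ₛ + x → Coprime x p
  coprime = OddPrime.prime-coprime m pr {+ x}
... | _ | non ∤ _      | inj₁ (c , u) = inj₁ (coprime-* (coprime ∤) c , unit-* (inj₂ refl) u)
  where
  coprime : ¬ + p ∣ₛ + x → Coprime x p
  coprime = OddPrime.prime-coprime m pr {+ x}
... | l | _            | inj₂ (¬c , z) = inj₂ ((λ c → ¬c (λ (d∣x , d∣n) → c (d∣x , ℕ.∣n⇒∣m*n p d∣n))) , trans (cong (l *_) z) (ℤ.*-zeroʳ l))

odd-* : ∀ m k → suc (m ℕ.+ m) ℕ.* suc (k ℕ.+ k) ≡ suc ((m ℕ.* suc (k ℕ.+ k) ℕ.+ k) ℕ.+ (m ℕ.* suc (k ℕ.+ k) ℕ.+ k))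
odd-* m k = cong suc (trans (cong (k ℕ.+ k ℕ.+_) (ℕ.*-distribʳ-+ (suc (k ℕ.+ k)) m m)) (lemma (m ℕ.* suc (k ℕ.+ k)) k))
  where
  lemma : ∀ a k → k ℕ.+ k ℕ.+ (a ℕ.+ a) ≡ a ℕ.+ k ℕ.+ (a ℕ.+ k)
  lemma = ℕ-solve-∀

sgn-odd-* : ∀ z m k → sgn (z * + (m ℕ.* suc (k ℕ.+ k) ℕ.+ k)) ≡ sgn (z * + m) * sgn (z * + k)
sgn-odd-* z m k = trans (cong (λ t → sgn (z * t)) (trans (ℤ.pos-+ (m ℕ.* suc (k ℕ.+ k)) k) (cong (_+ + k) (trans (ℤ.pos-* m (suc (k ℕ.+ k)))
    (cong (+ m *_) (trans (ℤ.pos-+ 1 (k ℕ.+ k)) (cong (_+_ (+ 1)) (ℤ.pos-+ k k))))))))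
  (trans (cong sgn (lemma z (+ m) (+ k))) (trans (sgn-+ (z * + m * + k + z * + m * + k) (z * + m + z * + k))
    (trans (cong (_* sgn (z * + m + z * + k)) (sgn-even (z * + m * + k))) (trans (ℤ.*-identityˡ (sgn (z * + m + z * + k))) (sgn-+ (z * + m) (z * + k))))))
  where
  lemma : ∀ z m k → z * (m * (+ 1 + (k + k)) + k) ≡ z * m * k + z * m * k + (z * m + z * k)
  lemma = solve-∀

odd-product : ∀ {ps} → All OddPrime⁺ ps → ∃[ k ] product ps ≡ suc (k ℕ.+ k)
odd-product [] = 0 , refl
odd-product ((m , refl , pr) ∷ odd) with odd-product odd
... | k , eq = m ℕ.* suc (k ℕ.+ k) ℕ.+ k , trans (cong (suc (m ℕ.+ m) ℕ.*_) eq) (odd-* m k)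

module _ {p : ℕ} {ps : List ℕ} {m k : ℕ} (pr : Prime p) (p≡ : p ≡ suc (m ℕ.+ m)) (n≡ : p ℕ.* product ps ≡ suc (k ℕ.+ k))
         (odd : All OddPrime⁺ ps) where

  private
    k′ = proj₁ (odd-product odd)
    n′≡ = proj₂ (odd-product odd)

  sgn-step : ∀ z → sgn (z * + k) ≡ sgn (z * + m) * sgn (z * + k′)
  sgn-step z = trans (cong (λ t → sgn (z * + t)) (double-injective k _ (ℕ.suc-injective
    (trans (sym n≡) (trans (cong₂ ℕ._*_ p≡ n′≡) (odd-* m k′)))))) (sgn-odd-* z m k′)

jac-minus1 : ∀ {ps} → All OddPrime⁺ ps → ∀ {x k} → product ps ≡ suc (k ℕ.+ k) → + x ≈[ product ps ] -1ℤ → jac x ps ≡ sgn (+ k)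
jac-minus1 [] {k = zero} eq e = refl
jac-minus1 {p ∷ ps} ((m , refl , pr) ∷ odd) {x} {k} eq e =
  trans (cong₂ _*_ (Supplements.legendre-minus1 m pr (≈-∣ (ℕ.m∣m*n (product ps)) e))
                   (jac-minus1 odd {x} {proj₁ (odd-product odd)} (proj₂ (odd-product odd)) (≈-∣ (ℕ.n∣m*n p) e)))
  (sym (trans (cong sgn (sym (ℤ.*-identityˡ (+ k)))) (trans (sgn-step {m = m} {k = k} pr refl eq odd (+ 1))
    (cong₂ (λ a b → sgn a * sgn b) (ℤ.*-identityˡ (+ m)) (ℤ.*-identityˡ (+ proj₁ (odd-product odd)))))))

jac-reciprocity : ∀ {ps} → All OddPrime⁺ ps → ∀ {m k} (pr : Prime (suc (m ℕ.+ m))) → ¬ suc (m ℕ.+ m) ℕ.∣ product ps →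
  product ps ≡ suc (k ℕ.+ k) → legendre (product ps) (suc (m ℕ.+ m)) * jac (suc (m ℕ.+ m)) ps ≡ sgn (+ m * + k)
jac-reciprocity [] {m} {zero} pr ∤ eq = trans (ℤ.*-identityʳ (legendre 1 p)) (trans (legendre-one (legendre 1 p) (legendre-spec 1 p)) (sym (cong sgn (ℤ.*-zeroʳ (+ m)))))
  where
  p = suc (m ℕ.+ m)
  legendre-one : ∀ l → Legendre 1 p l → l ≡ + 1
  legendre-one _ (zeroᴸ d)      = contradiction d (prime-∤1 pr)
  legendre-one _ (square _ _ _) = refl
  legendre-one _ (non ∤ nonsq)  = contradiction (≈-refl {x = + 1}) (nonsq 1 (s≤s (ℕ.≤-trans (OddPrime.0<m m pr) (ℕ.m≤m+n m m))))
jac-reciprocity {q ∷ ps} ((n , refl , qr) ∷ odd) {m} {k} pr ∤ eq =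
  trans (cong (_* (legendre p q * jac p ps)) (Supplements.legendre-* m pr q (product ps)))
  (trans (lemma (legendre q p) (legendre (product ps) p) (legendre p q) (jac p ps))
  (trans (cong₂ _*_ (reciprocity m n pr qr m≢n)
                    (jac-reciprocity odd {m} {proj₁ (odd-product odd)} pr (λ d → ∤ (ℕ.∣n⇒∣m*n q d)) (proj₂ (odd-product odd))))
         (sym (sgn-step {m = n} {k = k} qr refl eq odd (+ m)))))
  where
  p = suc (m ℕ.+ m)
  m≢n : m ≢ n
  m≢n refl = ∤ (ℕ.m∣m*n (product ps))
  lemma : ∀ a b c d → a * b * (c * d) ≡ a * c * (b * d)
  lemma = solve-∀

∑<-ones : ∀ n → ∑< n (λ _ → + 1) ≡ + n
∑<-ones zero    = refl
∑<-ones (suc n) = cong (_+_ (+ 1)) (∑<-ones n)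

-- The count behind (2/p) has the parity of (p² − 1)/8.
legendre-two-value : ∀ m (pr : Prime (suc (m ℕ.+ m))) →
  ∃[ t ] (+ suc (m ℕ.+ m) * + suc (m ℕ.+ m) ≡ + 1 + + 8 * t) × legendre 2 (suc (m ℕ.+ m)) ≡ sgn t
legendre-two-value m pr with parity-ℕ m
... | inj₁ (t , refl) = + t * (+ t + + t + + 1) , trans (cong (λ z → z * z) cast) (square-lemma (+ t)) ,
      trans (Supplements.legendre-two m pr) (trans (cong sgn (trans (∑-map (downFrom (t ℕ.+ t)) suc f) (trans (∑<-split t t (f ∘ suc)) (trans (cong₂ _+_
        (∑-zero (downFrom t) (λ {i} i∈ → 𝟙-no (suc (t ℕ.+ t) ℕ.≤? suc i ℕ.+ suc i) (ℕ.≤⇒≯ (ℕ.+-mono-≤ (∈-downFrom⁻ i∈) (∈-downFrom⁻ i∈)))))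
        (trans (∑-ext (downFrom t) (λ i → 𝟙-yes (suc (t ℕ.+ t) ℕ.≤? suc (t ℕ.+ i) ℕ.+ suc (t ℕ.+ i)) (s≤s (ℕ.+-mono-≤ (ℕ.m≤m+n t i) (ℕ.m≤n⇒m≤1+n (ℕ.m≤m+n t i)))))) (∑<-ones t))) (ℤ.+-identityˡ (+ t)))))) (sym (value (+ t))))
  where
  f : ℕ → ℤ
  f k = 𝟙 (suc (t ℕ.+ t) ℕ.≤? k ℕ.+ k)
  cast : + suc (t ℕ.+ t ℕ.+ (t ℕ.+ t)) ≡ + 1 + (+ t + + t + (+ t + + t))
  cast = trans (ℤ.pos-+ 1 (t ℕ.+ t ℕ.+ (t ℕ.+ t))) (cong (_+_ (+ 1)) (trans (ℤ.pos-+ (t ℕ.+ t) (t ℕ.+ t)) (cong₂ _+_ (ℤ.pos-+ t t) (ℤ.pos-+ t t))))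
  square-lemma : ∀ t → (+ 1 + (t + t + (t + t))) * (+ 1 + (t + t + (t + t))) ≡ + 1 + + 8 * (t * (t + t + + 1))
  square-lemma = solve-∀
  value : ∀ t → sgn (t * (t + t + + 1)) ≡ sgn t
  value t = trans (cong sgn (lemma t)) (trans (sgn-+ (t * t + t * t) t) (trans (cong (_* sgn t) (sgn-even (t * t))) (ℤ.*-identityˡ (sgn t))))
    where
    lemma : ∀ t → t * (t + t + + 1) ≡ t * t + t * t + t
    lemma = solve-∀
... | inj₂ (t , refl) = (+ t + + 1) * (+ t + + t + + 1) , trans (cong (λ z → z * z) cast) (square-lemma (+ t)) ,
      trans (Supplements.legendre-two m pr) (trans (cong sgn (trans (∑-map (downFrom (suc (t ℕ.+ t))) suc f) (trans (cong (λ s → ∑< s (f ∘ suc)) (sym (ℕ.+-suc t t))) (trans (∑<-split t (suc t) (f ∘ suc)) (trans (cong₂ _+_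
        (∑-zero (downFrom t) (λ {i} i∈ → 𝟙-no (suc (suc (t ℕ.+ t)) ℕ.≤? suc i ℕ.+ suc i) (ℕ.≤⇒≯ (ℕ.m≤n⇒m≤1+n (ℕ.+-mono-≤ (∈-downFrom⁻ i∈) (∈-downFrom⁻ i∈))))))
        (trans (∑-ext (downFrom (suc t)) (λ i → 𝟙-yes (suc (suc (t ℕ.+ t)) ℕ.≤? suc (t ℕ.+ i) ℕ.+ suc (t ℕ.+ i)) (s≤s (subst (ℕ._≤ t ℕ.+ i ℕ.+ suc (t ℕ.+ i)) (ℕ.+-suc t t) (ℕ.+-mono-≤ (ℕ.m≤m+n t i) (s≤s (ℕ.m≤m+n t i))))))) (∑<-ones (suc t)))) (ℤ.+-identityˡ (+ suc t))))))) (sym (trans (cong sgn (cong (_* (+ t + + t + + 1)) (ℤ.+-comm (+ t) (+ 1)))) (value (+ suc t) (+ t)))))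
  where
  f : ℕ → ℤ
  f k = 𝟙 (suc (suc (t ℕ.+ t)) ℕ.≤? k ℕ.+ k)
  cast : + suc (suc (t ℕ.+ t) ℕ.+ suc (t ℕ.+ t)) ≡ + 1 + (+ 1 + (+ t + + t) + (+ 1 + (+ t + + t)))
  cast = trans (ℤ.pos-+ 1 (suc (t ℕ.+ t) ℕ.+ suc (t ℕ.+ t))) (cong (_+_ (+ 1)) (trans (ℤ.pos-+ (suc (t ℕ.+ t)) (suc (t ℕ.+ t))) (cong (λ z → z + z) (trans (ℤ.pos-+ 1 (t ℕ.+ t)) (cong (_+_ (+ 1)) (ℤ.pos-+ t t))))))
  square-lemma : ∀ t → (+ 1 + (+ 1 + (t + t) + (+ 1 + (t + t)))) * (+ 1 + (+ 1 + (t + t) + (+ 1 + (t + t)))) ≡ + 1 + + 8 * ((t + + 1) * (t + t + + 1))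
  square-lemma = solve-∀
  value : ∀ s t → sgn (s * (t + t + + 1)) ≡ sgn s
  value s t = trans (cong sgn (lemma s t)) (trans (sgn-+ (s * t + s * t) s) (trans (cong (_* sgn s) (sgn-even (s * t))) (ℤ.*-identityˡ (sgn s))))
    where
    lemma : ∀ s t → s * (t + t + + 1) ≡ s * t + s * t + s
    lemma = solve-∀

jac-two : ∀ {ps} → All OddPrime⁺ ps → ∃[ t ] (+ product ps * + product ps ≡ + 1 + + 8 * t) × jac 2 ps ≡ sgn t
jac-two [] = + 0 , refl , refl
jac-two {p ∷ ps} ((m , refl , pr) ∷ odd) with legendre-two-value m pr | jac-two odd
... | s , ps≡ , ls | t , ns≡ , lt = s + t + (+ 4 * s * t + + 4 * s * t) ,
    trans (cong (λ z → z * z) (ℤ.pos-* p (product ps))) (trans (lemma₁ (+ p) (+ product ps)) (trans (cong₂ _*_ ps≡ ns≡) (lemma₂ s t))) ,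
    trans (cong₂ _*_ ls lt) (sym (trans (sgn-+ (s + t) _) (trans (cong₂ _*_ (sgn-+ s t) (sgn-even (+ 4 * s * t))) (ℤ.*-identityʳ _))))
  where
  lemma₁ : ∀ a b → a * b * (a * b) ≡ a * a * (b * b)
  lemma₁ = solve-∀
  lemma₂ : ∀ s t → (+ 1 + + 8 * s) * (+ 1 + + 8 * t) ≡ + 1 + + 8 * (s + t + (+ 4 * s * t + + 4 * s * t))
  lemma₂ = solve-∀

-- The character of conductor N = 4c + 3

conductor : ℕ → ℕ
conductor c = suc (suc (c ℕ.+ c) ℕ.+ suc (c ℕ.+ c))

conductor-ℤ : ∀ c → + conductor c ≡ + 4 * + c + + 3
conductor-ℤ c = trans (cong (λ t → + t) (lemma c)) (trans (ℤ.pos-+ (4 ℕ.* c) 3) (cong (_+ + 3) (ℤ.pos-* 4 c)))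
  where
  lemma : ∀ c → suc (suc (c ℕ.+ c) ℕ.+ suc (c ℕ.+ c)) ≡ 4 ℕ.* c ℕ.+ 3
  lemma = ℕ-solve-∀

record QuadraticCharacter (c : ℕ) (χ : ℤ → ℤ) : Set where
  field
    χ-cong    : ∀ {x y} → x ≈[ conductor c ] y → χ x ≡ χ y
    χ-*       : ∀ x y → χ (x * y) ≡ χ x * χ y
    χ-neg     : ∀ x → χ (- x) ≡ - χ x
    χ-ternary : ∀ x → Ternary (χ x)
    χ-zero    : ∀ x → ¬ Coprime x (conductor c) → χ (+ x) ≡ + 0
    χ-unit    : ∀ x → Coprime x (conductor c) → Unit (χ (+ x))
    χ-two     : χ (+ 2) ≡ - sgn (+ c)
    χ-prime   : ∀ {m} → Prime (suc (m ℕ.+ m)) → ∀ y → + y ≈[ suc (m ℕ.+ m) ] - + conductor c →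
                χ (+ suc (m ℕ.+ m)) ≡ legendre y (suc (m ℕ.+ m))

module Jacobi (c : ℕ) where

  private
    K = suc (c ℕ.+ c)
    N = conductor c

    factorisation : PrimeFactorisation N
    factorisation = factorise N

    ps : List ℕ
    ps = factors factorisation

    N≡ : N ≡ product ps
    N≡ = PrimeFactorisation.isFactorisation factorisation

    odd-factors : ∀ {qs} → product qs ℕ.∣ N → All Prime qs → All OddPrime⁺ qs
    odd-factors d [] = []
    odd-factors {q ∷ qs} d (pr ∷ prs) = odd-factor (parity-ℕ q) ∷ odd-factors (ℕ.∣-trans (ℕ.n∣m*n q) d) prs
      where
      odd-factor : _ → OddPrime⁺ q
      odd-factor (inj₂ (m , eq)) = m , eq , pr
      odd-factor (inj₁ (k , eq)) = contradiction (ℕ.∣-trans (ℕ.divides k (trans eq (n+n≡n*2 k))) (ℕ.∣-trans (ℕ.m∣m*n (product qs)) d)) (2∤1+n+n K)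

    odd : All OddPrime⁺ ps
    odd = odd-factors (ℕ.∣-reflexive (sym N≡)) (PrimeFactorisation.factorsPrime factorisation)

    lift : ∀ {x y} → x ≈[ N ] y → x ≈[ product ps ] y
    lift = subst (λ n → _ ≈[ n ] _) N≡

    sgn-K : sgn (+ K) ≡ -1ℤ
    sgn-K = trans (cong sgn (trans (ℤ.pos-+ 1 (c ℕ.+ c)) (trans (ℤ.+-comm (+ 1) (+ (c ℕ.+ c))) (cong (_+ + 1) (ℤ.pos-+ c c))))) (sgn-odd (+ c))

  χ : ℤ → ℤ
  χ z = jacobi (z %ℕ N) N

  private
    cong-χ : ∀ {x y} → x ≈[ N ] y → χ x ≡ χ y
    cong-χ {x} {y} e = jac-cong odd (lift (≈-trans (%ℕ-≈ x N) (≈-trans e (≈-sym (%ℕ-≈ y N)))))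

  χ-ℕ : ∀ x → χ (+ x) ≡ jacobi x N
  χ-ℕ x = jac-cong odd (lift (%ℕ-≈ (+ x) N))

  private
    mult : ∀ x y → χ (x * y) ≡ χ x * χ y
    mult x y = trans (jac-cong odd (lift (≈-trans (%ℕ-≈ (x * y) N) (≈-trans (≈-sym (≈-* (%ℕ-≈ x N) (%ℕ-≈ y N))) (≈-reflexive (sym (ℤ.pos-* (x %ℕ N) (y %ℕ N))))))))
      (jac-* odd (x %ℕ N) (y %ℕ N))

    two : χ (+ 2) ≡ - sgn (+ c)
    two with jac-two odd
    ... | t , eq , val = trans (χ-ℕ 2) (trans val (trans (cong sgn (sym t≡)) (trans (sgn-+ (+ c * + c + + c * + c + (+ c + + 1)) (+ c * + 2))
            (trans (cong₂ _*_ (trans (sgn-+ (+ c * + c + + c * + c) (+ c + + 1)) (cong₂ _*_ (sgn-even (+ c * + c)) (sgn-+ (+ c) (+ 1))))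
                              (trans (cong sgn (lemma₁ (+ c))) (sgn-even (+ c)))) (lemma₂ (sgn (+ c)))))))
      where
      lemma₁ : ∀ c → c * + 2 ≡ c + c
      lemma₁ = solve-∀
      lemma₂ : ∀ s → + 1 * (s * -1ℤ) * + 1 ≡ - s
      lemma₂ = solve-∀
      lemma₃ : ∀ c → (+ 4 * c + + 3) * (+ 4 * c + + 3) ≡ + 1 + + 8 * (c * c + c * c + (c + + 1) + c * + 2)
      lemma₃ = solve-∀
      t≡ : + c * + c + + c * + c + (+ c + + 1) + + c * + 2 ≡ t
      t≡ = ℤ.*-cancelˡ-≡ (+ 8) _ t (cancel (trans (sym (lemma₃ (+ c))) (trans (cong (λ z → z * z) (sym (trans (cong (λ n → + n) (sym N≡)) (conductor-ℤ c)))) eq)))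
        where
        cancel : ∀ {a b} → + 1 + a ≡ + 1 + b → a ≡ b
        cancel {a} {b} e = trans (sym (lemma a)) (trans (cong (λ z → -1ℤ + z) e) (lemma b))
          where
          lemma : ∀ a → -1ℤ + (+ 1 + a) ≡ a
          lemma = solve-∀

    prime-value : ∀ {m} → Prime (suc (m ℕ.+ m)) → ∀ y → + y ≈[ suc (m ℕ.+ m) ] - + N →
                  χ (+ suc (m ℕ.+ m)) ≡ legendre y (suc (m ℕ.+ m))
    prime-value {m} pr y e with suc (m ℕ.+ m) ℕ.∣? N
    ... | yes p∣N = trans (χ-ℕ p) (trans left (sym (right (legendre y p) (legendre-spec y p))))
      where
      p = suc (m ℕ.+ m)
      left : jac p ps ≡ + 0
      left with jac-dichotomy odd p
      ... | inj₁ (cop , _) = contradiction (subst Prime (cop (ℕ.∣-refl , subst (p ℕ.∣_) N≡ p∣N)) pr) Primality.¬prime[1]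
      ... | inj₂ (_ , z)   = z
      right : ∀ l → Legendre y p l → l ≡ + 0
      right _ (zeroᴸ _)      = refl
      right _ (square ∤ _ _) = contradiction (∣-≈ e (Signed.∣m⇒∣-m (∣ᵤ⇒∣ p∣N))) ∤
      right _ (non ∤ _)      = contradiction (∣-≈ e (Signed.∣m⇒∣-m (∣ᵤ⇒∣ p∣N))) ∤
    ... | no p∤N = trans (χ-ℕ p) (trans (unit-move u (sym reciprocal)) (sym split))
      where
      p = suc (m ℕ.+ m)
      open OddPrime m pr using (gauss-lemma; wraps)
      u : Unit (legendre N p)
      u = subst Unit (sym (gauss-lemma N (p∤N ∘ ∣⇒∣ᵤ))) (sgn-unit (∑ (1⋯ m) (wraps (+ N))))
      sgn-mK : sgn (+ m * + K) ≡ sgn (+ m)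
      sgn-mK = trans (cong sgn (trans (cong (+ m *_) (trans (ℤ.pos-+ 1 (c ℕ.+ c)) (cong (_+_ (+ 1)) (ℤ.pos-+ c c)))) (lemma (+ m) (+ c))))
        (trans (sgn-+ (+ m * + c + + m * + c) (+ m)) (trans (cong (_* sgn (+ m)) (sgn-even (+ m * + c))) (ℤ.*-identityˡ (sgn (+ m)))))
        where
        lemma : ∀ m c → m * (+ 1 + (c + c)) ≡ m * c + m * c + m
        lemma = solve-∀
      reciprocal : legendre N p * jac p ps ≡ sgn (+ m)
      reciprocal = trans (cong (λ n → legendre n p * jac p ps) N≡)
        (trans (jac-reciprocity odd {m} {K} pr (p∤N ∘ subst (p ℕ.∣_) (sym N≡)) (sym N≡)) sgn-mK)
      split : legendre y p ≡ legendre N p * sgn (+ m)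
      split = trans (Supplements.legendre-cong m pr (≈-trans e (≈-trans (≈-reflexive (lemma (+ N))) (≈-trans (≈-*ˡ (+ N) minus1) (≈-reflexive (sym (ℤ.pos-* N (m ℕ.+ m))))))))
        (trans (Supplements.legendre-* m pr N (m ℕ.+ m)) (cong (legendre N p *_) (Supplements.legendre-minus1 m pr {m ℕ.+ m} (≈-sym minus1))))
        where
        lemma : ∀ n → - n ≡ n * -1ℤ
        lemma = solve-∀
        lemma′ : ∀ q → -1ℤ - q ≡ -1ℤ * (+ 1 + q)
        lemma′ = solve-∀
        minus1 : -1ℤ ≈[ p ] + (m ℕ.+ m)
        minus1 = ≈-by (divides -1ℤ (trans (lemma′ (+ (m ℕ.+ m))) (cong (-1ℤ *_) (sym (ℤ.pos-+ 1 (m ℕ.+ m))))))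

    minus1-value : χ -1ℤ ≡ -1ℤ
    minus1-value = trans (jac-minus1 odd {x = -1ℤ %ℕ N} {K} (sym N≡) (lift (%ℕ-≈ -1ℤ N))) sgn-K

  isQuadraticCharacter : QuadraticCharacter c χ
  isQuadraticCharacter = record
    { χ-cong    = cong-χ
    ; χ-*       = mult
    ; χ-neg     = λ x → trans (cong χ (sym (ℤ.-1*i≡-i x))) (trans (mult -1ℤ x) (trans (cong (_* χ x) minus1-value) (ℤ.-1*i≡-i (χ x))))
    ; χ-ternary = λ x → jac-ternary (x %ℕ N) ps
    ; χ-zero    = λ x ¬cop → trans (χ-ℕ x) (vanish x ¬cop (jac-dichotomy odd x))
    ; χ-unit    = λ x cop → subst Unit (sym (χ-ℕ x)) (survive x cop (jac-dichotomy odd x))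
    ; χ-two     = two
    ; χ-prime   = λ {m} → prime-value {m}
    }
    where
    vanish : ∀ x → ¬ Coprime x N → _ → jac x ps ≡ + 0
    vanish x ¬cop (inj₁ (cop , _)) = ⊥-elim (¬cop (λ {d} d∣ → cop {d} (subst (λ n → d ℕ.∣ x × d ℕ.∣ n) N≡ d∣)))
    vanish x ¬cop (inj₂ (_ , z))   = z
    survive : ∀ x → Coprime x N → _ → Unit (jac x ps)
    survive x cop (inj₁ (_ , u))    = u
    survive x cop (inj₂ (¬cop , _)) = ⊥-elim (¬cop (λ {d} d∣ → cop {d} (subst (λ n → d ℕ.∣ x × d ℕ.∣ n) (sym N≡) d∣)))

-- Roots of t² + t + κ modulo a

abstract
  norm : ℕ → ℤ → ℤ
  norm c t = t * t + t + + suc c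

  norm-def : ∀ c t → norm c t ≡ t * t + t + + suc c
  norm-def c t = refl

discriminant-norm : ∀ c t → + 4 * norm c t ≡ (+ 2 * t + + 1) * (+ 2 * t + + 1) + + conductor c
discriminant-norm c t = trans (cong (+ 4 *_) (norm-def c t)) (trans (cong (λ k → + 4 * (t * t + t + k)) (ℤ.pos-+ 1 c))
  (trans (lemma t (+ c)) (cong (_+_ ((+ 2 * t + + 1) * (+ 2 * t + + 1))) (sym (conductor-ℤ c)))))
  where
  lemma : ∀ t c → + 4 * (t * t + t + (+ 1 + c)) ≡ (+ 2 * t + + 1) * (+ 2 * t + + 1) + (+ 4 * c + + 3)
  lemma = solve-∀

norm-≈ : ∀ c {n x y} → x ≈[ n ] y → norm c x ≈[ n ] norm c y
norm-≈ c {n} {x} {y} e = subst₂ (λ a b → a ≈[ n ] b) (sym (norm-def c x)) (sym (norm-def c y)) (≈-+ (≈-+ (≈-* e e) e) ≈-refl)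

rootCount : ℕ → ℕ → ℤ
rootCount c a = ∑< a (λ t → 𝟙 (+ a ∣ₛ? norm c (+ t)))

𝟙-× : ∀ {P Q R : Set} (p? : Dec P) (q? : Dec Q) (r? : Dec R) → (P → Q × R) → (Q → R → P) → 𝟙 p? ≡ 𝟙 q? * 𝟙 r?
𝟙-× p? (yes q) (yes r) to from = trans (𝟙-yes p? (from q r)) (sym (cong₂ _*_ (𝟙-yes (yes q) q) (𝟙-yes (yes r) r)))
𝟙-× p? (yes q) (no ¬r) to from =
  trans (𝟙-no p? (¬r ∘ proj₂ ∘ to)) (sym (trans (cong (𝟙 (yes q) *_) (𝟙-no (no ¬r) ¬r)) (ℤ.*-zeroʳ (𝟙 (yes q)))))
𝟙-× p? (no ¬q) r?      to from = trans (𝟙-no p? (¬q ∘ proj₁ ∘ to)) (sym (cong (_* 𝟙 r?) (𝟙-no (no ¬q) ¬q)))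

∑<-affine-periodic : ∀ n .{{_ : NonZero n}} {a} c (f : ℤ → ℤ) → (∀ {x y} → x ≈[ n ] y → f x ≡ f y) → Coprime a n →
                     ∑< n (λ i → f (c + + a * + i)) ≡ ∑< n (λ i → f (+ i))
∑<-affine-periodic n {a} c f periodic cop =
  trans (∑-ext (downFrom n) (λ i → periodic (≈-sym (%ℕ-≈ (c + + a * + i) n)))) (∑<-affine n c (λ i → f (+ i)) cop)

𝟙-∣-≈ : ∀ {n x y} → x ≈[ n ] y → 𝟙 (+ n ∣ₛ? x) ≡ 𝟙 (+ n ∣ₛ? y)
𝟙-∣-≈ {n} {x} {y} e = 𝟙-⇔ (+ n ∣ₛ? x) (+ n ∣ₛ? y) (∣-≈ (≈-sym e)) (∣-≈ e)

prime-∤⇒coprime : ∀ {p n} → Prime p → ¬ p ℕ.∣ n → Coprime n p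
prime-∤⇒coprime {p} pr p∤n {d} (d∣n , d∣p) with Primality.prime⇒irreducible pr d∣p
... | inj₁ eq   = eq
... | inj₂ refl = contradiction d∣n p∤n

∑<-∣-zero : ∀ p .{{_ : NonZero p}} → ∑< p (λ i → 𝟙 (+ p ∣ₛ? + i)) ≡ + 1
∑<-∣-zero p@(suc n) = trans (∑-single {x = 0} (λ i → 𝟙 (+ p ∣ₛ? + i)) (Unique.downFrom⁺ p) (∈-downFrom⁺ {p} {0} (s≤s z≤n))
  (λ {i} i∈ i≢0 → 𝟙-no (+ p ∣ₛ? + i) (λ d → i≢0 (≈⇒≡ (∈-downFrom⁻ i∈) (s≤s z≤n) (∣⇒≈0 d)))))
  (𝟙-yes (+ p ∣ₛ? + 0) (divides (+ 0) refl))

square-roots : ∀ m (pr : Prime (suc (m ℕ.+ m))) y →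
  ∑< (suc (m ℕ.+ m)) (λ x → 𝟙 (+ suc (m ℕ.+ m) ∣ₛ? + x * + x - + y)) ≡ + 1 + legendre y (suc (m ℕ.+ m))
square-roots m pr y = count (legendre-spec y p)
  where
  p = suc (m ℕ.+ m)
  f : ℕ → ℤ
  f x = 𝟙 (+ p ∣ₛ? + x * + x - + y)
  prime-∣-square : ∀ x → + p ∣ₛ x * x → + p ∣ₛ x
  prime-∣-square x d = [ id , id ]′ (prime-∣-* pr x x d)
  count : ∀ {l} → Legendre y p l → ∑< p f ≡ + 1 + l
  count (zeroᴸ p∣y) = trans (∑-cong (downFrom p) (λ {x} _ → 𝟙-⇔ (+ p ∣ₛ? + x * + x - + y) (+ p ∣ₛ? + x)
      (λ d → prime-∣-square (+ x) (∣-≈ (≈-by d) p∣y)) (λ d → Signed.∣m∣n⇒∣m-n (Signed.∣m⇒∣m*n (+ x) d) p∣y)))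
    (∑<-∣-zero p)
  count (non _ none) = ∑-zero (downFrom p) (λ {x} x∈ → 𝟙-no (+ p ∣ₛ? + x * + x - + y) (λ d → none x (∈-downFrom⁻ x∈) (≈-by d)))
  count (square p∤y z z²) = trans (∑-pair f (Unique.downFrom⁺ p) (∈-downFrom⁺ (ℤ.n%ℕd<d (+ z) p)) (∈-downFrom⁺ (ℤ.n%ℕd<d (- + z) p)) distinct
      (λ {x} x∈ x≢r x≢r′ → 𝟙-no (+ p ∣ₛ? + x * + x - + y) (λ d → [ (λ e → x≢r (≈⇒≡ (∈-downFrom⁻ x∈) (ℤ.n%ℕd<d (+ z) p) (≈-trans (≈-by e) (≈-sym (%ℕ-≈ (+ z) p)))))
                                                                 , (λ e → x≢r′ (≈⇒≡ (∈-downFrom⁻ x∈) (ℤ.n%ℕd<d (- + z) p) (≈-trans (≈-by (∣-by (cong (_+_ (+ x)) (sym (ℤ.neg-involutive (+ z)))) e)) (≈-sym (%ℕ-≈ (- + z) p)))))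
                                                                 ]′ (prime-∣-* pr (+ x - + z) (+ x + + z) (∣-by (lemma (+ x) (+ z)) (≈⇒∣ (≈-trans {x = + x * + x} (≈-by d) (≈-sym z²))))))))
    (cong₂ _+_ (𝟙-yes (+ p ∣ₛ? _) (≈⇒∣ (≈-trans (≈-* (%ℕ-≈ (+ z) p) (%ℕ-≈ (+ z) p)) z²)))
               (𝟙-yes (+ p ∣ₛ? _) (≈⇒∣ (≈-trans (≈-* (%ℕ-≈ (- + z) p) (%ℕ-≈ (- + z) p)) (≈-trans (≈-reflexive (lemma′ (+ z))) z²)))))
    where
    lemma : ∀ x z → x * x - z * z ≡ (x - z) * (x + z)
    lemma = solve-∀
    lemma′ : ∀ z → - z * - z ≡ z * z
    lemma′ = solve-∀
    lemma″ : ∀ z → z - - z ≡ + 2 * z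
    lemma″ = solve-∀
    distinct : (+ z) %ℕ p ≢ (- + z) %ℕ p
    distinct eq = [ OddPrime.small-∤ m pr {1} (s≤s (ℕ.+-mono-≤ (OddPrime.0<m m pr) (OddPrime.0<m m pr)))
                  , (λ d → p∤y (∣-≈ (≈-sym z²) (Signed.∣m⇒∣m*n (+ z) d))) ]′
                  (prime-∣-* pr (+ 2) (+ z) (∣-by (lemma″ (+ z)) (≈⇒∣ z≈-z)))
      where
      z≈-z : + z ≈[ p ] - + z
      z≈-z = ≈-trans (≈-sym (%ℕ-≈ (+ z) p)) (≈-trans (≈-reflexive (cong (λ r → + r) eq)) (%ℕ-≈ (- + z) p))

module RootCount {c : ℕ} {χ : ℤ → ℤ} (char : QuadraticCharacter c χ) (squareFree : ∀ d → d ℕ.* d ℕ.∣ conductor c → d ≡ 1) where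

  open QuadraticCharacter char

  private
    N = conductor c
    f = norm c

  rootCount-prime : ∀ {p} → Prime p → rootCount c p ≡ + 1 + χ (+ p)
  rootCount-prime {p} pr with parity-ℕ p
  ... | inj₂ (m , refl) = trans (trans (∑-cong (downFrom p) (λ {t} _ → 𝟙-⇔ (+ p ∣ₛ? f (+ t)) (+ p ∣ₛ? g (+ 1 + + 2 * + t)) (to t) (from t)))
        (trans (∑<-affine-periodic p (+ 1) (λ x → 𝟙 (+ p ∣ₛ? g x)) (λ e → 𝟙-∣-≈ (≈-+ (≈-* e e) ≈-refl)) coprime-2)
          (∑-ext (downFrom p) (λ x → 𝟙-∣-≈ (≈-trans (≈-+ (≈-refl {x = + x * + x}) (≈-trans (≈-reflexive (sym (ℤ.neg-involutive (+ N)))) (≈-neg (≈-sym (%ℕ-≈ (- + N) p))))) ≈-refl)))))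
      (trans (square-roots m pr y) (cong (_+_ (+ 1)) (sym (χ-prime {m} pr y (%ℕ-≈ (- + N) p)))))
    where
    y = (- + N) %ℕ p
    g : ℤ → ℤ
    g x = x * x + + N
    coprime-2 : Coprime 2 p
    coprime-2 = Coprimality.sym {p} {2} (prime-∤⇒coprime Primality.prime[2] (2∤1+n+n m))
    4f : ∀ t → + 4 * f (+ t) ≡ g (+ 1 + + 2 * + t)
    4f t = trans (discriminant-norm c (+ t)) (cong (λ x → x * x + + N) (ℤ.+-comm (+ 2 * + t) (+ 1)))
    to : ∀ t → + p ∣ₛ f (+ t) → + p ∣ₛ g (+ 1 + + 2 * + t)
    to t d = ∣-by (4f t) (Signed.∣n⇒∣m*n (+ 4) d)
    from : ∀ t → + p ∣ₛ g (+ 1 + + 2 * + t) → + p ∣ₛ f (+ t)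
    from t d = coprime-∣-cancel coprime-2 (coprime-∣-cancel coprime-2 (∣-by (trans (sym (4f t)) (ℤ.*-assoc (+ 2) (+ 2) (f (+ t)))) d))
  ... | inj₁ (k , refl) with 2≡p
    where
    2≡p : 2 ≡ k ℕ.+ k
    2≡p with Primality.prime⇒irreducible pr {2} (ℕ.divides k (n+n≡n*2 k))
    ... | inj₂ eq = eq
  ... | eq rewrite sym eq = trans (two (parity (+ c))) (cong (_+_ (+ 1)) (sym χ-two))
    where
    2∤1 : ∀ q → ¬ + 2 ∣ₛ q + q + + 1
    2∤1 q d = contradiction (ℕ.∣1⇒≡1 (∣⇒∣ᵤ (Signed.∣m+n∣m⇒∣n {+ 2} {q + q} {+ 1} d (divides q (double q))))) (λ ())
      where
      double : ∀ k → k + k ≡ k * + 2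
      double = solve-∀
    two : _ → rootCount c 2 ≡ + 1 + - sgn (+ c)
    two (inj₁ (q , eq)) = trans (cong₂ (λ a b → a + (b + + 0)) (𝟙-no (+ 2 ∣ₛ? f (+ 1)) (λ d → 2∤1 (+ 1 + q) (∣-by (trans (norm-def c (+ 1)) (trans (cong (λ k → + 2 + (+ 1 + k)) eq) (lemma₁ q))) d)))
                                                               (𝟙-no (+ 2 ∣ₛ? f (+ 0)) (λ d → 2∤1 q (∣-by (trans (norm-def c (+ 0)) (trans (cong (λ k → + 1 + k) eq) (lemma₀ q))) d))))
                                (cong (λ s → + 1 + - s) (sym (trans (cong sgn eq) (sgn-even q))))
      where
      lemma₁ : ∀ q → + 2 + (+ 1 + (q + q)) ≡ + 1 + q + (+ 1 + q) + + 1
      lemma₁ = solve-∀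
      lemma₀ : ∀ q → + 1 + (q + q) ≡ q + q + + 1
      lemma₀ = solve-∀
    two (inj₂ (q , eq)) = trans (cong₂ (λ a b → a + (b + + 0)) (𝟙-yes (+ 2 ∣ₛ? f (+ 1)) (divides (q + + 2) (trans (trans (norm-def c (+ 1)) (cong (λ k → + 2 + (+ 1 + k)) eq)) (lemma₁ q))))
                                                               (𝟙-yes (+ 2 ∣ₛ? f (+ 0)) (divides (q + + 1) (trans (trans (norm-def c (+ 0)) (cong (λ k → + 1 + k) eq)) (lemma₀ q)))))
                                (cong (λ s → + 1 + - s) (sym (trans (cong sgn eq) (sgn-odd q))))
      where
      lemma₁ : ∀ q → + 2 + (+ 1 + (q + q + + 1)) ≡ (q + + 2) * + 2
      lemma₁ = solve-∀
      lemma₀ : ∀ q → + 1 + (q + q + + 1) ≡ (q + + 1) * + 2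
      lemma₀ = solve-∀

  private
    blocks : ∀ p a → rootCount c (p ℕ.* a) ≡ ∑< a (λ i → ∑< p (λ q → 𝟙 (+ (p ℕ.* a) ∣ₛ? f (+ i + + a * + q))))
    blocks p a = trans (∑<-blocks p a _) (trans (∑-swap (downFrom p) (downFrom a) _)
      (∑-ext (downFrom a) (λ i → ∑-ext (downFrom p) (λ q → cong (λ t → 𝟙 (+ (p ℕ.* a) ∣ₛ? f t))
        (trans (ℤ.pos-+ (q ℕ.* a) i) (trans (ℤ.+-comm (+ (q ℕ.* a)) (+ i)) (cong (_+_ (+ i)) (trans (ℤ.pos-* q a) (ℤ.*-comm (+ q) (+ a))))))))))

    shift : ∀ a i q → f (+ i + + a * + q) ≈[ a ] f (+ i)
    shift a i q = norm-≈ c {x = + i + + a * + q} {y = + i} (≈-by (divides (+ q) (lemma (+ i) (+ a) (+ q))))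
      where
      lemma : ∀ i a q → i + a * q - i ≡ q * a
      lemma = solve-∀

    coprime-product-∣ : ∀ {m n x} → Coprime m n → + m ∣ₛ x → + n ∣ₛ x → + (m ℕ.* n) ∣ₛ x
    coprime-product-∣ {m} {n} cop m∣ (divides q refl) with coprime-∣-cancel {n} {m} {q} (λ {d} → Coprimality.sym {m} {n} cop {d}) (∣-by (ℤ.*-comm q (+ n)) m∣)
    ... | divides r refl = divides r (trans (ℤ.*-assoc r (+ m) (+ n)) (cong (r *_) (sym (ℤ.pos-* m n))))

  rootCount-∤ : ∀ {p a} → Prime p → ¬ p ℕ.∣ a → rootCount c (p ℕ.* a) ≡ (+ 1 + χ (+ p)) * rootCount c a
  rootCount-∤ {p} {a} pr p∤a = trans (blocks p a) (trans (∑-ext (downFrom a) inner) (∑-*ˡ (downFrom a) (+ 1 + χ (+ p)) _))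
    where
    instance
      p≢0 : NonZero p
      p≢0 = Primality.prime⇒nonZero pr
    cop : Coprime a p
    cop = prime-∤⇒coprime pr p∤a
    split : ∀ i q → 𝟙 (+ (p ℕ.* a) ∣ₛ? f (+ i + + a * + q)) ≡ 𝟙 (+ a ∣ₛ? f (+ i)) * 𝟙 (+ p ∣ₛ? f (+ i + + a * + q))
    split i q = 𝟙-× (+ (p ℕ.* a) ∣ₛ? f (+ i + + a * + q)) (+ a ∣ₛ? f (+ i)) (+ p ∣ₛ? f (+ i + + a * + q))
      (λ d → ∣-≈ (≈-sym (shift a i q)) (Signed.∣-trans (divides (+ p) (ℤ.pos-* p a)) d) , Signed.∣-trans (divides (+ a) (trans (ℤ.pos-* p a) (ℤ.*-comm (+ p) (+ a)))) d)
      (λ d e → coprime-product-∣ (λ {d} → Coprimality.sym {a} {p} cop {d}) e (∣-≈ (shift a i q) d))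
    inner : ∀ i → ∑< p (λ q → 𝟙 (+ (p ℕ.* a) ∣ₛ? f (+ i + + a * + q))) ≡ (+ 1 + χ (+ p)) * 𝟙 (+ a ∣ₛ? f (+ i))
    inner i = trans (∑-ext (downFrom p) (split i)) (trans (∑-*ˡ (downFrom p) (𝟙 (+ a ∣ₛ? f (+ i))) _)
      (trans (cong (𝟙 (+ a ∣ₛ? f (+ i)) *_) (trans (∑<-affine-periodic p (+ i) (λ x → 𝟙 (+ p ∣ₛ? f x)) (λ e → 𝟙-∣-≈ (norm-≈ c e)) cop) (rootCount-prime pr)))
        (ℤ.*-comm (𝟙 (+ a ∣ₛ? f (+ i))) (+ 1 + χ (+ p)))))

  rootCount-∣ : ∀ {p a} → Prime p → p ℕ.∣ a → .{{_ : NonZero a}} → rootCount c (p ℕ.* a) ≡ χ (+ p) * χ (+ p) * rootCount c a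
  rootCount-∣ {p} {a} pr p∣a = trans (blocks p a) (trans (∑-ext (downFrom a) inner) (∑-*ˡ (downFrom a) (χ (+ p) * χ (+ p)) _))
    where
    instance
      p≢0 : NonZero p
      p≢0 = Primality.prime⇒nonZero pr
    p∣a′ : + p ∣ₛ + a
    p∣a′ = ∣ᵤ⇒∣ p∣a
    expand : ∀ i a q k → i * i + i + k + a * q * (+ 2 * i + + 1) + a * q * (a * q) ≡ (i + a * q) * (i + a * q) + (i + a * q) + k
    expand = solve-∀
    pa∣⇒a∣ : ∀ i q → + (p ℕ.* a) ∣ₛ f (+ i + + a * + q) → + a ∣ₛ f (+ i)
    pa∣⇒a∣ i q d = ∣-≈ (≈-sym (shift a i q)) (Signed.∣-trans (divides (+ p) (ℤ.pos-* p a)) d)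
    p∣N : ∀ t → + p ∣ₛ f t → + p ∣ₛ + 2 * t + + 1 → + p ∣ₛ + N
    p∣N t d e = Signed.∣m+n∣m⇒∣n (∣-by (discriminant-norm c t) (Signed.∣n⇒∣m*n (+ 4) d)) (Signed.∣m⇒∣m*n (+ 2 * t + + 1) e)
    χ²≡0 : + p ∣ₛ + N → χ (+ p) * χ (+ p) ≡ + 0
    χ²≡0 d = trans (cong (_* χ (+ p)) (χ-zero p (λ cop → Primality.¬prime[1] (subst Prime (cop (ℕ.∣-refl , ∣⇒∣ᵤ d)) pr)))) refl
    χ²≡1 : ¬ + p ∣ₛ + N → χ (+ p) * χ (+ p) ≡ + 1
    χ²≡1 ∤ = unit-square (χ-unit p (λ {d} → Coprimality.sym {N} {p} (prime-∤⇒coprime pr (∤ ∘ ∣ᵤ⇒∣)) {d}))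
    inner : ∀ i → ∑< p (λ q → 𝟙 (+ (p ℕ.* a) ∣ₛ? f (+ i + + a * + q))) ≡ χ (+ p) * χ (+ p) * 𝟙 (+ a ∣ₛ? f (+ i))
    inner i = cases (+ a ∣ₛ? f (+ i)) (+ p ∣ₛ? + suc (i ℕ.+ i))
     where
     cases : Dec (+ a ∣ₛ f (+ i)) → Dec (+ p ∣ₛ + suc (i ℕ.+ i)) →
             ∑< p (λ q → 𝟙 (+ (p ℕ.* a) ∣ₛ? f (+ i + + a * + q))) ≡ χ (+ p) * χ (+ p) * 𝟙 (+ a ∣ₛ? f (+ i))
     cases (no a∤) _ = trans (∑-zero (downFrom p) (λ {q} _ → 𝟙-no (+ (p ℕ.* a) ∣ₛ? f (+ i + + a * + q)) (a∤ ∘ pa∣⇒a∣ i q))) (sym (trans (cong (χ (+ p) * χ (+ p) *_) (𝟙-no (+ a ∣ₛ? f (+ i)) a∤)) (ℤ.*-zeroʳ (χ (+ p) * χ (+ p)))))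
     cases (yes (divides k fi≡)) (yes p∣2i+1) = trans (∑-zero (downFrom p) (λ {q} _ → 𝟙-no (+ (p ℕ.* a) ∣ₛ? f (+ i + + a * + q)) (no-root q))) (sym (trans (trans (cong (χ (+ p) * χ (+ p) *_) (𝟙-yes (+ a ∣ₛ? f (+ i)) (divides k fi≡))) (ℤ.*-identityʳ (χ (+ p) * χ (+ p)))) (χ²≡0 p∣N-i)))
      where
      p∣N-i : + p ∣ₛ + N
      p∣N-i = p∣N (+ i) (∣-by (sym fi≡) (Signed.∣n⇒∣m*n k p∣a′)) (∣-by (pos-1+n+n i) p∣2i+1)
      no-root : ∀ q → ¬ + (p ℕ.* a) ∣ₛ f (+ i + + a * + q)
      no-root q d = Primality.¬prime[1] (subst Prime (squareFree p (∣⇒∣ᵤ p²∣N)) pr)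
        where
        t = + i + + a * + q
        p∣2t+1 : + p ∣ₛ + 2 * t + + 1
        p∣2t+1 = ∣-by (trans (cong (λ z → z + + 2 * (+ a * + q)) (pos-1+n+n i)) (lemma (+ i) (+ a * + q))) (Signed.∣m∣n⇒∣m+n p∣2i+1 (Signed.∣n⇒∣m*n (+ 2) (Signed.∣m⇒∣m*n (+ q) p∣a′)))
          where
          lemma : ∀ i b → + 2 * i + + 1 + + 2 * b ≡ + 2 * (i + b) + + 1
          lemma = solve-∀
        square-∣ : ∀ {x} → + p ∣ₛ x → + (p ℕ.* p) ∣ₛ x * x
        square-∣ (divides r refl) = divides (r * r) (trans (lemma r (+ p)) (cong (r * r *_) (sym (ℤ.pos-* p p))))
          where
          lemma : ∀ r p → r * p * (r * p) ≡ r * r * (p * p)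
          lemma = solve-∀
        p²∣pa : + (p ℕ.* p) ∣ₛ + (p ℕ.* a)
        p²∣pa = ∣ᵤ⇒∣ (ℕ.*-monoʳ-∣ p p∣a)
        p²∣N : + (p ℕ.* p) ∣ₛ + N
        p²∣N = Signed.∣m+n∣m⇒∣n (∣-by (discriminant-norm c t) (Signed.∣n⇒∣m*n (+ 4) (Signed.∣-trans p²∣pa d))) (square-∣ p∣2t+1)
     cases (yes (divides k fi≡)) (no p∤2i+1) = trans (∑-cong (downFrom p) (λ {q} _ → 𝟙-⇔ (+ (p ℕ.* a) ∣ₛ? f (+ i + + a * + q)) (+ p ∣ₛ? k + + b * + q) (to q) (from q)))
        (trans (∑<-affine-periodic p k (λ x → 𝟙 (+ p ∣ₛ? x)) 𝟙-∣-≈ (prime-∤⇒coprime pr (p∤2i+1 ∘ ∣ᵤ⇒∣)))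
          (trans (∑<-∣-zero p) (sym (trans (trans (cong (χ (+ p) * χ (+ p) *_) (𝟙-yes (+ a ∣ₛ? f (+ i)) (divides k fi≡))) (ℤ.*-identityʳ (χ (+ p) * χ (+ p)))) (χ²≡1 p∤N)))))
      where
      b = suc (i ℕ.+ i)
      p∤N : ¬ + p ∣ₛ + N
      p∤N d = p∤2i+1 (∣-by (sym (pos-1+n+n i)) ([ id , id ]′ (prime-∣-* pr (+ 2 * + i + + 1) (+ 2 * + i + + 1)
        (Signed.∣m+n∣n⇒∣m (∣-by (discriminant-norm c (+ i)) (Signed.∣n⇒∣m*n (+ 4) (∣-by (sym fi≡) (Signed.∣n⇒∣m*n k p∣a′)))) d))))
      value : ∀ q → f (+ i + + a * + q) ≡ + a * (k + + b * + q + + q * + q * + a)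
      value q = trans (norm-def c (+ i + + a * + q)) (trans (sym (expand (+ i) (+ a) (+ q) (+ suc c))) (trans (cong (λ z → z + + a * + q * (+ 2 * + i + + 1) + + a * + q * (+ a * + q)) (trans (sym (norm-def c (+ i))) fi≡))
        (trans (lemma k (+ a) (+ q) (+ 2 * + i + + 1)) (cong (λ z → + a * (k + z * + q + + q * + q * + a)) (sym (pos-1+n+n i))))))
        where
        lemma : ∀ k a q b → k * a + a * q * b + a * q * (a * q) ≡ a * (k + b * q + q * q * a)
        lemma = solve-∀
      to : ∀ q → + (p ℕ.* a) ∣ₛ f (+ i + + a * + q) → + p ∣ₛ k + + b * + q
      to q d = Signed.∣m+n∣n⇒∣m (Signed.*-cancelˡ-∣ (+ a) (∣-by (value q) (subst (_∣ₛ f (+ i + + a * + q)) (trans (ℤ.pos-* p a) (ℤ.*-comm (+ p) (+ a))) d)))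
                (Signed.∣n⇒∣m*n (+ q * + q) p∣a′)
      from : ∀ q → + p ∣ₛ k + + b * + q → + (p ℕ.* a) ∣ₛ f (+ i + + a * + q)
      from q d = subst₂ _∣ₛ_ (trans (ℤ.*-comm (+ a) (+ p)) (sym (ℤ.pos-* p a))) (sym (value q))
                   (Signed.*-monoʳ-∣ (+ a) (Signed.∣m∣n⇒∣m+n d (Signed.∣n⇒∣m*n (+ q * + q) p∣a′)))

-- Ideals of norm n: Σ_{m² a = n} ρ(a) = Σ_{d ∣ n} χ(d)

∈1⋯-≥1 : ∀ {B k} → k ∈ 1⋯ B → 1 ℕ.≤ k
∈1⋯-≥1 k∈ with ∈-1⋯⁻ k∈
... | i , refl , _ = s≤s z≤n

∈1⋯-≤ : ∀ {B k} → k ∈ 1⋯ B → k ℕ.≤ B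
∈1⋯-≤ k∈ with ∈-1⋯⁻ k∈
... | i , refl , i<B = i<B

∈1⋯ : ∀ {B k} → 1 ℕ.≤ k → k ℕ.≤ B → k ∈ 1⋯ B
∈1⋯ {k = suc k} _ k≤B = ∈-1⋯⁺ k≤B

∑-𝟙-* : ∀ {A : Set} {P : A → Set} {xs : List A} {x} (p? : ∀ y → Dec (P y)) (f : A → ℤ) → Unique xs → x ∈ xs → P x →
        (∀ {y} → y ∈ xs → P y → y ≡ x) → ∑ xs (λ y → 𝟙 (p? y) * f y) ≡ f x
∑-𝟙-* {x = x} p? f uniq x∈ px only = trans
  (∑-single (λ y → 𝟙 (p? y) * f y) uniq x∈ (λ {y} y∈ y≢x → cong (_* f y) (𝟙-no (p? y) (y≢x ∘ only y∈))))
  (trans (cong (_* f x) (𝟙-yes (p? x) px)) (ℤ.*-identityˡ (f x)))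

∑-𝟙-*-none : ∀ {A : Set} {P : A → Set} {xs : List A} (p? : ∀ y → Dec (P y)) (f : A → ℤ) →
             (∀ {y} → y ∈ xs → ¬ P y) → ∑ xs (λ y → 𝟙 (p? y) * f y) ≡ + 0
∑-𝟙-*-none {xs = xs} p? f none = ∑-zero xs (λ {y} y∈ → cong (_* f y) (𝟙-no (p? y) (none y∈)))

∑-multiples : ∀ B p .{{_ : NonZero p}} (G : ℕ → ℤ) → (∀ d → B ℕ.< d → G d ≡ + 0) →
              ∑ (1⋯ B) (λ d → 𝟙 (p ℕ.∣? d) * G d) ≡ ∑ (1⋯ B) (λ d → G (p ℕ.* d))
∑-multiples B p G vanish = sym (trans (∑-cong (1⋯ B) (λ {k} k∈ → expand k (∈1⋯-≥1 k∈))) (trans (∑-swap (1⋯ B) (1⋯ B) _)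
  (∑-cong (1⋯ B) (λ {d} d∈ → trans (∑-*ʳ (1⋯ B) (G d) (λ k → 𝟙 (p ℕ.* k ℕ.≟ d))) (cong (_* G d) (collect d∈))))))
  where
  expand : ∀ k → 1 ℕ.≤ k → G (p ℕ.* k) ≡ ∑ (1⋯ B) (λ d → 𝟙 (p ℕ.* k ℕ.≟ d) * G d)
  expand k 1≤k with p ℕ.* k ℕ.≤? B
  ... | yes pk≤B = sym (∑-𝟙-* (λ d → p ℕ.* k ℕ.≟ d) G (1⋯-unique B) (∈1⋯ (ℕ.*-mono-≤ (ℕ.>-nonZero⁻¹ p) 1≤k) pk≤B) refl (λ _ → sym))
  ... | no pk≰B  = trans (vanish (p ℕ.* k) (ℕ.≰⇒> pk≰B)) (sym (∑-𝟙-*-none (λ d → p ℕ.* k ℕ.≟ d) G (λ { d∈ refl → pk≰B (∈1⋯-≤ d∈) })))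
  collect : ∀ {d} → d ∈ 1⋯ B → ∑ (1⋯ B) (λ k → 𝟙 (p ℕ.* k ℕ.≟ d)) ≡ 𝟙 (p ℕ.∣? d)
  collect {d} d∈ with p ℕ.∣? d
  ... | no p∤d = trans (∑-zero (1⋯ B) (λ {k} _ → 𝟙-no (p ℕ.* k ℕ.≟ d) (λ { refl → p∤d (ℕ.m∣m*n k) }))) (sym (𝟙-no (no p∤d) p∤d))
  ... | yes p∣d@(ℕ.divides k refl) = trans (∑-single {x = k} (λ k′ → 𝟙 (p ℕ.* k′ ℕ.≟ d)) (1⋯-unique B) (∈1⋯ (positive k (∈1⋯-≥1 d∈)) (ℕ.≤-trans (ℕ.m≤m*n k p) (∈1⋯-≤ d∈)))
        (λ {k′} _ k′≢k → 𝟙-no (p ℕ.* k′ ℕ.≟ d) (λ eq → k′≢k (ℕ.*-cancelˡ-≡ k′ k p (trans eq (ℕ.*-comm k p))))))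
      (trans (𝟙-yes (p ℕ.* k ℕ.≟ d) (ℕ.*-comm p k)) (sym (𝟙-yes (yes p∣d) p∣d)))
    where
    positive : ∀ k → 1 ℕ.≤ k ℕ.* p → 1 ℕ.≤ k
    positive (suc k) _ = s≤s z≤n

module PairSums (B : ℕ) where

  pairSum : (ℕ → ℕ → ℕ) → (ℕ → ℕ → ℤ) → ℕ → ℤ
  pairSum K v n = ∑ (1⋯ B) (λ x → ∑ (1⋯ B) (λ y → 𝟙 (K x y ℕ.≟ n) * v x y))

  pairSum-cong : ∀ {K K′ v v′ n n′} → (∀ {x y} → x ∈ 1⋯ B → y ∈ 1⋯ B → 𝟙 (K x y ℕ.≟ n) * v x y ≡ 𝟙 (K′ x y ℕ.≟ n′) * v′ x y) →
                 pairSum K v n ≡ pairSum K′ v′ n′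
  pairSum-cong eq = ∑-cong (1⋯ B) (λ x∈ → ∑-cong (1⋯ B) (λ y∈ → eq x∈ y∈))

  pairSum-scale : ∀ K v k n → pairSum K (λ x y → k * v x y) n ≡ k * pairSum K v n
  pairSum-scale K v k n = trans (∑-ext (1⋯ B) (λ x → trans (∑-ext (1⋯ B) (λ y → lemma (𝟙 (K x y ℕ.≟ n)) k (v x y))) (∑-*ˡ (1⋯ B) k (λ y → 𝟙 (K x y ℕ.≟ n) * v x y)))) (∑-*ˡ (1⋯ B) k (λ x → ∑ (1⋯ B) (λ y → 𝟙 (K x y ℕ.≟ n) * v x y)))
    where
    lemma : ∀ i k v → i * (k * v) ≡ k * (i * v)
    lemma = solve-∀

  pairSum-rename : ∀ {K K′} v {n n′} → (∀ {x y} → K x y ≡ n → K′ x y ≡ n′) → (∀ {x y} → K′ x y ≡ n′ → K x y ≡ n) →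
                   pairSum K v n ≡ pairSum K′ v n′
  pairSum-rename {K} {K′} v {n} {n′} to from = pairSum-cong {K} {K′} {v} {v} (λ {x} {y} _ _ → cong (_* v x y) (𝟙-⇔ (K x y ℕ.≟ n) (K′ x y ℕ.≟ n′) to from))

  pairSum-none : ∀ K v n → (∀ {x y} → K x y ≢ n) → pairSum K v n ≡ + 0
  pairSum-none K v n none = ∑-zero (1⋯ B) (λ {x} _ → ∑-𝟙-*-none {xs = 1⋯ B} (λ y → K x y ℕ.≟ n) (v x) (λ _ → none))

  module _ (p : ℕ) .{{_ : NonZero p}} where

    offMultiples : (ℕ → ℕ → ℕ) → (ℕ → ℕ → ℤ) → ℕ → ℤ
    offMultiples K v n = pairSum K (λ x y → (+ 1 - 𝟙 (p ℕ.∣? x)) * v x y) n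

    pairSum-splitˡ : ∀ K v n → n ℕ.≤ B → (∀ x y → 1 ℕ.≤ y → x ℕ.≤ K x y) →
                     pairSum K v n ≡ pairSum (λ x → K (p ℕ.* x)) (λ x → v (p ℕ.* x)) n + offMultiples K v n
    pairSum-splitˡ K v n n≤B bound = begin
      ∑ (1⋯ B) G
        ≡⟨ ∑-ext (1⋯ B) (λ x → lemma (𝟙 (p ℕ.∣? x)) (G x)) ⟩
      ∑ (1⋯ B) (λ x → 𝟙 (p ℕ.∣? x) * G x + (+ 1 - 𝟙 (p ℕ.∣? x)) * G x)
        ≡⟨ ∑-+ (1⋯ B) (λ x → 𝟙 (p ℕ.∣? x) * G x) (λ x → (+ 1 - 𝟙 (p ℕ.∣? x)) * G x) ⟩
      ∑ (1⋯ B) (λ x → 𝟙 (p ℕ.∣? x) * G x) + ∑ (1⋯ B) (λ x → (+ 1 - 𝟙 (p ℕ.∣? x)) * G x)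
        ≡⟨ cong₂ _+_ (∑-multiples B p G vanish) (∑-ext (1⋯ B) (λ x → trans (sym (∑-*ˡ (1⋯ B) (+ 1 - 𝟙 (p ℕ.∣? x)) (λ y → 𝟙 (K x y ℕ.≟ n) * v x y)))
             (∑-ext (1⋯ B) (λ y → lemma′ (+ 1 - 𝟙 (p ℕ.∣? x)) (𝟙 (K x y ℕ.≟ n)) (v x y))))) ⟩
      pairSum (λ x → K (p ℕ.* x)) (λ x → v (p ℕ.* x)) n + offMultiples K v n ∎
      where
      open ≡-Reasoning
      G : ℕ → ℤ
      G x = ∑ (1⋯ B) (λ y → 𝟙 (K x y ℕ.≟ n) * v x y)
      vanish : ∀ x → B ℕ.< x → G x ≡ + 0
      vanish x B<x = ∑-𝟙-*-none {xs = 1⋯ B} (λ y → K x y ℕ.≟ n) (v x) (λ {y} y∈ eq → ℕ.<⇒≱ B<x (ℕ.≤-trans (subst (x ℕ.≤_) eq (bound x y (∈1⋯-≥1 y∈))) n≤B))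
      lemma : ∀ i g → g ≡ i * g + (+ 1 - i) * g
      lemma = solve-∀
      lemma′ : ∀ k i v → k * (i * v) ≡ i * (k * v)
      lemma′ = solve-∀

    offMultiples-right : ∀ K v n → n ℕ.≤ B → (∀ x y → 1 ℕ.≤ x → y ℕ.≤ K x y) →
      (∀ {x y} → K x y ≡ n → ¬ p ℕ.∣ x → p ℕ.∣ y) →
      offMultiples K v n ≡ offMultiples (λ x y → K x (p ℕ.* y)) (λ x y → v x (p ℕ.* y)) n
    offMultiples-right K v n n≤B bound forced = ∑-cong (1⋯ B) (λ {x} x∈ →
      trans (∑-ext (1⋯ B) (λ y → insert x y (p ℕ.∣? x) (p ℕ.∣? y) (K x y ℕ.≟ n)))
            (∑-multiples B p (λ y → 𝟙 (K x y ℕ.≟ n) * ((+ 1 - 𝟙 (p ℕ.∣? x)) * v x y))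
              (λ y B<y → cong (_* ((+ 1 - 𝟙 (p ℕ.∣? x)) * v x y)) (𝟙-no (K x y ℕ.≟ n) (λ eq → ℕ.<⇒≱ B<y (ℕ.≤-trans (subst (y ℕ.≤_) eq (bound x y (∈1⋯-≥1 x∈))) n≤B))))))
      where
      insert : ∀ x y (px? : Dec (p ℕ.∣ x)) (py? : Dec (p ℕ.∣ y)) (k? : Dec (K x y ≡ n)) →
               𝟙 k? * ((+ 1 - 𝟙 px?) * v x y) ≡ 𝟙 py? * (𝟙 k? * ((+ 1 - 𝟙 px?) * v x y))
      insert x y px? (yes py) k? = sym (trans (cong (_* (𝟙 k? * ((+ 1 - 𝟙 px?) * v x y))) (𝟙-yes (yes py) py)) (ℤ.*-identityˡ _))
      insert x y px? py? (no ¬k) rewrite 𝟙-no (no ¬k) ¬k = sym (ℤ.*-zeroʳ (𝟙 py?))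
      insert x y (yes px) py? k? rewrite 𝟙-yes (yes px) px = trans (ℤ.*-zeroʳ (𝟙 k?)) (sym (trans (cong (𝟙 py? *_) (ℤ.*-zeroʳ (𝟙 k?))) (ℤ.*-zeroʳ (𝟙 py?))))
      insert x y (no ¬px) (no ¬py) (yes k) = contradiction (forced k ¬px) ¬py

module IdealCount {c : ℕ} {χ : ℤ → ℤ} (char : QuadraticCharacter c χ) (squareFree : ∀ d → d ℕ.* d ℕ.∣ conductor c → d ≡ 1) (B : ℕ) where

  open QuadraticCharacter char
  open RootCount char squareFree
  open PairSums B

  private
    ρ = rootCount c

  idealCount : ℕ → ℤ
  idealCount = pairSum (λ m a → m ℕ.* m ℕ.* a) (λ _ a → ρ a)

  divisorSum : ℕ → ℤ
  divisorSum = pairSum ℕ._*_ (λ d _ → χ (+ d))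

  private
    ×-nonZero : ∀ {m n} → 1 ℕ.≤ m → 1 ℕ.≤ n → 1 ℕ.≤ m ℕ.* n
    ×-nonZero = ℕ.*-mono-≤

    ≤-*ʳ : ∀ x y → 1 ℕ.≤ y → x ℕ.≤ x ℕ.* y
    ≤-*ʳ x y 1≤y = subst (ℕ._≤ x ℕ.* y) (ℕ.*-identityʳ x) (ℕ.*-monoʳ-≤ x 1≤y)

    ≤-*ˡ : ∀ x y → 1 ℕ.≤ x → y ℕ.≤ x ℕ.* y
    ≤-*ˡ x y 1≤x = subst (y ℕ.≤_) (ℕ.*-comm y x) (≤-*ʳ y x 1≤x)

    ≤-square : ∀ x → x ℕ.≤ x ℕ.* x
    ≤-square zero    = z≤n
    ≤-square (suc x) = ≤-*ʳ (suc x) (suc x) (s≤s z≤n)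

  module _ {p : ℕ} (pr : Prime p) where

    private
      instance
        p≢0 : NonZero p
        p≢0 = Primality.prime⇒nonZero pr

      cancel : ∀ {x n} → p ℕ.* x ≡ p ℕ.* n → x ≡ n
      cancel {x} {n} = ℕ.*-cancelˡ-≡ x n p

    divisorSum/p : ℕ → ℤ
    divisorSum/p = pairSum (λ d e → p ℕ.* (d ℕ.* e)) (λ d _ → χ (+ d))

    idealCount/p : ℕ → ℤ
    idealCount/p = pairSum (λ m a → p ℕ.* (m ℕ.* m ℕ.* a)) (λ _ a → ρ a)

    divisorSum/p-* : ∀ n → divisorSum/p (p ℕ.* n) ≡ divisorSum n
    divisorSum/p-* n = pairSum-rename (λ d _ → χ (+ d)) cancel (cong (p ℕ.*_))

    idealCount/p-* : ∀ n → idealCount/p (p ℕ.* n) ≡ idealCount n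
    idealCount/p-* n = pairSum-rename (λ _ a → ρ a) cancel (cong (p ℕ.*_))

    divisorSum/p-∤ : ∀ n → ¬ p ℕ.∣ n → divisorSum/p n ≡ + 0
    divisorSum/p-∤ n p∤n = pairSum-none _ (λ d _ → χ (+ d)) n (λ {x} {y} eq → p∤n (subst (p ℕ.∣_) eq (ℕ.m∣m*n (x ℕ.* y))))

    idealCount/p-∤ : ∀ n → ¬ p ℕ.∣ n → idealCount/p n ≡ + 0
    idealCount/p-∤ n p∤n = pairSum-none _ (λ _ a → ρ a) n (λ {x} {y} eq → p∤n (subst (p ℕ.∣_) eq (ℕ.m∣m*n (x ℕ.* x ℕ.* y))))

    χ-p* : ∀ d → χ (+ (p ℕ.* d)) ≡ χ (+ p) * χ (+ d)
    χ-p* d = trans (cong χ (ℤ.pos-* p d)) (χ-* (+ p) (+ d))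

    private
      reassoc : ∀ d e → d ℕ.* (p ℕ.* e) ≡ p ℕ.* (d ℕ.* e)
      reassoc d e = trans (sym (ℕ.*-assoc d p e)) (trans (cong (ℕ._* e) (ℕ.*-comm d p)) (ℕ.*-assoc p d e))

    divisorSum-step : ∀ n → p ℕ.* n ℕ.≤ B → divisorSum (p ℕ.* n) ≡ (+ 1 + χ (+ p)) * divisorSum n - χ (+ p) * divisorSum/p n
    divisorSum-step n pn≤B = begin
      divisorSum (p ℕ.* n)
        ≡⟨ pairSum-splitˡ p ℕ._*_ (λ d _ → χ (+ d)) (p ℕ.* n) pn≤B ≤-*ʳ ⟩
      pairSum (λ d e → p ℕ.* d ℕ.* e) (λ d _ → χ (+ (p ℕ.* d))) (p ℕ.* n) + offMultiples p ℕ._*_ (λ d _ → χ (+ d)) (p ℕ.* n)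
        ≡⟨ cong₂ _+_ multiples others ⟩
      χ (+ p) * divisorSum n + (divisorSum n - χ (+ p) * divisorSum/p n)
        ≡⟨ lemma (χ (+ p)) (divisorSum n) (divisorSum/p n) ⟩
      (+ 1 + χ (+ p)) * divisorSum n - χ (+ p) * divisorSum/p n ∎
      where
      open ≡-Reasoning
      lemma : ∀ x s t → x * s + (s - x * t) ≡ (+ 1 + x) * s - x * t
      lemma = solve-∀
      n≤B : n ℕ.≤ B
      n≤B = ℕ.≤-trans (≤-*ˡ p n (ℕ.>-nonZero⁻¹ p)) pn≤B
      twisted : ∀ k → pairSum (λ d e → p ℕ.* d ℕ.* e) (λ d _ → χ (+ (p ℕ.* d))) k ≡ χ (+ p) * divisorSum/p k
      twisted k = trans (pairSum-cong {v′ = λ d _ → χ (+ p) * χ (+ d)} (λ {d} {e} _ _ → cong₂ _*_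
          (𝟙-⇔ (p ℕ.* d ℕ.* e ℕ.≟ k) (p ℕ.* (d ℕ.* e) ℕ.≟ k) (trans (sym (ℕ.*-assoc p d e))) (trans (ℕ.*-assoc p d e))) (χ-p* d)))
        (pairSum-scale (λ d e → p ℕ.* (d ℕ.* e)) (λ d _ → χ (+ d)) (χ (+ p)) k)
      multiples : pairSum (λ d e → p ℕ.* d ℕ.* e) (λ d _ → χ (+ (p ℕ.* d))) (p ℕ.* n) ≡ χ (+ p) * divisorSum n
      multiples = trans (twisted (p ℕ.* n)) (cong (χ (+ p) *_) (divisorSum/p-* n))
      forced : ∀ {x y} → x ℕ.* y ≡ p ℕ.* n → ¬ p ℕ.∣ x → p ℕ.∣ y
      forced {x} {y} eq p∤x = [ (λ d → contradiction d p∤x) , id ]′ (Primality.euclidsLemma x y pr (ℕ.divides n (trans eq (ℕ.*-comm p n))))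
      others : offMultiples p ℕ._*_ (λ d _ → χ (+ d)) (p ℕ.* n) ≡ divisorSum n - χ (+ p) * divisorSum/p n
      others = trans (offMultiples-right p ℕ._*_ (λ d _ → χ (+ d)) (p ℕ.* n) pn≤B ≤-*ˡ forced)
        (trans (pairSum-rename (λ x y → (+ 1 - 𝟙 (p ℕ.∣? x)) * χ (+ x)) (λ {d} {e} eq → cancel (trans (sym (reassoc d e)) eq)) (λ {d} {e} eq → trans (reassoc d e) (cong (p ℕ.*_) eq)))
          (trans (move-+ (pairSum-splitˡ p ℕ._*_ (λ d _ → χ (+ d)) n n≤B ≤-*ʳ)) (cong (λ z → divisorSum n - z) (twisted n))))

    private
      squares : ∀ m a → p ℕ.* m ℕ.* (p ℕ.* m) ℕ.* a ≡ p ℕ.* (p ℕ.* (m ℕ.* m ℕ.* a))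
      squares m a = lemma p m a
        where
        lemma : ∀ p m a → p ℕ.* m ℕ.* (p ℕ.* m) ℕ.* a ≡ p ℕ.* (p ℕ.* (m ℕ.* m ℕ.* a))
        lemma = ℕ-solve-∀

      boundˡ : ∀ m a → 1 ℕ.≤ a → m ℕ.≤ m ℕ.* m ℕ.* a
      boundˡ m a 1≤a = ℕ.≤-trans (≤-square m) (≤-*ʳ (m ℕ.* m) a 1≤a)

      boundʳ : ∀ m a → 1 ℕ.≤ m → a ℕ.≤ m ℕ.* m ℕ.* a
      boundʳ m a 1≤m = ≤-*ˡ (m ℕ.* m) a (×-nonZero 1≤m 1≤m)

      p∣m²a : ∀ {m a} → p ℕ.∣ m ℕ.* m ℕ.* a → ¬ p ℕ.∣ m → p ℕ.∣ a
      p∣m²a {m} {a} d p∤m = [ (λ e → contradiction ([ id , id ]′ (Primality.euclidsLemma m m pr e)) p∤m) , id ]′ (Primality.euclidsLemma (m ℕ.* m) a pr d)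

      idealCount-split : ∀ n → p ℕ.* n ℕ.≤ B → idealCount (p ℕ.* n) ≡
        idealCount/p n + offMultiples p (λ m a → m ℕ.* m ℕ.* a) (λ _ a → ρ (p ℕ.* a)) n
      idealCount-split n pn≤B = trans (pairSum-splitˡ p (λ m a → m ℕ.* m ℕ.* a) (λ _ a → ρ a) (p ℕ.* n) pn≤B boundˡ) (cong₂ _+_
        (pairSum-rename (λ _ a → ρ a) (λ {m} {a} eq → cancel (trans (sym (squares m a)) eq)) (λ {m} {a} eq → trans (squares m a) (cong (p ℕ.*_) eq)))
        (trans (offMultiples-right p (λ m a → m ℕ.* m ℕ.* a) (λ _ a → ρ a) (p ℕ.* n) pn≤B boundʳ (λ {m} {a} eq → p∣m²a {m} {a} (ℕ.divides n (trans eq (ℕ.*-comm p n)))))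
          (pairSum-rename (λ m a → (+ 1 - 𝟙 (p ℕ.∣? m)) * ρ (p ℕ.* a)) (λ {m} {a} eq → cancel (trans (sym (reassoc (m ℕ.* m) a)) eq)) (λ {m} {a} eq → trans (reassoc (m ℕ.* m) a) (cong (p ℕ.*_) eq)))))

    idealCount-∤ : ∀ n → p ℕ.* n ℕ.≤ B → ¬ p ℕ.∣ n → idealCount (p ℕ.* n) ≡ (+ 1 + χ (+ p)) * idealCount n
    idealCount-∤ n pn≤B p∤n = trans (idealCount-split n pn≤B) (trans (cong₂ _+_ (idealCount/p-∤ n p∤n)
      (trans (pairSum-cong {v = λ m a → (+ 1 - 𝟙 (p ℕ.∣? m)) * ρ (p ℕ.* a)} {v′ = λ _ a → (+ 1 + χ (+ p)) * ρ a} (λ {m} {a} _ _ → term m a (m ℕ.* m ℕ.* a ℕ.≟ n))) (pairSum-scale (λ m a → m ℕ.* m ℕ.* a) (λ _ a → ρ a) (+ 1 + χ (+ p)) n)))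
      (ℤ.+-identityˡ _))
      where
      term : ∀ m a (k? : Dec (m ℕ.* m ℕ.* a ≡ n)) → 𝟙 k? * ((+ 1 - 𝟙 (p ℕ.∣? m)) * ρ (p ℕ.* a)) ≡ 𝟙 k? * ((+ 1 + χ (+ p)) * ρ a)
      term m a (no ¬k) rewrite 𝟙-no (no ¬k) ¬k = refl
      term m a (yes k) = cong (𝟙 (yes k) *_) (trans (cong (λ z → (+ 1 - z) * ρ (p ℕ.* a)) (𝟙-no (p ℕ.∣? m) (λ d → p∤n (subst (p ℕ.∣_) k (ℕ.∣m⇒∣m*n a (ℕ.∣m⇒∣m*n m d))))))
        (trans (ℤ.*-identityˡ (ρ (p ℕ.* a))) (rootCount-∤ pr (λ d → p∤n (subst (p ℕ.∣_) k (ℕ.∣n⇒∣m*n (m ℕ.* m) d))))))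

    idealCount-∣ : ∀ n → p ℕ.* (p ℕ.* n) ℕ.≤ B →
      idealCount (p ℕ.* (p ℕ.* n)) ≡ idealCount n + χ (+ p) * χ (+ p) * (idealCount (p ℕ.* n) - idealCount/p n)
    idealCount-∣ n ppn≤B = trans (idealCount-split (p ℕ.* n) ppn≤B) (cong₂ _+_ (idealCount/p-* n)
      (trans (pairSum-cong {v = λ m a → (+ 1 - 𝟙 (p ℕ.∣? m)) * ρ (p ℕ.* a)} {v′ = λ m a → χ (+ p) * χ (+ p) * ((+ 1 - 𝟙 (p ℕ.∣? m)) * ρ a)} (λ {m} {a} _ a∈ → term m a (∈1⋯-≥1 a∈) (p ℕ.∣? m) (m ℕ.* m ℕ.* a ℕ.≟ p ℕ.* n)))
        (trans (pairSum-scale (λ m a → m ℕ.* m ℕ.* a) (λ m a → (+ 1 - 𝟙 (p ℕ.∣? m)) * ρ a) (χ (+ p) * χ (+ p)) (p ℕ.* n))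
          (cong (χ (+ p) * χ (+ p) *_) (trans (move-+ (pairSum-splitˡ p (λ m a → m ℕ.* m ℕ.* a) (λ _ a → ρ a) (p ℕ.* n) pn≤B boundˡ))
            (cong (λ z → idealCount (p ℕ.* n) - z) (pairSum-rename (λ _ a → ρ a) (λ {m} {a} eq → cancel (trans (sym (squares m a)) eq)) (λ {m} {a} eq → trans (squares m a) (cong (p ℕ.*_) eq)))))))))
      where
      pn≤B : p ℕ.* n ℕ.≤ B
      pn≤B = ℕ.≤-trans (≤-*ˡ p (p ℕ.* n) (ℕ.>-nonZero⁻¹ p)) ppn≤B
      term : ∀ m a → 1 ℕ.≤ a → (px? : Dec (p ℕ.∣ m)) (k? : Dec (m ℕ.* m ℕ.* a ≡ p ℕ.* n)) →
        𝟙 k? * ((+ 1 - 𝟙 px?) * ρ (p ℕ.* a)) ≡ 𝟙 k? * (χ (+ p) * χ (+ p) * ((+ 1 - 𝟙 px?) * ρ a))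
      term m a _ px? (no ¬k) rewrite 𝟙-no (no ¬k) ¬k = refl
      term m a _ (yes px) (yes k) rewrite 𝟙-yes (yes px) px = cong (𝟙 (yes k) *_) (sym (ℤ.*-zeroʳ (χ (+ p) * χ (+ p))))
      term m a@(suc _) _ (no ¬px) (yes k) rewrite 𝟙-no (no ¬px) ¬px = cong (𝟙 (yes k) *_) (trans (ℤ.*-identityˡ (ρ (p ℕ.* a)))
        (trans (rootCount-∣ pr (p∣m²a {m} {a} (ℕ.divides n (trans k (ℕ.*-comm p n))) ¬px)) (cong (χ (+ p) * χ (+ p) *_) (sym (ℤ.*-identityˡ (ρ a))))))

  χ-one : χ (+ 1) ≡ + 1
  χ-one with χ-unit 1 (Coprimality.1-coprimeTo _)
  ... | inj₁ eq = eq
  ... | inj₂ eq = trans (χ-* (+ 1) (+ 1)) (cong₂ _*_ eq eq)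

  ternary-cube : ∀ {x} → Ternary x → x * x * x ≡ x
  ternary-cube neg1 = refl
  ternary-cube zer0 = refl
  ternary-cube pos1 = refl

  private
    rootCount-one : ρ 1 ≡ + 1
    rootCount-one = cong (_+ + 0) (𝟙-yes (+ 1 ∣ₛ? norm c (+ 0)) (divides (norm c (+ 0)) (sym (ℤ.*-identityʳ (norm c (+ 0))))))

    base : ∀ K v → 1 ℕ.≤ B → K 1 1 ≡ 1 → (∀ {x y} → K x y ≡ 1 → x ≡ 1 × y ≡ 1) → pairSum K v 1 ≡ v 1 1
    base K v 1≤B eq only = trans (∑-single {x = 1} (λ x → ∑ (1⋯ B) (λ y → 𝟙 (K x y ℕ.≟ 1) * v x y)) (1⋯-unique B) (∈1⋯ (s≤s z≤n) 1≤B)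
        (λ {x} _ x≢1 → ∑-𝟙-*-none {xs = 1⋯ B} (λ y → K x y ℕ.≟ 1) (v x) (λ _ k → x≢1 (proj₁ (only k)))))
      (∑-𝟙-* {x = 1} (λ y → K 1 y ℕ.≟ 1) (v 1) (1⋯-unique B) (∈1⋯ (s≤s z≤n) 1≤B) eq (λ _ k → proj₂ (only k)))

    prime-divisor : ∀ n → 1 ℕ.< n → ∃[ p ] ∃[ k ] Prime p × n ≡ p ℕ.* k
    prime-divisor n@(suc _) 1<n = go (PrimeFactorisation.factors f) (PrimeFactorisation.isFactorisation f) (PrimeFactorisation.factorsPrime f)
      where
      f = factorise n
      go : ∀ ps → n ≡ product ps → All Prime ps → ∃[ p ] ∃[ k ] Prime p × n ≡ p ℕ.* k
      go []       eq _        = contradiction 1<n (subst (λ m → ¬ 1 ℕ.< m) (sym eq) (ℕ.<-irrefl refl))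
      go (p ∷ ps) eq (pr ∷ _) = p , product ps , pr , eq

  -- Both sides obey the same recursion when a prime p is removed from n.
  idealCount≡divisorSum : ∀ n → 1 ℕ.≤ n → n ℕ.≤ B → idealCount n ≡ divisorSum n
  idealCount≡divisorSum = <-rec (λ n → 1 ℕ.≤ n → n ℕ.≤ B → idealCount n ≡ divisorSum n) step
    where
    step : ∀ n → (∀ {k} → k ℕ.< n → 1 ℕ.≤ k → k ℕ.≤ B → idealCount k ≡ divisorSum k) → 1 ℕ.≤ n → n ℕ.≤ B → idealCount n ≡ divisorSum n
    step n rec 1≤n n≤B with ℕ.m≤n⇒m<n∨m≡n 1≤n
    ... | inj₂ refl = trans (base (λ m a → m ℕ.* m ℕ.* a) (λ _ a → ρ a) n≤B refl (λ {m} {a} eq → ℕ.m*n≡1⇒m≡1 m m (ℕ.m*n≡1⇒m≡1 (m ℕ.* m) a eq) , ℕ.m*n≡1⇒n≡1 (m ℕ.* m) a eq))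
                        (trans rootCount-one (sym (trans (base ℕ._*_ (λ d _ → χ (+ d)) n≤B refl (λ {x} {y} eq → ℕ.m*n≡1⇒m≡1 x y eq , ℕ.m*n≡1⇒n≡1 x y eq)) χ-one)))
    ... | inj₁ 1<n with prime-divisor n 1<n
    ...   | p , zero  , pr , refl = contradiction 1≤n (subst (λ m → ¬ 1 ℕ.≤ m) (sym (ℕ.*-zeroʳ p)) λ ())
    ...   | p , k@(suc _) , pr , refl = cases (p ℕ.∣? k)
      where
      instance
        p≢0 : NonZero p
        p≢0 = Primality.prime⇒nonZero pr
      k< : k ℕ.< p ℕ.* k
      k< = subst (k ℕ.<_) (ℕ.*-comm k p) (ℕ.m<m*n k p (ℕ.nonTrivial⇒n>1 p {{Primality.prime⇒nonTrivial pr}}))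
      at : ∀ j → j ℕ.< p ℕ.* k → 1 ℕ.≤ j → idealCount j ≡ divisorSum j
      at j j< 1≤j = rec j< 1≤j (ℕ.≤-trans (ℕ.<⇒≤ j<) n≤B)
      cases : Dec (p ℕ.∣ k) → idealCount (p ℕ.* k) ≡ divisorSum (p ℕ.* k)
      cases (no p∤k) = trans (idealCount-∤ pr k n≤B p∤k) (trans (cong ((+ 1 + χ (+ p)) *_) (at k k< (s≤s z≤n)))
        (sym (trans (divisorSum-step pr k n≤B) (trans (cong (λ z → (+ 1 + χ (+ p)) * divisorSum k - χ (+ p) * z) (divisorSum/p-∤ pr k p∤k)) (lemma ((+ 1 + χ (+ p)) * divisorSum k) (χ (+ p)))))))
        where
        lemma : ∀ a x → a - x * + 0 ≡ a
        lemma = solve-∀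
      cases (yes (ℕ.divides j k≡j*p)) = subst (λ k → idealCount (p ℕ.* k) ≡ divisorSum (p ℕ.* k)) (sym k≡) (begin
        idealCount (p ℕ.* (p ℕ.* j))
          ≡⟨ idealCount-∣ pr j ppj≤B ⟩
        idealCount j + x * x * (idealCount (p ℕ.* j) - idealCount/p pr j)
          ≡⟨ cong₂ (λ u v → u + x * x * v) (at j j< 1≤j) (cong₂ _-_ (subst (λ i → idealCount i ≡ divisorSum i) k≡ (at k k< (s≤s z≤n))) (quotients (p ℕ.∣? j))) ⟩
        divisorSum j + x * x * (divisorSum (p ℕ.* j) - divisorSum/p pr j)
          ≡⟨ cong (λ z → divisorSum j + x * x * (z - divisorSum/p pr j)) (divisorSum-step pr j (ℕ.≤-trans (≤-*ˡ p (p ℕ.* j) (ℕ.>-nonZero⁻¹ p)) ppj≤B)) ⟩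
        divisorSum j + x * x * ((+ 1 + x) * divisorSum j - x * divisorSum/p pr j - divisorSum/p pr j)
          ≡⟨ lemma₁ x (divisorSum j) (divisorSum/p pr j) ⟩
        divisorSum j + (x * x + x * x * x) * (divisorSum j - divisorSum/p pr j)
          ≡⟨ cong (λ z → divisorSum j + (x * x + z) * (divisorSum j - divisorSum/p pr j)) (ternary-cube (χ-ternary (+ p))) ⟩
        divisorSum j + (x * x + x) * (divisorSum j - divisorSum/p pr j)
          ≡⟨ lemma₂ x (divisorSum j) (divisorSum/p pr j) ⟩
        (+ 1 + x) * ((+ 1 + x) * divisorSum j - x * divisorSum/p pr j) - x * divisorSum j
          ≡⟨ cong₂ (λ u v → (+ 1 + x) * u - x * v) (sym (divisorSum-step pr j (ℕ.≤-trans (≤-*ˡ p (p ℕ.* j) (ℕ.>-nonZero⁻¹ p)) ppj≤B))) (sym (divisorSum/p-* pr j)) ⟩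
        (+ 1 + x) * divisorSum (p ℕ.* j) - x * divisorSum/p pr (p ℕ.* j)
          ≡⟨ sym (divisorSum-step pr (p ℕ.* j) ppj≤B) ⟩
        divisorSum (p ℕ.* (p ℕ.* j)) ∎)
        where
        open ≡-Reasoning
        x = χ (+ p)
        k≡ : k ≡ p ℕ.* j
        k≡ = trans k≡j*p (ℕ.*-comm j p)
        ppj≤B : p ℕ.* (p ℕ.* j) ℕ.≤ B
        ppj≤B = subst (λ i → p ℕ.* i ℕ.≤ B) k≡ n≤B
        1≤j : 1 ℕ.≤ j
        1≤j = ℕ.n≢0⇒n>0 (λ { refl → contradiction k≡j*p λ () })
        j< : j ℕ.< p ℕ.* k
        j< = ℕ.≤-<-trans (subst (j ℕ.≤_) (sym k≡) (≤-*ˡ p j (ℕ.>-nonZero⁻¹ p))) k<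
        quotients : Dec (p ℕ.∣ j) → idealCount/p pr j ≡ divisorSum/p pr j
        quotients (no p∤j) = trans (idealCount/p-∤ pr j p∤j) (sym (divisorSum/p-∤ pr j p∤j))
        quotients (yes (ℕ.divides i j≡i*p)) = subst (λ j → idealCount/p pr j ≡ divisorSum/p pr j) (sym j≡)
          (trans (idealCount/p-* pr i) (trans (at i i< 1≤i) (sym (divisorSum/p-* pr i))))
          where
          j≡ : j ≡ p ℕ.* i
          j≡ = trans j≡i*p (ℕ.*-comm i p)
          1≤i : 1 ℕ.≤ i
          1≤i = ℕ.n≢0⇒n>0 (λ { refl → contradiction 1≤j (subst (λ m → ¬ 1 ℕ.≤ m) (sym j≡i*p) λ ()) })
          i< : i ℕ.< p ℕ.* k
          i< = ℕ.≤-<-trans (subst (i ℕ.≤_) (sym j≡) (≤-*ˡ p i (ℕ.>-nonZero⁻¹ p))) j<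
        lemma₁ : ∀ x s t → s + x * x * ((+ 1 + x) * s - x * t - t) ≡ s + (x * x + x * x * x) * (s - t)
        lemma₁ = solve-∀
        lemma₂ : ∀ x s t → s + (x * x + x) * (s - t) ≡ (+ 1 + x) * ((+ 1 + x) * s - x * t) - x * s
        lemma₂ = solve-∀

-- The ring of integers of ℚ(√D) is ℤ + ℤω with ω = (1 + √D)/2

module ℚS = ℚSolver.+-*-Solver

infixr 8 _ℚ^_

_ℚ^_ : ℚ → ℕ → ℚ
x ℚ^ zero  = 1ℚ
x ℚ^ suc k = x ℚ.* (x ℚ^ k)

abstract
  ⌜_⌝ : ℤ → ℚ
  ⌜ z ⌝ = z ℚ./ 1

  ⌜⌝-def : ∀ z → z ℚ./ 1 ≡ ⌜ z ⌝
  ⌜⌝-def z = refl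

  ⌜0⌝ : ⌜ + 0 ⌝ ≡ 0ℚ
  ⌜0⌝ = refl

  ⌜1⌝ : ⌜ + 1 ⌝ ≡ 1ℚ
  ⌜1⌝ = refl

  ⌜-4⌝ : ⌜ - + 4 ⌝ ≡ ℚ.- (1ℚ ℚ.+ 1ℚ ℚ.+ 1ℚ ℚ.+ 1ℚ)
  ⌜-4⌝ = refl

  ⌜⌝-injective : ∀ {a b} → ⌜ a ⌝ ≡ ⌜ b ⌝ → a ≡ b
  ⌜⌝-injective {a} {b} eq with ℚ.fromℚᵘ-injective {mkℚᵘ a 0} {mkℚᵘ b 0} eq
  ... | *≡* e = trans (sym (ℤ.*-identityʳ a)) (trans e (ℤ.*-identityʳ b))

  ⌜⌝-+ : ∀ a b → ⌜ a + b ⌝ ≡ ⌜ a ⌝ ℚ.+ ⌜ b ⌝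
  ⌜⌝-+ a b = ℚ.toℚᵘ-injective (ℚᵘ.≃-trans (ℚ.toℚᵘ-fromℚᵘ (mkℚᵘ (a + b) 0)) (ℚᵘ.≃-trans (*≡* (lemma a b))
    (ℚᵘ.≃-sym (ℚᵘ.≃-trans (ℚ.toℚᵘ-homo-+ ⌜ a ⌝ ⌜ b ⌝) (ℚᵘ.+-cong (ℚ.toℚᵘ-fromℚᵘ (mkℚᵘ a 0)) (ℚ.toℚᵘ-fromℚᵘ (mkℚᵘ b 0)))))))
    where
    lemma : ∀ a b → (a + b) * + 1 ≡ (a * + 1 + b * + 1) * + 1
    lemma = solve-∀

  ⌜⌝-* : ∀ a b → ⌜ a * b ⌝ ≡ ⌜ a ⌝ ℚ.* ⌜ b ⌝
  ⌜⌝-* a b = ℚ.toℚᵘ-injective (ℚᵘ.≃-trans (ℚ.toℚᵘ-fromℚᵘ (mkℚᵘ (a * b) 0)) (ℚᵘ.≃-trans (*≡* refl)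
    (ℚᵘ.≃-sym (ℚᵘ.≃-trans (ℚ.toℚᵘ-homo-* ⌜ a ⌝ ⌜ b ⌝) (ℚᵘ.*-cong (ℚ.toℚᵘ-fromℚᵘ (mkℚᵘ a 0)) (ℚ.toℚᵘ-fromℚᵘ (mkℚᵘ b 0)))))))

  lowest-terms : ∀ r → ∃[ u ] ∃[ v ] r ℚ.* ⌜ + suc v ⌝ ≡ ⌜ u ⌝ × Coprime ∣ u ∣ (suc v)
  lowest-terms r@(mkℚ u v cop) = u , v , ℚ.toℚᵘ-injective (ℚᵘ.≃-trans (ℚ.toℚᵘ-homo-* r ⌜ + suc v ⌝)
    (ℚᵘ.≃-trans (ℚᵘ.*-cong (ℚᵘ.≃-refl {mkℚᵘ u v}) (ℚ.toℚᵘ-fromℚᵘ (mkℚᵘ (+ suc v) 0)))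
      (ℚᵘ.≃-trans (*≡* (trans (ℤ.*-identityʳ (u * + suc v)) (cong (λ n → u * + n) (sym (ℕ.*-identityʳ (suc v)))))) (ℚᵘ.≃-sym (ℚ.toℚᵘ-fromℚᵘ (mkℚᵘ u 0)))))) , Coprimality.recompute cop

  reciprocal : ∀ d → ∃[ r ] ⌜ + suc d ⌝ ℚ.* r ≡ 1ℚ
  reciprocal d = + 1 ℚ./ suc d , ℚ.toℚᵘ-injective (ℚᵘ.≃-trans (ℚ.toℚᵘ-homo-* ⌜ + suc d ⌝ (+ 1 ℚ./ suc d))
    (ℚᵘ.≃-trans (ℚᵘ.*-cong (ℚ.toℚᵘ-fromℚᵘ (mkℚᵘ (+ suc d) 0)) (ℚ.toℚᵘ-fromℚᵘ (mkℚᵘ (+ 1) d)))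
      (*≡* (trans (lemma (+ suc d)) (cong (λ n → + 1 * + n) (sym (ℕ.+-identityʳ (suc d))))))))
    where
    lemma : ∀ a → a * + 1 * + 1 ≡ + 1 * a
    lemma = solve-∀

⌜⌝-neg : ∀ a → ⌜ - a ⌝ ≡ ℚ.- ⌜ a ⌝
⌜⌝-neg a = solved ⌜ a ⌝ ⌜ - a ⌝ (trans (sym (⌜⌝-+ (- a) a)) (trans (cong ⌜_⌝ (ℤ.+-inverseˡ a)) ⌜0⌝))
  where
  solved : ∀ x y → y ℚ.+ x ≡ 0ℚ → y ≡ ℚ.- x
  solved x y eq = trans (ℚS.solve 2 (λ x y → y ℚS.:= (y ℚS.:+ x) ℚS.:+ ℚS.:- x) refl x y) (trans (cong (ℚ._+ ℚ.- x) eq) (ℚ.+-identityˡ (ℚ.- x)))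

⌜⌝-- : ∀ a b → ⌜ a - b ⌝ ≡ ⌜ a ⌝ ℚ.- ⌜ b ⌝
⌜⌝-- a b = trans (⌜⌝-+ a (- b)) (cong (⌜ a ⌝ ℚ.+_) (⌜⌝-neg b))

⌜⌝-^ : ∀ a k → ⌜ a ^ k ⌝ ≡ ⌜ a ⌝ ℚ^ k
⌜⌝-^ a zero    = ⌜1⌝
⌜⌝-^ a (suc k) = trans (⌜⌝-* a (a ^ k)) (cong (⌜ a ⌝ ℚ.*_) (⌜⌝-^ a k))

ℚ^-* : ∀ x y k → (x ℚ.* y) ℚ^ k ≡ (x ℚ^ k) ℚ.* (y ℚ^ k)
ℚ^-* x y zero    = refl
ℚ^-* x y (suc k) = trans (cong (x ℚ.* y ℚ.*_) (ℚ^-* x y k))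
  (ℚS.solve 4 (λ x y u v → (x ℚS.:* y) ℚS.:* (u ℚS.:* v) ℚS.:= (x ℚS.:* u) ℚS.:* (y ℚS.:* v)) refl x y (x ℚ^ k) (y ℚ^ k))

coprime-^ʳ : ∀ {m n} k → Coprime m n → Coprime m (n ℕ.^ k)
coprime-^ʳ zero    cop (_ , d∣1) = ℕ.∣1⇒≡1 d∣1
coprime-^ʳ {m} {n} (suc k) cop = coprime-* {m} {n} {n ℕ.^ k} cop (coprime-^ʳ {m} {n} k cop)

coprime-^ : ∀ {m n} k → Coprime m n → Coprime (m ℕ.^ k) (n ℕ.^ k)
coprime-^ {m} {n} k cop = coprime-^ʳ {m ℕ.^ k} {n} k (Coprimality.sym {n} {m ℕ.^ k} (coprime-^ʳ {n} {m} k (Coprimality.sym {m} {n} cop)))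

abs-^ : ∀ z k → ∣ z ^ k ∣ ≡ ∣ z ∣ ℕ.^ k
abs-^ z zero    = refl
abs-^ z (suc k) = trans (ℤ.abs-* z (z ^ k)) (cong (∣ z ∣ ℕ.*_) (abs-^ z k))

n<[2+v]^n : ∀ v n → n ℕ.< suc (suc v) ℕ.^ n
n<[2+v]^n v zero    = s≤s z≤n
n<[2+v]^n v (suc n) = ℕ.≤-trans (ℕ.+-mono-≤ {1} (ℕ.m^n>0 (suc (suc v)) n) (n<[2+v]^n v n))
  (ℕ.≤-trans (ℕ.≤-reflexive (cong (suc (suc v) ℕ.^ n ℕ.+_) (sym (ℕ.+-identityʳ _)))) (ℕ.*-monoˡ-≤ (suc (suc v) ℕ.^ n) {2} {suc (suc v)} (s≤s (s≤s z≤n))))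

bounded-denominators : ∀ r d → (∀ k → ∃[ z ] ⌜ + suc d ⌝ ℚ.* r ℚ^ k ≡ ⌜ z ⌝) → ∃[ z ] r ≡ ⌜ z ⌝
bounded-denominators r d bounded with lowest-terms r
... | u , zero  , eq , cop = u , trans (sym (ℚ.*-identityʳ r)) (trans (cong (r ℚ.*_) (sym ⌜1⌝)) eq)
... | u , suc v , eq , cop = contradiction (ℕ.∣⇒≤ v^k∣d) (ℕ.<⇒≱ (n<[2+v]^n v k))
  where
  k = suc d
  V = suc (suc v)
  z = proj₁ (bounded k)
  powers : + suc d * u ^ k ≡ z * (+ V) ^ k
  powers = ⌜⌝-injective (begin
    ⌜ + suc d * u ^ k ⌝                         ≡⟨ trans (⌜⌝-* (+ suc d) (u ^ k)) (cong (⌜ + suc d ⌝ ℚ.*_) (trans (⌜⌝-^ u k) (cong (_ℚ^ k) (sym eq)))) ⟩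
    ⌜ + suc d ⌝ ℚ.* (r ℚ.* ⌜ + V ⌝) ℚ^ k        ≡⟨ cong (⌜ + suc d ⌝ ℚ.*_) (ℚ^-* r ⌜ + V ⌝ k) ⟩
    ⌜ + suc d ⌝ ℚ.* ((r ℚ^ k) ℚ.* (⌜ + V ⌝ ℚ^ k)) ≡⟨ sym (ℚ.*-assoc ⌜ + suc d ⌝ (r ℚ^ k) (⌜ + V ⌝ ℚ^ k)) ⟩
    ⌜ + suc d ⌝ ℚ.* (r ℚ^ k) ℚ.* (⌜ + V ⌝ ℚ^ k) ≡⟨ cong₂ ℚ._*_ (proj₂ (bounded k)) (sym (⌜⌝-^ (+ V) k)) ⟩
    ⌜ z ⌝ ℚ.* ⌜ (+ V) ^ k ⌝                     ≡⟨ sym (⌜⌝-* z ((+ V) ^ k)) ⟩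
    ⌜ z * (+ V) ^ k ⌝                           ∎)
    where open ≡-Reasoning
  v^k∣d : V ℕ.^ k ℕ.∣ suc d
  v^k∣d = Coprimality.coprime-divisor {V ℕ.^ k} {∣ u ∣ ℕ.^ k} (coprime-^ {V} {∣ u ∣} k (Coprimality.sym {∣ u ∣} {V} cop))
    (ℕ.divides ∣ z ∣ (trans (ℕ.*-comm (∣ u ∣ ℕ.^ k) (suc d)) (trans (cong (suc d ℕ.*_) (sym (abs-^ u k)))
      (trans (sym (ℤ.abs-* (+ suc d) (u ^ k))) (trans (cong ∣_∣ powers) (trans (ℤ.abs-* z ((+ V) ^ k)) (cong (∣ z ∣ ℕ.*_) (abs-^ (+ V) k))))))))

squareFree-rational : ∀ N → (∀ d → d ℕ.* d ℕ.∣ N → d ≡ 1) → ∀ r z → ⌜ + N ⌝ ℚ.* (r ℚ.* r) ≡ ⌜ z ⌝ → ∃[ b ] r ≡ ⌜ b ⌝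
squareFree-rational N sf r z eq with lowest-terms r
... | u , v , ur , cop = u , trans (sym (ℚ.*-identityʳ r)) (trans (cong (r ℚ.*_) (sym (trans (cong (λ n → ⌜ + n ⌝) V≡1) ⌜1⌝))) ur)
  where
  V = suc v
  clear : + N * (u * u) ≡ z * (+ V * + V)
  clear = ⌜⌝-injective (begin
    ⌜ + N * (u * u) ⌝                                   ≡⟨ trans (⌜⌝-* (+ N) (u * u)) (cong (⌜ + N ⌝ ℚ.*_) (trans (⌜⌝-* u u) (sym (cong₂ ℚ._*_ ur ur)))) ⟩
    ⌜ + N ⌝ ℚ.* ((r ℚ.* ⌜ + V ⌝) ℚ.* (r ℚ.* ⌜ + V ⌝))   ≡⟨ ℚS.solve 3 (λ n r v → n ℚS.:* ((r ℚS.:* v) ℚS.:* (r ℚS.:* v)) ℚS.:= n ℚS.:* (r ℚS.:* r) ℚS.:* (v ℚS.:* v)) refl ⌜ + N ⌝ r ⌜ + V ⌝ ⟩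
    ⌜ + N ⌝ ℚ.* (r ℚ.* r) ℚ.* (⌜ + V ⌝ ℚ.* ⌜ + V ⌝)     ≡⟨ cong₂ ℚ._*_ eq (sym (⌜⌝-* (+ V) (+ V))) ⟩
    ⌜ z ⌝ ℚ.* ⌜ + V * + V ⌝                             ≡⟨ sym (⌜⌝-* z (+ V * + V)) ⟩
    ⌜ z * (+ V * + V) ⌝                                 ∎)
    where open ≡-Reasoning
  coprime-squares : Coprime (V ℕ.* V) (∣ u ∣ ℕ.* ∣ u ∣)
  coprime-squares = coprime-* {V ℕ.* V} {∣ u ∣} {∣ u ∣} right right
    where
    right : Coprime (V ℕ.* V) ∣ u ∣
    right = Coprimality.sym {∣ u ∣} {V ℕ.* V} (coprime-* {∣ u ∣} {V} {V} cop cop)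
  V≡1 : V ≡ 1
  V≡1 = sf V (Coprimality.coprime-divisor {V ℕ.* V} {∣ u ∣ ℕ.* ∣ u ∣} coprime-squares
    (ℕ.divides ∣ z ∣ (trans (ℕ.*-comm (∣ u ∣ ℕ.* ∣ u ∣) N) (trans (cong (N ℕ.*_) (sym (ℤ.abs-* u u))) (trans (sym (ℤ.abs-* (+ N) (u * u)))
      (trans (cong ∣_∣ clear) (trans (ℤ.abs-* z (+ V * + V)) (cong (∣ z ∣ ℕ.*_) (ℤ.abs-* (+ V) (+ V))))))))))

module Integers (D : ℤ) (c : ℕ) (D≡-N : D ≡ - + conductor c) where

  open QuadraticField D public

  κ : ℤ
  κ = + suc c

  δ : ℚ
  δ = D ℚ./ 1

  D≡ : D ≡ + 1 + - + 4 * κ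
  D≡ = trans D≡-N (trans (cong -_ (conductor-ℤ c)) (trans (lemma (+ c)) (cong (λ k → + 1 + - + 4 * k) (sym (ℤ.pos-+ 1 c)))))
    where
    lemma : ∀ c → - (+ 4 * c + + 3) ≡ + 1 + - + 4 * (+ 1 + c)
    lemma = solve-∀

  δ≡ : δ ≡ 1ℚ ℚ.+ ℚ.- (1ℚ ℚ.+ 1ℚ ℚ.+ 1ℚ ℚ.+ 1ℚ) ℚ.* ⌜ κ ⌝
  δ≡ = trans (⌜⌝-def D) (trans (cong ⌜_⌝ D≡) (trans (⌜⌝-+ (+ 1) (- + 4 * κ)) (cong₂ ℚ._+_ ⌜1⌝ (trans (⌜⌝-* (- + 4) κ) (cong (ℚ._* ⌜ κ ⌝) ⌜-4⌝)))))

  -- ι p q is p + qω.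
  ι : ℤ → ℤ → K
  ι p q = (⌜ p ⌝ ℚ.+ ½ ℚ.* ⌜ q ⌝) +√D (½ ℚ.* ⌜ q ⌝)

  K-≡ : ∀ {x y : K} → K.re x ≡ K.re y → K.im x ≡ K.im y → x ≡ y
  K-≡ refl refl = refl

  open ℚS using (con; _:+_; _:*_; _:=_; :-_; _:-_)

  ι-+ : ∀ p q r s → ι p q +K ι r s ≡ ι (p + r) (q + s)
  ι-+ p q r s = K-≡
    (trans (ℚS.solve 4 (λ p q r s → (p :+ con ½ :* q) :+ (r :+ con ½ :* s) := (p :+ r) :+ con ½ :* (q :+ s)) refl ⌜ p ⌝ ⌜ q ⌝ ⌜ r ⌝ ⌜ s ⌝)
           (sym (cong₂ (λ a b → a ℚ.+ ½ ℚ.* b) (⌜⌝-+ p r) (⌜⌝-+ q s))))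
    (trans (ℚS.solve 2 (λ q s → con ½ :* q :+ con ½ :* s := con ½ :* (q :+ s)) refl ⌜ q ⌝ ⌜ s ⌝) (sym (cong (½ ℚ.*_) (⌜⌝-+ q s))))

  ι-* : ∀ p q r s → ι p q *K ι r s ≡ ι (p * r - κ * (q * s)) (p * s + q * r + q * s)
  ι-* p q r s = K-≡
    (trans (cong (λ d → (⌜ p ⌝ ℚ.+ ½ ℚ.* ⌜ q ⌝) ℚ.* (⌜ r ⌝ ℚ.+ ½ ℚ.* ⌜ s ⌝) ℚ.+ d ℚ.* (½ ℚ.* ⌜ q ⌝ ℚ.* (½ ℚ.* ⌜ s ⌝))) δ≡)
      (trans (ℚS.solve 5 (λ p q r s k → (p :+ con ½ :* q) :* (r :+ con ½ :* s) :+ (con 1ℚ :+ :- (con 1ℚ :+ con 1ℚ :+ con 1ℚ :+ con 1ℚ) :* k) :* (con ½ :* q :* (con ½ :* s))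
                              := (p :* r :+ :- (k :* (q :* s))) :+ con ½ :* (p :* s :+ q :* r :+ q :* s)) refl ⌜ p ⌝ ⌜ q ⌝ ⌜ r ⌝ ⌜ s ⌝ ⌜ κ ⌝)
        (sym (cong₂ (λ a b → a ℚ.+ ½ ℚ.* b) real imag))))
    (trans (ℚS.solve 4 (λ p q r s → (p :+ con ½ :* q) :* (con ½ :* s) :+ con ½ :* q :* (r :+ con ½ :* s)
                            := con ½ :* (p :* s :+ q :* r :+ q :* s)) refl ⌜ p ⌝ ⌜ q ⌝ ⌜ r ⌝ ⌜ s ⌝)
      (sym (cong (½ ℚ.*_) imag)))
    where
    real : ⌜ p * r - κ * (q * s) ⌝ ≡ ⌜ p ⌝ ℚ.* ⌜ r ⌝ ℚ.+ ℚ.- (⌜ κ ⌝ ℚ.* (⌜ q ⌝ ℚ.* ⌜ s ⌝))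
    real = trans (⌜⌝-- (p * r) (κ * (q * s))) (cong₂ ℚ._-_ (⌜⌝-* p r) (trans (⌜⌝-* κ (q * s)) (cong (⌜ κ ⌝ ℚ.*_) (⌜⌝-* q s))))
    imag : ⌜ p * s + q * r + q * s ⌝ ≡ ⌜ p ⌝ ℚ.* ⌜ s ⌝ ℚ.+ ⌜ q ⌝ ℚ.* ⌜ r ⌝ ℚ.+ ⌜ q ⌝ ℚ.* ⌜ s ⌝
    imag = trans (⌜⌝-+ (p * s + q * r) (q * s)) (cong₂ ℚ._+_ (trans (⌜⌝-+ (p * s) (q * r)) (cong₂ ℚ._+_ (⌜⌝-* p s) (⌜⌝-* q r))) (⌜⌝-* q s))

  ι-injective : ∀ {p q r s} → ι p q ≡ ι r s → p ≡ r × q ≡ s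
  ι-injective {p} {q} {r} {s} eq = ⌜⌝-injective p≡r , ⌜⌝-injective q≡s
    where
    double : ∀ x → (1ℚ ℚ.+ 1ℚ) ℚ.* (½ ℚ.* x) ≡ x
    double = ℚS.solve 1 (λ x → (con 1ℚ :+ con 1ℚ) :* (con ½ :* x) := x) refl
    q≡s : ⌜ q ⌝ ≡ ⌜ s ⌝
    q≡s = trans (sym (double ⌜ q ⌝)) (trans (cong ((1ℚ ℚ.+ 1ℚ) ℚ.*_) (cong K.im eq)) (double ⌜ s ⌝))
    p≡r : ⌜ p ⌝ ≡ ⌜ r ⌝
    p≡r = trans (cancel₊ ⌜ p ⌝ (½ ℚ.* ⌜ q ⌝)) (trans (cong₂ ℚ._-_ (cong K.re eq) (cong K.im eq)) (sym (cancel₊ ⌜ r ⌝ (½ ℚ.* ⌜ s ⌝))))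
      where
      cancel₊ : ∀ x y → x ≡ (x ℚ.+ y) ℚ.- y
      cancel₊ = ℚS.solve 2 (λ x y → x := (x :+ y) :- y) refl

  ι-fromℚ : ∀ z → ι z (+ 0) ≡ fromℚ ⌜ z ⌝
  ι-fromℚ z = K-≡ (trans (cong (λ t → ⌜ z ⌝ ℚ.+ ½ ℚ.* t) ⌜0⌝) (ℚ.+-identityʳ ⌜ z ⌝)) (cong (½ ℚ.*_) ⌜0⌝)

  ι-fromℤ : ∀ z → fromℤ z ≡ ι z (+ 0)
  ι-fromℤ z = trans (cong fromℚ (⌜⌝-def z)) (sym (ι-fromℚ z))

  ι-0 : ι (+ 0) (+ 0) ≡ 0K
  ι-0 = trans (ι-fromℚ (+ 0)) (cong fromℚ ⌜0⌝)

  ι-1 : ι (+ 1) (+ 0) ≡ 1K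
  ι-1 = trans (ι-fromℚ (+ 1)) (cong fromℚ ⌜1⌝)

  *K-distribˡ : ∀ x y z → x *K (y +K z) ≡ x *K y +K x *K z
  *K-distribˡ (a +√D b) (c +√D d) (e +√D f) = K-≡
    (ℚS.solve 7 (λ a b c d e f δ → a :* (c :+ e) :+ δ :* (b :* (d :+ f)) := (a :* c :+ δ :* (b :* d)) :+ (a :* e :+ δ :* (b :* f))) refl a b c d e f δ)
    (ℚS.solve 6 (λ a b c d e f → a :* (d :+ f) :+ b :* (c :+ e) := (a :* d :+ b :* c) :+ (a :* f :+ b :* e)) refl a b c d e f)

  +K-assoc : ∀ x y z → (x +K y) +K z ≡ x +K (y +K z)
  +K-assoc (a +√D b) (c +√D d) (e +√D f) = K-≡ (ℚ.+-assoc a c e) (ℚ.+-assoc b d f)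

  +K-comm : ∀ x y → x +K y ≡ y +K x
  +K-comm (a +√D b) (c +√D d) = K-≡ (ℚ.+-comm a c) (ℚ.+-comm b d)

  +K-identityˡ : ∀ x → 0K +K x ≡ x
  +K-identityˡ (a +√D b) = K-≡ (ℚ.+-identityˡ a) (ℚ.+-identityˡ b)

  +K-identityʳ : ∀ x → x +K 0K ≡ x
  +K-identityʳ x = trans (+K-comm x 0K) (+K-identityˡ x)

  *K-zeroʳ : ∀ x → x *K 0K ≡ 0K
  *K-zeroʳ (a +√D b) = K-≡
    (ℚS.solve 3 (λ a b δ → a :* con 0ℚ :+ δ :* (b :* con 0ℚ) := con 0ℚ) refl a b δ)
    (ℚS.solve 2 (λ a b → a :* con 0ℚ :+ b :* con 0ℚ := con 0ℚ) refl a b)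

  *K-identityʳ : ∀ x → x *K 1K ≡ x
  *K-identityʳ x = trans (*K-comm x 1K) (*K-identityˡ x)

  *K-distribʳ : ∀ x y z → (y +K z) *K x ≡ y *K x +K z *K x
  *K-distribʳ x y z = trans (*K-comm (y +K z) x) (trans (*K-distribˡ x y z) (cong₂ _+K_ (*K-comm x y) (*K-comm x z)))

  *K-swap : ∀ x y z → x *K (y *K z) ≡ y *K (x *K z)
  *K-swap x y z = trans (sym (*K-assoc x y z)) (trans (cong (_*K z) (*K-comm x y)) (*K-assoc y x z))

  InLattice : K → Set
  InLattice x = ∃[ p ] ∃[ q ] x ≡ ι p q

  ι-integral : ∀ p q → IsIntegral (ι p q)
  ι-integral p q = n ∷ - t ∷ [] , (begin
    fromℤ n +K ι p q *K (fromℤ (- t) +K ι p q *K 1K)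
      ≡⟨ cong₂ (λ a b → a +K ι p q *K (b +K ι p q *K 1K)) (ι-fromℤ n) (ι-fromℤ (- t)) ⟩
    ι n (+ 0) +K ι p q *K (ι (- t) (+ 0) +K ι p q *K 1K)
      ≡⟨ cong (λ a → ι n (+ 0) +K ι p q *K (ι (- t) (+ 0) +K a)) (*K-identityʳ (ι p q)) ⟩
    ι n (+ 0) +K ι p q *K (ι (- t) (+ 0) +K ι p q)
      ≡⟨ cong (λ a → ι n (+ 0) +K ι p q *K a) (ι-+ (- t) (+ 0) p q) ⟩
    ι n (+ 0) +K ι p q *K ι (- t + p) (+ 0 + q)
      ≡⟨ cong (ι n (+ 0) +K_) (ι-* p q (- t + p) (+ 0 + q)) ⟩
    ι n (+ 0) +K ι (p * (- t + p) - κ * (q * (+ 0 + q))) (p * (+ 0 + q) + q * (- t + p) + q * (+ 0 + q))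
      ≡⟨ ι-+ n (+ 0) _ _ ⟩
    ι (n + (p * (- t + p) - κ * (q * (+ 0 + q)))) (+ 0 + (p * (+ 0 + q) + q * (- t + p) + q * (+ 0 + q)))
      ≡⟨ cong₂ ι (lemma₁ p q κ) (lemma₂ p q) ⟩
    ι (+ 0) (+ 0)
      ≡⟨ ι-0 ⟩
    0K ∎)
    where
    open ≡-Reasoning
    n = p * p + p * q + κ * (q * q)
    t = + 2 * p + q
    lemma₁ : ∀ p q κ → p * p + p * q + κ * (q * q) + (p * (- (+ 2 * p + q) + p) - κ * (q * (+ 0 + q))) ≡ + 0
    lemma₁ = solve-∀
    lemma₂ : ∀ p q → + 0 + (p * (+ 0 + q) + q * (- (+ 2 * p + q) + p) + q * (+ 0 + q)) ≡ + 0
    lemma₂ = solve-∀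

  _^K_ : K → ℕ → K
  x ^K zero  = 1K
  x ^K suc k = x *K (x ^K k)

  ^K-+ : ∀ x m n → x ^K (m ℕ.+ n) ≡ (x ^K m) *K (x ^K n)
  ^K-+ x zero    n = sym (*K-identityˡ _)
  ^K-+ x (suc m) n = trans (cong (x *K_) (^K-+ x m n)) (sym (*K-assoc x (x ^K m) (x ^K n)))

  InLattice-+ : ∀ {x y} → InLattice x → InLattice y → InLattice (x +K y)
  InLattice-+ (p , q , refl) (r , s , refl) = p + r , q + s , ι-+ p q r s

  InLattice-* : ∀ {x y} → InLattice x → InLattice y → InLattice (x *K y)
  InLattice-* (p , q , refl) (r , s , refl) = _ , _ , ι-* p q r s

  scalar : ℕ → K
  scalar d = ι (+ suc d) (+ 0)

  BoundedPowers : K → K → Set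
  BoundedPowers d x = ∀ k → InLattice (d *K (x ^K k))

  clear-denominators : ∀ x → ∃[ d ] InLattice (scalar d *K x)
  clear-denominators (a +√D b) with lowest-terms a | lowest-terms b
  ... | u₁ , v₁ , eq₁ , _ | u₂ , v₂ , eq₂ , _ = v₂ ℕ.+ v₁ ℕ.* suc v₂ , A - B , + 2 * B ,
      trans (cong (_*K (a +√D b)) (ι-fromℚ (+ (V₁ ℕ.* V₂))))
      (K-≡ (trans (ℚS.solve 4 (λ e a b δ → e :* a :+ δ :* (con 0ℚ :* b) := e :* a) refl e a b δ)
             (trans Re (trans (ℚS.solve 2 (λ a b → a := (a :- b) :+ con ½ :* ((con 1ℚ :+ con 1ℚ) :* b)) refl ⌜ A ⌝ ⌜ B ⌝) (sym (cong₂ (λ x y → x ℚ.+ ½ ℚ.* y) (⌜⌝-- A B) (twice B))))))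
           (trans (ℚS.solve 3 (λ e a b → e :* b :+ con 0ℚ :* a := e :* b) refl e a b)
             (trans Im (trans (ℚS.solve 1 (λ b → b := con ½ :* ((con 1ℚ :+ con 1ℚ) :* b)) refl ⌜ B ⌝) (sym (cong (½ ℚ.*_) (twice B)))))))
    where
    V₁ = suc v₁
    V₂ = suc v₂
    e = ⌜ + (V₁ ℕ.* V₂) ⌝
    A = u₁ * + V₂
    B = u₂ * + V₁
    twice : ∀ z → ⌜ + 2 * z ⌝ ≡ (1ℚ ℚ.+ 1ℚ) ℚ.* ⌜ z ⌝
    twice z = trans (⌜⌝-* (+ 2) z) (cong (ℚ._* ⌜ z ⌝) (trans (⌜⌝-+ (+ 1) (+ 1)) (cong₂ ℚ._+_ ⌜1⌝ ⌜1⌝)))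
    e≡ : e ≡ ⌜ + V₁ ⌝ ℚ.* ⌜ + V₂ ⌝
    e≡ = trans (cong ⌜_⌝ (ℤ.pos-* V₁ V₂)) (⌜⌝-* (+ V₁) (+ V₂))
    Re : e ℚ.* a ≡ ⌜ A ⌝
    Re = trans (cong (ℚ._* a) e≡) (trans (ℚS.solve 3 (λ v w a → v :* w :* a := (a :* v) :* w) refl ⌜ + V₁ ⌝ ⌜ + V₂ ⌝ a)
           (trans (cong (ℚ._* ⌜ + V₂ ⌝) eq₁) (sym (⌜⌝-* u₁ (+ V₂)))))
    Im : e ℚ.* b ≡ ⌜ B ⌝
    Im = trans (cong (ℚ._* b) e≡) (trans (ℚS.solve 3 (λ v w b → v :* w :* b := (b :* w) :* v) refl ⌜ + V₁ ⌝ ⌜ + V₂ ⌝ b)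
           (trans (cong (ℚ._* ⌜ + V₁ ⌝) eq₂) (sym (⌜⌝-* u₂ (+ V₁)))))

  low-powers : ∀ {e x} → InLattice e → InLattice (e *K x) → ∀ n i → i ℕ.≤ n → InLattice ((e ^K n) *K (x ^K i))
  low-powers Le Lex zero    zero    _ = + 1 , + 0 , trans (*K-identityˡ 1K) (sym ι-1)
  low-powers {e} Le Lex (suc n) zero    _ = subst InLattice (sym (*K-assoc e (e ^K n) 1K)) (InLattice-* Le (low-powers Le Lex n zero z≤n))
  low-powers {e} {x} Le Lex (suc n) (suc i) (s≤s i≤n) = subst InLattice
    (trans (*K-assoc e x ((e ^K n) *K (x ^K i))) (trans (cong (e *K_) (*K-swap x (e ^K n) (x ^K i))) (sym (*K-assoc e (e ^K n) (x *K (x ^K i))))))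
    (InLattice-* Lex (low-powers Le Lex n i i≤n))

  negate : ∀ {l y} → InLattice l → l +K y ≡ 0K → InLattice y
  negate {l} {y} (p , q , refl) eq = - p , - q , (begin
    y                                       ≡⟨ sym (+K-identityˡ y) ⟩
    0K +K y                                 ≡⟨ cong (_+K y) (sym (trans (ι-+ (- p) (- q) p q) (trans (cong₂ ι (ℤ.+-inverseˡ p) (ℤ.+-inverseˡ q)) ι-0))) ⟩
    (ι (- p) (- q) +K ι p q) +K y           ≡⟨ +K-assoc (ι (- p) (- q)) (ι p q) y ⟩
    ι (- p) (- q) +K (ι p q +K y)           ≡⟨ cong (ι (- p) (- q) +K_) eq ⟩
    ι (- p) (- q) +K 0K                     ≡⟨ +K-identityʳ _ ⟩
    ι (- p) (- q)                           ∎)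
    where open ≡-Reasoning

  leading-term : ∀ d x cs k → (∀ i → i ℕ.< length cs → InLattice (d *K (x ^K (i ℕ.+ k)))) →
    ∃[ l ] InLattice l × d *K ((x ^K k) *K evalMonic cs x) ≡ l +K d *K (x ^K (length cs ℕ.+ k))
  leading-term d x [] k low = 0K , (+ 0 , + 0 , sym ι-0) , trans (cong (d *K_) (*K-identityʳ (x ^K k))) (sym (+K-identityˡ _))
  leading-term d x (c ∷ cs) k low with leading-term d x cs (suc k) (λ i i< → subst (λ n → InLattice (d *K (x ^K n))) (sym (ℕ.+-suc i k)) (low (suc i) (s≤s i<)))
  ... | l , Ll , eq = fromℤ c *K (d *K (x ^K k)) +K l , InLattice-+ (InLattice-* (c , + 0 , ι-fromℤ c) (low 0 (s≤s z≤n))) Ll , (begin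
    d *K ((x ^K k) *K (fromℤ c +K x *K ev))
      ≡⟨ cong (d *K_) (*K-distribˡ (x ^K k) (fromℤ c) (x *K ev)) ⟩
    d *K ((x ^K k) *K fromℤ c +K (x ^K k) *K (x *K ev))
      ≡⟨ *K-distribˡ d _ _ ⟩
    d *K ((x ^K k) *K fromℤ c) +K d *K ((x ^K k) *K (x *K ev))
      ≡⟨ cong₂ _+K_ (trans (sym (*K-assoc d (x ^K k) (fromℤ c))) (*K-comm _ (fromℤ c)))
           (cong (d *K_) (trans (*K-swap (x ^K k) x ev) (sym (*K-assoc x (x ^K k) ev)))) ⟩
    fromℤ c *K (d *K (x ^K k)) +K d *K ((x ^K suc k) *K ev)
      ≡⟨ cong (fromℤ c *K (d *K (x ^K k)) +K_) eq ⟩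
    fromℤ c *K (d *K (x ^K k)) +K (l +K d *K (x ^K (length cs ℕ.+ suc k)))
      ≡⟨ sym (+K-assoc (fromℤ c *K (d *K (x ^K k))) l (d *K (x ^K (length cs ℕ.+ suc k)))) ⟩
    fromℤ c *K (d *K (x ^K k)) +K l +K d *K (x ^K (length cs ℕ.+ suc k))
      ≡⟨ cong (λ n → fromℤ c *K (d *K (x ^K k)) +K l +K d *K (x ^K n)) (ℕ.+-suc (length cs) k) ⟩
    fromℤ c *K (d *K (x ^K k)) +K l +K d *K (x ^K (suc (length cs) ℕ.+ k)) ∎)
    where
    open ≡-Reasoning
    ev = evalMonic cs x

  scalar-^ : ∀ d n → ∃[ e ] (scalar d ^K n) ≡ scalar e
  scalar-^ d zero = 0 , sym ι-1
  scalar-^ d (suc n) with scalar-^ d n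
  ... | e , eq = e ℕ.+ d ℕ.* suc e , trans (cong (scalar d *K_) eq) (trans (ι-* (+ suc d) (+ 0) (+ suc e) (+ 0))
        (cong₂ ι (trans (lemma₁ (+ suc d) (+ suc e) κ) (sym (ℤ.pos-* (suc d) (suc e)))) (lemma₂ (+ suc d) (+ suc e))))
    where
    lemma₁ : ∀ a b k → a * b - k * (+ 0 * + 0) ≡ a * b
    lemma₁ = solve-∀
    lemma₂ : ∀ a b → a * + 0 + + 0 * b + + 0 * + 0 ≡ + 0
    lemma₂ = solve-∀

  -- xᵏ for k ≥ n is reduced by the monic equation of degree n.
  powers-bounded : ∀ d x cs → evalMonic cs x ≡ 0K → (∀ k → k ℕ.≤ length cs → InLattice (d *K (x ^K k))) → BoundedPowers d x
  powers-bounded d x cs ev≡0 low = <-rec (λ k → InLattice (d *K (x ^K k))) step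
    where
    n = length cs
    high : ∀ k → (∀ {i} → i ℕ.< n ℕ.+ k → InLattice (d *K (x ^K i))) → InLattice (d *K (x ^K (n ℕ.+ k)))
    high k rec with leading-term d x cs k (λ i i<n → rec (ℕ.+-monoˡ-< k i<n))
    ... | l , Ll , eq = negate Ll (trans (sym eq) (trans (cong (λ z → d *K ((x ^K k) *K z)) ev≡0) (trans (cong (d *K_) (*K-zeroʳ (x ^K k))) (*K-zeroʳ d))))
    step : ∀ k → (∀ {i} → i ℕ.< k → InLattice (d *K (x ^K i))) → InLattice (d *K (x ^K k))
    step k rec = [ low k , (λ n<k → subst (λ m → InLattice (d *K (x ^K m))) (ℕ.m+[n∸m]≡n (ℕ.<⇒≤ n<k))
      (high (k ℕ.∸ n) (λ {i} i< → rec (subst (i ℕ.<_) (ℕ.m+[n∸m]≡n (ℕ.<⇒≤ n<k)) i<)))) ]′ (ℕ.≤-<-connex k n)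

  integral-bounded : ∀ x → IsIntegral x → ∃[ e ] BoundedPowers (scalar e) x
  integral-bounded x (cs , ev≡0) = proj₁ power , powers-bounded (scalar (proj₁ power)) x cs ev≡0
    (λ k k≤n → subst (λ s → InLattice (s *K (x ^K k))) (proj₂ power) (low-powers (+ suc d , + 0 , refl) (proj₂ cleared) (length cs) k k≤n))
    where
    cleared = clear-denominators x
    d = proj₁ cleared
    power = scalar-^ d (length cs)

  normK : K → ℚ
  normK (a +√D b) = a ℚ.* a ℚ.- δ ℚ.* (b ℚ.* b)

  normK-* : ∀ x y → normK (x *K y) ≡ normK x ℚ.* normK y
  normK-* (a +√D b) (c +√D d) = ℚS.solve 5 (λ a b c d δ →
    (a :* c :+ δ :* (b :* d)) :* (a :* c :+ δ :* (b :* d)) :- δ :* ((a :* d :+ b :* c) :* (a :* d :+ b :* c))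
    := (a :* a :- δ :* (b :* b)) :* (c :* c :- δ :* (d :* d))) refl a b c d δ

  normK-^ : ∀ x k → normK (x ^K k) ≡ normK x ℚ^ k
  normK-^ x zero    = ℚS.solve 1 (λ δ → con 1ℚ :* con 1ℚ :- δ :* (con 0ℚ :* con 0ℚ) := con 1ℚ) refl δ
  normK-^ x (suc k) = trans (normK-* x (x ^K k)) (cong (normK x ℚ.*_) (normK-^ x k))

  normK-ι : ∀ p q → normK (ι p q) ≡ ⌜ p * p + p * q + κ * (q * q) ⌝
  normK-ι p q = trans (cong (λ d → (⌜ p ⌝ ℚ.+ ½ ℚ.* ⌜ q ⌝) ℚ.* (⌜ p ⌝ ℚ.+ ½ ℚ.* ⌜ q ⌝) ℚ.- d ℚ.* (½ ℚ.* ⌜ q ⌝ ℚ.* (½ ℚ.* ⌜ q ⌝))) δ≡)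
    (trans (ℚS.solve 3 (λ p q k → (p :+ con ½ :* q) :* (p :+ con ½ :* q) :- (con 1ℚ :+ :- (con 1ℚ :+ con 1ℚ :+ con 1ℚ :+ con 1ℚ) :* k) :* (con ½ :* q :* (con ½ :* q))
        := p :* p :+ p :* q :+ k :* (q :* q)) refl ⌜ p ⌝ ⌜ q ⌝ ⌜ κ ⌝)
      (sym (trans (⌜⌝-+ (p * p + p * q) (κ * (q * q))) (cong₂ ℚ._+_ (trans (⌜⌝-+ (p * p) (p * q)) (cong₂ ℚ._+_ (⌜⌝-* p p) (⌜⌝-* p q)))
        (trans (⌜⌝-* κ (q * q)) (cong (⌜ κ ⌝ ℚ.*_) (⌜⌝-* q q)))))))

  bounded-norm : ∀ e x → BoundedPowers (scalar e) x → ∃[ z ] normK x ≡ ⌜ z ⌝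
  bounded-norm e x bounded = bounded-denominators (normK x) (e ℕ.+ e ℕ.* suc e) (λ k → norms k (bounded k))
    where
    norms : ∀ k → InLattice (scalar e *K (x ^K k)) → ∃[ z ] ⌜ + suc (e ℕ.+ e ℕ.* suc e) ⌝ ℚ.* normK x ℚ^ k ≡ ⌜ z ⌝
    norms k (p , q , eq) = p * p + p * q + κ * (q * q) , (begin
      ⌜ + suc (e ℕ.+ e ℕ.* suc e) ⌝ ℚ.* normK x ℚ^ k
        ≡⟨ cong₂ ℚ._*_ (sym (trans (normK-ι (+ suc e) (+ 0)) (cong ⌜_⌝ (trans (lemma (+ suc e) κ) (sym (ℤ.pos-* (suc e) (suc e))))))) (sym (normK-^ x k)) ⟩
      normK (scalar e) ℚ.* normK (x ^K k)
        ≡⟨ sym (normK-* (scalar e) (x ^K k)) ⟩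
      normK (scalar e *K (x ^K k))
        ≡⟨ trans (cong normK eq) (normK-ι p q) ⟩
      ⌜ p * p + p * q + κ * (q * q) ⌝ ∎)
      where
      open ≡-Reasoning
      lemma : ∀ a k → a * a + a * + 0 + k * (+ 0 * + 0) ≡ a * a
      lemma = solve-∀

  -- ℤ[x + 1] = ℤ[x]
  bounded-translate : ∀ d x → BoundedPowers d x → BoundedPowers d (x +K 1K)
  bounded-translate d x bounded n = subst InLattice (cong (d *K_) (*K-identityʳ _)) (go n 0)
    where
    go : ∀ n k → InLattice (d *K (((x +K 1K) ^K n) *K (x ^K k)))
    go zero    k = subst (λ z → InLattice (d *K z)) (sym (*K-identityˡ (x ^K k))) (bounded k)
    go (suc n) k = subst InLattice (sym (begin
      d *K ((x +K 1K) *K Y *K X)               ≡⟨ cong (d *K_) (trans (*K-assoc (x +K 1K) Y X) (*K-distribʳ (Y *K X) x 1K)) ⟩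
      d *K (x *K (Y *K X) +K 1K *K (Y *K X))   ≡⟨ cong₂ (λ a b → d *K (a +K b)) (*K-swap x Y X) (*K-identityˡ (Y *K X)) ⟩
      d *K (Y *K (x *K X) +K Y *K X)           ≡⟨ *K-distribˡ d _ _ ⟩
      d *K (Y *K (x *K X)) +K d *K (Y *K X)    ∎)) (InLattice-+ (go n (suc k)) (go n k))
      where
      open ≡-Reasoning
      Y = (x +K 1K) ^K n
      X = x ^K k

  4∤ : ∀ k → suc k ℕ.≤ 4 → .{{_ : NonZero k}} → ¬ + 4 ∣ₛ + k
  4∤ (suc k) k<4 d = ℕ.<⇒≱ k<4 (∣ₛ⇒≤ d)

  same-parity : ∀ A B n → A * A + + conductor c * (B * B) ≡ + 4 * n → ∃[ m ] A ≡ m + m + B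
  same-parity A B n eq with parity A | parity B
  ... | inj₁ (i , refl) | inj₁ (j , refl) = i - j , lemma i j
    where
    lemma : ∀ i j → i + i ≡ i - j + (i - j) + (j + j)
    lemma = solve-∀
  ... | inj₂ (i , refl) | inj₂ (j , refl) = i - j , lemma i j
    where
    lemma : ∀ i j → i + i + + 1 ≡ i - j + (i - j) + (j + j + + 1)
    lemma = solve-∀
  ... | inj₁ (i , refl) | inj₂ (j , refl) = contradiction (divides (n - i * i - (+ 4 * + c * j * j + + 4 * + c * j + + c + + 3 * j * j + + 3 * j))
      (trans (lemma i j (+ c) (+ conductor c)) (trans (cong₂ (λ u v → u - + 4 * (i * i) - (v - + 3) * ((j + j + + 1) * (j + j + + 1)) - + 3 * (+ 4 * (j * j + j))) eq (conductor-ℤ c)) (lemma′ n i j (+ c))))) (4∤ 3 (s≤s (s≤s (s≤s (s≤s z≤n)))))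
    where
    lemma : ∀ i j c N → + 3 ≡ (i + i) * (i + i) + N * ((j + j + + 1) * (j + j + + 1)) - + 4 * (i * i) - (N - + 3) * ((j + j + + 1) * (j + j + + 1)) - + 3 * (+ 4 * (j * j + j))
    lemma = solve-∀
    lemma′ : ∀ n i j c → + 4 * n - + 4 * (i * i) - (+ 4 * c + + 3 - + 3) * ((j + j + + 1) * (j + j + + 1)) - + 3 * (+ 4 * (j * j + j)) ≡ (n - i * i - (+ 4 * c * j * j + + 4 * c * j + c + + 3 * j * j + + 3 * j)) * + 4
    lemma′ = solve-∀
  ... | inj₂ (i , refl) | inj₁ (j , refl) = contradiction (divides (n - i * i - i - + conductor c * (j * j))
      (trans (lemma i j (+ conductor c)) (trans (cong (λ u → u - + 4 * (i * i + i) - + 4 * (+ conductor c * (j * j))) eq) (lemma′ n i j (+ conductor c))))) (4∤ 1 (s≤s (s≤s z≤n)))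
    where
    lemma : ∀ i j N → + 1 ≡ (i + i + + 1) * (i + i + + 1) + N * ((j + j) * (j + j)) - + 4 * (i * i + i) - + 4 * (N * (j * j))
    lemma = solve-∀
    lemma′ : ∀ n i j N → + 4 * n - + 4 * (i * i + i) - + 4 * (N * (j * j)) ≡ (n - i * i - i - N * (j * j)) * + 4
    lemma′ = solve-∀

  module _ (squareFree : ∀ d → d ℕ.* d ℕ.∣ conductor c → d ≡ 1) where

    private
      half-integers : ∀ a b A n → a ℚ.+ a ≡ ⌜ A ⌝ → normK (a +√D b) ≡ ⌜ n ⌝ → InLattice (a +√D b)
      half-integers a b A n 2a n≡ = m , B ,
        K-≡ (trans (ℚS.solve 1 (λ a → a := con ½ :* (a :+ a)) refl a) (trans (cong (ℚ._*_ ½) (trans 2a (trans (cong ⌜_⌝ A≡) (trans (⌜⌝-+ (m + m) B) (cong (ℚ._+ ⌜ B ⌝) (⌜⌝-+ m m))))))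
               (ℚS.solve 2 (λ m b → con ½ :* ((m :+ m) :+ b) := m :+ con ½ :* b) refl ⌜ m ⌝ ⌜ B ⌝)))
            (trans (ℚS.solve 1 (λ b → b := con ½ :* (b :+ b)) refl b) (cong (ℚ._*_ ½) 2b))
        where
        four : 1ℚ ℚ.+ 1ℚ ℚ.+ 1ℚ ℚ.+ 1ℚ ≡ ⌜ + 4 ⌝
        four = trans (cong ℚ.-_ (sym ⌜-4⌝)) (sym (⌜⌝-neg (- + 4)))
        -δ : ⌜ + conductor c ⌝ ≡ ℚ.- δ
        -δ = trans (ℚS.solve 1 (λ x → x := :- (:- x)) refl ⌜ + conductor c ⌝) (cong ℚ.-_ (trans (sym (⌜⌝-neg (+ conductor c))) (trans (cong ⌜_⌝ (sym D≡-N)) (sym (⌜⌝-def D)))))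
        Nb² : ⌜ + conductor c ⌝ ℚ.* ((b ℚ.+ b) ℚ.* (b ℚ.+ b)) ≡ ⌜ + 4 * n - A * A ⌝
        Nb² = begin
          ⌜ + conductor c ⌝ ℚ.* ((b ℚ.+ b) ℚ.* (b ℚ.+ b))
            ≡⟨ cong (ℚ._* ((b ℚ.+ b) ℚ.* (b ℚ.+ b))) -δ ⟩
          ℚ.- δ ℚ.* ((b ℚ.+ b) ℚ.* (b ℚ.+ b))
            ≡⟨ ℚS.solve 3 (λ a b δ → :- δ :* ((b :+ b) :* (b :+ b)) := (con 1ℚ :+ con 1ℚ :+ con 1ℚ :+ con 1ℚ) :* (a :* a :- δ :* (b :* b)) :- (a :+ a) :* (a :+ a)) refl a b δ ⟩
          (1ℚ ℚ.+ 1ℚ ℚ.+ 1ℚ ℚ.+ 1ℚ) ℚ.* normK (a +√D b) ℚ.- (a ℚ.+ a) ℚ.* (a ℚ.+ a)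
            ≡⟨ cong₂ (λ u v → u ℚ.- v) (cong₂ ℚ._*_ four n≡) (trans (cong₂ ℚ._*_ 2a 2a) (sym (⌜⌝-* A A))) ⟩
          ⌜ + 4 ⌝ ℚ.* ⌜ n ⌝ ℚ.- ⌜ A * A ⌝
            ≡⟨ sym (trans (⌜⌝-- (+ 4 * n) (A * A)) (cong (ℚ._- ⌜ A * A ⌝) (⌜⌝-* (+ 4) n))) ⟩
          ⌜ + 4 * n - A * A ⌝ ∎
          where open ≡-Reasoning
        integral-2b = squareFree-rational (conductor c) squareFree (b ℚ.+ b) (+ 4 * n - A * A) Nb²
        B = proj₁ integral-2b
        2b : b ℚ.+ b ≡ ⌜ B ⌝
        2b = proj₂ integral-2b
        NB² : + conductor c * (B * B) ≡ + 4 * n - A * A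
        NB² = ⌜⌝-injective (trans (⌜⌝-* (+ conductor c) (B * B)) (trans (cong (⌜ + conductor c ⌝ ℚ.*_) (trans (⌜⌝-* B B) (sym (cong₂ ℚ._*_ 2b 2b)))) Nb²))
        parities = same-parity A B n (trans (cong (_+_ (A * A)) NB²) (lemma A (+ 4 * n)))
          where
          lemma : ∀ A n → A * A + (n - A * A) ≡ n
          lemma = solve-∀
        m = proj₁ parities
        A≡ : A ≡ m + m + B
        A≡ = proj₂ parities

    integral⇒InLattice : ∀ x → IsIntegral x → InLattice x
    integral⇒InLattice x@(a +√D b) integral = half-integers a b (n′ - n - + 1) n
      (trans (ℚS.solve 3 (λ a b δ → a :+ a := ((a :+ con 1ℚ) :* (a :+ con 1ℚ) :- δ :* ((b :+ con 0ℚ) :* (b :+ con 0ℚ))) :- (a :* a :- δ :* (b :* b)) :- con 1ℚ) refl a b δ)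
             (trans (cong₂ (λ u v → u ℚ.- v ℚ.- 1ℚ) (proj₂ norm₁) (proj₂ norm₀)) (sym (trans (⌜⌝-- (n′ - n) (+ 1)) (cong₂ ℚ._-_ (⌜⌝-- n′ n) ⌜1⌝))))) (proj₂ norm₀)
      where
      e = proj₁ (integral-bounded x integral)
      bounded : BoundedPowers (scalar e) x
      bounded = proj₂ (integral-bounded x integral)
      norm₀ = bounded-norm e x bounded
      norm₁ = bounded-norm e (x +K 1K) (bounded-translate (scalar e) x bounded)
      n = proj₁ norm₀
      n′ = proj₁ norm₁

abs-square : ∀ z → z * z ≡ + (∣ z ∣ ℕ.* ∣ z ∣)
abs-square (+ n)    = sym (ℤ.pos-* n n)
abs-square -[1+ n ] = refl

-- Hermite normal form of sublattices of ℤ²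

Vector : Set
Vector = ℤ × ℤ

infixl 6 _⊞_
infixl 7 _·_

_⊞_ : Vector → Vector → Vector
(p , q) ⊞ (r , s) = p + r , q + s

_·_ : ℤ → Vector → Vector
z · (p , q) = z * p , z * q

bezout : ∀ a b → ∃[ g ] ∃[ u ] ∃[ v ] ∃[ a₁ ] ∃[ b₁ ] a ≡ g * a₁ × b ≡ g * b₁ × u * a₁ + v * b₁ ≡ + 1
bezout a b = signed (ℤ.+∣i∣≡i⊎+∣i∣≡-i b) (natural ∣ b ∣ a)
  where
  Bezout : ℤ → ℤ → Set
  Bezout a b = ∃[ g ] ∃[ u ] ∃[ v ] ∃[ a₁ ] ∃[ b₁ ] a ≡ g * a₁ × b ≡ g * b₁ × u * a₁ + v * b₁ ≡ + 1
  euclid : ∀ {n r q a} → a ≡ r + q * n → Bezout n r → Bezout a n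
  euclid {n} {r} {q} a≡ (g , u , v , n₁ , r₁ , n≡ , r≡ , eq) =
    g , v , u - v * q , r₁ + q * n₁ , n₁ , trans a≡ (trans (cong₂ (λ r n → r + q * n) r≡ n≡) (lemma₁ g r₁ q n₁)) , n≡ , trans (lemma₂ u v q r₁ n₁) eq
    where
    lemma₁ : ∀ g r q n → g * r + q * (g * n) ≡ g * (r + q * n)
    lemma₁ = solve-∀
    lemma₂ : ∀ u v q r n → v * (r + q * n) + (u - v * q) * n ≡ u * n + v * r
    lemma₂ = solve-∀
  natural : ∀ n a → Bezout a (+ n)
  natural = <-rec (λ n → ∀ a → Bezout a (+ n)) λ where
    zero    rec a → a , + 1 , + 0 , + 1 , + 0 , sym (ℤ.*-identityʳ a) , sym (ℤ.*-zeroʳ a) , refl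
    (suc n) rec a → euclid {q = a /ℕ suc n} (ℤ.a≡a%ℕn+[a/ℕn]*n a (suc n)) (rec (ℤ.n%ℕd<d a (suc n)) (+ suc n))
  signed : + ∣ b ∣ ≡ b ⊎ + ∣ b ∣ ≡ - b → Bezout a (+ ∣ b ∣) → Bezout a b
  signed (inj₁ eq) bez = subst (Bezout a) eq bez
  signed (inj₂ eq) (g , u , v , a₁ , b₁ , a≡ , b≡ , e) = g , u , - v , a₁ , - b₁ , a≡ ,
      trans (sym (ℤ.neg-involutive b)) (trans (cong -_ (trans (sym eq) b≡)) (ℤ.neg-distribʳ-* g b₁)) , trans (cong (_+_ (u * a₁)) (lemma v b₁)) e
    where
    lemma : ∀ v b → - v * - b ≡ v * b
    lemma = solve-∀

-- The lattice ℤ(α, 0) + ℤ(β, γ).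
InHermite : ℤ → ℤ → ℤ → Vector → Set
InHermite α β γ (p , q) = ∃[ s ] ∃[ t ] p ≡ s * α + t * β × q ≡ t * γ

Adjoin : (Vector → Set) → Vector → Vector → Set
Adjoin L v x = ∃[ r ] ∃[ y ] L y × x ≡ r · v ⊞ y

hermite-adjoin : ∀ α β γ v → ∃[ α′ ] ∃[ β′ ] ∃[ γ′ ] (∀ x → Adjoin (InHermite α β γ) v x ⇔ InHermite α′ β′ γ′ x)
hermite-adjoin α β γ (p , q) with bezout γ q
... | g , u , v , γ₁ , q₁ , refl , refl , uv with bezout α (γ₁ * p - q₁ * β)
...   | a , u′ , v′ , α₁ , δ₁ , refl , δ≡ , uv′ = a , u * β + v * p , g , λ x → mk⇔ (to x) (from x)
  where
  w = u * β + v * p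
  δ = γ₁ * p - q₁ * β
  to : ∀ x → Adjoin (InHermite (a * α₁) β (g * γ₁)) (p , g * q₁) x → InHermite a w g x
  to (x , y) (r , (x′ , y′) , (s , t , refl , refl) , refl) = s * α₁ + (r * u - t * v) * δ₁ , t * γ₁ + r * q₁ ,
    (begin
      r * p + (s * (a * α₁) + t * β)
        ≡⟨ lemma₁ r p s a α₁ t β u v γ₁ q₁ ⟩
      s * α₁ * a + (r * u - t * v) * (γ₁ * p - q₁ * β) + (t * γ₁ + r * q₁) * (u * β + v * p) + (+ 1 - (u * γ₁ + v * q₁)) * (t * β + r * p)
        ≡⟨ cong₂ (λ d e → s * α₁ * a + (r * u - t * v) * d + (t * γ₁ + r * q₁) * (u * β + v * p) + (+ 1 - e) * (t * β + r * p)) δ≡ uv ⟩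
      s * α₁ * a + (r * u - t * v) * (a * δ₁) + (t * γ₁ + r * q₁) * (u * β + v * p) + (+ 1 - + 1) * (t * β + r * p)
        ≡⟨ lemma₂ (s * α₁) (r * u - t * v) a δ₁ ((t * γ₁ + r * q₁) * w) (t * β + r * p) ⟩
      (s * α₁ + (r * u - t * v) * δ₁) * a + (t * γ₁ + r * q₁) * w ∎) ,
    lemma₃ r g q₁ t γ₁
    where
    open ≡-Reasoning
    lemma₁ : ∀ r p s a α₁ t β u v γ₁ q₁ → r * p + (s * (a * α₁) + t * β) ≡
      s * α₁ * a + (r * u - t * v) * (γ₁ * p - q₁ * β) + (t * γ₁ + r * q₁) * (u * β + v * p) + (+ 1 - (u * γ₁ + v * q₁)) * (t * β + r * p)
    lemma₁ = solve-∀
    lemma₂ : ∀ x y a d w z → x * a + y * (a * d) + w + (+ 1 - + 1) * z ≡ (x + y * d) * a + w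
    lemma₂ = solve-∀
    lemma₃ : ∀ r g q t γ → r * (g * q) + t * (g * γ) ≡ (t * γ + r * q) * g
    lemma₃ = solve-∀
  from : ∀ x → InHermite a w g x → Adjoin (InHermite (a * α₁) β (g * γ₁)) (p , g * q₁) x
  from (x , y) (s , t , refl , refl) = s * v′ * γ₁ + t * v , _ , (s * u′ , t * u - s * v′ * q₁ , refl , refl) ,
    cong₂ _,_ (begin
      s * a + t * (u * β + v * p)
        ≡⟨ cong (_+ t * (u * β + v * p)) (trans (sym (ℤ.*-identityʳ (s * a))) (cong (s * a *_) (sym uv′))) ⟩
      s * a * (u′ * α₁ + v′ * δ₁) + t * (u * β + v * p)
        ≡⟨ lemma₁ s a u′ α₁ v′ δ₁ t (u * β + v * p) ⟩
      s * u′ * (a * α₁) + s * v′ * (a * δ₁) + t * (u * β + v * p)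
        ≡⟨ cong (λ d → s * u′ * (a * α₁) + s * v′ * d + t * (u * β + v * p)) (sym δ≡) ⟩
      s * u′ * (a * α₁) + s * v′ * (γ₁ * p - q₁ * β) + t * (u * β + v * p)
        ≡⟨ lemma₂ (s * u′ * (a * α₁)) (s * v′) γ₁ p q₁ β t u v ⟩
      (s * v′ * γ₁ + t * v) * p + (s * u′ * (a * α₁) + (t * u - s * v′ * q₁) * β) ∎)
    (begin
      t * g
        ≡⟨ sym (ℤ.*-identityʳ (t * g)) ⟩
      t * g * + 1
        ≡⟨ cong (t * g *_) (sym uv) ⟩
      t * g * (u * γ₁ + v * q₁)
        ≡⟨ lemma₃ t g u γ₁ v q₁ (s * v′) ⟩
      (s * v′ * γ₁ + t * v) * (g * q₁) + (t * u - s * v′ * q₁) * (g * γ₁) ∎)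
    where
    open ≡-Reasoning
    lemma₁ : ∀ s a u α v δ t w → s * a * (u * α + v * δ) + t * w ≡ s * u * (a * α) + s * v * (a * δ) + t * w
    lemma₁ = solve-∀
    lemma₂ : ∀ z s γ p q β t u v → z + s * (γ * p - q * β) + t * (u * β + v * p) ≡ (s * γ + t * v) * p + (z + (t * u - s * q) * β)
    lemma₂ = solve-∀
    lemma₃ : ∀ t g u γ v q s → t * g * (u * γ + v * q) ≡ (s * γ + t * v) * (g * q) + (t * u - s * q) * (g * γ)
    lemma₃ = solve-∀

module Ideals (D : ℤ) (c : ℕ) (D≡-N : D ≡ - + conductor c) where

  open Integers D c D≡-N

  infixl 7 _⊡_

  _⊡_ : Vector → Vector → Vector
  (p , q) ⊡ (r , s) = p * r - κ * (q * s) , p * s + q * r + q * s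

  ω·_ : Vector → Vector
  ω· (p , q) = - κ * q , p + q

  ιᵥ : Vector → K
  ιᵥ (p , q) = ι p q

  ιᵥ-⊞ : ∀ x y → ιᵥ (x ⊞ y) ≡ ιᵥ x +K ιᵥ y
  ιᵥ-⊞ (p , q) (r , s) = sym (ι-+ p q r s)

  ιᵥ-⊡ : ∀ x y → ιᵥ (x ⊡ y) ≡ ιᵥ x *K ιᵥ y
  ιᵥ-⊡ (p , q) (r , s) = sym (ι-* p q r s)

  int : ℤ → K
  int z = ι z (+ 0)

  ιᵥ-· : ∀ z x → ιᵥ (z · x) ≡ int z *K ιᵥ x
  ιᵥ-· z (p , q) = sym (trans (ι-* z (+ 0) p q) (cong₂ ι (lemma₁ z p q κ) (lemma₂ z p q)))
    where
    lemma₁ : ∀ z p q k → z * p - k * (+ 0 * q) ≡ z * p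
    lemma₁ = solve-∀
    lemma₂ : ∀ z p q → z * q + + 0 * p + + 0 * q ≡ z * q
    lemma₂ = solve-∀

  ιᵥ-injective : ∀ {x y} → ιᵥ x ≡ ιᵥ y → x ≡ y
  ιᵥ-injective {p , q} {r , s} eq = cong₂ _,_ (proj₁ (ι-injective {p} {q} {r} {s} eq)) (proj₂ (ι-injective {p} {q} {r} {s} eq))

  Inverse : K → Set
  Inverse u = ∃[ v ] u *K v ≡ 1K

  int-inverse⁺ : ∀ d → Inverse (int (+ suc d))
  int-inverse⁺ d = fromℚ (proj₁ (reciprocal d)) , trans (cong (_*K fromℚ r) (ι-fromℚ (+ suc d)))
    (K-≡ (trans (ℚS.solve 3 (λ e r δ → e ℚS.:* r ℚS.:+ δ ℚS.:* (ℚS.con 0ℚ ℚS.:* ℚS.con 0ℚ) ℚS.:= e ℚS.:* r) refl ⌜ + suc d ⌝ r δ) (proj₂ (reciprocal d)))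
         (ℚS.solve 2 (λ e r → e ℚS.:* ℚS.con 0ℚ ℚS.:+ ℚS.con 0ℚ ℚS.:* r ℚS.:= ℚS.con 0ℚ) refl ⌜ + suc d ⌝ r))
    where
    r = proj₁ (reciprocal d)

  int-* : ∀ a b → int a *K int b ≡ int (a * b)
  int-* a b = trans (sym (ιᵥ-· a (b , + 0))) (cong (ι (a * b)) (ℤ.*-zeroʳ a))

  *K-inverse : ∀ {x y} → Inverse x → Inverse y → Inverse (x *K y)
  *K-inverse {x} {y} (v , xv) (w , yw) = v *K w , trans (*K-assoc x y (v *K w)) (trans (cong (x *K_) (*K-swap y v w))
    (trans (cong (λ z → x *K (v *K z)) yw) (trans (cong (x *K_) (*K-identityʳ v)) xv)))

  int-inverse : ∀ z → z ≢ + 0 → Inverse (int z)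
  int-inverse (+ zero)  z≢0 = contradiction refl z≢0
  int-inverse (+ suc d) _   = int-inverse⁺ d
  int-inverse -[1+ d ]  _   = subst Inverse (trans (int-* -1ℤ (+ suc d)) (cong int (ℤ.-1*i≡-i (+ suc d))))
    (*K-inverse {int -1ℤ} {int (+ suc d)} (int -1ℤ , trans (int-* -1ℤ -1ℤ) ι-1) (int-inverse⁺ d))

  cancel-inverse : ∀ u v {x y} → u *K v ≡ 1K → u *K x ≡ y → x ≡ v *K y
  cancel-inverse u v {x} uv eq = trans (sym (cancel v u (trans (*K-comm v u) uv) x)) (cong (v *K_) eq)

  InSpan : List Vector → Vector → Set
  InSpan []       x = x ≡ (+ 0 , + 0)
  InSpan (g ∷ gs) x = ∃[ r ] ∃[ y ] InSpan gs y × x ≡ r ⊡ g ⊞ y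

  data Scaled (u : K) : List K → List Vector → Set where
    []  : Scaled u [] []
    _∷_ : ∀ {g gs G Gs} → u *K g ≡ ιᵥ G → Scaled u gs Gs → Scaled u (g ∷ gs) (G ∷ Gs)

  rescale : ∀ {u gs Gs} z → Scaled u gs Gs → Scaled (int z *K u) gs (map (z ·_) Gs)
  rescale z [] = []
  rescale {u} z (_∷_ {g} {G = G} eq sc) = trans (*K-assoc (int z) u g) (trans (cong (int z *K_) eq) (sym (ιᵥ-· z G))) ∷ rescale z sc

  common-denominator : ∀ gs → ∃[ e ] ∃[ Gs ] Scaled (int (+ suc e)) gs Gs
  common-denominator [] = 0 , [] , []
  common-denominator (g ∷ gs) = combine (clear-denominators g) (common-denominator gs)
    where
    combine : ∃[ d ] InLattice (int (+ suc d) *K g) → ∃[ e ] ∃[ Gs ] Scaled (int (+ suc e)) gs Gs → ∃[ e ] ∃[ Gs ] Scaled (int (+ suc e)) (g ∷ gs) Gs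
    combine (d , p , q , eq) (e , Gs , sc) = e ℕ.+ d ℕ.* suc e , + suc e · (p , q) ∷ map (+ suc d ·_) Gs ,
        subst (λ u → Scaled u (g ∷ gs) (+ suc e · (p , q) ∷ map (+ suc d ·_) Gs)) (trans (int-* (+ suc d) (+ suc e)) (cong int (sym (ℤ.pos-* (suc d) (suc e)))))
          (head ∷ rescale (+ suc d) sc)
      where
      head : int (+ suc d) *K int (+ suc e) *K g ≡ ιᵥ (+ suc e · (p , q))
      head = trans (cong (_*K g) (*K-comm (int (+ suc d)) (int (+ suc e)))) (trans (*K-assoc (int (+ suc e)) (int (+ suc d)) g)
        (trans (cong (int (+ suc e) *K_) eq) (sym (ιᵥ-· (+ suc e) (p , q)))))

  InSpan⇒∈Span : ∀ {u v gs Gs} → u *K v ≡ 1K → Scaled u gs Gs → ∀ x X → u *K x ≡ ιᵥ X → InSpan Gs X → x ∈Span gs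
  InSpan⇒∈Span {u} {v} uv [] x X eq refl = trans (cancel-inverse u v uv eq) (trans (cong (v *K_) ι-0) (*K-zeroʳ v))
  InSpan⇒∈Span {u} {v} uv (_∷_ {g} {G = G} eqG sc) x X eq (r , Y , inY , refl) =
    ιᵥ r , v *K ιᵥ Y , ι-integral (proj₁ r) (proj₂ r) , InSpan⇒∈Span uv sc (v *K ιᵥ Y) Y (cancel u v uv (ιᵥ Y)) inY , (begin
      x                                       ≡⟨ cancel-inverse u v uv eq ⟩
      v *K ιᵥ (r ⊡ G ⊞ Y)                     ≡⟨ cong (v *K_) (trans (ιᵥ-⊞ (r ⊡ G) Y) (cong (_+K ιᵥ Y) (ιᵥ-⊡ r G))) ⟩
      v *K (ιᵥ r *K ιᵥ G +K ιᵥ Y)             ≡⟨ *K-distribˡ v _ _ ⟩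
      v *K (ιᵥ r *K ιᵥ G) +K v *K ιᵥ Y        ≡⟨ cong (_+K v *K ιᵥ Y) (trans (*K-swap v (ιᵥ r) (ιᵥ G)) (cong (ιᵥ r *K_) (sym (cancel-inverse u v uv eqG)))) ⟩
      ιᵥ r *K g +K v *K ιᵥ Y                  ∎)
    where open ≡-Reasoning

  module _ (squareFree : ∀ d → d ℕ.* d ℕ.∣ conductor c → d ≡ 1) where

    ∈Span⇒InSpan : ∀ {u gs Gs} → Scaled u gs Gs → ∀ x → x ∈Span gs → ∃[ X ] u *K x ≡ ιᵥ X × InSpan Gs X
    ∈Span⇒InSpan {u} [] x refl = (+ 0 , + 0) , trans (*K-zeroʳ u) (sym ι-0) , refl
    ∈Span⇒InSpan {u} (_∷_ {g} {gs} {G} {Gs} eqG sc) x (r , y , int-r , y∈ , x≡) = combine (integral⇒InLattice squareFree r int-r) (∈Span⇒InSpan sc y y∈)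
      where
      combine : InLattice r → ∃[ Y ] u *K y ≡ ιᵥ Y × InSpan Gs Y → ∃[ X ] u *K x ≡ ιᵥ X × InSpan (G ∷ Gs) X
      combine (p , q , r≡) (Y , eqY , inY) = (p , q) ⊡ G ⊞ Y , (begin
        u *K x                            ≡⟨ cong (u *K_) x≡ ⟩
        u *K (r *K g +K y)                ≡⟨ *K-distribˡ u (r *K g) y ⟩
        u *K (r *K g) +K u *K y           ≡⟨ cong₂ _+K_ (trans (*K-swap u r g) (cong₂ _*K_ r≡ eqG)) eqY ⟩
        ι p q *K ιᵥ G +K ιᵥ Y             ≡⟨ sym (trans (ιᵥ-⊞ ((p , q) ⊡ G) Y) (cong (_+K ιᵥ Y) (ιᵥ-⊡ (p , q) G))) ⟩
        ιᵥ ((p , q) ⊡ G ⊞ Y)              ∎) , (p , q) , Y , inY , refl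
        where open ≡-Reasoning

  ω-InSpan : ∀ Gs x → InSpan Gs x → InSpan Gs (ω· x)
  ω-InSpan []       x refl = cong₂ _,_ (ℤ.*-zeroʳ (- κ)) refl
  ω-InSpan (G ∷ Gs) x (r , y , y∈ , refl) = ω· r , ω· y , ω-InSpan Gs y y∈ , distribute r G y
    where
    distribute : ∀ r G y → ω· (r ⊡ G ⊞ y) ≡ (ω· r) ⊡ G ⊞ ω· y
    distribute (a , b) (c , d) (e , f) = cong₂ _,_ (lemma₁ κ a b c d f) (lemma₂ κ a b c d e f)
      where
      lemma₁ : ∀ k a b c d f → - k * (a * d + b * c + b * d + f) ≡ - k * b * c - k * ((a + b) * d) + - k * f
      lemma₁ = solve-∀
      lemma₂ : ∀ k a b c d e f → a * c - k * (b * d) + e + (a * d + b * c + b * d + f) ≡ - k * b * d + (a + b) * c + (a + b) * d + (e + f)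
      lemma₂ = solve-∀

  hermite : ∀ Gs → ∃[ α ] ∃[ β ] ∃[ γ ] (∀ x → InSpan Gs x ⇔ InHermite α β γ x)
  hermite [] = + 0 , + 0 , + 0 , λ x → mk⇔ (λ { refl → + 0 , + 0 , refl , refl })
    (λ { (s , t , p≡ , q≡) → cong₂ _,_ (trans p≡ (lemma s t)) (trans q≡ (ℤ.*-zeroʳ t)) })
    where
    lemma : ∀ s t → s * + 0 + t * + 0 ≡ + 0
    lemma = solve-∀
  hermite (G ∷ Gs) = adjoin₁ (hermite Gs)
    where
    Hermite : List Vector → Set
    Hermite Gs = ∃[ α ] ∃[ β ] ∃[ γ ] (∀ x → InSpan Gs x ⇔ InHermite α β γ x)
    expand : ∀ r G y → r ⊡ G ⊞ y ≡ proj₁ r · G ⊞ (proj₂ r · (ω· G) ⊞ y)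
    expand (a , b) (c , d) (e , f) = cong₂ _,_ (lemma₁ κ a b c d e) (lemma₂ a b c d f)
      where
      lemma₁ : ∀ k a b c d e → a * c - k * (b * d) + e ≡ a * c + (b * (- k * d) + e)
      lemma₁ = solve-∀
      lemma₂ : ∀ a b c d f → a * d + b * c + b * d + f ≡ a * d + (b * (c + d) + f)
      lemma₂ = solve-∀
    adjoin₂ : ∀ α β γ α′ β′ γ′ → (∀ x → InSpan Gs x ⇔ InHermite α β γ x) → (∀ x → Adjoin (InHermite α β γ) (ω· G) x ⇔ InHermite α′ β′ γ′ x) →
              ∃[ α″ ] ∃[ β″ ] ∃[ γ″ ] (∀ x → Adjoin (InHermite α′ β′ γ′) G x ⇔ InHermite α″ β″ γ″ x) → Hermite (G ∷ Gs)
    adjoin₂ α β γ α′ β′ γ′ h h′ (α″ , β″ , γ″ , h″) = α″ , β″ , γ″ , λ x → mk⇔ (pack x) (λ x∈ → unpack (Equivalence.from (h″ x) x∈))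
      where
      pack : ∀ x → InSpan (G ∷ Gs) x → InHermite α″ β″ γ″ x
      pack x ((a , b) , y , y∈ , x≡) = Equivalence.to (h″ x) (a , b · (ω· G) ⊞ y ,
        Equivalence.to (h′ _) (b , y , Equivalence.to (h y) y∈ , refl) , trans x≡ (expand (a , b) G y))
      unpack : ∀ {x} → Adjoin (InHermite α′ β′ γ′) G x → InSpan (G ∷ Gs) x
      unpack {x} (a , z , z∈ , x≡) = unpack′ (Equivalence.from (h′ z) z∈)
        where
        unpack′ : Adjoin (InHermite α β γ) (ω· G) z → InSpan (G ∷ Gs) x
        unpack′ (b , y , y∈ , z≡) = (a , b) , y , Equivalence.from (h y) y∈ , trans x≡ (trans (cong (a · G ⊞_) z≡) (sym (expand (a , b) G y)))
    adjoin₁ : Hermite Gs → Hermite (G ∷ Gs)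
    adjoin₁ (α , β , γ , h) = adjoin₁′ (hermite-adjoin α β γ (ω· G))
      where
      adjoin₁′ : ∃[ α′ ] ∃[ β′ ] ∃[ γ′ ] (∀ x → Adjoin (InHermite α β γ) (ω· G) x ⇔ InHermite α′ β′ γ′ x) → Hermite (G ∷ Gs)
      adjoin₁′ (α′ , β′ , γ′ , h′) = adjoin₂ α β γ α′ β′ γ′ h h′ (hermite-adjoin α′ β′ γ′ G)

  -- The ideal ℤa + ℤ(t + ω).
  InIdeal : ℤ → ℤ → Vector → Set
  InIdeal a t (p , q) = a ∣ₛ p - q * t

  norm≢0 : ∀ t → norm c t ≢ + 0
  norm≢0 t eq = impossible (trans (cong (_+ + conductor c) (sym (abs-square (+ 2 * t + + 1)))) (trans (sym (discriminant-norm c t)) (cong (+ 4 *_) eq)))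
    where
    impossible : ∀ {k} → + k + + conductor c ≢ + 0
    impossible {k} e = contradiction (trans (sym (ℕ.+-suc k _)) (ℤ.+-injective e)) λ ()

  Stable : ℤ → ℤ → ℤ → Set
  Stable α β γ = ∀ x → InHermite α β γ x → InHermite α β γ (ω· x)

  IsScaledIdeal : ℤ → ℤ → ℤ → Set
  IsScaledIdeal α β γ = ∃[ a ] ∃[ t ] γ ≢ + 0 × + suc a ∣ₛ norm c t ×
    (∀ x → InHermite α β γ x ⇔ (∃[ y ] x ≡ γ · y × InIdeal (+ suc a) t y))

  stable⇒ideal : ∀ α β γ → Stable α β γ → ∃[ x ] InHermite α β γ x × x ≢ (+ 0 , + 0) → IsScaledIdeal α β γ
  stable⇒ideal α β γ stable (x₀ , x₀∈ , x₀≢0) = from-generators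
      (stable (α , + 0) (+ 1 , + 0 , lemma₁ α β , sym (ℤ.*-zeroˡ γ))) (stable (β , γ) (+ 0 , + 1 , lemma₂ α β , sym (ℤ.*-identityˡ γ)))
    where
    lemma₁ : ∀ α β → α ≡ + 1 * α + + 0 * β
    lemma₁ = solve-∀
    lemma₂ : ∀ α β → β ≡ + 0 * α + + 1 * β
    lemma₂ = solve-∀
    from-generators : InHermite α β γ (ω· (α , + 0)) → InHermite α β γ (ω· (β , γ)) → IsScaledIdeal α β γ
    from-generators (_ , t₁ , _ , α≡) (s₂ , t₂ , κ≡ , βγ≡) = result ∣ a₀ ∣ refl (ℤ.+∣i∣≡i⊎+∣i∣≡-i a₀)
      where
      a₀ = t₁
      t = t₂ - + 1
      α≡γa : α ≡ γ * a₀
      α≡γa = trans (sym (ℤ.+-identityʳ α)) (trans α≡ (ℤ.*-comm t₁ γ))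
      β≡γt : β ≡ γ * t
      β≡γt = trans (lemma β γ) (trans (cong (_- γ) βγ≡) (lemma′ t₂ γ))
        where
        lemma : ∀ b g → b ≡ b + g - g
        lemma = solve-∀
        lemma′ : ∀ t g → t * g - g ≡ g * (t - + 1)
        lemma′ = solve-∀
      γ≢0 : γ ≢ + 0
      γ≢0 refl = x₀≢0 (all-zero x₀∈)
        where
        all-zero : ∀ {x} → InHermite α β (+ 0) x → x ≡ (+ 0 , + 0)
        all-zero (s , t , p≡ , q≡) = cong₂ _,_ (trans p≡ (trans (cong₂ (λ a b → s * a + t * b) α≡γa β≡γt) (lemma s t))) (trans q≡ (ℤ.*-zeroʳ t))
          where
          lemma : ∀ s t → s * + 0 + t * + 0 ≡ + 0
          lemma = solve-∀
      instance
        γ-nonZero : ℤ.NonZero γ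
        γ-nonZero = ℤ.≢-nonZero γ≢0
      -- ω(t + ω) ∈ ℤa₀ + ℤ(t + ω)
      norm≡ : norm c t ≡ - s₂ * a₀
      norm≡ = ℤ.*-cancelˡ-≡ γ (norm c t) (- s₂ * a₀) (begin
        γ * norm c t                                    ≡⟨ cong (γ *_) (norm-def c t) ⟩
        γ * (t * t + t + κ)                             ≡⟨ lemma₃ γ t₂ κ ⟩
        γ * (t₂ * t) - - κ * γ                          ≡⟨ cong (λ z → γ * (t₂ * t) - z) (trans κ≡ (cong₂ (λ a b → s₂ * a + t₂ * b) α≡γa β≡γt)) ⟩
        γ * (t₂ * t) - (s₂ * (γ * a₀) + t₂ * (γ * t))   ≡⟨ lemma₄ γ t₂ t s₂ a₀ ⟩
        γ * (- s₂ * a₀)                                 ∎)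
        where
        open ≡-Reasoning
        lemma₃ : ∀ g u k → g * ((u - + 1) * (u - + 1) + (u - + 1) + k) ≡ g * (u * (u - + 1)) - - k * g
        lemma₃ = solve-∀
        lemma₄ : ∀ g u t s a → g * (u * t) - (s * (g * a) + u * (g * t)) ≡ g * (- s * a)
        lemma₄ = solve-∀
      a₀∣ : ∀ {a} → + a ≡ a₀ ⊎ + a ≡ - a₀ → ∀ z → + a ∣ₛ z * a₀
      a₀∣ (inj₁ eq) z = divides z (cong (z *_) (sym eq))
      a₀∣ {a} (inj₂ eq) z = divides (- z) (trans (lemma z a₀) (cong (- z *_) (sym eq)))
        where
        lemma : ∀ z a → z * a ≡ - z * - a
        lemma = solve-∀
      result : ∀ a → a ≡ ∣ a₀ ∣ → + a ≡ a₀ ⊎ + a ≡ - a₀ → IsScaledIdeal α β γ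
      result zero eq _ = contradiction (trans norm≡ (trans (cong (- s₂ *_) (ℤ.∣i∣≡0⇒i≡0 (sym eq))) (ℤ.*-zeroʳ (- s₂)))) (norm≢0 t)
      result (suc a) _ sign = a , t , γ≢0 , ∣-by (sym norm≡) (a₀∣ sign (- s₂)) , λ x → mk⇔ (to x) (from x)
        where
        to : ∀ x → InHermite α β γ x → ∃[ y ] x ≡ γ · y × InIdeal (+ suc a) t y
        to x (s , u , p≡ , q≡) = (s * a₀ + u * t , u) ,
          cong₂ _,_ (trans p≡ (trans (cong₂ (λ a b → s * a + u * b) α≡γa β≡γt) (lemma s u γ a₀ t))) (trans q≡ (ℤ.*-comm u γ)) , ∣-by (lemma′ s u a₀ t) (a₀∣ sign s)
          where
          lemma : ∀ s u g a t → s * (g * a) + u * (g * t) ≡ g * (s * a + u * t)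
          lemma = solve-∀
          lemma′ : ∀ s u a t → s * a ≡ s * a + u * t - u * t
          lemma′ = solve-∀
        from : ∀ x → ∃[ y ] x ≡ γ · y × InIdeal (+ suc a) t y → InHermite α β γ x
        from _ ((p , q) , refl , divides s eq) = multiple sign , q , trans (cong (γ *_) p≡) (trans (lemma′ sign) (cong₂ (λ a b → multiple sign * a + q * b) (sym α≡γa) (sym β≡γt))) , ℤ.*-comm γ q
          where
          multiple : + suc a ≡ a₀ ⊎ + suc a ≡ - a₀ → ℤ
          multiple (inj₁ _) = s
          multiple (inj₂ _) = - s
          p≡ : p ≡ s * + suc a + q * t
          p≡ = trans (lemma p (q * t)) (cong (_+ q * t) eq)
            where
            lemma : ∀ p r → p ≡ p - r + r
            lemma = solve-∀
          lemma′ : ∀ sign → γ * (s * + suc a + q * t) ≡ multiple sign * (γ * a₀) + q * (γ * t)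
          lemma′ (inj₁ eq) = trans (cong (λ a → γ * (s * a + q * t)) eq) (solved γ s a₀ q t)
            where
            solved : ∀ g s a q t → g * (s * a + q * t) ≡ s * (g * a) + q * (g * t)
            solved = solve-∀
          lemma′ (inj₂ eq) = trans (cong (λ a → γ * (s * a + q * t)) eq) (solved γ s a₀ q t)
            where
            solved : ∀ g s a q t → g * (s * - a + q * t) ≡ - s * (g * a) + q * (g * t)
            solved = solve-∀

  -- I = u⁻¹(ℤa + ℤ(t + ω)).
  Shape : FractionalIdeal → ℤ → ℤ → Set
  Shape I a t = ∃[ u ] ∃[ v ] u *K v ≡ 1K × (∀ x → x ∈I I ⇔ (∃[ y ] u *K x ≡ ιᵥ y × InIdeal a t y))

  module _ (squareFree : ∀ d → d ℕ.* d ℕ.∣ conductor c → d ≡ 1) where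

    nonzero-InSpan : ∀ {u v gs Gs} → u *K v ≡ 1K → Scaled u gs Gs → Any (_≢ 0K) gs → ∃[ x ] InSpan Gs x × x ≢ (+ 0 , + 0)
    nonzero-InSpan {u} {v} uv (_∷_ {g} {gs} {G} {Gs} eqG sc) (here g≢0) = G , ((+ 1 , + 0) , (+ 0 , + 0) , zero∈ Gs , identity G) ,
      (λ { refl → g≢0 (trans (cancel-inverse u v uv (trans eqG ι-0)) (*K-zeroʳ v)) })
      where
      zero∈ : ∀ Gs → InSpan Gs (+ 0 , + 0)
      zero∈ []       = refl
      zero∈ (G ∷ Gs) = (+ 0 , + 0) , (+ 0 , + 0) , zero∈ Gs , cong₂ _,_ (lemma₁ κ (proj₁ G) (proj₂ G)) (lemma₂ (proj₁ G) (proj₂ G))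
        where
        lemma₁ : ∀ k p q → + 0 ≡ + 0 * p - k * (+ 0 * q) + + 0
        lemma₁ = solve-∀
        lemma₂ : ∀ p q → + 0 ≡ + 0 * q + + 0 * p + + 0 * q + + 0
        lemma₂ = solve-∀
      identity : ∀ G → G ≡ (+ 1 , + 0) ⊡ G ⊞ (+ 0 , + 0)
      identity (p , q) = cong₂ _,_ (lemma₁ κ p q) (lemma₂ p q)
        where
        lemma₁ : ∀ k p q → p ≡ + 1 * p - k * (+ 0 * q) + + 0
        lemma₁ = solve-∀
        lemma₂ : ∀ p q → q ≡ + 1 * q + + 0 * p + + 0 * q + + 0
        lemma₂ = solve-∀
    nonzero-InSpan uv (_∷_ {G = G} _ sc) (there nz) = extend (nonzero-InSpan uv sc nz)
      where
      extend : _ → _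
      extend (x , x∈ , x≢0) = x , ((+ 0 , + 0) , x , x∈ , identity G x) , x≢0
        where
        identity : ∀ G x → x ≡ (+ 0 , + 0) ⊡ G ⊞ x
        identity (p , q) (r , s) = cong₂ _,_ (lemma₁ κ p q r) (lemma₂ p q s)
          where
          lemma₁ : ∀ k p q r → r ≡ + 0 * p - k * (+ 0 * q) + r
          lemma₁ = solve-∀
          lemma₂ : ∀ p q s → s ≡ + 0 * q + + 0 * p + + 0 * q + s
          lemma₂ = solve-∀

    ideal-shape : ∀ I → ∃[ a ] ∃[ t ] + suc a ∣ₛ norm c t × Shape I (+ suc a) t
    ideal-shape I = from-denominator (common-denominator (generators I))
      where
      from-denominator : ∃[ e ] ∃[ Gs ] Scaled (int (+ suc e)) (generators I) Gs → _
      from-denominator (e , Gs , sc) = from-hermite (hermite Gs)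
        where
        u = int (+ suc e)
        v = proj₁ (int-inverse⁺ e)
        uv : u *K v ≡ 1K
        uv = proj₂ (int-inverse⁺ e)
        from-hermite : ∃[ α ] ∃[ β ] ∃[ γ ] (∀ x → InSpan Gs x ⇔ InHermite α β γ x) → _
        from-hermite (α , β , γ , h) = from-ideal (stable⇒ideal α β γ
            (λ x x∈ → Equivalence.to (h (ω· x)) (ω-InSpan Gs x (Equivalence.from (h x) x∈))) (map₂ (nonzero-InSpan uv sc (nonzero I))))
          where
          map₂ : ∃[ x ] InSpan Gs x × x ≢ (+ 0 , + 0) → ∃[ x ] InHermite α β γ x × x ≢ (+ 0 , + 0)
          map₂ (x , x∈ , x≢0) = x , Equivalence.to (h x) x∈ , x≢0
          from-ideal : IsScaledIdeal α β γ → ∃[ a ] ∃[ t ] + suc a ∣ₛ norm c t × Shape I (+ suc a) t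
          from-ideal (a , t , γ≢0 , a∣ , scaled) = a , t , a∣ , w *K u , proj₁ inverse , proj₂ inverse , λ x → mk⇔ (to x) (from x)
            where
            w = proj₁ (int-inverse γ γ≢0)
            γw : int γ *K w ≡ 1K
            γw = proj₂ (int-inverse γ γ≢0)
            inverse : Inverse (w *K u)
            inverse = *K-inverse {w} {u} (int γ , trans (*K-comm w (int γ)) γw) (v , uv)
            to : ∀ x → x ∈I I → ∃[ y ] w *K u *K x ≡ ιᵥ y × InIdeal (+ suc a) t y
            to x x∈ = step (∈Span⇒InSpan squareFree sc x x∈)
              where
              step : ∃[ X ] u *K x ≡ ιᵥ X × InSpan Gs X → ∃[ y ] w *K u *K x ≡ ιᵥ y × InIdeal (+ suc a) t y
              step (X , eq , X∈) = step′ (Equivalence.to (scaled X) (Equivalence.to (h X) X∈))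
                where
                step′ : ∃[ y ] X ≡ γ · y × InIdeal (+ suc a) t y → ∃[ y ] w *K u *K x ≡ ιᵥ y × InIdeal (+ suc a) t y
                step′ (y , X≡ , y∈) = y , trans (*K-assoc w u x) (trans (cong (w *K_) (trans eq (trans (cong ιᵥ X≡) (ιᵥ-· γ y))))
                  (cancel w (int γ) (trans (*K-comm w (int γ)) γw) (ιᵥ y))) , y∈
            from : ∀ x → ∃[ y ] w *K u *K x ≡ ιᵥ y × InIdeal (+ suc a) t y → x ∈I I
            from x (y , eq , y∈) = InSpan⇒∈Span uv sc x (γ · y)
              (trans (sym (cancel (int γ) w γw (u *K x))) (trans (cong (int γ *K_) (trans (sym (*K-assoc w u x)) eq)) (sym (ιᵥ-· γ y))))
              (Equivalence.from (h (γ · y)) (Equivalence.from (scaled (γ · y)) (y , refl , y∈)))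

    standardIdeal : ℤ → ℤ → FractionalIdeal
    standardIdeal a t = record { generators = ι a (+ 0) ∷ ι t (+ 1) ∷ [] ; nonzero = there (here λ eq → contradiction (proj₂ (ι-injective {t} {+ 1} (trans eq (sym ι-0)))) λ ()) }

    standardIdeal-shape : ∀ a t → a ∣ₛ norm c t → Shape (standardIdeal a t) a t
    standardIdeal-shape a t (divides n norm≡) = 1K , 1K , *K-identityˡ 1K , λ x → mk⇔ (to x) (from x)
      where
      Gs = (a , + 0) ∷ (t , + 1) ∷ []
      sc : Scaled 1K (ι a (+ 0) ∷ ι t (+ 1) ∷ []) Gs
      sc = *K-identityˡ _ ∷ *K-identityˡ _ ∷ []
      norm′ : t * t + t + κ ≡ n * a
      norm′ = trans (sym (norm-def c t)) norm≡
      to : ∀ x → x ∈I standardIdeal a t → ∃[ y ] 1K *K x ≡ ιᵥ y × InIdeal a t y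
      to x x∈ = step (∈Span⇒InSpan squareFree sc x x∈)
        where
        step : ∃[ X ] 1K *K x ≡ ιᵥ X × InSpan Gs X → ∃[ y ] 1K *K x ≡ ιᵥ y × InIdeal a t y
        step (X , eq , (r₁ , r₂) , _ , ((s₁ , s₂) , _ , refl , refl) , refl) = X , eq ,
          divides (r₁ - r₂ * t - s₂ * n) (trans (lemma a t κ r₁ r₂ s₁ s₂) (trans (cong (λ z → a * r₁ - a * r₂ * t - s₂ * z) norm′) (lemma′ a r₁ r₂ t s₂ n)))
          where
          lemma : ∀ a t k r₁ r₂ s₁ s₂ →
            (r₁ * a - k * (r₂ * + 0) + (s₁ * t - k * (s₂ * + 1) + + 0)) - (r₁ * + 0 + r₂ * a + r₂ * + 0 + (s₁ * + 1 + s₂ * t + s₂ * + 1 + + 0)) * t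
            ≡ a * r₁ - a * r₂ * t - s₂ * (t * t + t + k)
          lemma = solve-∀
          lemma′ : ∀ a r₁ r₂ t s n → a * r₁ - a * r₂ * t - s * (n * a) ≡ (r₁ - r₂ * t - s * n) * a
          lemma′ = solve-∀
      from : ∀ x → ∃[ y ] 1K *K x ≡ ιᵥ y × InIdeal a t y → x ∈I standardIdeal a t
      from x ((p , q) , eq , divides s eq′) = InSpan⇒∈Span {1K} {1K} (*K-identityˡ 1K) sc x (p , q) eq
        ((s , + 0) , _ , ((q , + 0) , _ , refl , refl) , cong₂ _,_ (trans (lemma p q t) (trans (cong (_+ q * t) eq′) (lemma₁ s a q t κ))) (lemma₂ s q a t))
        where
        lemma : ∀ p q t → p ≡ p - q * t + q * t
        lemma = solve-∀
        lemma₁ : ∀ s a q t k → s * a + q * t ≡ s * a - k * (+ 0 * + 0) + (q * t - k * (+ 0 * + 1) + + 0)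
        lemma₁ = solve-∀
        lemma₂ : ∀ s q a t → q ≡ s * + 0 + + 0 * a + + 0 * + 0 + (q * + 1 + + 0 * t + + 0 * + 1 + + 0)
        lemma₂ = solve-∀

-- Binary quadratic forms and ideal classes

∣-cancel : ∀ {a x} z → a ≢ + 0 → a * z ≡ a * x → z ≡ x
∣-cancel {a} {x} z a≢0 = ℤ.*-cancelˡ-≡ a z x {{ℤ.≢-nonZero a≢0}}

squareFree-∣ : ∀ N → (∀ d → d ℕ.* d ℕ.∣ N → d ≡ 1) → ∀ R z b → + N * (R * R) ≡ z * (+ suc b * + suc b) → ∃[ g ] R ≡ g * + suc b
squareFree-∣ N squareFree R z b eq = proj₁ quotient , ⌜⌝-injective (trans (sym (ℚ.*-identityʳ ⌜ R ⌝)) (trans (cong (⌜ R ⌝ ℚ.*_) (sym (proj₂ (reciprocal b))))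
    (trans (ℚS.solve 3 (λ r b i → r ℚS.:* (b ℚS.:* i) ℚS.:= r ℚS.:* i ℚS.:* b) refl ⌜ R ⌝ ⌜ + suc b ⌝ i)
      (trans (cong (ℚ._* ⌜ + suc b ⌝) (proj₂ quotient)) (sym (⌜⌝-* (proj₁ quotient) (+ suc b)))))))
  where
  i = proj₁ (reciprocal b)
  quotient = squareFree-rational N squareFree (⌜ R ⌝ ℚ.* i) z (begin
    ⌜ + N ⌝ ℚ.* (⌜ R ⌝ ℚ.* i ℚ.* (⌜ R ⌝ ℚ.* i))
      ≡⟨ ℚS.solve 3 (λ n r i → n ℚS.:* (r ℚS.:* i ℚS.:* (r ℚS.:* i)) ℚS.:= n ℚS.:* (r ℚS.:* r) ℚS.:* (i ℚS.:* i)) refl ⌜ + N ⌝ ⌜ R ⌝ i ⟩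
    ⌜ + N ⌝ ℚ.* (⌜ R ⌝ ℚ.* ⌜ R ⌝) ℚ.* (i ℚ.* i)
      ≡⟨ cong (ℚ._* (i ℚ.* i)) (trans (cong (⌜ + N ⌝ ℚ.*_) (sym (⌜⌝-* R R))) (trans (sym (⌜⌝-* (+ N) (R * R))) (trans (cong ⌜_⌝ eq) (trans (⌜⌝-* z (+ suc b * + suc b)) (cong (⌜ z ⌝ ℚ.*_) (⌜⌝-* (+ suc b) (+ suc b))))))) ⟩
    ⌜ z ⌝ ℚ.* (⌜ + suc b ⌝ ℚ.* ⌜ + suc b ⌝) ℚ.* (i ℚ.* i)
      ≡⟨ ℚS.solve 3 (λ z b i → z ℚS.:* (b ℚS.:* b) ℚS.:* (i ℚS.:* i) ℚS.:= z ℚS.:* ((b ℚS.:* i) ℚS.:* (b ℚS.:* i))) refl ⌜ z ⌝ ⌜ + suc b ⌝ i ⟩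
    ⌜ z ⌝ ℚ.* ((⌜ + suc b ⌝ ℚ.* i) ℚ.* (⌜ + suc b ⌝ ℚ.* i))
      ≡⟨ cong (λ e → ⌜ z ⌝ ℚ.* (e ℚ.* e)) (proj₂ (reciprocal b)) ⟩
    ⌜ z ⌝ ℚ.* (1ℚ ℚ.* 1ℚ)
      ≡⟨ ℚS.solve 1 (λ z → z ℚS.:* (ℚS.con 1ℚ ℚS.:* ℚS.con 1ℚ) ℚS.:= z) refl ⌜ z ⌝ ⟩
    ⌜ z ⌝ ∎)
    where open ≡-Reasoning

-- The ideal ℤa + ℤ(t + ω), a = lead + 1, with its norm form a x² + (2t + 1) x y + k y².
record Form (c : ℕ) : Set where
  field
    lead  : ℕ
    shift : ℤ
    last  : ℤ
    norm≡ : norm c shift ≡ last * + suc lead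

module FormValues {c : ℕ} (F : Form c) where

  open Form F public renaming (shift to t; last to k)

  a : ℤ
  a = + suc lead

  value : ℤ → ℤ → ℤ
  value x y = a * x * x + (+ 2 * t + + 1) * x * y + k * y * y

  norm-expand : t * t + t + + suc c ≡ k * a
  norm-expand = trans (sym (norm-def c t)) norm≡

  discriminant : + 4 * (a * k) ≡ (+ 2 * t + + 1) * (+ 2 * t + + 1) + + conductor c
  discriminant = trans (cong (+ 4 *_) (trans (ℤ.*-comm a k) (sym norm≡))) (discriminant-norm c t)

  completed-square : ∀ x y → + 4 * a * value x y ≡ (+ 2 * a * x + (+ 2 * t + + 1) * y) * (+ 2 * a * x + (+ 2 * t + + 1) * y) + + conductor c * (y * y)
  completed-square x y = trans (lemma₁ a x (+ 2 * t + + 1) y k) (trans (cong (λ d → + 4 * a * (a * x * x) + + 4 * a * ((+ 2 * t + + 1) * x * y) + d * (y * y)) discriminant) (lemma₂ a x (+ 2 * t + + 1) y (+ conductor c)))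
    where
    lemma₁ : ∀ a x b y k → + 4 * a * (a * x * x + b * x * y + k * y * y) ≡ + 4 * a * (a * x * x) + + 4 * a * (b * x * y) + + 4 * (a * k) * (y * y)
    lemma₁ = solve-∀
    lemma₂ : ∀ a x b y n → + 4 * a * (a * x * x) + + 4 * a * (b * x * y) + (b * b + n) * (y * y) ≡ (+ 2 * a * x + b * y) * (+ 2 * a * x + b * y) + n * (y * y)
    lemma₂ = solve-∀

  4a-value : ℤ → ℤ → ℕ
  4a-value x y = ∣ + 2 * a * x + (+ 2 * t + + 1) * y ∣ ℕ.* ∣ + 2 * a * x + (+ 2 * t + + 1) * y ∣ ℕ.+ conductor c ℕ.* (∣ y ∣ ℕ.* ∣ y ∣)

  4a-value≡ : ∀ x y → + 4 * a * value x y ≡ + 4a-value x y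
  4a-value≡ x y = trans (completed-square x y) (trans (cong₂ _+_ (abs-square (+ 2 * a * x + (+ 2 * t + + 1) * y)) (trans (cong (+ conductor c *_) (abs-square y)) (sym (ℤ.pos-* (conductor c) (∣ y ∣ ℕ.* ∣ y ∣))))) (sym (ℤ.pos-+ (∣ + 2 * a * x + (+ 2 * t + + 1) * y ∣ ℕ.* ∣ + 2 * a * x + (+ 2 * t + + 1) * y ∣) (conductor c ℕ.* (∣ y ∣ ℕ.* ∣ y ∣)))))

  value-nonneg : ∀ x y n → value x y ≢ -[1+ n ]
  value-nonneg x y n eq = contradiction (trans (sym (4a-value≡ x y)) (cong (+ 4 * a *_) eq)) λ ()

  value-zero : ∀ x y → value x y ≡ + 0 → x ≡ + 0 × y ≡ + 0
  value-zero x y eq = x≡0 , y≡0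
    where
    total : 4a-value x y ≡ 0
    total = ℤ.+-injective (trans (sym (4a-value≡ x y)) (trans (cong (+ 4 * a *_) eq) (ℤ.*-zeroʳ (+ 4 * a))))
    square-zero : ∀ n → n ℕ.* n ≡ 0 → n ≡ 0
    square-zero zero _ = refl
    y≡0 : y ≡ + 0
    y≡0 = ℤ.∣i∣≡0⇒i≡0 (square-zero ∣ y ∣ (ℕ.m+n≡0⇒m≡0 (∣ y ∣ ℕ.* ∣ y ∣) (ℕ.m+n≡0⇒n≡0 (∣ + 2 * a * x + (+ 2 * t + + 1) * y ∣ ℕ.* ∣ + 2 * a * x + (+ 2 * t + + 1) * y ∣) total)))
    x≡0 : x ≡ + 0
    x≡0 = ∣-cancel {+ 2 * a} {+ 0} x (λ ()) (trans (trans (lemma a x t) (cong (λ z → + 2 * a * x + (+ 2 * t + + 1) * z) (sym y≡0)))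
      (trans (ℤ.∣i∣≡0⇒i≡0 (square-zero ∣ + 2 * a * x + (+ 2 * t + + 1) * y ∣ (ℕ.m+n≡0⇒m≡0 (∣ + 2 * a * x + (+ 2 * t + + 1) * y ∣ ℕ.* ∣ + 2 * a * x + (+ 2 * t + + 1) * y ∣) total))) (sym (ℤ.*-zeroʳ (+ 2 * a)))))
      where
      lemma : ∀ a x t → + 2 * a * x ≡ + 2 * a * x + (+ 2 * t + + 1) * + 0
      lemma = solve-∀

-- The vector (x, y) represents b by F, and the change of basis of determinant 1 extending it
-- carries F to the form with leading coefficient b and middle coefficient 2s + 1.
record Match {c : ℕ} (F : Form c) (x y : ℤ) (b : ℕ) (s : ℤ) : Set where
  constructor matching
  open FormValues F
  field
    represents : value x y ≡ + b
    ∣first     : + b ∣ₛ (s - t) * x - k * y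
    ∣second    : + b ∣ₛ a * x + (s + t + + 1) * y

open Match

match? : ∀ {c} (F : Form c) x y b s → Dec (Match F x y b s)
match? F x y b s = map′ (λ (p , q , r) → matching p q r) (λ m → represents m , ∣first m , ∣second m)
  ((value x y ℤ.≟ + b) ×-dec (+ b ∣ₛ? (s - t) * x - k * y) ×-dec (+ b ∣ₛ? a * x + (s + t + + 1) * y))
  where open FormValues F

module Matching {c : ℕ} (F : Form c) where

  open FormValues F

  determinant : ∀ b x y s w₁ w₂ → (s - t) * x - k * y ≡ w₁ * b → a * x + (s + t + + 1) * y ≡ w₂ * b → value x y ≡ b * (x * w₂ - y * w₁)
  determinant b x y s w₁ w₂ e₁ e₂ = trans (lemma a x t y k s) (trans (cong₂ (λ u v → x * u - y * v) e₂ e₁) (lemma′ x w₂ b y w₁))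
    where
    lemma : ∀ a x t y k s → a * x * x + (+ 2 * t + + 1) * x * y + k * y * y ≡ x * (a * x + (s + t + + 1) * y) - y * ((s - t) * x - k * y)
    lemma = solve-∀
    lemma′ : ∀ x w b y v → x * (w * b) - y * (v * b) ≡ b * (x * w - y * v)
    lemma′ = solve-∀

  module _ {x y b s} (match : Match F x y (suc b) s) where

    w₁ w₂ : ℤ
    w₁ = Signed._∣_.quotient (∣first match)
    w₂ = Signed._∣_.quotient (∣second match)

    w₁≡ : (s - t) * x - k * y ≡ w₁ * + suc b
    w₁≡ = Signed._∣_.equality (∣first match)

    w₂≡ : a * x + (s + t + + 1) * y ≡ w₂ * + suc b
    w₂≡ = Signed._∣_.equality (∣second match)

    unimodular : x * w₂ - y * w₁ ≡ + 1
    unimodular = ∣-cancel {+ suc b} {+ 1} (x * w₂ - y * w₁) (λ ()) (trans (sym (determinant (+ suc b) x y s w₁ w₂ w₁≡ w₂≡)) (trans (represents match) (sym (ℤ.*-identityʳ (+ suc b)))))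

    ∣norm : + suc b ∣ₛ norm c s
    ∣norm = divides (p * w₁ * w₂ + k * w₂ * w₂ - q * w₂ * w₁ + a * w₁ * w₁) (begin
      norm c s
        ≡⟨ trans (norm-def c s) (trans (lemma₁ s t (+ suc c)) (cong (λ z → q * p + z) (trans norm-expand (ℤ.*-comm k a)))) ⟩
      q * p + a * k
        ≡⟨ trans (sym (ℤ.*-identityʳ (q * p + a * k))) (cong ((q * p + a * k) *_) (sym unimodular)) ⟩
      (q * p + a * k) * (x * w₂ - y * w₁)
        ≡⟨ lemma₂ q p a k x y w₁ w₂ ⟩
      (w₂ * p + w₁ * a) * (q * x - k * y) + (w₂ * k - w₁ * q) * (a * x + p * y)
        ≡⟨ cong₂ (λ u v → (w₂ * p + w₁ * a) * u + (w₂ * k - w₁ * q) * v) w₁≡ w₂≡ ⟩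
      (w₂ * p + w₁ * a) * (w₁ * + suc b) + (w₂ * k - w₁ * q) * (w₂ * + suc b)
        ≡⟨ lemma₃ w₁ w₂ p a k q (+ suc b) ⟩
      (p * w₁ * w₂ + k * w₂ * w₂ - q * w₂ * w₁ + a * w₁ * w₁) * + suc b ∎)
      where
      open ≡-Reasoning
      p = s + t + + 1
      q = s - t
      lemma₁ : ∀ s t c → s * s + s + c ≡ (s - t) * (s + t + + 1) + (t * t + t + c)
      lemma₁ = solve-∀
      lemma₂ : ∀ q p a k x y w₁ w₂ → (q * p + a * k) * (x * w₂ - y * w₁) ≡ (w₂ * p + w₁ * a) * (q * x - k * y) + (w₂ * k - w₁ * q) * (a * x + p * y)
      lemma₂ = solve-∀
      lemma₃ : ∀ w₁ w₂ p a k q b → (w₂ * p + w₁ * a) * (w₁ * b) + (w₂ * k - w₁ * q) * (w₂ * b) ≡ (p * w₁ * w₂ + k * w₂ * w₂ - q * w₂ * w₁ + a * w₁ * w₁) * b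
      lemma₃ = solve-∀

  match-shift : ∀ {x y b s s′} → s ≈[ b ] s′ → Match F x y b s → Match F x y b s′
  match-shift {x} {y} {b} {s} {s′} s≈s′ (matching v≡ d₁ d₂) = matching v≡
    (∣-≈ (≈-+ (≈-*ʳ x (≈-+ (≈-sym s≈s′) (≈-refl {x = - t}))) (≈-refl {x = - (k * y)})) d₁)
    (∣-≈ (≈-+ (≈-refl {x = a * x}) (≈-*ʳ y (≈-+ (≈-+ (≈-sym s≈s′) (≈-refl {x = t})) (≈-refl {x = + 1})))) d₂)

  match-neg : ∀ {x y b s} → Match F x y b s → Match F (- x) (- y) b s
  match-neg {x} {y} {b} {s} (matching v≡ d₁ d₂) = matching (trans (lemma₀ a t k x y) v≡)
    (∣-by (lemma₁ (s - t) k x y) (Signed.∣m⇒∣-m d₁)) (∣-by (lemma₂ a (s + t + + 1) x y) (Signed.∣m⇒∣-m d₂))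
    where
    lemma₀ : ∀ a t k x y → a * - x * - x + (+ 2 * t + + 1) * - x * - y + k * - y * - y ≡ a * x * x + (+ 2 * t + + 1) * x * y + k * y * y
    lemma₀ = solve-∀
    lemma₁ : ∀ s k x y → - (s * x - k * y) ≡ s * - x - k * - y
    lemma₁ = solve-∀
    lemma₂ : ∀ a s x y → - (a * x + s * y) ≡ a * - x + s * - y
    lemma₂ = solve-∀

  match-exists : ∀ x y u v → u * x + v * y ≡ + 1 → ∀ b → value x y ≡ + b → ∃[ s ] Match F x y b s
  match-exists x y u v uv b v≡ = s , matching v≡
      (divides (- v) (trans (lemma₁ a x t y k u v) (trans (cong (λ e → - v * value x y + (e - + 1) * (t * x + k * y)) uv) (trans (lemma₀ (- v * value x y) (t * x + k * y)) (cong (- v *_) v≡)))))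
      (divides u (trans (lemma₂ a x t y k u v) (trans (cong (λ e → u * value x y + (+ 1 - e) * (a * x + (t + + 1) * y)) uv) (trans (lemma₀ (u * value x y) (a * x + (t + + 1) * y)) (cong (u *_) v≡)))))
    where
    s = a * x * - v + t * x * u + (t + + 1) * y * - v + k * y * u
    lemma₀ : ∀ z w → z + (+ 1 - + 1) * w ≡ z
    lemma₀ = solve-∀
    lemma₁ : ∀ a x t y k u v → ((a * x * - v + t * x * u + (t + + 1) * y * - v + k * y * u) - t) * x - k * y
      ≡ - v * (a * x * x + (+ 2 * t + + 1) * x * y + k * y * y) + (u * x + v * y - + 1) * (t * x + k * y)
    lemma₁ = solve-∀
    lemma₂ : ∀ a x t y k u v → a * x + ((a * x * - v + t * x * u + (t + + 1) * y * - v + k * y * u) + t + + 1) * y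
      ≡ u * (a * x * x + (+ 2 * t + + 1) * x * y + k * y * y) + (+ 1 - (u * x + v * y)) * (a * x + (t + + 1) * y)
    lemma₂ = solve-∀

  match-shift-unique : ∀ {x y b s s′} → Match F x y (suc b) s → Match F x y (suc b) s′ → s ≈[ suc b ] s′
  match-shift-unique {x} {y} {b} {s} {s′} m m′ = ≈-by (divides ((w₁ m - w₁ m′) * w₂ m - (w₂ m - w₂ m′) * w₁ m) (begin
    s - s′
      ≡⟨ trans (sym (ℤ.*-identityʳ (s - s′))) (cong ((s - s′) *_) (sym (unimodular m))) ⟩
    (s - s′) * (x * w₂ m - y * w₁ m)
      ≡⟨ lemma₁ s s′ t a k x y (w₁ m) (w₂ m) ⟩
    ((s - t) * x - k * y - ((s′ - t) * x - k * y)) * w₂ m - (a * x + (s + t + + 1) * y - (a * x + (s′ + t + + 1) * y)) * w₁ m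
      ≡⟨ cong₂ (λ p q → p * w₂ m - q * w₁ m) (cong₂ _-_ (w₁≡ m) (w₁≡ m′)) (cong₂ _-_ (w₂≡ m) (w₂≡ m′)) ⟩
    (w₁ m * + suc b - w₁ m′ * + suc b) * w₂ m - (w₂ m * + suc b - w₂ m′ * + suc b) * w₁ m
      ≡⟨ lemma₂ (w₁ m) (w₁ m′) (w₂ m) (w₂ m′) (+ suc b) ⟩
    ((w₁ m - w₁ m′) * w₂ m - (w₂ m - w₂ m′) * w₁ m) * + suc b ∎))
    where
    open ≡-Reasoning
    lemma₁ : ∀ s s′ t a k x y w₁ w₂ → (s - s′) * (x * w₂ - y * w₁) ≡ ((s - t) * x - k * y - ((s′ - t) * x - k * y)) * w₂ - (a * x + (s + t + + 1) * y - (a * x + (s′ + t + + 1) * y)) * w₁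
    lemma₁ = solve-∀
    lemma₂ : ∀ w w′ v v′ b → (w * b - w′ * b) * v - (v * b - v′ * b) * w ≡ ((w - w′) * v - (v - v′) * w) * b
    lemma₂ = solve-∀

  -- Two matching vectors differ by an automorph of F, and the only automorphs are ±1.
  match-unique : (∀ d → d ℕ.* d ℕ.∣ conductor c → d ≡ 1) → 1 ℕ.≤ c → ∀ {x₁ y₁ x₂ y₂ b s} → Match F x₁ y₁ (suc b) s → Match F x₂ y₂ (suc b) s →
                 (x₂ ≡ x₁ × y₂ ≡ y₁) ⊎ (x₂ ≡ - x₁ × y₂ ≡ - y₁)
  match-unique squareFree 1≤c {x₁} {y₁} {x₂} {y₂} {b} {s} m₁ m₂ = signs (ℤ.i*j≡0⇒i≡0∨j≡0 (λ′ - + 1) factored)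
    where
    open ≡-Reasoning
    N = conductor c
    B = + suc b
    R = x₁ * y₂ - x₂ * y₁
    v₁ = w₁ m₁
    e₁ = w₂ m₁
    v₂ = w₁ m₂
    e₂ = w₂ m₂
    U W M : ℤ
    U = e₁ * y₂ - e₂ * y₁
    W = v₁ * x₂ - v₂ * x₁
    M = - (e₁ * x₂ - e₂ * x₁) - (v₁ * y₂ - v₂ * y₁)
    aR : a * R ≡ U * B
    aR = trans (lemma a (s + t + + 1) x₁ y₁ x₂ y₂) (trans (cong₂ (λ p q → p * y₂ - q * y₁) (w₂≡ m₁) (w₂≡ m₂)) (lemma′ e₁ e₂ B y₁ y₂))
      where
      lemma : ∀ a p x₁ y₁ x₂ y₂ → a * (x₁ * y₂ - x₂ * y₁) ≡ (a * x₁ + p * y₁) * y₂ - (a * x₂ + p * y₂) * y₁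
      lemma = solve-∀
      lemma′ : ∀ e₁ e₂ B y₁ y₂ → e₁ * B * y₂ - e₂ * B * y₁ ≡ (e₁ * y₂ - e₂ * y₁) * B
      lemma′ = solve-∀
    kR : k * R ≡ W * B
    kR = trans (lemma k (s - t) x₁ y₁ x₂ y₂) (trans (cong₂ (λ p q → p * x₂ - q * x₁) (w₁≡ m₁) (w₁≡ m₂)) (lemma′ v₁ v₂ B x₁ x₂))
      where
      lemma : ∀ k q x₁ y₁ x₂ y₂ → k * (x₁ * y₂ - x₂ * y₁) ≡ (q * x₁ - k * y₁) * x₂ - (q * x₂ - k * y₂) * x₁
      lemma = solve-∀
      lemma′ : ∀ e₁ e₂ B y₁ y₂ → e₁ * B * y₂ - e₂ * B * y₁ ≡ (e₁ * y₂ - e₂ * y₁) * B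
      lemma′ = solve-∀
    tR : (+ 2 * t + + 1) * R ≡ M * B
    tR = trans (lemma a k s t x₁ y₁ x₂ y₂) (trans (cong₂ _-_ (cong -_ (cong₂ (λ p q → p * x₂ - q * x₁) (w₂≡ m₁) (w₂≡ m₂))) (cong₂ (λ p q → p * y₂ - q * y₁) (w₁≡ m₁) (w₁≡ m₂))) (lemma′ e₁ e₂ v₁ v₂ B x₁ y₁ x₂ y₂))
      where
      lemma : ∀ a k s t x₁ y₁ x₂ y₂ → (+ 2 * t + + 1) * (x₁ * y₂ - x₂ * y₁) ≡
        - ((a * x₁ + (s + t + + 1) * y₁) * x₂ - (a * x₂ + (s + t + + 1) * y₂) * x₁) - (((s - t) * x₁ - k * y₁) * y₂ - ((s - t) * x₂ - k * y₂) * y₁)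
      lemma = solve-∀
      lemma′ : ∀ e₁ e₂ v₁ v₂ B x₁ y₁ x₂ y₂ → - (e₁ * B * x₂ - e₂ * B * x₁) - (v₁ * B * y₂ - v₂ * B * y₁) ≡ (- (e₁ * x₂ - e₂ * x₁) - (v₁ * y₂ - v₂ * y₁)) * B
      lemma′ = solve-∀
    NR² : + N * (R * R) ≡ (+ 4 * U * W - M * M) * (B * B)
    NR² = begin
      + N * (R * R)
        ≡⟨ cong (_* (R * R)) (trans (lemma₁ ((+ 2 * t + + 1) * (+ 2 * t + + 1)) (+ N)) (cong (_- (+ 2 * t + + 1) * (+ 2 * t + + 1)) (sym discriminant))) ⟩
      (+ 4 * (a * k) - (+ 2 * t + + 1) * (+ 2 * t + + 1)) * (R * R)
        ≡⟨ lemma₂ a k (+ 2 * t + + 1) R ⟩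
      + 4 * (a * R) * (k * R) - (+ 2 * t + + 1) * R * ((+ 2 * t + + 1) * R)
        ≡⟨ cong₂ _-_ (cong₂ (λ p q → + 4 * p * q) aR kR) (cong₂ _*_ tR tR) ⟩
      + 4 * (U * B) * (W * B) - M * B * (M * B)
        ≡⟨ lemma₃ U W M B ⟩
      (+ 4 * U * W - M * M) * (B * B) ∎
      where
      lemma₁ : ∀ d n → n ≡ d + n - d
      lemma₁ = solve-∀
      lemma₂ : ∀ a k b R → (+ 4 * (a * k) - b * b) * (R * R) ≡ + 4 * (a * R) * (k * R) - b * R * (b * R)
      lemma₂ = solve-∀
      lemma₃ : ∀ U W M B → + 4 * (U * B) * (W * B) - M * B * (M * B) ≡ (+ 4 * U * W - M * M) * (B * B)
      lemma₃ = solve-∀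
    R∣ : ∃[ g ] R ≡ g * B
    R∣ = squareFree-∣ N squareFree R (+ 4 * U * W - M * M) b NR²
    g = proj₁ R∣
    P = + 2 * a * x₁ * x₂ + (+ 2 * t + + 1) * (x₁ * y₂ + x₂ * y₁) + + 2 * k * y₁ * y₂
    gram : P * P + + N * (R * R) ≡ + 4 * (B * B)
    gram = trans (cong (λ n → P * P + n * (R * R)) (trans (lemma₁ ((+ 2 * t + + 1) * (+ 2 * t + + 1)) (+ N)) (cong (_- (+ 2 * t + + 1) * (+ 2 * t + + 1)) (sym discriminant))))
      (trans (lemma a (+ 2 * t + + 1) k x₁ y₁ x₂ y₂) (cong₂ (λ p q → + 4 * (p * q)) (represents m₁) (represents m₂)))
      where
      lemma₁ : ∀ d n → n ≡ d + n - d
      lemma₁ = solve-∀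
      lemma : ∀ a d k x₁ y₁ x₂ y₂ → (+ 2 * a * x₁ * x₂ + d * (x₁ * y₂ + x₂ * y₁) + + 2 * k * y₁ * y₂) * (+ 2 * a * x₁ * x₂ + d * (x₁ * y₂ + x₂ * y₁) + + 2 * k * y₁ * y₂)
        + (+ 4 * (a * k) - d * d) * ((x₁ * y₂ - x₂ * y₁) * (x₁ * y₂ - x₂ * y₁)) ≡ + 4 * ((a * x₁ * x₁ + d * x₁ * y₁ + k * y₁ * y₁) * (a * x₂ * x₂ + d * x₂ * y₂ + k * y₂ * y₂))
      lemma = solve-∀
    bounded : ∣ P ∣ ℕ.* ∣ P ∣ ℕ.+ N ℕ.* (∣ g ∣ ℕ.* ∣ g ∣) ℕ.* (suc b ℕ.* suc b) ≡ 4 ℕ.* (suc b ℕ.* suc b)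
    bounded = ℤ.+-injective (begin
      + (∣ P ∣ ℕ.* ∣ P ∣ ℕ.+ N ℕ.* (∣ g ∣ ℕ.* ∣ g ∣) ℕ.* (suc b ℕ.* suc b))
        ≡⟨ trans (ℤ.pos-+ (∣ P ∣ ℕ.* ∣ P ∣) _) (cong₂ _+_ (sym (abs-square P)) (trans (ℤ.pos-* (N ℕ.* (∣ g ∣ ℕ.* ∣ g ∣)) (suc b ℕ.* suc b)) (cong₂ _*_ (trans (ℤ.pos-* N (∣ g ∣ ℕ.* ∣ g ∣)) (cong (+ N *_) (sym (abs-square g)))) (ℤ.pos-* (suc b) (suc b))))) ⟩
      P * P + + N * (g * g) * (B * B)
        ≡⟨ cong (_+_ (P * P)) (trans (lemma (+ N) g B) (cong (λ r → + N * (r * r)) (sym (proj₂ R∣)))) ⟩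
      P * P + + N * (R * R)
        ≡⟨ gram ⟩
      + 4 * (B * B)
        ≡⟨ sym (trans (ℤ.pos-* 4 (suc b ℕ.* suc b)) (cong (+ 4 *_) (ℤ.pos-* (suc b) (suc b)))) ⟩
      + (4 ℕ.* (suc b ℕ.* suc b)) ∎)
      where
      lemma : ∀ n g B → n * (g * g) * (B * B) ≡ n * (g * B * (g * B))
      lemma = solve-∀
    4<N : 4 ℕ.< N
    4<N = ℕ.≤-trans (s≤s (s≤s (s≤s (s≤s (s≤s z≤n))))) (s≤s (ℕ.+-mono-≤ {3} {suc (c ℕ.+ c)} {3} (s≤s (ℕ.+-mono-≤ 1≤c 1≤c)) (s≤s (ℕ.+-mono-≤ 1≤c 1≤c))))
    g-zero : ∀ n → N ℕ.* (n ℕ.* n) ℕ.≤ 4 → n ≡ 0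
    g-zero zero    _  = refl
    g-zero (suc n) le = contradiction (ℕ.≤-trans (ℕ.m≤m*n N (suc n ℕ.* suc n)) le) (ℕ.<⇒≱ 4<N)
    R≡0 : R ≡ + 0
    R≡0 = trans (proj₂ R∣) (cong (_* B) (ℤ.∣i∣≡0⇒i≡0 {g} (g-zero ∣ g ∣ (ℕ.*-cancelʳ-≤ (N ℕ.* (∣ g ∣ ℕ.* ∣ g ∣)) 4 (suc b ℕ.* suc b)
      (ℕ.≤-trans (ℕ.m≤n+m (N ℕ.* (∣ g ∣ ℕ.* ∣ g ∣) ℕ.* (suc b ℕ.* suc b)) (∣ P ∣ ℕ.* ∣ P ∣)) (ℕ.≤-reflexive bounded))))))
    λ′ = x₂ * e₁ - y₂ * v₁
    x₂≡ : x₂ ≡ λ′ * x₁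
    x₂≡ = trans (trans (sym (ℤ.*-identityʳ x₂)) (cong (x₂ *_) (sym (unimodular m₁)))) (trans (lemma x₁ y₁ x₂ y₂ e₁ v₁) (trans (cong (λ r → (x₂ * e₁ - y₂ * v₁) * x₁ + r * v₁) R≡0) (lemma₀ (λ′ * x₁) v₁)))
      where
      lemma : ∀ x₁ y₁ x₂ y₂ e v → x₂ * (x₁ * e - y₁ * v) ≡ (x₂ * e - y₂ * v) * x₁ + (x₁ * y₂ - x₂ * y₁) * v
      lemma = solve-∀
      lemma₀ : ∀ z v → z + + 0 * v ≡ z
      lemma₀ = solve-∀
    y₂≡ : y₂ ≡ λ′ * y₁
    y₂≡ = trans (trans (sym (ℤ.*-identityʳ y₂)) (cong (y₂ *_) (sym (unimodular m₁)))) (trans (lemma x₁ y₁ x₂ y₂ e₁ v₁) (trans (cong (λ r → (x₂ * e₁ - y₂ * v₁) * y₁ + r * e₁) R≡0) (lemma₀ (λ′ * y₁) e₁)))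
      where
      lemma : ∀ x₁ y₁ x₂ y₂ e v → y₂ * (x₁ * e - y₁ * v) ≡ (x₂ * e - y₂ * v) * y₁ + (x₁ * y₂ - x₂ * y₁) * e
      lemma = solve-∀
      lemma₀ : ∀ z v → z + + 0 * v ≡ z
      lemma₀ = solve-∀
    λ²≡1 : λ′ * λ′ ≡ + 1
    λ²≡1 = ∣-cancel {B} {+ 1} (λ′ * λ′) (λ ()) (begin
      B * (λ′ * λ′)                       ≡⟨ trans (ℤ.*-comm B (λ′ * λ′)) (cong (λ′ * λ′ *_) (sym (represents m₁))) ⟩
      λ′ * λ′ * value x₁ y₁               ≡⟨ lemma λ′ a (+ 2 * t + + 1) k x₁ y₁ ⟩
      value (λ′ * x₁) (λ′ * y₁)           ≡⟨ cong₂ value (sym x₂≡) (sym y₂≡) ⟩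
      value x₂ y₂                         ≡⟨ represents m₂ ⟩
      B                                   ≡⟨ sym (ℤ.*-identityʳ B) ⟩
      B * + 1                             ∎)
      where
      lemma : ∀ l a d k x y → l * l * (a * x * x + d * x * y + k * y * y) ≡ a * (l * x) * (l * x) + d * (l * x) * (l * y) + k * (l * y) * (l * y)
      lemma = solve-∀
    factored : (λ′ - + 1) * (λ′ + + 1) ≡ + 0
    factored = trans (lemma λ′) (cong (_- + 1) λ²≡1)
      where
      lemma : ∀ l → (l - + 1) * (l + + 1) ≡ l * l - + 1
      lemma = solve-∀
    signs : λ′ - + 1 ≡ + 0 ⊎ λ′ + + 1 ≡ + 0 → (x₂ ≡ x₁ × y₂ ≡ y₁) ⊎ (x₂ ≡ - x₁ × y₂ ≡ - y₁)
    signs (inj₁ eq) = inj₁ (trans x₂≡ (trans (cong (_* x₁) λ≡1) (ℤ.*-identityˡ x₁)) , trans y₂≡ (trans (cong (_* y₁) λ≡1) (ℤ.*-identityˡ y₁)))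
      where
      λ≡1 : λ′ ≡ + 1
      λ≡1 = ℤ.i-j≡0⇒i≡j λ′ (+ 1) eq
    signs (inj₂ eq) = inj₂ (trans x₂≡ (trans (cong (_* x₁) λ≡-1) (ℤ.-1*i≡-i x₁)) , trans y₂≡ (trans (cong (_* y₁) λ≡-1) (ℤ.-1*i≡-i y₁)))
      where
      λ≡-1 : λ′ ≡ -1ℤ
      λ≡-1 = ℤ.i-j≡0⇒i≡j λ′ -1ℤ eq

module IdealClasses (D : ℤ) (c : ℕ) (D≡-N : D ≡ - + conductor c) where

  open Integers D c D≡-N
  open Ideals D c D≡-N

  point : Form c → ℤ → ℤ → Vector
  point F x y = x * a + y * t , y
    where open FormValues F

  InForm : Form c → Vector → Set
  InForm F = InIdeal (FormValues.a F) (FormValues.t F)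

  point-∈ : ∀ F x y → InForm F (point F x y)
  point-∈ F x y = divides x (lemma x (FormValues.a F) y (FormValues.t F))
    where
    lemma : ∀ x a y t → x * a + y * t - y * t ≡ x * a
    lemma = solve-∀

  ∈-point : ∀ F X → InForm F X → ∃[ x ] ∃[ y ] X ≡ point F x y
  ∈-point F (p , q) (divides x eq) = x , q , cong₂ _,_ (trans (lemma p (q * FormValues.t F)) (cong (_+ q * FormValues.t F) eq)) refl
    where
    lemma : ∀ p r → p ≡ p - r + r
    lemma = solve-∀

  normᵥ : Vector → ℤ
  normᵥ (p , q) = p * p + p * q + κ * (q * q)

  normᵥ-⊡ : ∀ X Y → normᵥ (X ⊡ Y) ≡ normᵥ X * normᵥ Y
  normᵥ-⊡ (p , q) (r , s) = lemma κ p q r s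
    where
    lemma : ∀ k p q r s → (p * r - k * (q * s)) * (p * r - k * (q * s)) + (p * r - k * (q * s)) * (p * s + q * r + q * s) + k * ((p * s + q * r + q * s) * (p * s + q * r + q * s))
      ≡ (p * p + p * q + k * (q * q)) * (r * r + r * s + k * (s * s))
    lemma = solve-∀

  normᵥ-point : ∀ F x y → normᵥ (point F x y) ≡ FormValues.a F * FormValues.value F x y
  normᵥ-point F x y = trans (lemma₁ a t κ x y) (trans (cong (λ n → a * (a * x * x + (+ 2 * t + + 1) * x * y) + n * (y * y)) norm-expand) (lemma₂ a t k x y))
    where
    open FormValues F
    lemma₁ : ∀ a t κ x y → (x * a + y * t) * (x * a + y * t) + (x * a + y * t) * y + κ * (y * y) ≡ a * (a * x * x + (+ 2 * t + + 1) * x * y) + (t * t + t + κ) * (y * y)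
    lemma₁ = solve-∀
    lemma₂ : ∀ a t k x y → a * (a * x * x + (+ 2 * t + + 1) * x * y) + k * a * (y * y) ≡ a * (a * x * x + (+ 2 * t + + 1) * x * y + k * y * y)
    lemma₂ = solve-∀

  Embeds : K → Form c → Form c → Set
  Embeds w G F = ∀ X → InForm G X → ∃[ Y ] w *K ιᵥ X ≡ ιᵥ Y × InForm F Y

  embedding-vector : ∀ w (G F : Form c) → Embeds w G F →
    ∃[ x ] ∃[ y ] ∃[ w₁ ] ∃[ w₂ ] w *K ιᵥ (FormValues.a G , + 0) ≡ ιᵥ (point F x y)
      × (FormValues.t G - FormValues.t F) * x - FormValues.k F * y ≡ w₁ * FormValues.a G
      × FormValues.a F * x + (FormValues.t G + FormValues.t F + + 1) * y ≡ w₂ * FormValues.a G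
  embedding-vector w G F embeds = from-images (embeds (b , + 0) (divides (+ 1) (lemma₀ b s))) (embeds (s , + 1) (divides (+ 0) (lemma₁ b s)))
    where
    open FormValues F
    b = FormValues.a G
    s = FormValues.t G
    lemma₀ : ∀ b s → b - + 0 * s ≡ + 1 * b
    lemma₀ = solve-∀
    lemma₁ : ∀ b s → s - + 1 * s ≡ + 0 * b
    lemma₁ = solve-∀
    Result : Set
    Result = ∃[ x ] ∃[ y ] ∃[ w₁ ] ∃[ w₂ ] w *K ιᵥ (b , + 0) ≡ ιᵥ (point F x y)
      × (s - t) * x - k * y ≡ w₁ * b × a * x + (s + t + + 1) * y ≡ w₂ * b
    from-images : ∃[ Y ] w *K ιᵥ (b , + 0) ≡ ιᵥ Y × InForm F Y → ∃[ Z ] w *K ιᵥ (s , + 1) ≡ ιᵥ Z × InForm F Z → Result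
    from-images (Y , Y≡ , Y∈) (Z , Z≡ , Z∈) = from-coordinates (∈-point F Y Y∈) (∈-point F Z Z∈)
      where
      from-coordinates : ∃[ x ] ∃[ y ] Y ≡ point F x y → ∃[ w₁ ] ∃[ w₂ ] Z ≡ point F w₁ w₂ → Result
      from-coordinates (x , y , refl) (w₁ , w₂ , refl) = x , y , w₁ , w₂ , Y≡ , first , second
        where
        compatible : (s , + 1) ⊡ point F x y ≡ b · point F w₁ w₂
        compatible = ιᵥ-injective (begin
          ιᵥ ((s , + 1) ⊡ point F x y)             ≡⟨ ιᵥ-⊡ (s , + 1) (point F x y) ⟩
          ιᵥ (s , + 1) *K ιᵥ (point F x y)         ≡⟨ cong (ιᵥ (s , + 1) *K_) (sym Y≡) ⟩
          ιᵥ (s , + 1) *K (w *K int b)             ≡⟨ trans (*K-swap (ιᵥ (s , + 1)) w (int b)) (trans (cong (w *K_) (*K-comm (ιᵥ (s , + 1)) (int b))) (*K-swap w (int b) (ιᵥ (s , + 1)))) ⟩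
          int b *K (w *K ιᵥ (s , + 1))             ≡⟨ cong (int b *K_) Z≡ ⟩
          int b *K ιᵥ (point F w₁ w₂)              ≡⟨ sym (ιᵥ-· b (point F w₁ w₂)) ⟩
          ιᵥ (b · point F w₁ w₂)                   ∎)
          where open ≡-Reasoning
        second : a * x + (s + t + + 1) * y ≡ w₂ * b
        second = trans (lemma a x s t y) (trans (cong proj₂ compatible) (ℤ.*-comm b w₂))
          where
          lemma : ∀ a x s t y → a * x + (s + t + + 1) * y ≡ s * y + + 1 * (x * a + y * t) + + 1 * y
          lemma = solve-∀
        first : (s - t) * x - k * y ≡ w₁ * b
        first = ∣-cancel {a} ((s - t) * x - k * y) (λ ()) (begin
          a * ((s - t) * x - k * y)
            ≡⟨ trans (lemma₂ a s t x k y) (cong (λ z → a * (s - t) * x - z * y) (sym norm-expand)) ⟩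
          a * (s - t) * x - (t * t + t + κ) * y
            ≡⟨ lemma₃ a s t x κ y ⟩
          s * (x * a + y * t) - κ * (+ 1 * y) - t * (a * x + (s + t + + 1) * y)
            ≡⟨ cong₂ (λ u v → u - t * v) (cong proj₁ compatible) second ⟩
          b * (w₁ * a + w₂ * t) - t * (w₂ * b)
            ≡⟨ lemma₄ b w₁ w₂ a t ⟩
          a * (w₁ * b) ∎)
          where
          open ≡-Reasoning
          lemma₂ : ∀ a s t x k y → a * ((s - t) * x - k * y) ≡ a * (s - t) * x - k * a * y
          lemma₂ = solve-∀
          lemma₃ : ∀ a s t x κ y → a * (s - t) * x - (t * t + t + κ) * y ≡ s * (x * a + y * t) - κ * (+ 1 * y) - t * (a * x + (s + t + + 1) * y)
          lemma₃ = solve-∀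
          lemma₄ : ∀ b w₁ w₂ a t → b * (w₁ * a + w₂ * t) - t * (w₂ * b) ≡ a * (w₁ * b)
          lemma₄ = solve-∀

  embeddings⇒match : ∀ w w′ → w *K w′ ≡ 1K → ∀ G F → Embeds w G F → Embeds w′ F G →
                     ∃[ x ] ∃[ y ] Match F x y (suc (Form.lead G)) (Form.shift G)
  embeddings⇒match w w′ ww′ G F embeds embeds′ = combine (embedding-vector w G F embeds) (embedding-vector w′ F G embeds′)
    where
    open FormValues F
    b = FormValues.a G
    s = FormValues.t G
    combine : ∃[ x ] ∃[ y ] ∃[ w₁ ] ∃[ w₂ ] w *K ιᵥ (b , + 0) ≡ ιᵥ (point F x y)
        × (s - t) * x - k * y ≡ w₁ * b × a * x + (s + t + + 1) * y ≡ w₂ * b →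
      ∃[ x ] ∃[ y ] ∃[ w₁ ] ∃[ w₂ ] w′ *K ιᵥ (a , + 0) ≡ ιᵥ (point G x y)
        × (t - s) * x - FormValues.k G * y ≡ w₁ * a × b * x + (t + s + + 1) * y ≡ w₂ * a →
      ∃[ x ] ∃[ y ] Match F x y (suc (Form.lead G)) s
    combine (x , y , w₁ , w₂ , image , e₁ , e₂) (x′ , y′ , w₁′ , w₂′ , image′ , e₁′ , e₂′) =
      x , y , matching (trans value≡ (trans (cong (b *_) (unit (from-product det det′ det*det′))) (ℤ.*-identityʳ b))) (divides w₁ e₁) (divides w₂ e₂)
      where
      det = x * w₂ - y * w₁
      det′ = x′ * w₂′ - y′ * w₁′
      value≡ : value x y ≡ b * det
      value≡ = Matching.determinant F b x y s w₁ w₂ e₁ e₂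
      value′≡ : FormValues.value G x′ y′ ≡ a * det′
      value′≡ = Matching.determinant G a x′ y′ t w₁′ w₂′ e₁′ e₂′
      product≡ : point F x y ⊡ point G x′ y′ ≡ (a * b , + 0)
      product≡ = ιᵥ-injective (begin
        ιᵥ (point F x y ⊡ point G x′ y′)           ≡⟨ ιᵥ-⊡ (point F x y) (point G x′ y′) ⟩
        ιᵥ (point F x y) *K ιᵥ (point G x′ y′)     ≡⟨ sym (cong₂ _*K_ image image′) ⟩
        (w *K int b) *K (w′ *K int a)              ≡⟨ trans (*K-assoc w (int b) (w′ *K int a)) (cong (w *K_) (*K-swap (int b) w′ (int a))) ⟩
        w *K (w′ *K (int b *K int a))              ≡⟨ cancel w w′ ww′ (int b *K int a) ⟩
        int b *K int a                             ≡⟨ trans (*K-comm (int b) (int a)) (int-* a b) ⟩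
        ιᵥ (a * b , + 0)                           ∎)
        where open ≡-Reasoning
      det*det′ : det * det′ ≡ + 1
      det*det′ = ∣-cancel {a * b} {+ 1} (det * det′) (λ ()) (∣-cancel {a * b} {a * b * + 1} (a * b * (det * det′)) (λ ()) (begin
        a * b * (a * b * (det * det′))                         ≡⟨ lemma₁ a b det det′ ⟩
        a * (b * det) * (b * (a * det′))                       ≡⟨ cong₂ (λ u v → a * u * (b * v)) (sym value≡) (sym value′≡) ⟩
        a * value x y * (b * FormValues.value G x′ y′)         ≡⟨ sym (cong₂ _*_ (normᵥ-point F x y) (normᵥ-point G x′ y′)) ⟩
        normᵥ (point F x y) * normᵥ (point G x′ y′)            ≡⟨ sym (normᵥ-⊡ (point F x y) (point G x′ y′)) ⟩
        normᵥ (point F x y ⊡ point G x′ y′)                    ≡⟨ cong normᵥ product≡ ⟩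
        normᵥ (a * b , + 0)                                    ≡⟨ lemma₂ (a * b) κ ⟩
        a * b * (a * b * + 1)                                  ∎))
        where
        open ≡-Reasoning
        lemma₁ : ∀ a b d e → a * b * (a * b * (d * e)) ≡ a * (b * d) * (b * (a * e))
        lemma₁ = solve-∀
        lemma₂ : ∀ z k → z * z + z * + 0 + k * (+ 0 * + 0) ≡ z * (z * + 1)
        lemma₂ = solve-∀
      from-product : ∀ d e → d * e ≡ + 1 → Unit d
      from-product d e eq = abs-one d (ℕ.m*n≡1⇒m≡1 ∣ d ∣ ∣ e ∣ (trans (sym (ℤ.abs-* d e)) (cong ∣_∣ eq)))
        where
        abs-one : ∀ d → ∣ d ∣ ≡ 1 → Unit d
        abs-one (+ 1)    refl = inj₁ refl
        abs-one -[1+ 0 ] refl = inj₂ refl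
      unit : Unit det → det ≡ + 1
      unit (inj₁ eq) = eq
      unit (inj₂ eq) = contradiction (trans value≡ (cong (b *_) eq)) (value-nonneg x y (Form.lead G ℕ.* 1))

  equivalent⇒match : ∀ I J G F → Shape I (FormValues.a G) (FormValues.t G) → Shape J (FormValues.a F) (FormValues.t F) → I ∼ J →
                     ∃[ x ] ∃[ y ] Match F x y (suc (Form.lead G)) (Form.shift G)
  equivalent⇒match I J G F (u , v , uv , I≡) (u′ , v′ , u′v′ , J≡) (r , r⁻¹ , rr⁻¹ , I∼J) =
    embeddings⇒match (u′ *K (r *K v)) (u *K (r⁻¹ *K v′)) inverse G F embeds embeds′
    where
    inverse : u′ *K (r *K v) *K (u *K (r⁻¹ *K v′)) ≡ 1K
    inverse = begin
      u′ *K (r *K v) *K (u *K (r⁻¹ *K v′))    ≡⟨ trans (*K-assoc u′ (r *K v) _) (cong (u′ *K_) (*K-assoc r v _)) ⟩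
      u′ *K (r *K (v *K (u *K (r⁻¹ *K v′))))  ≡⟨ cong (λ z → u′ *K (r *K z)) (cancel v u (trans (*K-comm v u) uv) (r⁻¹ *K v′)) ⟩
      u′ *K (r *K (r⁻¹ *K v′))                ≡⟨ cong (u′ *K_) (cancel r r⁻¹ rr⁻¹ v′) ⟩
      u′ *K v′                                ≡⟨ u′v′ ⟩
      1K                                      ∎
      where open ≡-Reasoning
    assoc₃ : ∀ x y z w → x *K (y *K z) *K w ≡ x *K (y *K (z *K w))
    assoc₃ x y z w = trans (*K-assoc x (y *K z) w) (cong (x *K_) (*K-assoc y z w))
    embeds : Embeds (u′ *K (r *K v)) G F
    embeds X X∈ = image (Equivalence.to (J≡ (r *K (v *K ιᵥ X))) (Equivalence.to (I∼J (v *K ιᵥ X)) (Equivalence.from (I≡ (v *K ιᵥ X)) (X , cancel u v uv (ιᵥ X) , X∈))))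
      where
      image : ∃[ Y ] u′ *K (r *K (v *K ιᵥ X)) ≡ ιᵥ Y × InForm F Y → ∃[ Y ] u′ *K (r *K v) *K ιᵥ X ≡ ιᵥ Y × InForm F Y
      image (Y , eq , Y∈) = Y , trans (assoc₃ u′ r v (ιᵥ X)) eq , Y∈
    embeds′ : Embeds (u *K (r⁻¹ *K v′)) F G
    embeds′ Y Y∈ = image (Equivalence.to (I≡ (r⁻¹ *K (v′ *K ιᵥ Y))) (Equivalence.from (I∼J (r⁻¹ *K (v′ *K ιᵥ Y)))
        (subst (_∈I J) (sym (cancel r r⁻¹ rr⁻¹ (v′ *K ιᵥ Y))) (Equivalence.from (J≡ (v′ *K ιᵥ Y)) (Y , cancel u′ v′ u′v′ (ιᵥ Y) , Y∈)))))
      where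
      image : ∃[ X ] u *K (r⁻¹ *K (v′ *K ιᵥ Y)) ≡ ιᵥ X × InForm G X → ∃[ X ] u *K (r⁻¹ *K v′) *K ιᵥ Y ≡ ιᵥ X × InForm G X
      image (X , eq , X∈) = X , trans (assoc₃ u r⁻¹ v′ (ιᵥ Y)) eq , X∈

  module _ (G F : Form c) {x y : ℤ} (match : Match F x y (suc (Form.lead G)) (Form.shift G)) where

    open FormValues F
    open Matching F using (w₁; w₂; w₁≡; w₂≡)

    private
      b = FormValues.a G
      s = FormValues.t G
      A = point F x y
      conj : Vector
      conj = x * a + y * t + y , - y
      v₁ = w₁ match
      v₂ = w₂ match

      -- A is the image of b, and (v₁, v₂) that of s + ω.
      forward : ∀ m n → A ⊡ point G m n ≡ b · point F (m * x + n * v₁) (m * y + n * v₂)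
      forward m n = cong₂ _,_
        (begin
          (x * a + y * t) * (m * b + n * s) - κ * (y * n)
            ≡⟨ lemma₁ x a y t m b n s κ ⟩
          b * m * (x * a + y * t) + n * (a * (s - t) * x - (t * t + t + κ) * y + t * (a * x + (s + t + + 1) * y))
            ≡⟨ cong (λ z → b * m * (x * a + y * t) + n * (a * (s - t) * x - z * y + t * (a * x + (s + t + + 1) * y))) norm-expand ⟩
          b * m * (x * a + y * t) + n * (a * (s - t) * x - k * a * y + t * (a * x + (s + t + + 1) * y))
            ≡⟨ cong (λ z → b * m * (x * a + y * t) + n * z) (trans (lemma₂ a s t x k y) (cong₂ (λ p q → a * p + t * q) (w₁≡ match) (w₂≡ match))) ⟩
          b * m * (x * a + y * t) + n * (a * (v₁ * b) + t * (v₂ * b))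
            ≡⟨ lemma₃ b m x a y t n v₁ v₂ ⟩
          b * ((m * x + n * v₁) * a + (m * y + n * v₂) * t) ∎)
        (trans (lemma₄ x a y t m b n s) (trans (cong (λ z → b * (m * y) + n * z) (w₂≡ match)) (lemma₅ b m y n v₂)))
        where
        open ≡-Reasoning
        lemma₁ : ∀ x a y t m b n s κ → (x * a + y * t) * (m * b + n * s) - κ * (y * n) ≡ b * m * (x * a + y * t) + n * (a * (s - t) * x - (t * t + t + κ) * y + t * (a * x + (s + t + + 1) * y))
        lemma₁ = solve-∀
        lemma₂ : ∀ a s t x k y → a * (s - t) * x - k * a * y + t * (a * x + (s + t + + 1) * y) ≡ a * ((s - t) * x - k * y) + t * (a * x + (s + t + + 1) * y)
        lemma₂ = solve-∀
        lemma₃ : ∀ b m x a y t n v₁ v₂ → b * m * (x * a + y * t) + n * (a * (v₁ * b) + t * (v₂ * b)) ≡ b * ((m * x + n * v₁) * a + (m * y + n * v₂) * t)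
        lemma₃ = solve-∀
        lemma₄ : ∀ x a y t m b n s → (x * a + y * t) * n + y * (m * b + n * s) + y * n ≡ b * (m * y) + n * (a * x + (s + t + + 1) * y)
        lemma₄ = solve-∀
        lemma₅ : ∀ b m y n v → b * (m * y) + n * (v * b) ≡ b * (m * y + n * v)
        lemma₅ = solve-∀

      backward : ∀ m n → conj ⊡ point F m n ≡ a · point G (m * v₂ - n * v₁) (n * x - m * y)
      backward m n = cong₂ _,_
        (begin
          (x * a + y * t + y) * (m * a + n * t) - κ * (- y * n)
            ≡⟨ lemma₁ x a y t m n κ ⟩
          a * (m * (x * a + y * t + y) + n * (t * x)) + n * y * (t * t + t + κ)
            ≡⟨ cong (λ z → a * (m * (x * a + y * t + y) + n * (t * x)) + n * y * z) norm-expand ⟩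
          a * (m * (x * a + y * t + y) + n * (t * x)) + n * y * (k * a)
            ≡⟨ lemma₂ x a y t m n k s ⟩
          a * (m * (a * x + (s + t + + 1) * y) - n * ((s - t) * x - k * y) + (n * x - m * y) * s)
            ≡⟨ cong₂ (λ p q → a * (m * p - n * q + (n * x - m * y) * s)) (w₂≡ match) (w₁≡ match) ⟩
          a * (m * (v₂ * b) - n * (v₁ * b) + (n * x - m * y) * s)
            ≡⟨ lemma₃ a m v₂ b n v₁ ((n * x - m * y) * s) ⟩
          a * ((m * v₂ - n * v₁) * b + (n * x - m * y) * s) ∎)
        (lemma₄ x a y t m n)
        where
        open ≡-Reasoning
        lemma₁ : ∀ x a y t m n κ → (x * a + y * t + y) * (m * a + n * t) - κ * (- y * n) ≡ a * (m * (x * a + y * t + y) + n * (t * x)) + n * y * (t * t + t + κ)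
        lemma₁ = solve-∀
        lemma₂ : ∀ x a y t m n k s → a * (m * (x * a + y * t + y) + n * (t * x)) + n * y * (k * a) ≡ a * (m * (a * x + (s + t + + 1) * y) - n * ((s - t) * x - k * y) + (n * x - m * y) * s)
        lemma₂ = solve-∀
        lemma₃ : ∀ a m v b n w z → a * (m * (v * b) - n * (w * b) + z) ≡ a * ((m * v - n * w) * b + z)
        lemma₃ = solve-∀
        lemma₄ : ∀ x a y t m n → (x * a + y * t + y) * n + - y * (m * a + n * t) + - y * n ≡ a * (n * x - m * y)
        lemma₄ = solve-∀

      conj-* : A ⊡ conj ≡ (a * b , + 0)
      conj-* = cong₂ _,_ (trans (lemma₁ (x * a + y * t) y κ) (trans (normᵥ-point F x y) (cong (a *_) (Match.represents match)))) (lemma₂ (x * a + y * t) y)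
        where
        lemma₁ : ∀ p y κ → p * (p + y) - κ * (y * - y) ≡ p * p + p * y + κ * (y * y)
        lemma₁ = solve-∀
        lemma₂ : ∀ p y → p * - y + y * (p + y) + y * - y ≡ + 0
        lemma₂ = solve-∀

      b⁻¹ a⁻¹ w w′ : K
      b⁻¹ = proj₁ (int-inverse⁺ (Form.lead G))
      a⁻¹ = proj₁ (int-inverse⁺ lead)
      w = b⁻¹ *K ιᵥ A
      w′ = a⁻¹ *K ιᵥ conj

      b⁻¹b : b⁻¹ *K int b ≡ 1K
      b⁻¹b = trans (*K-comm b⁻¹ (int b)) (proj₂ (int-inverse⁺ (Form.lead G)))

      a⁻¹a : a⁻¹ *K int a ≡ 1K
      a⁻¹a = trans (*K-comm a⁻¹ (int a)) (proj₂ (int-inverse⁺ lead))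

      ww′ : w *K w′ ≡ 1K
      ww′ = begin
        b⁻¹ *K ιᵥ A *K (a⁻¹ *K ιᵥ conj)        ≡⟨ trans (*K-assoc b⁻¹ (ιᵥ A) _) (cong (b⁻¹ *K_) (*K-swap (ιᵥ A) a⁻¹ (ιᵥ conj))) ⟩
        b⁻¹ *K (a⁻¹ *K (ιᵥ A *K ιᵥ conj))      ≡⟨ cong (λ z → b⁻¹ *K (a⁻¹ *K z)) (trans (sym (ιᵥ-⊡ A conj)) (trans (cong ιᵥ conj-*) (sym (int-* a b)))) ⟩
        b⁻¹ *K (a⁻¹ *K (int a *K int b))       ≡⟨ cong (b⁻¹ *K_) (cancel a⁻¹ (int a) a⁻¹a (int b)) ⟩
        b⁻¹ *K int b                           ≡⟨ b⁻¹b ⟩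
        1K                                     ∎
        where open ≡-Reasoning

      embeds : Embeds w G F
      embeds X X∈ = go (∈-point G X X∈)
        where
        go : ∃[ m ] ∃[ n ] X ≡ point G m n → ∃[ Y ] w *K ιᵥ X ≡ ιᵥ Y × InForm F Y
        go (m , n , refl) = Y , trans (*K-assoc b⁻¹ (ιᵥ A) _) (trans (cong (b⁻¹ *K_) (trans (sym (ιᵥ-⊡ A (point G m n))) (trans (cong ιᵥ (forward m n)) (ιᵥ-· b Y))))
            (cancel b⁻¹ (int b) b⁻¹b (ιᵥ Y))) , point-∈ F (m * x + n * v₁) (m * y + n * v₂)
          where
          Y = point F (m * x + n * v₁) (m * y + n * v₂)

      embeds′ : Embeds w′ F G
      embeds′ Y Y∈ = go (∈-point F Y Y∈)
        where
        go : ∃[ m ] ∃[ n ] Y ≡ point F m n → ∃[ X ] w′ *K ιᵥ Y ≡ ιᵥ X × InForm G X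
        go (m , n , refl) = X , trans (*K-assoc a⁻¹ (ιᵥ conj) _) (trans (cong (a⁻¹ *K_) (trans (sym (ιᵥ-⊡ conj (point F m n))) (trans (cong ιᵥ (backward m n)) (ιᵥ-· a X))))
            (cancel a⁻¹ (int a) a⁻¹a (ιᵥ X))) , point-∈ G (m * v₂ - n * v₁) (n * x - m * y)
          where
          X = point G (m * v₂ - n * v₁) (n * x - m * y)

    match⇒equivalent : ∀ I J → Shape I (FormValues.a G) (FormValues.t G) → Shape J (FormValues.a F) (FormValues.t F) → I ∼ J
    match⇒equivalent I J (u , v , uv , I≡) (u′ , v′ , u′v′ , J≡) = v′ *K (w *K u) , proj₁ inverse , proj₂ inverse , λ z → mk⇔ (to z) (from z)
      where
      inverse : Inverse (v′ *K (w *K u))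
      inverse = *K-inverse {v′} {w *K u} (u′ , trans (*K-comm v′ u′) u′v′) (*K-inverse {w} {u} (w′ , ww′) (v , uv))
      scaled : ∀ z → u′ *K (v′ *K (w *K u) *K z) ≡ w *K (u *K z)
      scaled z = trans (cong (u′ *K_) (*K-assoc v′ (w *K u) z)) (trans (cancel u′ v′ u′v′ (w *K u *K z)) (*K-assoc w u z))
      to : ∀ z → z ∈I I → (v′ *K (w *K u) *K z) ∈I J
      to z z∈ = step (Equivalence.to (I≡ z) z∈)
        where
        step : ∃[ X ] u *K z ≡ ιᵥ X × InForm G X → (v′ *K (w *K u) *K z) ∈I J
        step (X , eq , X∈) = Equivalence.from (J≡ _) (proj₁ (embeds X X∈) , trans (scaled z) (trans (cong (w *K_) eq) (proj₁ (proj₂ (embeds X X∈)))) , proj₂ (proj₂ (embeds X X∈)))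
      from : ∀ z → (v′ *K (w *K u) *K z) ∈I J → z ∈I I
      from z z∈ = step (Equivalence.to (J≡ _) z∈)
        where
        step : ∃[ Y ] u′ *K (v′ *K (w *K u) *K z) ≡ ιᵥ Y × InForm F Y → z ∈I I
        step (Y , eq , Y∈) = Equivalence.from (I≡ z) (proj₁ (embeds′ Y Y∈) , trans (sym (cancel w′ w (trans (*K-comm w′ w) ww′) (u *K z)))
          (trans (cong (w′ *K_) (trans (sym (scaled z)) eq)) (proj₁ (proj₂ (embeds′ Y Y∈)))) , proj₂ (proj₂ (embeds′ Y Y∈)))

-- Representations by a system of representatives of the ideal classes

interval : ℕ → List ℤ
interval B = map (λ n → + n) (downFrom (suc B)) ++ map -[1+_] (downFrom B)

∈-interval : ∀ {B x} → ∣ x ∣ ℕ.≤ B → x ∈ interval B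
∈-interval {B} {+ n}      le = ∈-++⁺ˡ (∈-map⁺ (λ n → + n) (∈-downFrom⁺ (s≤s le)))
∈-interval {B} { -[1+ n ]} le = ∈-++⁺ʳ (map (λ n → + n) (downFrom (suc B))) (∈-map⁺ -[1+_] (∈-downFrom⁺ le))

interval-unique : ∀ B → Unique (interval B)
interval-unique B = Unique.++⁺ (Unique.map⁺ ℤ.+-injective (Unique.downFrom⁺ (suc B))) (Unique.map⁺ ℤ.-[1+-injective (Unique.downFrom⁺ B)) disjoint
  where
  disjoint : ∀ {z} → z ∈ map (λ n → + n) (downFrom (suc B)) × z ∈ map -[1+_] (downFrom B) → ⊥
  disjoint (p , q) with ∈-map⁻ (λ n → + n) p | ∈-map⁻ -[1+_] q
  ... | _ , _ , refl | _ , _ , ()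

box : ℕ → List (ℤ × ℤ)
box B = cartesianProduct (interval B) (interval B)

box-unique : ∀ B → Unique (box B)
box-unique B = Unique.cartesianProduct⁺ (interval-unique B) (interval-unique B)

∈-box : ∀ {B x y} → ∣ x ∣ ℕ.≤ B → ∣ y ∣ ℕ.≤ B → (x , y) ∈ box B
∈-box x≤ y≤ = ∈-cartesianProduct⁺ (∈-interval x≤) (∈-interval y≤)

∣∣-nonneg : ∀ {z} → (∀ n → z ≢ -[1+ n ]) → + ∣ z ∣ ≡ z
∣∣-nonneg {+ n}      _   = refl
∣∣-nonneg { -[1+ n ]} neg = contradiction refl (neg n)

bezout⁺ : ∀ x y → (x , y) ≢ (+ 0 , + 0) → ∃[ m ] ∃[ x′ ] ∃[ y′ ] ∃[ u ] ∃[ v ] x ≡ x′ * + suc m × y ≡ y′ * + suc m × u * x′ + v * y′ ≡ + 1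
bezout⁺ x y ≢0 = positive (bezout x y)
  where
  positive : ∃[ g ] ∃[ u ] ∃[ v ] ∃[ x′ ] ∃[ y′ ] x ≡ g * x′ × y ≡ g * y′ × u * x′ + v * y′ ≡ + 1 →
             ∃[ m ] ∃[ x′ ] ∃[ y′ ] ∃[ u ] ∃[ v ] x ≡ x′ * + suc m × y ≡ y′ * + suc m × u * x′ + v * y′ ≡ + 1
  positive (+ zero , u , v , x′ , y′ , refl , refl , eq) = contradiction refl ≢0
  positive (+ suc m , u , v , x′ , y′ , x≡ , y≡ , eq) = m , x′ , y′ , u , v , trans x≡ (ℤ.*-comm (+ suc m) x′) , trans y≡ (ℤ.*-comm (+ suc m) y′) , eq
  positive (-[1+ m ] , u , v , x′ , y′ , x≡ , y≡ , eq) = m , - x′ , - y′ , - u , - v , trans x≡ (lemma (+ suc m) x′) , trans y≡ (lemma (+ suc m) y′) , trans (lemma′ u v x′ y′) eq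
    where
    lemma : ∀ m x → - m * x ≡ - x * m
    lemma = solve-∀
    lemma′ : ∀ u v x y → - u * - x + - v * - y ≡ u * x + v * y
    lemma′ = solve-∀

value-scale : ∀ {c} (F : Form c) x y m → FormValues.value F (x * m) (y * m) ≡ m * m * FormValues.value F x y
value-scale F x y m = lemma a (+ 2 * t + + 1) k x y m
  where
  open FormValues F
  lemma : ∀ a b k x y m → a * (x * m) * (x * m) + b * (x * m) * (y * m) + k * (y * m) * (y * m) ≡ m * m * (a * x * x + b * x * y + k * y * y)
  lemma = solve-∀

Multiple : ∀ {c} → Form c → ℤ × ℤ → ℕ → ℕ → ℕ → Set
Multiple F (x , y) m b s = ∃[ x′ ] ∃[ y′ ] x ≡ x′ * + m × y ≡ y′ * + m × Match F x′ y′ b (+ s)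

multiple? : ∀ {c} (F : Form c) v m b s → Dec (1 ℕ.≤ m × Multiple F v m b s)
multiple? F (x , y) zero      b s = no λ ()
multiple? F (x , y) m@(suc _) b s with + m ∣ₛ? x | + m ∣ₛ? y
... | no ∤   | _      = no (λ (_ , x′ , y′ , x≡ , _) → ∤ (divides x′ x≡))
... | yes _  | no ∤   = no (λ (_ , x′ , y′ , _ , y≡ , _) → ∤ (divides y′ y≡))
... | yes (divides x′ x≡) | yes (divides y′ y≡) = map′ (λ mt → s≤s z≤n , x′ , y′ , x≡ , y≡ , mt)
      (λ (_ , x″ , y″ , x≡′ , y≡′ , mt) → subst₂ (λ u v → Match F u v b (+ s)) (same x″ x′ (trans (sym x≡′) x≡)) (same y″ y′ (trans (sym y≡′) y≡)) mt)
      (match? F x′ y′ b (+ s))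
  where
  same : ∀ u v → u * + m ≡ v * + m → u ≡ v
  same u v eq = ℤ.*-cancelʳ-≡ u v (+ m) eq

module Decomposition {c : ℕ} (F : Form c) where

  open FormValues F
  open Matching F

  multiple-value : ∀ {x y m b s} → Multiple F (x , y) m b s → value x y ≡ + (m ℕ.* m ℕ.* b)
  multiple-value {m = m} {b} (x′ , y′ , refl , refl , mt) = trans (value-scale F x′ y′ (+ m))
    (trans (cong (+ m * + m *_) (Match.represents mt)) (sym (trans (ℤ.pos-* (m ℕ.* m) b) (cong (_* + b) (ℤ.pos-* m m)))))

  decompose : ∀ x y → (x , y) ≢ (+ 0 , + 0) → ∃[ m ] ∃[ b ] ∃[ s ] s ℕ.< suc b × Multiple F (x , y) (suc m) (suc b) s
  decompose x y ≢0 = from-bezout (bezout⁺ x y ≢0)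
    where
    from-bezout : ∃[ m ] ∃[ x′ ] ∃[ y′ ] ∃[ u ] ∃[ v ] x ≡ x′ * + suc m × y ≡ y′ * + suc m × u * x′ + v * y′ ≡ + 1 → _
    from-bezout (m , x′ , y′ , u , v , x≡ , y≡ , uv) = from-value ∣ value x′ y′ ∣ (sym (∣∣-nonneg (value-nonneg x′ y′)))
      where
      from-value : ∀ b → value x′ y′ ≡ + b → ∃[ m ] ∃[ b ] ∃[ s ] s ℕ.< suc b × Multiple F (x , y) (suc m) (suc b) s
      from-value zero v≡0 = contradiction (cong₂ _,_ (trans x≡ (cong (_* + suc m) (proj₁ (value-zero x′ y′ v≡0)))) (trans y≡ (cong (_* + suc m) (proj₂ (value-zero x′ y′ v≡0))))) ≢0
      from-value (suc b) v≡ = m , b , s %ℕ suc b , ℤ.n%ℕd<d s (suc b) , x′ , y′ , x≡ , y≡ , match-shift (≈-sym (%ℕ-≈ s (suc b))) (proj₂ found)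
        where
        found = match-exists x′ y′ u v uv (suc b) v≡
        s = proj₁ found

  primitive-∣ : ∀ {x y x′ y′ m m₂ u v} → x ≡ x′ * m → y ≡ y′ * m → u * x′ + v * y′ ≡ + 1 → m₂ ∣ₛ x → m₂ ∣ₛ y → m₂ ∣ₛ m
  primitive-∣ {x} {y} {x′} {y′} {m} {m₂} {u} {v} refl refl uv d e = ∣-by (trans (lemma u v x′ y′ m) (trans (cong (_* m) uv) (ℤ.*-identityˡ m)))
      (Signed.∣m∣n⇒∣m+n (Signed.∣n⇒∣m*n u d) (Signed.∣n⇒∣m*n v e))
    where
    lemma : ∀ u v x y m → u * (x * m) + v * (y * m) ≡ (u * x + v * y) * m
    lemma = solve-∀

  decomposition-unique : ∀ {x y m b s m₂ b₂ s₂} → s ℕ.< suc b → s₂ ℕ.< suc b₂ →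
    Multiple F (x , y) (suc m) (suc b) s → Multiple F (x , y) (suc m₂) (suc b₂) s₂ → m₂ ≡ m × b₂ ≡ b × s₂ ≡ s
  decomposition-unique {x} {y} {m} {b} {s} {m₂} {b₂} {s₂} s<b s₂<b₂ (x′ , y′ , x≡ , y≡ , mt) (x″ , y″ , x≡₂ , y≡₂ , mt₂) =
      m₂≡m , b₂≡b , shifts b₂≡b
    where
    bez : ∀ {x y b s} (mt : Match F x y (suc b) s) → w₂ mt * x + - w₁ mt * y ≡ + 1
    bez {x} {y} mt = trans (lemma x y (w₁ mt) (w₂ mt)) (unimodular mt)
      where
      lemma : ∀ x y w v → v * x + - w * y ≡ x * v - y * w
      lemma = solve-∀
    m₂≡m : m₂ ≡ m
    m₂≡m = ℕ.suc-injective (ℕ.∣-antisym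
      (∣⇒∣ᵤ (primitive-∣ {u = w₂ mt} {v = - w₁ mt} x≡ y≡ (bez mt) (divides x″ x≡₂) (divides y″ y≡₂)))
      (∣⇒∣ᵤ (primitive-∣ {u = w₂ mt₂} {v = - w₁ mt₂} x≡₂ y≡₂ (bez mt₂) (divides x′ x≡) (divides y′ y≡))))
    same : ∀ {u v z} → z ≡ u * + suc m → z ≡ v * + suc m₂ → v ≡ u
    same {u} {v} eq eq₂ = ℤ.*-cancelʳ-≡ v u (+ suc m) (trans (cong (λ n → v * + suc n) (sym m₂≡m)) (trans (sym eq₂) eq))
    mt₂′ : Match F x′ y′ (suc b₂) (+ s₂)
    mt₂′ = subst₂ (λ u v → Match F u v (suc b₂) (+ s₂)) (same x≡ x≡₂) (same y≡ y≡₂) mt₂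
    b₂≡b : b₂ ≡ b
    b₂≡b = ℕ.suc-injective (ℤ.+-injective (trans (sym (Match.represents mt₂′)) (Match.represents mt)))
    shifts : b₂ ≡ b → s₂ ≡ s
    shifts refl = ≈⇒≡ s₂<b₂ s<b (match-shift-unique mt₂′ mt)

module Representatives {c : ℕ} (squareFree : ∀ d → d ℕ.* d ℕ.∣ conductor c → d ≡ 1) (1≤c : 1 ℕ.≤ c)
  (h : ℕ) (F : Fin h → Form c)
  (represented : ∀ (G : Form c) → ∃[ j ] ∃[ x ] ∃[ y ] Match (F j) x y (suc (Form.lead G)) (Form.shift G))
  (inequivalent : ∀ (G : Form c) {i j x y x′ y′} → Match (F i) x y (suc (Form.lead G)) (Form.shift G) → Match (F j) x′ y′ (suc (Form.lead G)) (Form.shift G) → i ≡ j)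
  where

  private
    Q : Fin h → ℤ × ℤ → ℕ
    Q j (x , y) = ∣ FormValues.value (F j) x y ∣

  module _ (Y : ℕ) (w : ℕ → ℤ) (w-vanishes : ∀ n → Y ℕ.< n → w n ≡ + 0)
           (B : Fin h → ℕ) (box-large : ∀ j x y → Q j (x , y) ℕ.≤ Y → ∣ x ∣ ℕ.≤ B j × ∣ y ∣ ℕ.≤ B j) where

    private
      term : Fin h → ℤ × ℤ → ℕ → ℕ → ℕ → ℤ
      term j v m b s = 𝟙 (multiple? (F j) v m b s) * w (m ℕ.* m ℕ.* b)

      total : Fin h → ℤ × ℤ → ℤ
      total j v = ∑ (1⋯ Y) (λ m → ∑ (1⋯ Y) (λ b → ∑< b (term j v m b)))

      term-no : ∀ {j v m b s} → ¬ (1 ℕ.≤ m × Multiple (F j) v m b s) → term j v m b s ≡ + 0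
      term-no {j} {v} {m} {b} {s} ¬mt = cong (_* w (m ℕ.* m ℕ.* b)) (𝟙-no (multiple? (F j) v m b s) ¬mt)

      total-nonzero : ∀ j v → v ≢ (+ 0 , + 0) → w (Q j v) ≡ total j v
      total-nonzero j v@(x , y) v≢0 = go (Decomposition.decompose (F j) x y v≢0)
        where
        go : ∃[ m ] ∃[ b ] ∃[ s ] s ℕ.< suc b × Multiple (F j) v (suc m) (suc b) s → w (Q j v) ≡ total j v
        go (m , b , s , s<b , mt) with suc m ℕ.* suc m ℕ.* suc b ℕ.≤? Y
        ... | yes le = sym (begin
              total j v
                ≡⟨ ∑-single (λ m′ → ∑ (1⋯ Y) (λ b′ → ∑< b′ (term j v m′ b′))) (1⋯-unique Y) (∈1⋯ {Y} {suc m} (s≤s z≤n) (ℕ.≤-trans (ℕ.≤-trans (ℕ.m≤m*n (suc m) (suc m)) (ℕ.m≤m*n (suc m ℕ.* suc m) (suc b))) le))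
                     (λ {m′} _ m′≢ → ∑-zero (1⋯ Y) (λ {b′} _ → ∑-zero (downFrom b′) (λ {s′} s′∈ → term-no (λ (_ , mt′) → m′≢ (proj₁ (unique m′ b′ s′ (∈-downFrom⁻ s′∈) mt′)))))) ⟩
              ∑ (1⋯ Y) (λ b′ → ∑< b′ (term j v (suc m) b′))
                ≡⟨ ∑-single (λ b′ → ∑< b′ (term j v (suc m) b′)) (1⋯-unique Y) (∈1⋯ {Y} {suc b} (s≤s z≤n) (ℕ.≤-trans (ℕ.m≤n*m (suc b) (suc m ℕ.* suc m)) le))
                     (λ {b′} _ b′≢ → ∑-zero (downFrom b′) (λ {s′} s′∈ → term-no (λ (_ , mt′) → b′≢ (proj₁ (proj₂ (unique (suc m) b′ s′ (∈-downFrom⁻ s′∈) mt′)))))) ⟩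
              ∑< (suc b) (term j v (suc m) (suc b))
                ≡⟨ ∑-single (term j v (suc m) (suc b)) (Unique.downFrom⁺ (suc b)) (∈-downFrom⁺ s<b)
                     (λ {s′} s′∈ s′≢ → term-no (λ (_ , mt′) → s′≢ (proj₂ (proj₂ (unique (suc m) (suc b) s′ (∈-downFrom⁻ s′∈) mt′))))) ⟩
              term j v (suc m) (suc b) s
                ≡⟨ trans (cong (_* w (suc m ℕ.* suc m ℕ.* suc b)) (𝟙-yes (multiple? (F j) v (suc m) (suc b) s) (s≤s z≤n , mt))) (ℤ.*-identityˡ _) ⟩
              w (suc m ℕ.* suc m ℕ.* suc b)
                ≡⟨ cong w (sym (cong ∣_∣ (Decomposition.multiple-value (F j) mt))) ⟩
              w (Q j v) ∎)
          where
          open ≡-Reasoning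
          unique : ∀ m′ b′ s′ → s′ ℕ.< b′ → Multiple (F j) v m′ b′ s′ → m′ ≡ suc m × b′ ≡ suc b × s′ ≡ s
          unique zero b′ s′ _ (x′ , y′ , x≡ , y≡ , _) = contradiction (cong₂ _,_ (trans x≡ (ℤ.*-zeroʳ x′)) (trans y≡ (ℤ.*-zeroʳ y′))) v≢0
          unique (suc m′) (suc b′) s′ s′<b′ mt′ = cong suc (proj₁ same) , cong suc (proj₁ (proj₂ same)) , proj₂ (proj₂ same)
            where
            same = Decomposition.decomposition-unique (F j) s<b s′<b′ mt mt′
        ... | no nle = trans (w-vanishes (Q j v) (subst (Y ℕ.<_) (sym (cong ∣_∣ (Decomposition.multiple-value (F j) mt))) (ℕ.≰⇒> nle)))
              (sym (∑-zero (1⋯ Y) (λ {m′} _ → ∑-zero (1⋯ Y) (λ {b′} _ → ∑-zero (downFrom b′) (λ {s′} _ → vanish m′ b′ s′)))))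
          where
          vanish : ∀ m′ b′ s′ → term j v m′ b′ s′ ≡ + 0
          vanish m′ b′ s′ with multiple? (F j) v m′ b′ s′
          ... | no ¬mt = cong (_* w (m′ ℕ.* m′ ℕ.* b′)) (𝟙-no (no ¬mt) ¬mt)
          ... | yes (1≤m′ , mt′) = trans (cong (𝟙 (yes (1≤m′ , mt′)) *_) (w-vanishes (m′ ℕ.* m′ ℕ.* b′)
                  (subst (Y ℕ.<_) (ℤ.+-injective (trans (sym (Decomposition.multiple-value (F j) mt)) (Decomposition.multiple-value (F j) mt′))) (ℕ.≰⇒> nle)))) (ℤ.*-zeroʳ (𝟙 (yes (1≤m′ , mt′))))

      total-zero : ∀ j → total j (+ 0 , + 0) ≡ + 0
      total-zero j = ∑-zero (1⋯ Y) (λ {m} _ → ∑-zero (1⋯ Y) (λ {b} b∈ → ∑-zero (downFrom b) (λ {s} _ → term-no {j} {+ 0 , + 0} {m} {b} {s} (λ (1≤m , mt) → impossible m b 1≤m (∈1⋯-≥1 b∈) (Decomposition.multiple-value (F j) mt)))))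
        where
        zero-value : FormValues.value (F j) (+ 0) (+ 0) ≡ + 0
        zero-value = lemma (FormValues.a (F j)) (+ 2 * FormValues.t (F j) + + 1) (FormValues.k (F j))
          where
          lemma : ∀ a b k → a * + 0 * + 0 + b * + 0 * + 0 + k * + 0 * + 0 ≡ + 0
          lemma = solve-∀
        impossible : ∀ m b → 1 ℕ.≤ m → 1 ℕ.≤ b → FormValues.value (F j) (+ 0) (+ 0) ≢ + (m ℕ.* m ℕ.* b)
        impossible (suc m) (suc b) _ _ eq = contradiction (ℤ.+-injective (trans (sym zero-value) eq)) λ ()

      box-sum : ∀ j → ∑ (box (B j)) (λ v → w (Q j v)) ≡ w 0 + ∑ (box (B j)) (total j)
      box-sum j = trans (split (box (B j)) (box-unique (B j)) (∈-box {B j} {+ 0} {+ 0} z≤n z≤n)) (cong (λ z → w z + ∑ (box (B j)) (total j)) (cong ∣_∣ (lemma (FormValues.a (F j)) (+ 2 * FormValues.t (F j) + + 1) (FormValues.k (F j)))))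
        where
        lemma : ∀ a b k → a * + 0 * + 0 + b * + 0 * + 0 + k * + 0 * + 0 ≡ + 0
        lemma = solve-∀
        move : ∀ {a b} → a - b ≡ w (Q j (+ 0 , + 0)) → a ≡ w (Q j (+ 0 , + 0)) + b
        move {a} {b} eq = trans (solved a b) (cong (_+ b) eq)
          where
          solved : ∀ a b → a ≡ a - b + b
          solved = solve-∀
        split : ∀ xs → Unique xs → (+ 0 , + 0) ∈ xs → ∑ xs (λ v → w (Q j v)) ≡ w (Q j (+ 0 , + 0)) + ∑ xs (total j)
        split xs uniq 0∈ = move (trans (sym (∑-- xs (λ v → w (Q j v)) (total j)))
          (trans (∑-single {x = + 0 , + 0} (λ v → w (Q j v) - total j v) uniq 0∈ (λ {v} _ v≢0 → ℤ.i≡j⇒i-j≡0 (total-nonzero j v v≢0)))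
            (trans (cong (λ z → w (Q j (+ 0 , + 0)) - z) (total-zero j)) (ℤ.+-identityʳ _))))

      matches : ℕ → ℕ → ℕ → ℤ
      matches m b s = ∑ (allFin h) (λ j → ∑ (box (B j)) (λ v → 𝟙 (multiple? (F j) v m b s)))

      matches-count : ∀ m b s → s ℕ.< suc b → suc m ℕ.* suc m ℕ.* suc b ℕ.≤ Y → matches (suc m) (suc b) s ≡ + 2 * 𝟙 (+ suc b ∣ₛ? norm c (+ s))
      matches-count m b s s<b le = cases (+ suc b ∣ₛ? norm c (+ s))
        where
        count : Fin h → ℤ
        count j = ∑ (box (B j)) (λ v → 𝟙 (multiple? (F j) v (suc m) (suc b) s))
        cases : (d : Dec (+ suc b ∣ₛ norm c (+ s))) → matches (suc m) (suc b) s ≡ + 2 * 𝟙 d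
        cases (no ∤) = trans (∑-zero (allFin h) (λ {j} _ → ∑-zero (box (B j)) (λ {v} _ → 𝟙-no (multiple? (F j) v (suc m) (suc b) s) (λ (_ , _ , _ , _ , _ , mt) → ∤ (Matching.∣norm (F j) mt)))))
          (sym (cong (+ 2 *_) (𝟙-no (no ∤) ∤)))
        cases (yes d@(divides k norm≡)) = trans (trans (∑-single {x = j₀} count (Unique.allFin⁺ h) (∈-allFin j₀)
            (λ {j} _ j≢j₀ → ∑-zero (box (B j)) (λ {v} _ → 𝟙-no (multiple? (F j) v (suc m) (suc b) s) (λ (_ , _ , _ , _ , _ , mt) → j≢j₀ (inequivalent G mt mt₀)))))
            (∑-pair {x = v₀} {y = v₁} (λ v → 𝟙 (multiple? (F j₀) v (suc m) (suc b) s)) (box-unique (B j₀)) v₀∈ v₁∈ v₀≢v₁ others))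
          (trans (cong₂ _+_ (𝟙-yes (multiple? (F j₀) v₀ (suc m) (suc b) s) (s≤s z≤n , mult₀)) (𝟙-yes (multiple? (F j₀) v₁ (suc m) (suc b) s) (s≤s z≤n , mult₁)))
            (sym (cong (+ 2 *_) (𝟙-yes (yes d) d))))
          where
          G : Form c
          G = record { lead = b ; shift = + s ; last = k ; norm≡ = norm≡ }
          j₀ = proj₁ (represented G)
          x₀ = proj₁ (proj₂ (represented G))
          y₀ = proj₁ (proj₂ (proj₂ (represented G)))
          mt₀ : Match (F j₀) x₀ y₀ (suc b) (+ s)
          mt₀ = proj₂ (proj₂ (proj₂ (represented G)))
          v₀ v₁ : ℤ × ℤ
          v₀ = x₀ * + suc m , y₀ * + suc m
          v₁ = - x₀ * + suc m , - y₀ * + suc m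
          mult₀ : Multiple (F j₀) v₀ (suc m) (suc b) s
          mult₀ = x₀ , y₀ , refl , refl , mt₀
          mult₁ : Multiple (F j₀) v₁ (suc m) (suc b) s
          mult₁ = - x₀ , - y₀ , refl , refl , Matching.match-neg (F j₀) mt₀
          inside : ∀ {x y} → Multiple (F j₀) (x , y) (suc m) (suc b) s → (x , y) ∈ box (B j₀)
          inside {x} {y} mt = ∈-box (proj₁ large) (proj₂ large)
            where
            large = box-large j₀ x y (ℕ.≤-trans (ℕ.≤-reflexive (cong ∣_∣ (Decomposition.multiple-value (F j₀) mt))) le)
          v₀∈ : v₀ ∈ box (B j₀)
          v₀∈ = inside mult₀
          v₁∈ : v₁ ∈ box (B j₀)
          v₁∈ = inside mult₁
          self-neg : ∀ z → z * + suc m ≡ - z * + suc m → z ≡ + 0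
          self-neg z eq = ∣-cancel {+ 2 * + suc m} {+ 0} z (λ ()) (trans (trans (lemma z (+ suc m)) (cong (λ e → e + z * + suc m) eq)) (trans (lemma′ z (+ suc m)) (sym (ℤ.*-zeroʳ (+ 2 * + suc m)))))
            where
            lemma : ∀ z m → + 2 * m * z ≡ z * m + z * m
            lemma = solve-∀
            lemma′ : ∀ z m → - z * m + z * m ≡ + 0
            lemma′ = solve-∀
          v₀≢v₁ : v₀ ≢ v₁
          v₀≢v₁ eq = contradiction (trans (sym (Match.represents mt₀)) (trans (cong₂ (FormValues.value (F j₀)) (self-neg x₀ (cong proj₁ eq)) (self-neg y₀ (cong proj₂ eq)))
              (lemma (FormValues.a (F j₀)) (+ 2 * FormValues.t (F j₀) + + 1) (FormValues.k (F j₀))))) λ ()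
            where
            lemma : ∀ a b k → a * + 0 * + 0 + b * + 0 * + 0 + k * + 0 * + 0 ≡ + 0
            lemma = solve-∀
          others : ∀ {v} → v ∈ box (B j₀) → v ≢ v₀ → v ≢ v₁ → 𝟙 (multiple? (F j₀) v (suc m) (suc b) s) ≡ + 0
          others {v} _ v≢v₀ v≢v₁ = 𝟙-no (multiple? (F j₀) v (suc m) (suc b) s) impossible
            where
            impossible : ¬ (1 ℕ.≤ suc m × Multiple (F j₀) v (suc m) (suc b) s)
            impossible (_ , x′ , y′ , x≡ , y≡ , mt) = [ (λ (p , q) → v≢v₀ (cong₂ _,_ (trans x≡ (cong (_* + suc m) p)) (trans y≡ (cong (_* + suc m) q))))
                                                      , (λ (p , q) → v≢v₁ (cong₂ _,_ (trans x≡ (cong (_* + suc m) p)) (trans y≡ (cong (_* + suc m) q)))) ]′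
              (Matching.match-unique (F j₀) squareFree 1≤c mt₀ mt)

      matches-weighted : ∀ m b s → 1 ℕ.≤ m → s ℕ.< b → matches m b s * w (m ℕ.* m ℕ.* b) ≡ + 2 * 𝟙 (+ b ∣ₛ? norm c (+ s)) * w (m ℕ.* m ℕ.* b)
      matches-weighted (suc m) (suc b) s _ s<b with suc m ℕ.* suc m ℕ.* suc b ℕ.≤? Y
      ... | yes le = cong (_* w (suc m ℕ.* suc m ℕ.* suc b)) (matches-count m b s s<b le)
      ... | no nle = trans (cong (matches (suc m) (suc b) s *_) vanish) (trans (ℤ.*-zeroʳ (matches (suc m) (suc b) s)) (sym (trans (cong (+ 2 * 𝟙 (+ suc b ∣ₛ? norm c (+ s)) *_) vanish) (ℤ.*-zeroʳ (+ 2 * 𝟙 (+ suc b ∣ₛ? norm c (+ s)))))))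
        where
        vanish = w-vanishes (suc m ℕ.* suc m ℕ.* suc b) (ℕ.≰⇒> nle)

    representation-sum : ∑ (allFin h) (λ j → ∑ (box (B j)) (λ v → w (Q j v))) ≡
      + h * w 0 + + 2 * ∑ (1⋯ Y) (λ m → ∑ (1⋯ Y) (λ b → rootCount c b * w (m ℕ.* m ℕ.* b)))
    representation-sum = begin
      ∑ (allFin h) (λ j → ∑ (box (B j)) (λ v → w (Q j v)))
        ≡⟨ ∑-ext (allFin h) box-sum ⟩
      ∑ (allFin h) (λ j → w 0 + ∑ (box (B j)) (total j))
        ≡⟨ ∑-+ (allFin h) (λ _ → w 0) (λ j → ∑ (box (B j)) (total j)) ⟩
      ∑ (allFin h) (λ _ → w 0) + ∑ (allFin h) (λ j → ∑ (box (B j)) (total j))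
        ≡⟨ cong₂ _+_ (trans (∑-constant (allFin h) (w 0)) (cong (λ n → + n * w 0) (length-tabulate {n = h} (λ i → i)))) swap-all ⟩
      + h * w 0 + + 2 * ∑ (1⋯ Y) (λ m → ∑ (1⋯ Y) (λ b → rootCount c b * w (m ℕ.* m ℕ.* b))) ∎
      where
      open ≡-Reasoning
      ∑-constant : ∀ {A : Set} (xs : List A) z → ∑ xs (λ _ → z) ≡ + length xs * z
      ∑-constant []       z = refl
      ∑-constant (x ∷ xs) z = trans (cong (_+_ z) (∑-constant xs z)) (sym (trans (cong (_* z) (ℤ.pos-+ 1 (length xs))) (lemma (+ length xs) z)))
        where
        lemma : ∀ n z → (+ 1 + n) * z ≡ z + n * z
        lemma = solve-∀
      swap₃ : ∀ {A : Set} (xs : List A) (f : A → ℕ → ℕ → ℕ → ℤ) →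
        ∑ xs (λ x → ∑ (1⋯ Y) (λ m → ∑ (1⋯ Y) (λ b → ∑< b (f x m b)))) ≡ ∑ (1⋯ Y) (λ m → ∑ (1⋯ Y) (λ b → ∑< b (λ s → ∑ xs (λ x → f x m b s))))
      swap₃ xs f = trans (∑-swap xs (1⋯ Y) _) (∑-ext (1⋯ Y) (λ m → trans (∑-swap xs (1⋯ Y) _) (∑-ext (1⋯ Y) (λ b → ∑-swap xs (downFrom b) _))))
      swap-all : ∑ (allFin h) (λ j → ∑ (box (B j)) (total j)) ≡ + 2 * ∑ (1⋯ Y) (λ m → ∑ (1⋯ Y) (λ b → rootCount c b * w (m ℕ.* m ℕ.* b)))
      swap-all = begin
        ∑ (allFin h) (λ j → ∑ (box (B j)) (total j))
          ≡⟨ ∑-ext (allFin h) (λ j → swap₃ (box (B j)) (term j)) ⟩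
        ∑ (allFin h) (λ j → ∑ (1⋯ Y) (λ m → ∑ (1⋯ Y) (λ b → ∑< b (λ s → ∑ (box (B j)) (λ v → term j v m b s)))))
          ≡⟨ swap₃ (allFin h) (λ j m b s → ∑ (box (B j)) (λ v → term j v m b s)) ⟩
        ∑ (1⋯ Y) (λ m → ∑ (1⋯ Y) (λ b → ∑< b (λ s → ∑ (allFin h) (λ j → ∑ (box (B j)) (λ v → term j v m b s)))))
          ≡⟨ ∑-cong (1⋯ Y) (λ {m} m∈ → ∑-cong (1⋯ Y) (λ {b} _ → trans (∑-cong (downFrom b) (λ {s} s∈ →
               trans (trans (∑-ext (allFin h) (λ j → ∑-*ʳ (box (B j)) (w (m ℕ.* m ℕ.* b)) (λ v → 𝟙 (multiple? (F j) v m b s)))) (∑-*ʳ (allFin h) (w (m ℕ.* m ℕ.* b)) _))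
                 (trans (matches-weighted m b s (∈1⋯-≥1 m∈) (∈-downFrom⁻ s∈)) (lemma (𝟙 (+ b ∣ₛ? norm c (+ s))) (w (m ℕ.* m ℕ.* b))))))
               (trans (∑-*ˡ (downFrom b) (+ 2) (λ s → 𝟙 (+ b ∣ₛ? norm c (+ s)) * w (m ℕ.* m ℕ.* b))) (cong (+ 2 *_) (∑-*ʳ (downFrom b) (w (m ℕ.* m ℕ.* b)) (λ s → 𝟙 (+ b ∣ₛ? norm c (+ s)))))))) ⟩
        ∑ (1⋯ Y) (λ m → ∑ (1⋯ Y) (λ b → + 2 * (rootCount c b * w (m ℕ.* m ℕ.* b))))
          ≡⟨ trans (∑-ext (1⋯ Y) (λ m → ∑-*ˡ (1⋯ Y) (+ 2) _)) (∑-*ˡ (1⋯ Y) (+ 2) _) ⟩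
        + 2 * ∑ (1⋯ Y) (λ m → ∑ (1⋯ Y) (λ b → rootCount c b * w (m ℕ.* m ℕ.* b))) ∎
        where
        lemma : ∀ i w → + 2 * i * w ≡ + 2 * (i * w)
        lemma = solve-∀

-- Alternating sums of truncated quartics

≤-by : ∀ {x y} n → y ≡ x + + n → x ≤ y
≤-by {x} n eq = subst (x ≤_) (sym eq) (ℤ.i≤i+j x (+ n))

abs-≤ : ∀ {z n} → z ≤ + n → - z ≤ + n → ∣ z ∣ ℕ.≤ n
abs-≤ {+ m}      le _  = ℤ.drop‿+≤+ le
abs-≤ { -[1+ m ]} _  le = ℤ.drop‿+≤+ le

≤-∣∣ : ∀ z → z ≤ + ∣ z ∣
≤-∣∣ (+ n)    = ℤ.≤-refl
≤-∣∣ -[1+ n ] = -≤+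

abs-between : ∀ {p z q n} → p ≤ z → z ≤ q → ∣ p ∣ ℕ.≤ n → ∣ q ∣ ℕ.≤ n → ∣ z ∣ ℕ.≤ n
abs-between {p} {z} {q} p≤z z≤q p≤n q≤n = abs-≤ (ℤ.≤-trans z≤q (ℤ.≤-trans (≤-∣∣ q) (+≤+ q≤n)))
  (ℤ.≤-trans (ℤ.neg-mono-≤ p≤z) (ℤ.≤-trans (≤-∣∣ (- p)) (+≤+ (subst (ℕ._≤ _) (sym (ℤ.∣-i∣≡∣i∣ p)) p≤n))))

square-cancel-≤ : ∀ m n → m ℕ.* m ℕ.≤ n ℕ.* n → m ℕ.≤ n
square-cancel-≤ m n le with m ℕ.≤? n
... | yes m≤n = m≤n
... | no m≰n  = contradiction le (ℕ.<⇒≱ (ℕ.*-mono-< (ℕ.≰⇒> m≰n) (ℕ.≰⇒> m≰n)))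

module Alternating (h₀ : ℕ) (T : ℤ) where

  h : ℤ
  h = + suc h₀

  record Inside (z : ℤ) : Set where
    constructor inside
    field square≤ : z * z ≤ T

  open Inside

  inside? : ∀ z → Dec (Inside z)
  inside? z = map′ inside square≤ (z * z ℤ.≤? T)

  quartic : ℤ → ℤ
  quartic z = (T - z * z) * (T - z * z)

  truncated : ℤ → ℤ
  truncated z = 𝟙 (inside? z) * quartic z

  truncated-inside : ∀ {z} → Inside z → truncated z ≡ quartic z
  truncated-inside {z} i = trans (cong (_* quartic z) (𝟙-yes (inside? z) i)) (ℤ.*-identityˡ (quartic z))

  truncated-outside : ∀ {z} → ¬ Inside z → truncated z ≡ + 0
  truncated-outside {z} o = cong (_* quartic z) (𝟙-no (inside? z) o)

  truncated-neg : ∀ z → truncated (- z) ≡ truncated z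
  truncated-neg z with inside? z
  ... | yes i = trans (truncated-inside (inside (subst (_≤ T) (sym (even z)) (square≤ i)))) (trans (cong (λ s → (T - s) * (T - s)) (even z)) (sym (trans (cong (_* quartic z) (𝟙-yes (yes i) i)) (ℤ.*-identityˡ (quartic z)))))
    where
    even : ∀ z → - z * - z ≡ z * z
    even = solve-∀
  ... | no o = trans (truncated-outside (λ i → o (inside (subst (_≤ T) (even z) (square≤ i))))) (sym (cong (_* quartic z) (𝟙-no (no o) o)))
    where
    even : ∀ z → - z * - z ≡ z * z
    even = solve-∀

  alternating : ℕ → ℤ → ℤ
  alternating zero    b = + 0
  alternating (suc n) b = truncated b - alternating n (b + + 2 * h)

  -- (1/2) antidifference(w) is the polynomial solution of G(z - h) + G(z + h) = (T - z²)².
  antidifference : ℤ → ℤ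
  antidifference w = (T - w * w) * (T - w * w) - + 2 * h * h * (+ 3 * w * w - T) + + 5 * h * h * h * h

  antidifference-step : ∀ z → antidifference (z - h) + antidifference (z + h) ≡ + 2 * quartic z
  antidifference-step z = lemma T z h
    where
    lemma : ∀ T w h → ((T - (w - h) * (w - h)) * (T - (w - h) * (w - h)) - + 2 * h * h * (+ 3 * (w - h) * (w - h) - T) + + 5 * h * h * h * h) +
      ((T - (w + h) * (w + h)) * (T - (w + h) * (w + h)) - + 2 * h * h * (+ 3 * (w + h) * (w + h) - T) + + 5 * h * h * h * h) ≡ + 2 * ((T - w * w) * (T - w * w))
    lemma = solve-∀

  antidifference-neg : ∀ w → antidifference (- w) ≡ antidifference w
  antidifference-neg w = lemma T w h
    where
    lemma : ∀ T w h → (T - - w * - w) * (T - - w * - w) - + 2 * h * h * (+ 3 * - w * - w - T) + + 5 * h * h * h * h ≡ (T - w * w) * (T - w * w) - + 2 * h * h * (+ 3 * w * w - T) + + 5 * h * h * h * h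
    lemma = solve-∀

  Boundary : ℤ → Set
  Boundary w = (Inside (w - h) × ¬ Inside (w + h)) ⊎ (Inside (w + h) × ¬ Inside (w - h))

  module Bounds (C : ℕ) (antidifference-bound : ∀ w → Boundary w → ∣ antidifference w ∣ ℕ.≤ C) where

    shift : ∀ b → b + + 2 * h ≡ b + h + h
    shift b = lemma b h
      where
      lemma : ∀ b h → b + + 2 * h ≡ b + h + h
      lemma = solve-∀

    unshift : ∀ b → b ≡ b + h - h
    unshift b = lemma b h
      where
      lemma : ∀ b h → b ≡ b + h - h
      lemma = solve-∀

    leaving : ∀ b → Inside b → ¬ Inside (b + + 2 * h) → ∣ antidifference (b + h) ∣ ℕ.≤ C
    leaving b i o = antidifference-bound (b + h) (inj₁ (subst Inside (unshift b) i , o ∘ subst Inside (sym (shift b))))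

    entering : ∀ b → ¬ Inside b → Inside (b + + 2 * h) → ∣ antidifference (b + h) ∣ ℕ.≤ C
    entering b o i = antidifference-bound (b + h) (inj₂ (subst Inside (shift b) i , o ∘ subst Inside (sym (unshift b))))

    beyond : ∀ n k → ¬ Inside (+ k) → alternating n (+ k) ≡ + 0
    beyond zero    k o = refl
    beyond (suc n) k o = cong₂ _-_ (truncated-outside o) (beyond n (k ℕ.+ 2 ℕ.* suc h₀) (λ i → o (inside (ℤ.≤-trans (subst₂ _≤_ (ℤ.pos-* k k) (ℤ.pos-* (k ℕ.+ 2 ℕ.* suc h₀) (k ℕ.+ 2 ℕ.* suc h₀))
      (+≤+ (ℕ.*-mono-≤ (ℕ.m≤m+n k (2 ℕ.* suc h₀)) (ℕ.m≤m+n k (2 ℕ.* suc h₀))))) (square≤ i)))))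

    -- Leaving the region to the right, one ends at a positive point.
    exit-positive : ∀ b → Inside b → ¬ Inside (b + + 2 * h) → ∃[ k ] b + + 2 * h ≡ + k
    exit-positive b i o = nonneg (b + + 2 * h) refl
      where
      nonneg : ∀ z → b + + 2 * h ≡ z → ∃[ k ] b + + 2 * h ≡ + k
      nonneg (+ k)    eq = k , eq
      nonneg -[1+ k ] eq = contradiction (inside (ℤ.≤-trans (≤-by (4 ℕ.* suc h₀ ℕ.* (suc k ℕ.+ suc h₀)) (trans (lemma b h)
          (trans (cong (λ z → (b + + 2 * h) * (b + + 2 * h) + + 4 * h * (- z + h)) eq) (cong (_+_ ((b + + 2 * h) * (b + + 2 * h))) (sym (trans (ℤ.pos-* (4 ℕ.* suc h₀) (suc k ℕ.+ suc h₀)) (cong (_* + (suc k ℕ.+ suc h₀)) (ℤ.pos-* 4 (suc h₀))))))))) (square≤ i))) o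
        where
        lemma : ∀ b h → b * b ≡ (b + + 2 * h) * (b + + 2 * h) + + 4 * h * (- (b + + 2 * h) + h)
        lemma = solve-∀

    from-inside : ∀ n b → Inside b → ¬ Inside (b + + 2 * h * + n) → ∣ + 2 * alternating n b - antidifference (b - h) ∣ ℕ.≤ C
    from-inside zero    b i o = contradiction (subst Inside (sym (trans (cong (_+_ b) (ℤ.*-zeroʳ (+ 2 * h))) (ℤ.+-identityʳ b))) i) o
    from-inside (suc n) b i o with inside? (b + + 2 * h)
    ... | yes i′ = subst (ℕ._≤ C) (trans (sym (ℤ.∣-i∣≡∣i∣ (+ 2 * alternating n (b + + 2 * h) - antidifference (b + h)))) (cong ∣_∣ (sym (step (alternating n (b + + 2 * h))))))
                     (subst (λ w → ∣ + 2 * alternating n (b + + 2 * h) - antidifference w ∣ ℕ.≤ C) (trans (cong (_- h) (shift b)) (sym (unshift (b + h))))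
                       (from-inside n (b + + 2 * h) i′ (o ∘ subst Inside (lemma b h n))))
      where
      lemma : ∀ b h n → b + + 2 * h + + 2 * h * + n ≡ b + + 2 * h * + suc n
      lemma b h n = trans (solved b h (+ n)) (cong (λ m → b + + 2 * h * m) (sym (ℤ.pos-+ 1 n)))
        where
        solved : ∀ b h n → b + + 2 * h + + 2 * h * n ≡ b + + 2 * h * (+ 1 + n)
        solved = solve-∀
      step : ∀ r → + 2 * (truncated b - r) - antidifference (b - h) ≡ - (+ 2 * r - antidifference (b + h))
      step r = trans (cong (λ u → + 2 * (u - r) - antidifference (b - h)) (truncated-inside i)) (trans (solved (quartic b) r (antidifference (b - h)))
        (trans (cong (λ u → u - + 2 * r - antidifference (b - h)) (sym (antidifference-step b))) (solved′ (antidifference (b - h)) (antidifference (b + h)) r)))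
        where
        solved : ∀ q r p → + 2 * (q - r) - p ≡ + 2 * q - + 2 * r - p
        solved = solve-∀
        solved′ : ∀ p p′ r → p + p′ - + 2 * r - p ≡ - (+ 2 * r - p′)
        solved′ = solve-∀
    ... | no o′ = subst (λ z → ∣ z ∣ ℕ.≤ C) (sym last-step) (leaving b i o′)
      where
      rest : alternating n (b + + 2 * h) ≡ + 0
      rest = trans (cong (alternating n) (proj₂ (exit-positive b i o′))) (beyond n (proj₁ (exit-positive b i o′)) (o′ ∘ subst Inside (sym (proj₂ (exit-positive b i o′)))))
      last-step : + 2 * (truncated b - alternating n (b + + 2 * h)) - antidifference (b - h) ≡ antidifference (b + h)
      last-step = trans (cong₂ (λ u v → + 2 * (u - v) - antidifference (b - h)) (truncated-inside i) rest) (trans (solved (quartic b) (antidifference (b - h)))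
        (trans (cong (_- antidifference (b - h)) (sym (antidifference-step b))) (solved′ (antidifference (b - h)) (antidifference (b + h)))))
        where
        solved : ∀ q p → + 2 * (q - + 0) - p ≡ + 2 * q - p
        solved = solve-∀
        solved′ : ∀ p p′ → p + p′ - p ≡ p′
        solved′ = solve-∀

    from-outside : ∀ n b → ¬ Inside b → ¬ Inside (b + + 2 * h * + n) → ∣ + 2 * alternating n b ∣ ℕ.≤ C ℕ.+ C
    from-outside zero    b o _ = z≤n
    from-outside (suc n) b o e = subst (ℕ._≤ C ℕ.+ C) (trans (sym (ℤ.∣-i∣≡∣i∣ (+ 2 * r))) (cong ∣_∣ (sym skip))) (cases (inside? (b + + 2 * h)))
      where
      r = alternating n (b + + 2 * h)
      skip : + 2 * (truncated b - r) ≡ - (+ 2 * r)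
      skip = trans (cong (λ u → + 2 * (u - r)) (truncated-outside o)) (lemma r)
        where
        lemma : ∀ r → + 2 * (+ 0 - r) ≡ - (+ 2 * r)
        lemma = solve-∀
      end : b + + 2 * h + + 2 * h * + n ≡ b + + 2 * h * + suc n
      end = trans (solved b h (+ n)) (cong (λ m → b + + 2 * h * m) (sym (ℤ.pos-+ 1 n)))
        where
        solved : ∀ b h n → b + + 2 * h + + 2 * h * n ≡ b + + 2 * h * (+ 1 + n)
        solved = solve-∀
      cases : Dec (Inside (b + + 2 * h)) → ∣ + 2 * r ∣ ℕ.≤ C ℕ.+ C
      cases (no o′) = from-outside n (b + + 2 * h) o′ (e ∘ subst Inside end)
      cases (yes i) = ℕ.≤-trans (ℕ.≤-reflexive (cong ∣_∣ (lemma (+ 2 * r) (antidifference (b + + 2 * h - h))))) (ℕ.≤-trans (ℤ.∣i+j∣≤∣i∣+∣j∣ (+ 2 * r - antidifference (b + + 2 * h - h)) (antidifference (b + + 2 * h - h)))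
          (ℕ.+-mono-≤ (from-inside n (b + + 2 * h) i (e ∘ subst Inside end)) (subst (λ w → ∣ antidifference w ∣ ℕ.≤ C) (trans (unshift (b + h)) (cong (_- h) (sym (shift b)))) (entering b o i))))
        where
        lemma : ∀ u p → u ≡ u - p + p
        lemma = solve-∀

    two-sided : ∀ n b → ¬ Inside (b + + 2 * h * + suc n) → ¬ Inside (b - + 2 * h * + suc n) →
                ∣ + 2 * (alternating (suc n) b - alternating n (+ 2 * h - b)) ∣ ℕ.≤ 4 ℕ.* C
    two-sided n b right left = ℕ.≤-trans (ℕ.≤-reflexive (cong ∣_∣ (ℤ.*-distribˡ-+ (+ 2) r (- l) ■ cong (_+_ (+ 2 * r)) (sym (ℤ.neg-distribʳ-* (+ 2) l))))) (cases (inside? b) (inside? (+ 2 * h - b)))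
      where
      infixl 2 _■_
      _■_ : ∀ {x y z : ℤ} → x ≡ y → y ≡ z → x ≡ z
      _■_ = trans
      r = alternating (suc n) b
      l = alternating n (+ 2 * h - b)
      left′ : ¬ Inside (+ 2 * h - b + + 2 * h * + n)
      left′ (inside i) = left (inside (subst (_≤ T) (trans (cong (λ m → (+ 2 * h - b + + 2 * h * m) * (+ 2 * h - b + + 2 * h * m)) refl) (trans (solved h b (+ n)) (cong (λ m → (b - + 2 * h * m) * (b - + 2 * h * m)) (sym (ℤ.pos-+ 1 n))))) i))
        where
        solved : ∀ h b n → (+ 2 * h - b + + 2 * h * n) * (+ 2 * h - b + + 2 * h * n) ≡ (b - + 2 * h * (+ 1 + n)) * (b - + 2 * h * (+ 1 + n))
        solved = solve-∀
      g = antidifference (b - h)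
      g≡ : antidifference (+ 2 * h - b - h) ≡ g
      g≡ = trans (cong antidifference (lemma h b)) (antidifference-neg (b - h))
        where
        lemma : ∀ h b → + 2 * h - b - h ≡ - (b - h)
        lemma = solve-∀
      flip : ∀ {b} → - (+ 2 * h - b) + + 2 * h ≡ b
      flip {b} = lemma h b
        where
        lemma : ∀ h b → - (+ 2 * h - b) + + 2 * h ≡ b
        lemma = solve-∀
      negated : ∀ z → Inside (- z) → Inside z
      negated z (inside i) = inside (subst (_≤ T) (lemma z) i)
        where
        lemma : ∀ z → - z * - z ≡ z * z
        lemma = solve-∀
      negated′ : ∀ z → Inside z → Inside (- z)
      negated′ z (inside i) = inside (subst (_≤ T) (lemma z) i)
        where
        lemma : ∀ z → z * z ≡ - z * - z
        lemma = solve-∀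
      at-g : - (+ 2 * h - b) + h ≡ b - h
      at-g = lemma h b
        where
        lemma : ∀ h b → - (+ 2 * h - b) + h ≡ b - h
        lemma = solve-∀
      four : ∀ C → C ℕ.+ C ℕ.+ (C ℕ.+ C) ≡ 4 ℕ.* C
      four = ℕ-solve-∀
      cases : Dec (Inside b) → Dec (Inside (+ 2 * h - b)) → ∣ + 2 * r - + 2 * l ∣ ℕ.≤ 4 ℕ.* C
      cases (yes i) (yes i′) = ℕ.≤-trans (ℕ.≤-reflexive (cong ∣_∣ (lemma (+ 2 * r) (+ 2 * l) g))) (ℕ.≤-trans (ℤ.∣i-j∣≤∣i∣+∣j∣ (+ 2 * r - g) (+ 2 * l - g))
          (ℕ.≤-trans (ℕ.+-mono-≤ (from-inside (suc n) b i right) (subst (λ z → ∣ + 2 * l - z ∣ ℕ.≤ C) g≡ (from-inside n (+ 2 * h - b) i′ left′))) (ℕ.+-monoʳ-≤ C (ℕ.m≤m+n C (C ℕ.+ (C ℕ.+ 0))))))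
        where
        lemma : ∀ u v g → u - v ≡ u - g - (v - g)
        lemma = solve-∀
      cases (yes i) (no o′) = ℕ.≤-trans (ℕ.≤-reflexive (cong ∣_∣ (lemma (+ 2 * r) (+ 2 * l) g))) (ℕ.≤-trans (ℤ.∣i-j∣≤∣i∣+∣j∣ (+ 2 * r - g + g) (+ 2 * l))
          (ℕ.≤-trans (ℕ.+-mono-≤ (ℕ.≤-trans (ℤ.∣i+j∣≤∣i∣+∣j∣ (+ 2 * r - g) g) (ℕ.+-mono-≤ (from-inside (suc n) b i right) g-small)) (from-outside n (+ 2 * h - b) o′ left′)) (ℕ.≤-reflexive (four C))))
        where
        lemma : ∀ u v g → u - v ≡ u - g + g - v
        lemma = solve-∀
        g-small : ∣ g ∣ ℕ.≤ C
        g-small = subst (λ w → ∣ antidifference w ∣ ℕ.≤ C) at-g (entering (- (+ 2 * h - b)) (o′ ∘ negated (+ 2 * h - b)) (subst Inside (sym flip) i))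
      cases (no o) (yes i′) = ℕ.≤-trans (ℕ.≤-reflexive (cong ∣_∣ (lemma (+ 2 * r) (+ 2 * l) g))) (ℕ.≤-trans (ℤ.∣i-j∣≤∣i∣+∣j∣ (+ 2 * r) (+ 2 * l - g + g))
          (ℕ.≤-trans (ℕ.+-mono-≤ (from-outside (suc n) b o right) (ℕ.≤-trans (ℤ.∣i+j∣≤∣i∣+∣j∣ (+ 2 * l - g) g) (ℕ.+-mono-≤ (subst (λ z → ∣ + 2 * l - z ∣ ℕ.≤ C) g≡ (from-inside n (+ 2 * h - b) i′ left′)) g-small))) (ℕ.≤-reflexive (four C))))
        where
        lemma : ∀ u v g → u - v ≡ u - (v - g + g)
        lemma = solve-∀
        g-small : ∣ g ∣ ℕ.≤ C
        g-small = subst (λ w → ∣ antidifference w ∣ ℕ.≤ C) at-g (leaving (- (+ 2 * h - b)) (negated′ (+ 2 * h - b) i′) (o ∘ subst Inside flip))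
      cases (no o) (no o′) = ℕ.≤-trans (ℤ.∣i-j∣≤∣i∣+∣j∣ (+ 2 * r) (+ 2 * l)) (ℕ.≤-trans (ℕ.+-mono-≤ (from-outside (suc n) b o right) (from-outside n (+ 2 * h - b) o′ left′)) (ℕ.≤-reflexive (four C)))
  
  boundary-bound : ∀ m → T ≤ + 4 * h * (+ suc m * + suc m) → ∀ w → Boundary w → ∣ antidifference w ∣ ℕ.≤ 116 ℕ.* (suc h₀ ℕ.^ 4) ℕ.* (suc m ℕ.* suc m)
  boundary-bound m T≤ w boundary = bound T refl
    where
    H = suc h₀
    M = suc m
    T-nonneg : ∀ n → T ≢ -[1+ n ]
    T-nonneg n eq = from boundary
      where
      square-≰ : ∀ z → ¬ Inside z
      square-≰ z (inside le) = contradiction (subst₂ _≤_ (abs-square z) eq le) λ ()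
      from : ¬ Boundary w
      from (inj₁ (i , _)) = square-≰ (w - h) i
      from (inj₂ (i , _)) = square-≰ (w + h) i
    inner-small : ∀ z → Inside z → ∣ z ∣ ℕ.≤ 2 ℕ.* H ℕ.* M
    inner-small z i = square-cancel-≤ ∣ z ∣ (2 ℕ.* H ℕ.* M) (ℤ.drop‿+≤+ (ℤ.≤-trans (subst (_≤ T) (abs-square z) (square≤ i))
      (ℤ.≤-trans T≤ (ℤ.≤-trans (ℤ.≤-reflexive (sym (trans (ℤ.pos-* (4 ℕ.* H) (M ℕ.* M)) (cong₂ _*_ (ℤ.pos-* 4 H) (ℤ.pos-* M M))))) (+≤+ (ℕ.≤-trans (ℕ.*-monoˡ-≤ (M ℕ.* M) (ℕ.*-monoʳ-≤ 4 (ℕ.m≤m*n H H))) (ℕ.≤-reflexive (lemma H M))))))))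
      where
      lemma : ∀ H M → 4 ℕ.* (H ℕ.* H) ℕ.* (M ℕ.* M) ≡ 2 ℕ.* H ℕ.* M ℕ.* (2 ℕ.* H ℕ.* M)
      lemma = ℕ-solve-∀
    near : ∣ w ∣ ℕ.≤ 3 ℕ.* H ℕ.* M
    near = ℕ.≤-trans (from boundary) (ℕ.≤-trans (ℕ.+-monoʳ-≤ (2 ℕ.* H ℕ.* M) (ℕ.m≤m*n H M)) (ℕ.≤-reflexive (lemma H M)))
      where
      lemma : ∀ H M → 2 ℕ.* H ℕ.* M ℕ.+ H ℕ.* M ≡ 3 ℕ.* H ℕ.* M
      lemma = ℕ-solve-∀
      lemma₁ : ∀ w h → w ≡ w - h + h
      lemma₁ = solve-∀
      lemma₂ : ∀ w h → w ≡ w + h - h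
      lemma₂ = solve-∀
      from : Boundary w → ∣ w ∣ ℕ.≤ 2 ℕ.* H ℕ.* M ℕ.+ H
      from (inj₁ (i , _)) = ℕ.≤-trans (ℕ.≤-reflexive (cong ∣_∣ (lemma₁ w h))) (ℕ.≤-trans (ℤ.∣i+j∣≤∣i∣+∣j∣ (w - h) h) (ℕ.+-monoˡ-≤ H (inner-small (w - h) i)))
      from (inj₂ (i , _)) = ℕ.≤-trans (ℕ.≤-reflexive (cong ∣_∣ (lemma₂ w h))) (ℕ.≤-trans (ℤ.∣i-j∣≤∣i∣+∣j∣ (w + h) h) (ℕ.+-monoˡ-≤ H (inner-small (w + h) i)))
    ends : ∀ z → ∣ z ∣ ℕ.≤ 2 ℕ.* H ℕ.* ∣ w ∣ → ∣ z + h * h ∣ ℕ.≤ 7 ℕ.* (H ℕ.* H) ℕ.* M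
    ends z z≤ = ℕ.≤-trans (ℤ.∣i+j∣≤∣i∣+∣j∣ z (h * h)) (ℕ.≤-trans (ℕ.+-mono-≤ (ℕ.≤-trans z≤ (ℕ.*-monoʳ-≤ (2 ℕ.* H) near)) (ℕ.≤-trans (ℕ.≤-reflexive (ℤ.abs-* h h)) (ℕ.m≤m*n (H ℕ.* H) M))) (ℕ.≤-reflexive (lemma H M)))
      where
      lemma : ∀ H M → 2 ℕ.* H ℕ.* (3 ℕ.* H ℕ.* M) ℕ.+ H ℕ.* H ℕ.* M ≡ 7 ℕ.* (H ℕ.* H) ℕ.* M
      lemma = ℕ-solve-∀
    2hw : ∣ + 2 * h * w ∣ ℕ.≤ 2 ℕ.* H ℕ.* ∣ w ∣
    2hw = ℕ.≤-reflexive (trans (ℤ.abs-* (+ 2 * h) w) (cong (ℕ._* ∣ w ∣) (ℤ.abs-* (+ 2) h)))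
    -2hw : ∣ - (+ 2 * h * w) ∣ ℕ.≤ 2 ℕ.* H ℕ.* ∣ w ∣
    -2hw = subst (ℕ._≤ 2 ℕ.* H ℕ.* ∣ w ∣) (sym (ℤ.∣-i∣≡∣i∣ (+ 2 * h * w))) 2hw
    difference : ∣ T - w * w ∣ ℕ.≤ 7 ℕ.* (H ℕ.* H) ℕ.* M
    difference = from boundary
      where
      lemma₁ : ∀ w h → (w - h) * (w - h) - w * w ≡ - (+ 2 * h * w) + h * h
      lemma₁ = solve-∀
      lemma₂ : ∀ w h → (w + h) * (w + h) - w * w ≡ + 2 * h * w + h * h
      lemma₂ = solve-∀
      below : ∀ z → Inside z → z * z - w * w ≤ T - w * w
      below z i = ℤ.+-monoˡ-≤ (- (w * w)) (square≤ i)
      above : ∀ z → ¬ Inside z → T - w * w ≤ z * z - w * w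
      above z o = ℤ.+-monoˡ-≤ (- (w * w)) (ℤ.<⇒≤ (ℤ.≰⇒> (o ∘ inside)))
      from : Boundary w → ∣ T - w * w ∣ ℕ.≤ 7 ℕ.* (H ℕ.* H) ℕ.* M
      from (inj₁ (i , o)) = abs-between (subst (_≤ T - w * w) (lemma₁ w h) (below (w - h) i)) (subst (T - w * w ≤_) (lemma₂ w h) (above (w + h) o)) (ends (- (+ 2 * h * w)) -2hw) (ends (+ 2 * h * w) 2hw)
      from (inj₂ (i , o)) = abs-between (subst (_≤ T - w * w) (lemma₂ w h) (below (w + h) i)) (subst (T - w * w ≤_) (lemma₁ w h) (above (w - h) o)) (ends (+ 2 * h * w) 2hw) (ends (- (+ 2 * h * w)) -2hw)
    bound : ∀ T′ → T′ ≡ T → ∣ antidifference w ∣ ℕ.≤ 116 ℕ.* (H ℕ.^ 4) ℕ.* (M ℕ.* M)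
    bound -[1+ n ] eq = contradiction (sym eq) (T-nonneg n)
    bound (+ n) eq = begin
      ∣ X * X - Z + V ∣
        ≤⟨ ℕ.≤-trans (ℤ.∣i+j∣≤∣i∣+∣j∣ (X * X - Z) V) (ℕ.+-monoˡ-≤ ∣ V ∣ (ℤ.∣i-j∣≤∣i∣+∣j∣ (X * X) Z)) ⟩
      ∣ X * X ∣ ℕ.+ ∣ Z ∣ ℕ.+ ∣ V ∣
        ≤⟨ ℕ.+-mono-≤ (ℕ.+-mono-≤ (ℕ.≤-trans (ℕ.≤-reflexive (ℤ.abs-* X X)) (ℕ.*-mono-≤ difference difference)) middle) (ℕ.≤-reflexive V≡) ⟩
      7 ℕ.* (H ℕ.* H) ℕ.* M ℕ.* (7 ℕ.* (H ℕ.* H) ℕ.* M) ℕ.+ 2 ℕ.* H ℕ.* H ℕ.* (3 ℕ.* (3 ℕ.* H ℕ.* M) ℕ.* (3 ℕ.* H ℕ.* M) ℕ.+ 4 ℕ.* (H ℕ.* H) ℕ.* (M ℕ.* M)) ℕ.+ 5 ℕ.* H ℕ.* H ℕ.* H ℕ.* H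
        ≤⟨ ℕ.+-monoʳ-≤ (7 ℕ.* (H ℕ.* H) ℕ.* M ℕ.* (7 ℕ.* (H ℕ.* H) ℕ.* M) ℕ.+ 2 ℕ.* H ℕ.* H ℕ.* (3 ℕ.* (3 ℕ.* H ℕ.* M) ℕ.* (3 ℕ.* H ℕ.* M) ℕ.+ 4 ℕ.* (H ℕ.* H) ℕ.* (M ℕ.* M))) (ℕ.m≤m*n (5 ℕ.* H ℕ.* H ℕ.* H ℕ.* H) (M ℕ.* M)) ⟩
      7 ℕ.* (H ℕ.* H) ℕ.* M ℕ.* (7 ℕ.* (H ℕ.* H) ℕ.* M) ℕ.+ 2 ℕ.* H ℕ.* H ℕ.* (3 ℕ.* (3 ℕ.* H ℕ.* M) ℕ.* (3 ℕ.* H ℕ.* M) ℕ.+ 4 ℕ.* (H ℕ.* H) ℕ.* (M ℕ.* M)) ℕ.+ 5 ℕ.* H ℕ.* H ℕ.* H ℕ.* H ℕ.* (M ℕ.* M)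
        ≡⟨ lemma H M ⟩
      116 ℕ.* (H ℕ.* (H ℕ.* (H ℕ.* (H ℕ.* 1)))) ℕ.* (M ℕ.* M) ∎
      where
      open ℕ.≤-Reasoning
      X Z V : ℤ
      X = T - w * w
      Z = + 2 * h * h * (+ 3 * w * w - T)
      V = + 5 * h * h * h * h
      V≡ : ∣ V ∣ ≡ 5 ℕ.* H ℕ.* H ℕ.* H ℕ.* H
      V≡ = refl
      T≤′ : ∣ T ∣ ℕ.≤ 4 ℕ.* (H ℕ.* H) ℕ.* (M ℕ.* M)
      T≤′ = ℕ.≤-trans (ℤ.drop‿+≤+ (subst₂ _≤_ (trans (sym eq) (cong (λ z → + ∣ z ∣) eq)) (sym (trans (ℤ.pos-* (4 ℕ.* H) (M ℕ.* M)) (cong₂ _*_ (ℤ.pos-* 4 H) (ℤ.pos-* M M)))) T≤)) (ℕ.*-monoˡ-≤ (M ℕ.* M) (ℕ.*-monoʳ-≤ 4 (ℕ.m≤m*n H H)))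
      middle : ∣ Z ∣ ℕ.≤ 2 ℕ.* H ℕ.* H ℕ.* (3 ℕ.* (3 ℕ.* H ℕ.* M) ℕ.* (3 ℕ.* H ℕ.* M) ℕ.+ 4 ℕ.* (H ℕ.* H) ℕ.* (M ℕ.* M))
      middle = ℕ.≤-trans (ℕ.≤-reflexive (ℤ.abs-* (+ 2 * h * h) (+ 3 * w * w - T))) (ℕ.*-monoʳ-≤ (2 ℕ.* H ℕ.* H)
        (ℕ.≤-trans (ℤ.∣i-j∣≤∣i∣+∣j∣ (+ 3 * w * w) T) (ℕ.+-mono-≤ (ℕ.≤-trans (ℕ.≤-reflexive (trans (ℤ.abs-* (+ 3 * w) w) (cong (ℕ._* ∣ w ∣) (ℤ.abs-* (+ 3) w)))) (ℕ.*-mono-≤ (ℕ.*-monoʳ-≤ 3 near) near)) T≤′)))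
      lemma : ∀ H M → 7 ℕ.* (H ℕ.* H) ℕ.* M ℕ.* (7 ℕ.* (H ℕ.* H) ℕ.* M) ℕ.+ 2 ℕ.* H ℕ.* H ℕ.* (3 ℕ.* (3 ℕ.* H ℕ.* M) ℕ.* (3 ℕ.* H ℕ.* M) ℕ.+ 4 ℕ.* (H ℕ.* H) ℕ.* (M ℕ.* M)) ℕ.+ 5 ℕ.* H ℕ.* H ℕ.* H ℕ.* H ℕ.* (M ℕ.* M) ≡ 116 ℕ.* (H ℕ.* (H ℕ.* (H ℕ.* (H ℕ.* 1)))) ℕ.* (M ℕ.* M)
      lemma = ℕ-solve-∀

-- The weighted number of lattice points in an ellipse

∑<-head : ∀ n f → ∑< (suc n) f ≡ f 0 + ∑< n (f ∘ suc)
∑<-head n f = trans (∑<-split 1 n f) (cong (_+ ∑< n (f ∘ suc)) (ℤ.+-identityʳ (f 0)))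

-- (Y - n)² for n ≤ Y, and 0 for n ≥ Y because the subtraction is truncated.
cutoff : ℕ → ℕ → ℤ
cutoff Y n = + ((Y ℕ.∸ n) ℕ.* (Y ℕ.∸ n))

cutoff-zero : ∀ {Y n} → Y ℕ.≤ n → cutoff Y n ≡ + 0
cutoff-zero {Y} {n} Y≤n = cong (λ z → + (z ℕ.* z)) (ℕ.m≤n⇒m∸n≡0 Y≤n)

cutoff-≤ : ∀ {Y n} → n ℕ.≤ Y → cutoff Y n ≡ (+ Y - + n) * (+ Y - + n)
cutoff-≤ {Y} {n} n≤Y = trans (ℤ.pos-* (Y ℕ.∸ n) (Y ℕ.∸ n)) (cong (λ z → z * z) (sym (trans (ℤ.m-n≡m⊖n Y n) (ℤ.⊖-≥ n≤Y))))

module _ (h₀ : ℕ) (T : ℤ) where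

  open Alternating h₀ T

  alternating-sum : ∀ n b → ∑< n (λ i → sgn (+ i) * truncated (b + + 2 * h * + i)) ≡ alternating n b
  alternating-sum zero    b = refl
  alternating-sum (suc n) b = trans (∑<-head n (λ i → sgn (+ i) * truncated (b + + 2 * h * + i))) (cong₂ _+_
    (trans (ℤ.*-identityˡ _) (cong truncated (trans (cong (_+_ b) (ℤ.*-zeroʳ (+ 2 * h))) (ℤ.+-identityʳ b))))
    (trans (∑-ext (downFrom n) (λ i → trans (cong₂ _*_ (sgn-+ (+ 1) (+ i)) (cong truncated (trans (cong (λ z → b + + 2 * h * z) (ℤ.pos-+ 1 i)) (lemma₁ b h (+ i))))) (lemma₂ (sgn (+ i)) (truncated (b + + 2 * h + + 2 * h * + i)))))
      (trans (∑-neg (downFrom n) (λ i → sgn (+ i) * truncated (b + + 2 * h + + 2 * h * + i))) (cong -_ (alternating-sum n (b + + 2 * h))))))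
    where
    lemma₁ : ∀ b h i → b + + 2 * h * (+ 1 + i) ≡ b + + 2 * h + + 2 * h * i
    lemma₁ = solve-∀
    lemma₂ : ∀ s t → -1ℤ * s * t ≡ - (s * t)
    lemma₂ = solve-∀

  interval-alternating : ∀ B b → ∑ (interval B) (λ x → sgn x * truncated (b + + 2 * h * x)) ≡ alternating (suc B) b - alternating B (+ 2 * h - b)
  interval-alternating B b = trans (∑-++ (map (λ n → + n) (downFrom (suc B))) (map -[1+_] (downFrom B)) f) (cong₂ _+_
    (trans (∑-map (downFrom (suc B)) (λ n → + n) f) (alternating-sum (suc B) b))
    (trans (∑-map (downFrom B) -[1+_] f) (trans (∑-ext (downFrom B) reflect) (trans (∑-neg (downFrom B) (λ n → sgn (+ n) * truncated (+ 2 * h - b + + 2 * h * + n))) (cong -_ (alternating-sum B (+ 2 * h - b)))))))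
    where
    f : ℤ → ℤ
    f x = sgn x * truncated (b + + 2 * h * x)
    sgn-reflect : ∀ n → sgn -[1+ n ] ≡ - sgn (+ n)
    sgn-reflect n = trans (unit-move (sgn-unit (+ n)) (sym (trans (sym (sgn-+ (+ n) -[1+ n ])) (cong sgn (trans (cong (λ z → + n + - z) (ℤ.pos-+ 1 n)) (lemma (+ n))))))) (trans (ℤ.*-comm (sgn (+ n)) -1ℤ) (ℤ.-1*i≡-i (sgn (+ n))))
      where
      lemma : ∀ n → n + - (+ 1 + n) ≡ -1ℤ
      lemma = solve-∀
    reflect : ∀ n → f -[1+ n ] ≡ - (sgn (+ n) * truncated (+ 2 * h - b + + 2 * h * + n))
    reflect n = trans (cong₂ _*_ (sgn-reflect n) (trans (cong truncated (trans (cong (λ z → b + + 2 * h * - z) (ℤ.pos-+ 1 n)) (lemma b h (+ n)))) (truncated-neg (+ 2 * h - b + + 2 * h * + n))))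
      (sym (ℤ.neg-distribˡ-* (sgn (+ n)) (truncated (+ 2 * h - b + + 2 * h * + n))))
      where
      lemma : ∀ b h n → b + + 2 * h * - (+ 1 + n) ≡ - (+ 2 * h - b + + 2 * h * n)
      lemma = solve-∀

  line-bound : ∀ m → T ≤ + 4 * h * (+ suc m * + suc m) → ∀ B b (f : ℤ → ℤ) → (∀ x → + 16 * h * h * f x ≡ truncated (b + + 2 * h * x)) →
    ¬ Inside (b + + 2 * h * + suc B) → ¬ Inside (b - + 2 * h * + suc B) →
    ∣ ∑ (interval B) (λ x → sgn x * f x) ∣ ℕ.≤ 4 ℕ.* (116 ℕ.* (suc h₀ ℕ.^ 4) ℕ.* (suc m ℕ.* suc m))
  line-bound m T≤ B b f f≡ right left = ℕ.≤-trans (ℕ.m≤n*m ∣ S ∣ (32 ℕ.* suc h₀ ℕ.* suc h₀)) (ℕ.≤-trans (ℕ.≤-reflexive (sym (trans (ℤ.abs-* (+ 32 * h * h) S) (cong (ℕ._* ∣ S ∣) {∣ + 32 * h * h ∣} {32 ℕ.* suc h₀ ℕ.* suc h₀} (trans (ℤ.abs-* (+ 32 * h) h) (cong (ℕ._* suc h₀) (ℤ.abs-* (+ 32) h)))))))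
    (subst (λ z → ∣ z ∣ ℕ.≤ 4 ℕ.* C) (sym scaled) (Bounds.two-sided C (boundary-bound m T≤) B b right left)))
    where
    C = 116 ℕ.* (suc h₀ ℕ.^ 4) ℕ.* (suc m ℕ.* suc m)
    S = ∑ (interval B) (λ x → sgn x * f x)
    scaled : + 32 * h * h * S ≡ + 2 * (alternating (suc B) b - alternating B (+ 2 * h - b))
    scaled = trans (lemma h S) (cong (+ 2 *_) (trans (sym (∑-*ˡ (interval B) (+ 16 * h * h) (λ x → sgn x * f x)))
      (trans (∑-ext (interval B) (λ x → trans (lemma′ (+ 16 * h * h) (sgn x) (f x)) (cong (sgn x *_) (f≡ x)))) (interval-alternating B b))))
      where
      lemma : ∀ h s → + 32 * h * h * s ≡ + 2 * (+ 16 * h * h * s)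
      lemma = solve-∀
      lemma′ : ∀ c s f → c * (s * f) ≡ s * (c * f)
      lemma′ = solve-∀

  module _ (Y n : ℕ) (z : ℤ) (T≡ : T ≡ z * z + + 4 * h * (+ Y - + n)) where

    inside⇒≤ : Inside z → n ℕ.≤ Y
    inside⇒≤ (inside le) with n ℕ.≤? Y
    ... | yes n≤Y = n≤Y
    ... | no n≰Y  = contradiction (subst (z * z ≤_) T≡ le) (ℤ.<⇒≱ (subst (z * z + + 4 * h * (+ Y - + n) <_) (sym (decompose (ℕ.≰⇒> n≰Y))) (below (z * z + + 4 * h * (+ Y - + n)) (ℕ.≰⇒> n≰Y))))
      where
      decompose : Y ℕ.< n → z * z ≡ z * z + + 4 * h * (+ Y - + n) + + (4 ℕ.* suc h₀ ℕ.* (n ℕ.∸ Y))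
      decompose Y<n = trans (lemma (z * z) h (+ Y) (+ n)) (cong (_+_ (z * z + + 4 * h * (+ Y - + n))) (sym (trans (ℤ.pos-* (4 ℕ.* suc h₀) (n ℕ.∸ Y)) (cong₂ _*_ (ℤ.pos-* 4 (suc h₀)) (sym (trans (ℤ.m-n≡m⊖n n Y) (ℤ.⊖-≥ (ℕ.<⇒≤ Y<n))))))))
        where
        lemma : ∀ s h y n → s ≡ s + + 4 * h * (y - n) + + 4 * h * (n - y)
        lemma = solve-∀
      below : ∀ x → Y ℕ.< n → x < x + + (4 ℕ.* suc h₀ ℕ.* (n ℕ.∸ Y))
      below x Y<n = subst (_< x + + (4 ℕ.* suc h₀ ℕ.* (n ℕ.∸ Y))) (ℤ.+-identityʳ x) (ℤ.+-monoʳ-< x (+<+ (ℕ.*-mono-< {0} {4 ℕ.* suc h₀} {0} (s≤s z≤n) (ℕ.m<n⇒0<n∸m Y<n))))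

    cutoff-truncated : + 16 * h * h * cutoff Y n ≡ truncated z
    cutoff-truncated with n ℕ.≤? Y
    ... | no n≰Y  = trans (cong (+ 16 * h * h *_) (cutoff-zero {Y} {n} (ℕ.<⇒≤ (ℕ.≰⇒> n≰Y)))) (trans (ℤ.*-zeroʳ (+ 16 * h * h)) (sym (truncated-outside (n≰Y ∘ inside⇒≤))))
    ... | yes n≤Y = trans (cong (+ 16 * h * h *_) (cutoff-≤ n≤Y)) (trans (lemma h (+ Y) (+ n)) (sym (trans (truncated-inside (inside (≤-by (4 ℕ.* suc h₀ ℕ.* (Y ℕ.∸ n)) z²≤)))
        (cong (λ d → d * d) (trans (cong (_- z * z) T≡) (lemma′ (z * z) (+ 4 * h * (+ Y - + n))))))))
      where
      lemma : ∀ h y n → + 16 * h * h * ((y - n) * (y - n)) ≡ + 4 * h * (y - n) * (+ 4 * h * (y - n))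
      lemma = solve-∀
      lemma′ : ∀ s d → s + d - s ≡ d
      lemma′ = solve-∀
      z²≤ : T ≡ z * z + + (4 ℕ.* suc h₀ ℕ.* (Y ℕ.∸ n))
      z²≤ = trans T≡ (cong (_+_ (z * z)) (sym (trans (ℤ.pos-* (4 ℕ.* suc h₀) (Y ℕ.∸ n)) (cong₂ _*_ (ℤ.pos-* 4 (suc h₀)) (sym (trans (ℤ.m-n≡m⊖n Y n) (ℤ.⊖-≥ n≤Y)))))))

transpose : ∀ {c} (F : Form c) k₀ → Form.last F ≡ + suc k₀ → Form c
transpose F k₀ k≡ = record { lead = k₀ ; shift = Form.shift F ; last = + suc (Form.lead F) ; norm≡ = trans (Form.norm≡ F) (trans (cong (_* + suc (Form.lead F)) k≡) (ℤ.*-comm (+ suc k₀) (+ suc (Form.lead F)))) }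

value-transpose : ∀ {c} (F : Form c) k₀ (k≡ : Form.last F ≡ + suc k₀) x y → FormValues.value (transpose F k₀ k≡) y x ≡ FormValues.value F x y
value-transpose F k₀ k≡ x y = trans (lemma (+ suc k₀) (+ suc (Form.lead F)) (+ 2 * Form.shift F + + 1) x y) (cong (λ k → + suc (Form.lead F) * x * x + (+ 2 * Form.shift F + + 1) * x * y + k * y * y) (sym k≡))
  where
  lemma : ∀ k a b x y → k * y * y + b * y * x + a * x * x ≡ a * x * x + b * x * y + k * y * y
  lemma = solve-∀

module Lattice {c : ℕ} where

  module _ (F : Form c) where

    open FormValues F

    row-bound : ∀ m B y → (∀ x → ∣ value x y ∣ ℕ.≤ suc m ℕ.* suc m → ∣ x ∣ ℕ.≤ B) →
      ∣ ∑ (interval B) (λ x → sgn x * cutoff (suc m ℕ.* suc m) ∣ value x y ∣) ∣ ℕ.≤ 4 ℕ.* (116 ℕ.* (suc lead ℕ.^ 4) ℕ.* (suc m ℕ.* suc m))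
    row-bound m B y large = line-bound lead T m T≤ B b (λ x → cutoff Y ∣ value x y ∣)
        (λ x → cutoff-truncated lead T Y ∣ value x y ∣ (b + + 2 * a * x) (T≡ x))
        (λ i → ℕ.<⇒≱ (ℕ.n<1+n B) (large (+ suc B) (inside⇒≤ lead T Y ∣ value (+ suc B) y ∣ (b + + 2 * a * + suc B) (T≡ (+ suc B)) i)))
        (λ i → ℕ.<⇒≱ (ℕ.n<1+n B) (large -[1+ B ] (inside⇒≤ lead T Y ∣ value -[1+ B ] y ∣ (b + + 2 * a * -[1+ B ]) (T≡ -[1+ B ]) (subst (Alternating.Inside lead T) (cong (_+_ b) (ℤ.neg-distribʳ-* (+ 2 * a) (+ suc B))) i))))
      where
      Y = suc m ℕ.* suc m
      b = (+ 2 * t + + 1) * y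
      T = + 4 * a * + Y - + conductor c * (y * y)
      T≤ : T ≤ + 4 * a * (+ suc m * + suc m)
      T≤ = ≤-by (conductor c ℕ.* (∣ y ∣ ℕ.* ∣ y ∣)) (trans (cong (+ 4 * a *_) (sym (ℤ.pos-* (suc m) (suc m)))) (trans (lemma (+ 4 * a * + Y) (+ conductor c * (y * y)))
        (cong (_+_ T) (trans (cong (+ conductor c *_) (abs-square y)) (sym (ℤ.pos-* (conductor c) (∣ y ∣ ℕ.* ∣ y ∣)))))))
        where
        lemma : ∀ p q → p ≡ p - q + q
        lemma = solve-∀
      T≡ : ∀ x → T ≡ (b + + 2 * a * x) * (b + + 2 * a * x) + + 4 * a * (+ Y - + ∣ value x y ∣)
      T≡ x = trans (lemma (+ 4 * a) (+ Y) (+ conductor c * (y * y)) ((b + + 2 * a * x) * (b + + 2 * a * x)))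
        (trans (cong (λ s → (b + + 2 * a * x) * (b + + 2 * a * x) + (+ 4 * a * + Y - s)) (trans (cong (λ z → z * z + + conductor c * (y * y)) (ℤ.+-comm b (+ 2 * a * x))) (sym (completed-square x y))))
          (trans (cong (λ v → (b + + 2 * a * x) * (b + + 2 * a * x) + (+ 4 * a * + Y - + 4 * a * v)) (sym (∣∣-nonneg (value-nonneg x y)))) (lemma′ ((b + + 2 * a * x) * (b + + 2 * a * x)) (+ 4 * a) (+ Y) (+ ∣ value x y ∣))))
        where
        lemma : ∀ f y n z → f * y - n ≡ z + (f * y - (z + n))
        lemma = solve-∀
        lemma′ : ∀ z f y v → z + (f * y - f * v) ≡ z + f * (y - v)
        lemma′ = solve-∀

    y-bound : ∀ x y m → ∣ value x y ∣ ℕ.≤ suc m ℕ.* suc m → ∣ y ∣ ℕ.≤ 4 ℕ.* suc lead ℕ.* suc m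
    y-bound x y m le = square-cancel-≤ ∣ y ∣ (4 ℕ.* suc lead ℕ.* suc m) (begin
      ∣ y ∣ ℕ.* ∣ y ∣
        ≤⟨ ℕ.m≤n*m (∣ y ∣ ℕ.* ∣ y ∣) (conductor c) ⟩
      conductor c ℕ.* (∣ y ∣ ℕ.* ∣ y ∣)
        ≤⟨ ℕ.m≤n+m (conductor c ℕ.* (∣ y ∣ ℕ.* ∣ y ∣)) (∣ + 2 * a * x + (+ 2 * t + + 1) * y ∣ ℕ.* ∣ + 2 * a * x + (+ 2 * t + + 1) * y ∣) ⟩
      4a-value x y
        ≡⟨ ℤ.+-injective (trans (sym (4a-value≡ x y)) (trans (cong (+ 4 * a *_) (sym (∣∣-nonneg (value-nonneg x y)))) (sym (trans (ℤ.pos-* (4 ℕ.* suc lead) ∣ value x y ∣) (cong (_* + ∣ value x y ∣) (ℤ.pos-* 4 (suc lead))))))) ⟩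
      4 ℕ.* suc lead ℕ.* ∣ value x y ∣
        ≤⟨ ℕ.*-monoʳ-≤ (4 ℕ.* suc lead) le ⟩
      4 ℕ.* suc lead ℕ.* (suc m ℕ.* suc m)
        ≤⟨ ℕ.m≤n*m (4 ℕ.* suc lead ℕ.* (suc m ℕ.* suc m)) (4 ℕ.* suc lead) ⟩
      4 ℕ.* suc lead ℕ.* (4 ℕ.* suc lead ℕ.* (suc m ℕ.* suc m))
        ≡⟨ lemma (4 ℕ.* suc lead) (suc m) ⟩
      4 ℕ.* suc lead ℕ.* suc m ℕ.* (4 ℕ.* suc lead ℕ.* suc m) ∎)
      where
      open ℕ.≤-Reasoning
      lemma : ∀ p m → p ℕ.* (p ℕ.* (m ℕ.* m)) ≡ p ℕ.* m ℕ.* (p ℕ.* m)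
      lemma = ℕ-solve-∀

  last-positive : ∀ (F : Form c) → ∃[ k₀ ] Form.last F ≡ + suc k₀
  last-positive F = positive (Form.last F) refl
    where
    open FormValues F using (value; value-nonneg; value-zero; a; t)
    at-0-1 : value (+ 0) (+ 1) ≡ Form.last F
    at-0-1 = lemma a (+ 2 * t + + 1) (Form.last F)
      where
      lemma : ∀ a b k → a * + 0 * + 0 + b * + 0 * + 1 + k * + 1 * + 1 ≡ k
      lemma = solve-∀
    positive : ∀ k → Form.last F ≡ k → ∃[ k₀ ] Form.last F ≡ + suc k₀
    positive (+ zero)  eq = contradiction (proj₂ (value-zero (+ 0) (+ 1) (trans at-0-1 eq))) λ ()
    positive (+ suc k) eq = k , eq
    positive -[1+ k ]  eq = contradiction (trans at-0-1 eq) (value-nonneg (+ 0) (+ 1) k)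

  radius : Form c → ℕ → ℕ
  radius F m = 4 ℕ.* suc (proj₁ (last-positive F)) ℕ.* suc m ℕ.+ 4 ℕ.* suc (Form.lead F) ℕ.* suc m

  radius-large : ∀ F m x y → ∣ FormValues.value F x y ∣ ℕ.≤ suc m ℕ.* suc m → ∣ x ∣ ℕ.≤ radius F m × ∣ y ∣ ℕ.≤ radius F m
  radius-large F m x y le =
    ℕ.≤-trans (y-bound (transpose F k₀ k≡) y x m (subst (λ v → ∣ v ∣ ℕ.≤ suc m ℕ.* suc m) (sym (value-transpose F k₀ k≡ x y)) le)) (ℕ.m≤m+n _ _) ,
    ℕ.≤-trans (y-bound F x y m le) (ℕ.m≤n+m _ (4 ℕ.* suc k₀ ℕ.* suc m))
    where
    k₀ = proj₁ (last-positive F)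
    k≡ = proj₂ (last-positive F)

  -- 2 - χ(2) for even n and - 2 - χ(2) for odd n.
  weight : ℕ → ℤ
  weight n = + 2 * sgn (+ n) + sgn (+ c)

  sgn-* : ∀ x y → + 2 * sgn (x * y) ≡ + 1 + sgn x + sgn y - sgn x * sgn y
  sgn-* x y = cases (parity x) (parity y)
    where
    even-case : ∀ q y → + 2 * sgn ((q + q) * y) ≡ + 1 + sgn (q + q) + sgn y - sgn (q + q) * sgn y
    even-case q y = trans (cong (+ 2 *_) (trans (cong sgn (ℤ.*-distribʳ-+ y q q)) (sgn-even (q * y)))) (trans (lemma (sgn y)) (cong (λ s → + 1 + s + sgn y - s * sgn y) (sym (sgn-even q))))
      where
      lemma : ∀ s → + 2 * + 1 ≡ + 1 + + 1 + s - + 1 * s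
      lemma = solve-∀
    odd-case : ∀ q y → + 2 * sgn ((q + q + + 1) * y) ≡ + 1 + sgn (q + q + + 1) + sgn y - sgn (q + q + + 1) * sgn y
    odd-case q y = trans (cong (+ 2 *_) (trans (cong sgn (lemma q y)) (trans (sgn-+ (q * y + q * y) y) (trans (cong (_* sgn y) (sgn-even (q * y))) (ℤ.*-identityˡ (sgn y))))))
        (trans (lemma′ (sgn y)) (cong (λ s → + 1 + s + sgn y - s * sgn y) (sym (sgn-odd q))))
      where
      lemma : ∀ q y → (q + q + + 1) * y ≡ q * y + q * y + y
      lemma = solve-∀
      lemma′ : ∀ s → + 2 * s ≡ + 1 + -1ℤ + s - -1ℤ * s
      lemma′ = solve-∀
    cases : _ → _ → + 2 * sgn (x * y) ≡ + 1 + sgn x + sgn y - sgn x * sgn y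
    cases (inj₁ (q , eq)) _ = subst (λ x → + 2 * sgn (x * y) ≡ + 1 + sgn x + sgn y - sgn x * sgn y) (sym eq) (even-case q y)
    cases (inj₂ (q , eq)) _ = subst (λ x → + 2 * sgn (x * y) ≡ + 1 + sgn x + sgn y - sgn x * sgn y) (sym eq) (odd-case q y)

  module _ (F : Form c) where

    open FormValues F

    private
      A = sgn a
      κ = sgn k

    c₁ c₂ c₃ : ℤ
    c₁ = + 1 - A + κ + A * κ
    c₂ = + 1 + A - κ + A * κ
    c₃ = + 1 - A - κ - A * κ

    sgn-value : ∀ x y → + 8 * sgn (value x y) ≡ (+ 1 + A + sgn x - A * sgn x) * (+ 1 + sgn x + sgn y - sgn x * sgn y) * (+ 1 + κ + sgn y - κ * sgn y)
    sgn-value x y = trans (cong (+ 8 *_) (trans (sgn-+ (a * x * x + (+ 2 * t + + 1) * x * y) (k * y * y)) (cong (_* sgn (k * y * y)) (sgn-+ (a * x * x) ((+ 2 * t + + 1) * x * y)))))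
      (trans (lemma (sgn (a * x * x)) (sgn ((+ 2 * t + + 1) * x * y)) (sgn (k * y * y))) (cong₂ _*_ (cong₂ _*_ (quadratic a x) middle) (quadratic k y)))
      where
      lemma : ∀ p q r → + 8 * (p * q * r) ≡ + 2 * p * (+ 2 * q) * (+ 2 * r)
      lemma = solve-∀
      sgn-square : ∀ x → sgn (x * x) ≡ sgn x
      sgn-square x = ∣-cancel {+ 2} (sgn (x * x)) (λ ()) (trans (sgn-* x x) (trans (cong (λ e → + 1 + sgn x + sgn x - e) (unit-square (sgn-unit x))) (lemma′ (sgn x))))
        where
        lemma′ : ∀ s → + 1 + s + s - + 1 ≡ + 2 * s
        lemma′ = solve-∀
      quadratic : ∀ a x → + 2 * sgn (a * x * x) ≡ + 1 + sgn a + sgn x - sgn a * sgn x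
      quadratic a x = trans (cong (λ z → + 2 * sgn z) (ℤ.*-assoc a x x)) (trans (sgn-* a (x * x)) (cong (λ s → + 1 + sgn a + s - sgn a * s) (sgn-square x)))
      middle : + 2 * sgn ((+ 2 * t + + 1) * x * y) ≡ + 1 + sgn x + sgn y - sgn x * sgn y
      middle = trans (cong (+ 2 *_) (trans (cong sgn (lemma′ t x y)) (trans (sgn-+ (t * (x * y) + t * (x * y)) (x * y)) (trans (cong (_* sgn (x * y)) (sgn-even (t * (x * y)))) (ℤ.*-identityˡ (sgn (x * y))))))) (sgn-* x y)
        where
        lemma′ : ∀ t x y → (+ 2 * t + + 1) * x * y ≡ t * (x * y) + t * (x * y) + x * y
        lemma′ = solve-∀

    sgn-c : + 2 * sgn (+ c) ≡ - (+ 1 + A + κ - A * κ)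
    sgn-c = trans (cong (+ 2 *_) c≡) (trans (sym (ℤ.neg-distribʳ-* (+ 2) (sgn (a * k)))) (cong -_ (sgn-* a k)))
      where
      lemma : ∀ t → t * t + t ≡ t * (t + + 1)
      lemma = solve-∀
      consecutive : sgn (t * t + t) ≡ + 1
      consecutive = ∣-cancel {+ 2} (sgn (t * t + t)) (λ ()) (trans (trans (cong (λ z → + 2 * sgn z) (lemma t)) (sgn-* t (t + + 1)))
        (trans (cong (λ s → + 1 + sgn t + s - sgn t * s) (sgn-+ t (+ 1))) (trans (lemma′ (sgn t)) (cong (_+_ (+ 1)) (unit-square (sgn-unit t))))))
        where
        lemma′ : ∀ s → + 1 + s + s * -1ℤ - s * (s * -1ℤ) ≡ + 1 + s * s
        lemma′ = solve-∀
      c≡ : sgn (+ c) ≡ - sgn (a * k)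
      c≡ = trans (lemma″ (sgn (+ c))) (cong -_ (sym (trans (cong sgn (trans (ℤ.*-comm a k) (trans (sym norm-expand) (cong (_+_ (t * t + t)) (ℤ.pos-+ 1 c)))))
          (trans (sgn-+ (t * t + t) (+ 1 + + c)) (trans (cong₂ _*_ consecutive (sgn-+ (+ 1) (+ c))) (ℤ.*-identityˡ (-1ℤ * sgn (+ c))))))))
        where
        lemma″ : ∀ s → s ≡ - (-1ℤ * s)
        lemma″ = solve-∀

    weight-value : ∀ x y → + 2 * weight ∣ value x y ∣ ≡ c₁ * sgn x + c₂ * sgn y + c₃ * (sgn x * sgn y)
    weight-value x y = ∣-cancel {+ 8} (+ 2 * weight ∣ value x y ∣) (λ ()) (trans (cong (λ v → + 8 * (+ 2 * (+ 2 * sgn v + sgn (+ c)))) (∣∣-nonneg (value-nonneg x y)))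
      (trans (lemma (sgn (value x y)) (sgn (+ c))) (trans (cong₂ (λ p q → + 4 * p + + 8 * q) (sgn-value x y) sgn-c) (cases (sgn-unit a) (sgn-unit k) (sgn-unit x) (sgn-unit y)))))
      where
      lemma : ∀ s e → + 8 * (+ 2 * (+ 2 * s + e)) ≡ + 4 * (+ 8 * s) + + 8 * (+ 2 * e)
      lemma = solve-∀
      cases : ∀ {A κ α β} → Unit A → Unit κ → Unit α → Unit β →
        + 4 * ((+ 1 + A + α - A * α) * (+ 1 + α + β - α * β) * (+ 1 + κ + β - κ * β)) + + 8 * - (+ 1 + A + κ - A * κ)
        ≡ + 8 * ((+ 1 - A + κ + A * κ) * α + (+ 1 + A - κ + A * κ) * β + (+ 1 - A - κ - A * κ) * (α * β))
      cases (inj₁ refl) (inj₁ refl) (inj₁ refl) (inj₁ refl) = refl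
      cases (inj₁ refl) (inj₁ refl) (inj₁ refl) (inj₂ refl) = refl
      cases (inj₁ refl) (inj₁ refl) (inj₂ refl) (inj₁ refl) = refl
      cases (inj₁ refl) (inj₁ refl) (inj₂ refl) (inj₂ refl) = refl
      cases (inj₁ refl) (inj₂ refl) (inj₁ refl) (inj₁ refl) = refl
      cases (inj₁ refl) (inj₂ refl) (inj₁ refl) (inj₂ refl) = refl
      cases (inj₁ refl) (inj₂ refl) (inj₂ refl) (inj₁ refl) = refl
      cases (inj₁ refl) (inj₂ refl) (inj₂ refl) (inj₂ refl) = refl
      cases (inj₂ refl) (inj₁ refl) (inj₁ refl) (inj₁ refl) = refl
      cases (inj₂ refl) (inj₁ refl) (inj₁ refl) (inj₂ refl) = refl
      cases (inj₂ refl) (inj₁ refl) (inj₂ refl) (inj₁ refl) = refl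
      cases (inj₂ refl) (inj₁ refl) (inj₂ refl) (inj₂ refl) = refl
      cases (inj₂ refl) (inj₂ refl) (inj₁ refl) (inj₁ refl) = refl
      cases (inj₂ refl) (inj₂ refl) (inj₁ refl) (inj₂ refl) = refl
      cases (inj₂ refl) (inj₂ refl) (inj₂ refl) (inj₁ refl) = refl
      cases (inj₂ refl) (inj₂ refl) (inj₂ refl) (inj₂ refl) = refl

    c₁₃-bound : ∀ {s} → Unit s → ∣ c₁ + c₃ * s ∣ ℕ.≤ 8
    c₁₃-bound = go (sgn-unit a) (sgn-unit k)
      where
      go : ∀ {A κ s} → Unit A → Unit κ → Unit s → ∣ + 1 - A + κ + A * κ + (+ 1 - A - κ - A * κ) * s ∣ ℕ.≤ 8
      go (inj₁ refl) (inj₁ refl) (inj₁ refl) = ℕ.≤ᵇ⇒≤ _ _ tt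
      go (inj₁ refl) (inj₁ refl) (inj₂ refl) = ℕ.≤ᵇ⇒≤ _ _ tt
      go (inj₁ refl) (inj₂ refl) (inj₁ refl) = ℕ.≤ᵇ⇒≤ _ _ tt
      go (inj₁ refl) (inj₂ refl) (inj₂ refl) = ℕ.≤ᵇ⇒≤ _ _ tt
      go (inj₂ refl) (inj₁ refl) (inj₁ refl) = ℕ.≤ᵇ⇒≤ _ _ tt
      go (inj₂ refl) (inj₁ refl) (inj₂ refl) = ℕ.≤ᵇ⇒≤ _ _ tt
      go (inj₂ refl) (inj₂ refl) (inj₁ refl) = ℕ.≤ᵇ⇒≤ _ _ tt
      go (inj₂ refl) (inj₂ refl) (inj₂ refl) = ℕ.≤ᵇ⇒≤ _ _ tt

    c₂-bound : ∣ c₂ ∣ ℕ.≤ 8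
    c₂-bound = go (sgn-unit a) (sgn-unit k)
      where
      go : ∀ {A κ} → Unit A → Unit κ → ∣ + 1 + A - κ + A * κ ∣ ℕ.≤ 8
      go (inj₁ refl) (inj₁ refl) = ℕ.≤ᵇ⇒≤ _ _ tt
      go (inj₁ refl) (inj₂ refl) = ℕ.≤ᵇ⇒≤ _ _ tt
      go (inj₂ refl) (inj₁ refl) = ℕ.≤ᵇ⇒≤ _ _ tt
      go (inj₂ refl) (inj₂ refl) = ℕ.≤ᵇ⇒≤ _ _ tt

  length-interval : ∀ B → length (interval B) ≡ suc B ℕ.+ B
  length-interval B = trans (length-++ (map (λ n → + n) (downFrom (suc B)))) (cong₂ ℕ._+_ (trans (length-map (λ n → + n) (downFrom (suc B))) (length-downFrom (suc B))) (trans (length-map -[1+_] (downFrom B)) (length-downFrom B)))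

  lattice-bound : ∀ (F : Form c) → ∃[ C ] ∀ m →
    ∣ ∑ (box (radius F m)) (λ v → weight ∣ FormValues.value F (proj₁ v) (proj₂ v) ∣ * cutoff (suc m ℕ.* suc m) ∣ FormValues.value F (proj₁ v) (proj₂ v) ∣) ∣ ℕ.≤ C ℕ.* (suc m ℕ.^ 3)
  lattice-bound F = C , bound
    where
    open FormValues F using (value; lead)
    k₀ = proj₁ (last-positive F)
    k≡ = proj₂ (last-positive F)
    R₀ = 4 ℕ.* suc k₀ ℕ.+ 4 ℕ.* suc lead
    r = 4 ℕ.* (116 ℕ.* (suc lead ℕ.^ 4))
    s = 4 ℕ.* (116 ℕ.* (suc k₀ ℕ.^ 4))
    C = 3 ℕ.* R₀ ℕ.* (8 ℕ.* r) ℕ.+ 3 ℕ.* R₀ ℕ.* (8 ℕ.* s)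
    bound : ∀ m → _
    bound m = ℕ.≤-trans (ℕ.m≤n*m ∣ S ∣ 2) (ℕ.≤-trans (ℕ.≤-reflexive (sym (ℤ.abs-* (+ 2) S))) (subst (λ z → ∣ z ∣ ℕ.≤ C ℕ.* (M ℕ.^ 3)) (sym doubled)
      (ℕ.≤-trans (ℤ.∣i+j∣≤∣i∣+∣j∣ rows columns) (ℕ.≤-trans (ℕ.+-mono-≤ rows-bound columns-bound) (ℕ.≤-reflexive (lemma R₀ r s M))))))
      where
      M = suc m
      Y = M ℕ.* M
      B = radius F m
      I = interval B
      f : ℤ → ℤ → ℤ
      f x y = cutoff Y ∣ value x y ∣
      S = ∑ (box B) (λ v → weight ∣ value (proj₁ v) (proj₂ v) ∣ * f (proj₁ v) (proj₂ v))
      rows = ∑ I (λ y → (c₁ F + c₃ F * sgn y) * ∑ I (λ x → sgn x * f x y))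
      columns = ∑ I (λ x → c₂ F * ∑ I (λ y → sgn y * f x y))
      lemma : ∀ R₀ r s M → 3 ℕ.* R₀ ℕ.* M ℕ.* (8 ℕ.* (r ℕ.* (M ℕ.* M))) ℕ.+ 3 ℕ.* R₀ ℕ.* M ℕ.* (8 ℕ.* (s ℕ.* (M ℕ.* M))) ≡ (3 ℕ.* R₀ ℕ.* (8 ℕ.* r) ℕ.+ 3 ℕ.* R₀ ℕ.* (8 ℕ.* s)) ℕ.* (M ℕ.* (M ℕ.* (M ℕ.* 1)))
      lemma = ℕ-solve-∀
      length-I : length I ℕ.≤ 3 ℕ.* R₀ ℕ.* M
      length-I = ℕ.≤-trans (ℕ.≤-reflexive (length-interval B)) (ℕ.≤-trans (ℕ.+-monoˡ-≤ B (ℕ.+-monoˡ-≤ B {1} {B} (s≤s z≤n))) (ℕ.≤-reflexive (trans (cong (λ b → b ℕ.+ b ℕ.+ b) (sym (ℕ.*-distribʳ-+ M (4 ℕ.* suc k₀) (4 ℕ.* suc lead)))) (lemma′ R₀ M))))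
        where
        lemma′ : ∀ r m → r ℕ.* m ℕ.+ r ℕ.* m ℕ.+ r ℕ.* m ≡ 3 ℕ.* r ℕ.* m
        lemma′ = ℕ-solve-∀
      regroup : ∀ p m → 4 ℕ.* (116 ℕ.* p ℕ.* (m ℕ.* m)) ≡ 4 ℕ.* (116 ℕ.* p) ℕ.* (m ℕ.* m)
      regroup = ℕ-solve-∀
      rows-bound : ∣ rows ∣ ℕ.≤ 3 ℕ.* R₀ ℕ.* M ℕ.* (8 ℕ.* (r ℕ.* (M ℕ.* M)))
      rows-bound = ℕ.≤-trans (∑-abs-≤ I (λ y → (c₁ F + c₃ F * sgn y) * ∑ I (λ x → sgn x * f x y)) (8 ℕ.* (r ℕ.* (M ℕ.* M))) (λ {y} _ → ℕ.≤-trans (ℕ.≤-reflexive (ℤ.abs-* (c₁ F + c₃ F * sgn y) (∑ I (λ x → sgn x * f x y))))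
        (ℕ.*-mono-≤ (c₁₃-bound F (sgn-unit y)) (ℕ.≤-trans (row-bound F m B y (λ x le → proj₁ (radius-large F m x y le))) (ℕ.≤-reflexive (regroup (suc lead ℕ.^ 4) M))))))
        (ℕ.*-monoˡ-≤ (8 ℕ.* (r ℕ.* (M ℕ.* M))) length-I)
      Fᵀ = transpose F k₀ k≡
      columns-bound : ∣ columns ∣ ℕ.≤ 3 ℕ.* R₀ ℕ.* M ℕ.* (8 ℕ.* (s ℕ.* (M ℕ.* M)))
      columns-bound = ℕ.≤-trans (∑-abs-≤ I (λ x → c₂ F * ∑ I (λ y → sgn y * f x y)) (8 ℕ.* (s ℕ.* (M ℕ.* M))) (λ {x} _ → ℕ.≤-trans (ℕ.≤-reflexive (ℤ.abs-* (c₂ F) (∑ I (λ y → sgn y * f x y))))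
        (ℕ.*-mono-≤ (c₂-bound F) (ℕ.≤-trans (column x) (ℕ.≤-reflexive (regroup (suc k₀ ℕ.^ 4) M))))))
        (ℕ.*-monoˡ-≤ (8 ℕ.* (s ℕ.* (M ℕ.* M))) length-I)
        where
        column : ∀ x → ∣ ∑ I (λ y → sgn y * f x y) ∣ ℕ.≤ 4 ℕ.* (116 ℕ.* (suc k₀ ℕ.^ 4) ℕ.* (M ℕ.* M))
        column x = subst (λ z → ∣ z ∣ ℕ.≤ 4 ℕ.* (116 ℕ.* (suc k₀ ℕ.^ 4) ℕ.* (M ℕ.* M))) (∑-ext I (λ y → cong (λ v → sgn y * cutoff Y ∣ v ∣) (value-transpose F k₀ k≡ x y)))
          (row-bound Fᵀ m B x (λ y le → proj₂ (radius-large F m x y (subst (λ v → ∣ v ∣ ℕ.≤ Y) (value-transpose F k₀ k≡ x y) le))))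
      doubled : + 2 * S ≡ rows + columns
      doubled = begin
        + 2 * S
          ≡⟨ trans (sym (∑-*ˡ (box B) (+ 2) (λ v → weight ∣ value (proj₁ v) (proj₂ v) ∣ * f (proj₁ v) (proj₂ v)))) (∑-cartesianProduct I I (λ v → + 2 * (weight ∣ value (proj₁ v) (proj₂ v) ∣ * f (proj₁ v) (proj₂ v)))) ⟩
        ∑ I (λ x → ∑ I (λ y → + 2 * (weight ∣ value x y ∣ * f x y)))
          ≡⟨ ∑-ext I (λ x → trans (∑-ext I (λ y → trans (sym (ℤ.*-assoc (+ 2) (weight ∣ value x y ∣) (f x y))) (trans (cong (_* f x y) (weight-value F x y)) (lemma₁ (c₁ F) (c₂ F) (c₃ F) (sgn x) (sgn y) (f x y)))))
               (trans (∑-+ I (λ y → (c₁ F + c₃ F * sgn y) * (sgn x * f x y)) (λ y → c₂ F * (sgn y * f x y))) (cong (_+_ (∑ I (λ y → (c₁ F + c₃ F * sgn y) * (sgn x * f x y)))) (∑-*ˡ I (c₂ F) (λ y → sgn y * f x y))))) ⟩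
        ∑ I (λ x → ∑ I (λ y → (c₁ F + c₃ F * sgn y) * (sgn x * f x y)) + c₂ F * ∑ I (λ y → sgn y * f x y))
          ≡⟨ ∑-+ I (λ x → ∑ I (λ y → (c₁ F + c₃ F * sgn y) * (sgn x * f x y))) (λ x → c₂ F * ∑ I (λ y → sgn y * f x y)) ⟩
        ∑ I (λ x → ∑ I (λ y → (c₁ F + c₃ F * sgn y) * (sgn x * f x y))) + columns
          ≡⟨ cong (_+ columns) (trans (∑-swap I I (λ x y → (c₁ F + c₃ F * sgn y) * (sgn x * f x y))) (∑-ext I (λ y → ∑-*ˡ I (c₁ F + c₃ F * sgn y) (λ x → sgn x * f x y)))) ⟩
        rows + columns ∎
        where
        open ≡-Reasoning
        lemma₁ : ∀ c₁ c₂ c₃ s u f → (c₁ * s + c₂ * u + c₃ * (s * u)) * f ≡ (c₁ + c₃ * u) * (s * f) + c₂ * (u * f)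
        lemma₁ = solve-∀

-- Sums of periodic functions under a hyperbola

∑-1⋯-split : ∀ m n f → ∑ (1⋯ (m ℕ.+ n)) f ≡ ∑ (1⋯ m) f + ∑ (1⋯ n) (λ e → f (m ℕ.+ e))
∑-1⋯-split m n f = trans (∑-map (downFrom (m ℕ.+ n)) suc f) (trans (∑<-split m n (f ∘ suc))
  (sym (cong₂ _+_ (∑-map (downFrom m) suc f) (trans (∑-map (downFrom n) suc (λ e → f (m ℕ.+ e))) (∑-ext (downFrom n) (λ i → cong f (ℕ.+-suc m i)))))))

∑-1⋯-beyond : ∀ m n f → (∀ e → m ℕ.< e → f e ≡ + 0) → (∀ e → n ℕ.< e → f e ≡ + 0) → ∑ (1⋯ m) f ≡ ∑ (1⋯ n) f
∑-1⋯-beyond m n f beyond-m beyond-n = trans (sym (extend m n beyond-m)) (trans (cong (λ k → ∑ (1⋯ k) f) (ℕ.+-comm m n)) (extend n m beyond-n))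
  where
  extend : ∀ m n → (∀ e → m ℕ.< e → f e ≡ + 0) → ∑ (1⋯ (m ℕ.+ n)) f ≡ ∑ (1⋯ m) f
  extend m n beyond = trans (∑-1⋯-split m n f) (trans (cong (_+_ (∑ (1⋯ m) f)) (∑-zero (1⋯ n) (λ {e} e∈ → beyond (m ℕ.+ e) (ℕ.m<m+n m (∈1⋯-≥1 e∈))))) (ℤ.+-identityʳ (∑ (1⋯ m) f)))

abs-+-≤ : ∀ x y {m n} → ∣ x ∣ ℕ.≤ m → ∣ y ∣ ℕ.≤ n → ∣ x + y ∣ ℕ.≤ m ℕ.+ n
abs-+-≤ x y x≤ y≤ = ℕ.≤-trans (ℤ.∣i+j∣≤∣i∣+∣j∣ x y) (ℕ.+-mono-≤ x≤ y≤)

abs-*-≤ : ∀ x y {m n} → ∣ x ∣ ℕ.≤ m → ∣ y ∣ ℕ.≤ n → ∣ x * y ∣ ℕ.≤ m ℕ.* n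
abs-*-≤ x y x≤ y≤ = ℕ.≤-trans (ℕ.≤-reflexive (ℤ.abs-* x y)) (ℕ.*-mono-≤ x≤ y≤)

abs-neg-≤ : ∀ x {m} → ∣ x ∣ ℕ.≤ m → ∣ - x ∣ ℕ.≤ m
abs-neg-≤ x = subst (ℕ._≤ _) (sym (ℤ.∣-i∣≡∣i∣ x))

record Balanced (P : ℕ) (b : ℕ → ℤ) : Set where
  field
    bound    : ℕ
    bounded  : ∀ e → ∣ b e ∣ ℕ.≤ bound
    periodic : ∀ q e → b (q ℕ.* P ℕ.+ e) ≡ b e
    balanced : ∑ (1⋯ P) b ≡ + 0

  moment₁ moment₂ : ℤ
  moment₁ = ∑ (1⋯ P) (λ e → b e * + e)
  moment₂ = ∑ (1⋯ P) (λ e → b e * (+ e * + e))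

  one-period : ∀ u v w → ∑ (1⋯ P) (λ e → b e * (u + v * + e + w * (+ e * + e))) ≡ v * moment₁ + w * moment₂
  one-period u v w = begin
    ∑ (1⋯ P) (λ e → b e * (u + v * + e + w * (+ e * + e)))
      ≡⟨ ∑-ext (1⋯ P) (λ e → lemma (b e) u v w (+ e)) ⟩
    ∑ (1⋯ P) (λ e → u * b e + (v * (b e * + e) + w * (b e * (+ e * + e))))
      ≡⟨ ∑-+ (1⋯ P) (λ e → u * b e) (λ e → v * (b e * + e) + w * (b e * (+ e * + e))) ⟩
    ∑ (1⋯ P) (λ e → u * b e) + ∑ (1⋯ P) (λ e → v * (b e * + e) + w * (b e * (+ e * + e)))
      ≡⟨ cong₂ _+_ (trans (∑-*ˡ (1⋯ P) u b) (trans (cong (u *_) balanced) (ℤ.*-zeroʳ u))) (trans (∑-+ (1⋯ P) (λ e → v * (b e * + e)) (λ e → w * (b e * (+ e * + e))))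
           (cong₂ _+_ (∑-*ˡ (1⋯ P) v (λ e → b e * + e)) (∑-*ˡ (1⋯ P) w (λ e → b e * (+ e * + e))))) ⟩
    + 0 + (v * moment₁ + w * moment₂)
      ≡⟨ ℤ.+-identityˡ _ ⟩
    v * moment₁ + w * moment₂ ∎
    where
    open ≡-Reasoning
    lemma : ∀ b u v w e → b * (u + v * e + w * (e * e)) ≡ u * b + (v * (b * e) + w * (b * (e * e)))
    lemma = solve-∀

  periods : ∀ L u v w → ∑ (1⋯ (L ℕ.* P)) (λ e → b e * (u + v * + e + w * (+ e * + e))) ≡
    + L * (v * moment₁ + w * moment₂) + w * + P * moment₁ * (+ L * (+ L - + 1))
  periods zero    u v w = lemma (v * moment₁ + w * moment₂) (w * + P * moment₁)
    where
    lemma : ∀ x y → + 0 ≡ + 0 * x + y * (+ 0 * (+ 0 - + 1))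
    lemma = solve-∀
  periods (suc L) u v w = begin
    ∑ (1⋯ (P ℕ.+ n)) f
      ≡⟨ trans (cong (λ k → ∑ (1⋯ k) f) (ℕ.+-comm P n)) (∑-1⋯-split n P f) ⟩
    ∑ (1⋯ n) f + ∑ (1⋯ P) (λ e → f (n ℕ.+ e))
      ≡⟨ cong₂ _+_ (periods L u v w) (trans (∑-ext (1⋯ P) (λ e → cong₂ _*_ (periodic L e) (trans (cong (λ z → u + v * z + w * (z * z)) (ℤ.pos-+ n e)) (shift u v w (+ n) (+ e)))))
           (one-period (u + v * + n + w * (+ n * + n)) (v + + 2 * w * + n) w)) ⟩
    + L * (v * moment₁ + w * moment₂) + w * + P * moment₁ * (+ L * (+ L - + 1)) + ((v + + 2 * w * + n) * moment₁ + w * moment₂)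
      ≡⟨ cong (λ z → + L * (v * moment₁ + w * moment₂) + w * + P * moment₁ * (+ L * (+ L - + 1)) + ((v + + 2 * w * z) * moment₁ + w * moment₂)) (ℤ.pos-* L P) ⟩
    + L * (v * moment₁ + w * moment₂) + w * + P * moment₁ * (+ L * (+ L - + 1)) + ((v + + 2 * w * (+ L * + P)) * moment₁ + w * moment₂)
      ≡⟨ collect (+ L) (+ P) v w moment₁ moment₂ ⟩
    (+ 1 + + L) * (v * moment₁ + w * moment₂) + w * + P * moment₁ * ((+ 1 + + L) * (+ 1 + + L - + 1))
      ≡⟨ cong (λ l → l * (v * moment₁ + w * moment₂) + w * + P * moment₁ * (l * (l - + 1))) (sym (ℤ.pos-+ 1 L)) ⟩
    + suc L * (v * moment₁ + w * moment₂) + w * + P * moment₁ * (+ suc L * (+ suc L - + 1)) ∎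
    where
    open ≡-Reasoning
    n = L ℕ.* P
    f : ℕ → ℤ
    f e = b e * (u + v * + e + w * (+ e * + e))
    shift : ∀ u v w n e → u + v * (n + e) + w * ((n + e) * (n + e)) ≡ u + v * n + w * (n * n) + (v + + 2 * w * n) * e + w * (e * e)
    shift = solve-∀
    collect : ∀ l p v w x y → l * (v * x + w * y) + w * p * x * (l * (l - + 1)) + ((v + + 2 * w * (l * p)) * x + w * y)
      ≡ (+ 1 + l) * (v * x + w * y) + w * p * x * ((+ 1 + l) * (+ 1 + l - + 1))
    collect = solve-∀

cutoff-expand : ∀ {Y} d e → d ℕ.* e ℕ.≤ Y → cutoff Y (d ℕ.* e) ≡ + Y * + Y + - (+ 2 * + d * + Y) * + e + + d * + d * (+ e * + e)
cutoff-expand {Y} d e le = trans (cutoff-≤ le) (trans (cong (λ z → (+ Y - z) * (+ Y - z)) (ℤ.pos-* d e)) (lemma (+ Y) (+ d) (+ e)))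
  where
  lemma : ∀ y d e → (y - d * e) * (y - d * e) ≡ y * y + - (+ 2 * d * y) * e + d * d * (e * e)
  lemma = solve-∀

module Hyperbola (p₀ : ℕ) where

  P = suc p₀

  module Row {b : ℕ → ℤ} (B : Balanced P b) where

    open Balanced B renaming (moment₁ to β₁; moment₂ to β₂)

    row : ℕ → ℕ → ℤ
    row Y d = ∑ (1⋯ Y) (λ e → b e * cutoff Y (d ℕ.* e))

    -- The main term of P · row Y d comes from the ⌊Y / dP⌋ full periods; the incomplete one contributes O(d²).
    rowMain : ℕ → ℕ → ℤ
    rowMain Y d = - (β₁ * (+ Y * + Y)) + + d * (β₂ - + P * β₁) * + Y

    rowError : ℕ
    rowError = ∣ β₁ ∣ ℕ.* (P ℕ.* P) ℕ.+ ∣ β₁ ∣ ℕ.* (P ℕ.* P) ℕ.+ ∣ β₂ ∣ ℕ.* P ℕ.+ P ℕ.* (P ℕ.* (bound ℕ.* (P ℕ.* P)))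

    row-estimate : ∀ Y d → 1 ℕ.≤ d → ∣ + P * row Y d - rowMain Y d ∣ ℕ.≤ rowError ℕ.* (d ℕ.* d)
    row-estimate Y (suc d₀) _ = subst (λ z → ∣ z ∣ ℕ.≤ rowError ℕ.* (d ℕ.* d)) (sym error≡) error≤
      where
      d = suc d₀
      q = d ℕ.* P
      L = Y ℕ./ q
      r = Y % q
      n = L ℕ.* P
      Y≡ : Y ≡ r ℕ.+ L ℕ.* q
      Y≡ = m≡m%n+[m/n]*n Y q
      r≤q : r ℕ.≤ q
      r≤q = ℕ.<⇒≤ (m%n<n Y q)
      dn≡ : d ℕ.* n ≡ L ℕ.* q
      dn≡ = lemma d L P
        where
        lemma : ∀ d l p → d ℕ.* (l ℕ.* p) ≡ l ℕ.* (d ℕ.* p)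
        lemma = ℕ-solve-∀
      dn≤Y : d ℕ.* n ℕ.≤ Y
      dn≤Y = ℕ.≤-trans (ℕ.≤-reflexive dn≡) (ℕ.≤-trans (ℕ.m≤n+m (L ℕ.* q) r) (ℕ.≤-reflexive (sym Y≡)))
      Y≤ : Y ℕ.≤ d ℕ.* n ℕ.+ q
      Y≤ = ℕ.≤-trans (ℕ.≤-reflexive Y≡) (ℕ.≤-trans (ℕ.+-monoˡ-≤ (L ℕ.* q) r≤q) (ℕ.≤-reflexive (trans (ℕ.+-comm q (L ℕ.* q)) (cong (ℕ._+ q) (sym dn≡)))))
      tail : ℤ
      tail = ∑ (1⋯ P) (λ e → b (n ℕ.+ e) * cutoff Y (d ℕ.* (n ℕ.+ e)))
      tail≤ : ∣ tail ∣ ℕ.≤ P ℕ.* (bound ℕ.* (q ℕ.* q))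
      tail≤ = subst (λ l → ∣ tail ∣ ℕ.≤ l ℕ.* (bound ℕ.* (q ℕ.* q))) (length-1⋯ P) (∑-abs-≤ (1⋯ P) (λ e → b (n ℕ.+ e) * cutoff Y (d ℕ.* (n ℕ.+ e))) (bound ℕ.* (q ℕ.* q))
        (λ {e} _ → abs-*-≤ (b (n ℕ.+ e)) (cutoff Y (d ℕ.* (n ℕ.+ e))) (bounded (n ℕ.+ e)) (ℕ.*-mono-≤ (small e) (small e))))
        where
        small : ∀ e → Y ℕ.∸ d ℕ.* (n ℕ.+ e) ℕ.≤ q
        small e = ℕ.≤-trans (ℕ.∸-monoʳ-≤ Y (ℕ.*-monoʳ-≤ d (ℕ.m≤m+n n e))) (ℕ.m≤n+o⇒m∸n≤o Y (d ℕ.* n) Y≤)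
      v w full : ℤ
      v = - (+ 2 * + d * + Y)
      w = + d * + d
      full = + L * (v * β₁ + w * β₂) + w * + P * β₁ * (+ L * (+ L - + 1))
      row≡ : row Y d ≡ full + tail
      row≡ = trans (∑-1⋯-beyond Y (n ℕ.+ P) (λ e → b e * cutoff Y (d ℕ.* e))
          (λ e Y<e → vanish e (ℕ.≤-trans (ℕ.<⇒≤ Y<e) (ℕ.m≤n*m e d)))
          (λ e n+P<e → vanish e (ℕ.≤-trans Y≤ (ℕ.≤-trans (ℕ.≤-reflexive (sym (ℕ.*-distribˡ-+ d n P))) (ℕ.*-monoʳ-≤ d (ℕ.<⇒≤ n+P<e))))))
        (trans (∑-1⋯-split n P (λ e → b e * cutoff Y (d ℕ.* e)))
          (cong (_+ tail) (trans (∑-cong (1⋯ n) (λ {e} e∈ → cong (b e *_) (cutoff-expand d e (ℕ.≤-trans (ℕ.*-monoʳ-≤ d (∈1⋯-≤ e∈)) dn≤Y)))) (periods L (+ Y * + Y) v w))))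
        where
        vanish : ∀ e → Y ℕ.≤ d ℕ.* e → b e * cutoff Y (d ℕ.* e) ≡ + 0
        vanish e le = trans (cong (b e *_) (cutoff-zero le)) (ℤ.*-zeroʳ (b e))
      error : ℤ
      error = β₁ * (+ r * + r) + β₁ * (+ q * + r) + - (+ d * β₂ * + r) + + P * tail
      error≡ : + P * row Y d - rowMain Y d ≡ error
      error≡ = trans (cong (λ z → + P * z - rowMain Y d) row≡) (trans (cong (λ y → + P * (+ L * (- (+ 2 * + d * y) * β₁ + w * β₂) + w * + P * β₁ * (+ L * (+ L - + 1)) + tail) - (- (β₁ * (y * y)) + + d * (β₂ - + P * β₁) * y)) Yℤ)
        (trans (lemma (+ P) (+ L) (+ d) (+ r) β₁ β₂ tail) (cong (λ z → β₁ * (+ r * + r) + β₁ * (z * + r) + - (+ d * β₂ * + r) + + P * tail) (sym (ℤ.pos-* d P)))))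
        where
        Yℤ : + Y ≡ + r + + L * (+ d * + P)
        Yℤ = trans (cong +_ Y≡) (trans (ℤ.pos-+ r (L ℕ.* q)) (cong (_+_ (+ r)) (trans (ℤ.pos-* L q) (cong (+ L *_) (ℤ.pos-* d P)))))
        lemma : ∀ p l d r x y t →
          p * (l * (- (+ 2 * d * (r + l * (d * p))) * x + d * d * y) + d * d * p * x * (l * (l - + 1)) + t) - (- (x * ((r + l * (d * p)) * (r + l * (d * p)))) + d * (y - p * x) * (r + l * (d * p)))
          ≡ x * (r * r) + x * (d * p * r) + - (d * y * r) + p * t
        lemma = solve-∀
      error≤ : ∣ error ∣ ℕ.≤ rowError ℕ.* (d ℕ.* d)
      error≤ = ℕ.≤-trans (abs-+-≤ (β₁ * (+ r * + r) + β₁ * (+ q * + r) + - (+ d * β₂ * + r)) (+ P * tail)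
          (abs-+-≤ (β₁ * (+ r * + r) + β₁ * (+ q * + r)) (- (+ d * β₂ * + r))
            (abs-+-≤ (β₁ * (+ r * + r)) (β₁ * (+ q * + r))
              (abs-*-≤ β₁ (+ r * + r) ℕ.≤-refl (abs-*-≤ (+ r) (+ r) r≤q r≤q))
              (abs-*-≤ β₁ (+ q * + r) ℕ.≤-refl (abs-*-≤ (+ q) (+ r) ℕ.≤-refl r≤q)))
            (abs-neg-≤ (+ d * β₂ * + r) (abs-*-≤ (+ d * β₂) (+ r) (abs-*-≤ (+ d) β₂ ℕ.≤-refl ℕ.≤-refl) r≤q)))
          (abs-*-≤ (+ P) tail ℕ.≤-refl tail≤))
        (ℕ.≤-reflexive (lemma ∣ β₁ ∣ ∣ β₂ ∣ d P bound))
        where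
        lemma : ∀ x y d p b → x ℕ.* (d ℕ.* p ℕ.* (d ℕ.* p)) ℕ.+ x ℕ.* (d ℕ.* p ℕ.* (d ℕ.* p)) ℕ.+ d ℕ.* y ℕ.* (d ℕ.* p) ℕ.+ p ℕ.* (p ℕ.* (b ℕ.* (d ℕ.* p ℕ.* (d ℕ.* p))))
          ≡ (x ℕ.* (p ℕ.* p) ℕ.+ x ℕ.* (p ℕ.* p) ℕ.+ y ℕ.* p ℕ.+ p ℕ.* (p ℕ.* (b ℕ.* (p ℕ.* p)))) ℕ.* (d ℕ.* d)
        lemma = ℕ-solve-∀

  module Rows {a b : ℕ → ℤ} (A : Balanced P a) (B : Balanced P b) where

    open Row B
    open Balanced A using () renaming (moment₁ to α₁; bound to boundᵃ; bounded to boundedᵃ; periods to periodsᵃ)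
    open Balanced B using () renaming (moment₁ to β₁; moment₂ to β₂)

    rows : ℕ → ℤ
    rows k = ∑ (1⋯ (k ℕ.* P)) (λ d → a d * row (k ℕ.* P ℕ.* (k ℕ.* P)) d)

    rowsError : ℕ
    rowsError = ∣ (β₂ - + P * β₁) * α₁ ∣ ℕ.* (P ℕ.* P) ℕ.+ P ℕ.* (boundᵃ ℕ.* (rowError ℕ.* (P ℕ.* P)))

    rows-bound : ∀ k → ∣ rows k ∣ ℕ.≤ rowsError ℕ.* (k ℕ.* k ℕ.* k)
    rows-bound k = ℕ.≤-trans (ℕ.m≤n*m ∣ rows k ∣ P) (ℕ.≤-trans (ℕ.≤-reflexive (sym (ℤ.abs-* (+ P) (rows k)))) (subst (λ z → ∣ z ∣ ℕ.≤ rowsError ℕ.* (k ℕ.* k ℕ.* k)) (sym split)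
      (ℕ.≤-trans (abs-+-≤ main errors main≤ errors≤) (ℕ.≤-reflexive (lemma ∣ (β₂ - + P * β₁) * α₁ ∣ k P boundᵃ rowError)))))
      where
      M = k ℕ.* P
      Y = M ℕ.* M
      main errors : ℤ
      main = ∑ (1⋯ M) (λ d → a d * rowMain Y d)
      errors = ∑ (1⋯ M) (λ d → a d * (+ P * row Y d - rowMain Y d))
      split : + P * rows k ≡ main + errors
      split = trans (sym (∑-*ˡ (1⋯ M) (+ P) (λ d → a d * row Y d))) (trans (∑-ext (1⋯ M) (λ d → lemma (+ P) (a d) (row Y d) (rowMain Y d)))
        (∑-+ (1⋯ M) (λ d → a d * rowMain Y d) (λ d → a d * (+ P * row Y d - rowMain Y d))))
        where
        lemma : ∀ p a r m → p * (a * r) ≡ a * m + a * (p * r - m)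
        lemma = solve-∀
      main≡ : main ≡ (β₂ - + P * β₁) * α₁ * (+ k * + Y)
      main≡ = trans (∑-ext (1⋯ M) (λ d → cong (a d *_) (lemma β₁ (β₂ - + P * β₁) (+ Y) (+ d))))
        (trans (periodsᵃ k (- (β₁ * (+ Y * + Y))) ((β₂ - + P * β₁) * + Y) (+ 0)) (lemma′ (+ k) (β₂ - + P * β₁) (+ Y) α₁ (Balanced.moment₂ A) (+ P)))
        where
        lemma : ∀ x z y d → - (x * (y * y)) + d * z * y ≡ - (x * (y * y)) + z * y * d + + 0 * (d * d)
        lemma = solve-∀
        lemma′ : ∀ k z y x x₂ p → k * (z * y * x + + 0 * x₂) + + 0 * p * x * (k * (k - + 1)) ≡ z * x * (k * y)
        lemma′ = solve-∀
      main≤ : ∣ main ∣ ℕ.≤ ∣ (β₂ - + P * β₁) * α₁ ∣ ℕ.* (k ℕ.* Y)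
      main≤ = subst (λ z → ∣ z ∣ ℕ.≤ ∣ (β₂ - + P * β₁) * α₁ ∣ ℕ.* (k ℕ.* Y)) (sym main≡) (abs-*-≤ ((β₂ - + P * β₁) * α₁) (+ k * + Y) ℕ.≤-refl (abs-*-≤ (+ k) (+ Y) ℕ.≤-refl ℕ.≤-refl))
      errors≤ : ∣ errors ∣ ℕ.≤ M ℕ.* (boundᵃ ℕ.* (rowError ℕ.* (M ℕ.* M)))
      errors≤ = subst (λ l → ∣ errors ∣ ℕ.≤ l ℕ.* (boundᵃ ℕ.* (rowError ℕ.* (M ℕ.* M)))) (length-1⋯ M) (∑-abs-≤ (1⋯ M) (λ d → a d * (+ P * row Y d - rowMain Y d)) (boundᵃ ℕ.* (rowError ℕ.* (M ℕ.* M)))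
        (λ {d} d∈ → abs-*-≤ (a d) (+ P * row Y d - rowMain Y d) (boundedᵃ d) (ℕ.≤-trans (row-estimate Y d (∈1⋯-≥1 d∈)) (ℕ.*-monoʳ-≤ rowError (ℕ.*-mono-≤ (∈1⋯-≤ d∈) (∈1⋯-≤ d∈))))))
      lemma : ∀ x k p b e → x ℕ.* (k ℕ.* (k ℕ.* p ℕ.* (k ℕ.* p))) ℕ.+ k ℕ.* p ℕ.* (b ℕ.* (e ℕ.* (k ℕ.* p ℕ.* (k ℕ.* p)))) ≡ (x ℕ.* (p ℕ.* p) ℕ.+ p ℕ.* (b ℕ.* (e ℕ.* (p ℕ.* p)))) ℕ.* (k ℕ.* k ℕ.* k)
      lemma = ℕ-solve-∀

  module _ {a b : ℕ → ℤ} (A : Balanced P a) (B : Balanced P b) where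

    open Row
    open Rows
    open Balanced A using () renaming (moment₁ to α₁; moment₂ to α₂; periods to periodsᵃ)
    open Balanced B using () renaming (moment₁ to β₁; moment₂ to β₂; periods to periodsᵇ)

    private
      γ δ : ℤ
      γ = α₂ - + P * α₁
      δ = β₂ - + P * β₁

      squareError : ℤ → ℤ
      squareError k = + P * (β₁ * γ + α₁ * δ) * (k * k * k) + δ * γ * (k * k)

    square-sum : ∀ k → ∑ (1⋯ (k ℕ.* P)) (λ d → ∑ (1⋯ (k ℕ.* P)) (λ e → a d * (b e * cutoff (k ℕ.* P ℕ.* (k ℕ.* P)) (d ℕ.* e)))) ≡
      - (+ P * + P * (α₁ * β₁) * (+ k * + k * (+ k * + k))) + squareError (+ k)
    square-sum k = begin
      ∑ (1⋯ M) (λ d → ∑ (1⋯ M) (λ e → a d * (b e * cutoff Y (d ℕ.* e))))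
        ≡⟨ ∑-cong (1⋯ M) (λ {d} d∈ → trans (∑-*ˡ (1⋯ M) (a d) (λ e → b e * cutoff Y (d ℕ.* e))) (cong (a d *_) (trans (∑-cong (1⋯ M) (λ {e} e∈ → cong (b e *_) (cutoff-expand d e (ℕ.*-mono-≤ (∈1⋯-≤ d∈) (∈1⋯-≤ e∈)))))
             (trans (periodsᵇ k (+ Y * + Y) (- (+ 2 * + d * + Y)) (+ d * + d)) (lemma (+ k) (+ P) (+ Y) (+ d) β₁ β₂))))) ⟩
      ∑ (1⋯ M) (λ d → a d * (+ 0 + - (+ 2 * + k * β₁ * + Y) * + d + (+ k * β₂ + + P * β₁ * (+ k * (+ k - + 1))) * (+ d * + d)))
        ≡⟨ periodsᵃ k (+ 0) (- (+ 2 * + k * β₁ * + Y)) (+ k * β₂ + + P * β₁ * (+ k * (+ k - + 1))) ⟩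
      _
        ≡⟨ cong (λ y → + k * (- (+ 2 * + k * β₁ * y) * α₁ + (+ k * β₂ + + P * β₁ * (+ k * (+ k - + 1))) * α₂) + (+ k * β₂ + + P * β₁ * (+ k * (+ k - + 1))) * + P * α₁ * (+ k * (+ k - + 1)))
             (trans (ℤ.pos-* M M) (cong (λ m → m * m) (ℤ.pos-* k P))) ⟩
      _
        ≡⟨ lemma′ (+ k) (+ P) α₁ α₂ β₁ β₂ ⟩
      - (+ P * + P * (α₁ * β₁) * (+ k * + k * (+ k * + k))) + squareError (+ k) ∎
      where
      open ≡-Reasoning
      M = k ℕ.* P
      Y = M ℕ.* M
      lemma : ∀ k p y d x x₂ → k * (- (+ 2 * d * y) * x + d * d * x₂) + d * d * p * x * (k * (k - + 1)) ≡ + 0 + - (+ 2 * k * x * y) * d + (k * x₂ + p * x * (k * (k - + 1))) * (d * d)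
      lemma = solve-∀
      lemma′ : ∀ k p α₁ α₂ β₁ β₂ →
        k * (- (+ 2 * k * β₁ * (k * p * (k * p))) * α₁ + (k * β₂ + p * β₁ * (k * (k - + 1))) * α₂) + (k * β₂ + p * β₁ * (k * (k - + 1))) * p * α₁ * (k * (k - + 1))
        ≡ - (p * p * (α₁ * β₁) * (k * k * (k * k))) + (p * (β₁ * (α₂ - p * α₁) + α₁ * (β₂ - p * β₁)) * (k * k * k) + (β₂ - p * β₁) * (α₂ - p * α₁) * (k * k))
      lemma′ = solve-∀

    hyperbolaError : ℕ
    hyperbolaError = rowsError A B ℕ.+ rowsError B A ℕ.+ (∣ + P * (β₁ * γ + α₁ * δ) ∣ ℕ.+ ∣ δ * γ ∣)

    hyperbola : ∀ k → let Y = suc k ℕ.* P ℕ.* (suc k ℕ.* P) in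
      ∣ ∑ (1⋯ Y) (λ d → ∑ (1⋯ Y) (λ e → a d * (b e * cutoff Y (d ℕ.* e)))) - + P * + P * (α₁ * β₁) * (+ suc k * + suc k * (+ suc k * + suc k)) ∣
      ℕ.≤ hyperbolaError ℕ.* (suc k ℕ.* suc k ℕ.* suc k)
    hyperbola k₀ = subst (λ z → ∣ z ∣ ℕ.≤ hyperbolaError ℕ.* (k ℕ.* k ℕ.* k)) (sym total) (ℕ.≤-trans
        (abs-+-≤ (rows A B k + rows B A k) (- squareError (+ k)) (abs-+-≤ (rows A B k) (rows B A k) (rows-bound A B k) (rows-bound B A k)) (abs-neg-≤ (squareError (+ k)) squareError≤))
        (ℕ.≤-reflexive (lemma (rowsError A B) (rowsError B A) (∣ + P * (β₁ * γ + α₁ * δ) ∣ ℕ.+ ∣ δ * γ ∣) (k ℕ.* k ℕ.* k))))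
      where
      k = suc k₀
      M = k ℕ.* P
      Y = M ℕ.* M
      Z = Y ℕ.∸ M
      Y≡ : Y ≡ M ℕ.+ Z
      Y≡ = sym (ℕ.m+[n∸m]≡n (ℕ.m≤m*n M M))
      lemma : ∀ x y z t → x ℕ.* t ℕ.+ y ℕ.* t ℕ.+ z ℕ.* t ≡ (x ℕ.+ y ℕ.+ z) ℕ.* t
      lemma = ℕ-solve-∀
      squareError≤ : ∣ squareError (+ k) ∣ ℕ.≤ (∣ + P * (β₁ * γ + α₁ * δ) ∣ ℕ.+ ∣ δ * γ ∣) ℕ.* (k ℕ.* k ℕ.* k)
      squareError≤ = ℕ.≤-trans (abs-+-≤ (+ P * (β₁ * γ + α₁ * δ) * (+ k * + k * + k)) (δ * γ * (+ k * + k))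
          (abs-*-≤ (+ P * (β₁ * γ + α₁ * δ)) (+ k * + k * + k) ℕ.≤-refl (ℕ.≤-refl {k ℕ.* k ℕ.* k}))
          (abs-*-≤ (δ * γ) (+ k * + k) ℕ.≤-refl (ℕ.m≤m*n (k ℕ.* k) k)))
        (ℕ.≤-reflexive (sym (ℕ.*-distribʳ-+ (k ℕ.* k ℕ.* k) ∣ + P * (β₁ * γ + α₁ * δ) ∣ ∣ δ * γ ∣)))
      g : ℕ → ℕ → ℤ
      g d e = a d * (b e * cutoff Y (d ℕ.* e))
      -- As Y = M², the terms with d > M and e > M vanish.
      quadrants : ∑ (1⋯ Y) (λ d → ∑ (1⋯ Y) (g d)) ≡ ∑ (1⋯ M) (λ d → ∑ (1⋯ Y) (g d)) + (∑ (1⋯ M) (λ e → ∑ (1⋯ Y) (λ d → g d e)) - ∑ (1⋯ M) (λ d → ∑ (1⋯ M) (g d)))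
      quadrants = begin
        ∑ (1⋯ Y) (λ d → ∑ (1⋯ Y) (g d))
          ≡⟨ trans (cong (λ y → ∑ (1⋯ y) (λ d → ∑ (1⋯ Y) (g d))) Y≡) (∑-1⋯-split M Z (λ d → ∑ (1⋯ Y) (g d))) ⟩
        ∑ (1⋯ M) (λ d → ∑ (1⋯ Y) (g d)) + ∑ (1⋯ Z) (λ d → ∑ (1⋯ Y) (g (M ℕ.+ d)))
          ≡⟨ cong (_+_ (∑ (1⋯ M) (λ d → ∑ (1⋯ Y) (g d)))) (trans (∑-cong (1⋯ Z) (λ {d} d∈ → ∑-1⋯-beyond Y M (g (M ℕ.+ d))
               (λ e Y<e → outside (M ℕ.+ d) e (ℕ.≤-trans (ℕ.<⇒≤ Y<e) (ℕ.m≤n*m e (M ℕ.+ d))))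
               (λ e M<e → outside (M ℕ.+ d) e (ℕ.*-mono-≤ (ℕ.m≤m+n M d) (ℕ.<⇒≤ M<e))))) rest) ⟩
        ∑ (1⋯ M) (λ d → ∑ (1⋯ Y) (g d)) + (∑ (1⋯ M) (λ e → ∑ (1⋯ Y) (λ d → g d e)) - ∑ (1⋯ M) (λ d → ∑ (1⋯ M) (g d))) ∎
        where
        open ≡-Reasoning
        outside : ∀ d e → Y ℕ.≤ d ℕ.* e → g d e ≡ + 0
        outside d e le = trans (cong (λ z → a d * (b e * z)) (cutoff-zero le)) (trans (cong (a d *_) (ℤ.*-zeroʳ (b e))) (ℤ.*-zeroʳ (a d)))
        rest : ∑ (1⋯ Z) (λ d → ∑ (1⋯ M) (g (M ℕ.+ d))) ≡ ∑ (1⋯ M) (λ e → ∑ (1⋯ Y) (λ d → g d e)) - ∑ (1⋯ M) (λ d → ∑ (1⋯ M) (g d))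
        rest = trans (move-+ (trans (sym (∑-swap (1⋯ Y) (1⋯ M) g)) (trans (cong (λ y → ∑ (1⋯ y) (λ d → ∑ (1⋯ M) (g d))) Y≡) (∑-1⋯-split M Z (λ d → ∑ (1⋯ M) (g d)))))) refl
      total : ∑ (1⋯ Y) (λ d → ∑ (1⋯ Y) (g d)) - + P * + P * (α₁ * β₁) * (+ k * + k * (+ k * + k)) ≡ rows A B k + rows B A k + - squareError (+ k)
      total = trans (cong (_- + P * + P * (α₁ * β₁) * (+ k * + k * (+ k * + k))) (trans quadrants (cong₂ _+_ (∑-ext (1⋯ M) (λ d → ∑-*ˡ (1⋯ Y) (a d) (λ e → b e * cutoff Y (d ℕ.* e))))
          (cong₂ _-_ (∑-ext (1⋯ M) (λ e → trans (∑-ext (1⋯ Y) (λ d → trans (swap (a d) (b e) (cutoff Y (d ℕ.* e))) (cong (λ n → b e * (a d * cutoff Y n)) (ℕ.*-comm d e)))) (∑-*ˡ (1⋯ Y) (b e) (λ d → a d * cutoff Y (e ℕ.* d))))) (square-sum k)))))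
        (combine (rows A B k) (rows B A k) (+ P * + P * (α₁ * β₁) * (+ k * + k * (+ k * + k))) (squareError (+ k)))
        where
        swap : ∀ x y z → x * (y * z) ≡ y * (x * z)
        swap = solve-∀
        combine : ∀ r s m t → r + (s - (- m + t)) - m ≡ r + s + - t
        combine = solve-∀

-- The class number formula N h = - Σ x χ(x)

∑<-double : ∀ n f → ∑< (n ℕ.+ n) f ≡ ∑< n (λ i → f (i ℕ.+ i) + f (suc (i ℕ.+ i)))
∑<-double zero    f = refl
∑<-double (suc n) f = trans (cong (λ k → f k + ∑< k f) (ℕ.+-suc n n)) (trans (cong (λ s → f (suc (n ℕ.+ n)) + (f (n ℕ.+ n) + s)) (∑<-double n f)) (lemma (f (suc (n ℕ.+ n))) (f (n ℕ.+ n)) _))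
  where
  lemma : ∀ x y z → x + (y + z) ≡ y + x + z
  lemma = solve-∀

∑<-reverse : ∀ n f → ∑< n f ≡ ∑< n (λ i → f (n ℕ.∸ suc i))
∑<-reverse zero    f = refl
∑<-reverse (suc n) f = trans (cong (_+_ (f n)) (∑<-reverse n f)) (sym (∑<-head n (λ i → f (n ℕ.∸ i))))

∑-1⋯-shift : ∀ n f → f 0 ≡ f n → ∑ (1⋯ n) f ≡ ∑< n f
∑-1⋯-shift n f eq = trans (∑-map (downFrom n) suc f) (cancel {f 0} (trans (sym (∑<-head n f)) (cong (_+ ∑< n f) (sym eq))))
  where
  cancel : ∀ {x y z} → x + y ≡ x + z → y ≡ z
  cancel {x} {y} {z} e = trans (sym (lemma x y)) (trans (cong (_- x) e) (lemma x z))
    where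
    lemma : ∀ x y → x + y - x ≡ y
    lemma = solve-∀

sgn-double : ∀ i → sgn (+ (i ℕ.+ i)) ≡ + 1
sgn-double i = trans (cong sgn (ℤ.pos-+ i i)) (sgn-even (+ i))

sgn-double⁺ : ∀ i → sgn (+ suc (i ℕ.+ i)) ≡ -1ℤ
sgn-double⁺ i = trans (cong sgn (trans (ℤ.pos-+ 1 (i ℕ.+ i)) (trans (ℤ.+-comm (+ 1) (+ (i ℕ.+ i))) (cong (_+ + 1) (ℤ.pos-+ i i))))) (sgn-odd (+ i))

∑-sgn : ∀ n f → ∑ (1⋯ (n ℕ.+ n)) (λ d → sgn (+ d) * f d) ≡ + 2 * ∑ (1⋯ n) (λ k → f (k ℕ.+ k)) - ∑ (1⋯ (n ℕ.+ n)) f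
∑-sgn n f = begin
  ∑ (1⋯ (n ℕ.+ n)) (λ d → sgn (+ d) * f d)
    ≡⟨ trans (∑-map (downFrom (n ℕ.+ n)) suc (λ d → sgn (+ d) * f d)) (∑<-double n (λ i → sgn (+ suc i) * f (suc i))) ⟩
  ∑< n (λ i → sgn (+ suc (i ℕ.+ i)) * f (suc (i ℕ.+ i)) + sgn (+ suc (suc (i ℕ.+ i))) * f (suc (suc (i ℕ.+ i))))
    ≡⟨ ∑-ext (downFrom n) (λ i → trans (cong₂ (λ s t → s * f (suc (i ℕ.+ i)) + t * f (suc (suc (i ℕ.+ i)))) (sgn-double⁺ i) (trans (cong (λ k → sgn (+ suc k)) (sym (ℕ.+-suc i i))) (sgn-double (suc i))))
         (lemma (f (suc (i ℕ.+ i))) (f (suc (suc (i ℕ.+ i)))))) ⟩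
  ∑< n (λ i → + 2 * f (suc (suc (i ℕ.+ i))) - (f (suc (i ℕ.+ i)) + f (suc (suc (i ℕ.+ i)))))
    ≡⟨ ∑-- (downFrom n) (λ i → + 2 * f (suc (suc (i ℕ.+ i)))) (λ i → f (suc (i ℕ.+ i)) + f (suc (suc (i ℕ.+ i)))) ⟩
  ∑< n (λ i → + 2 * f (suc (suc (i ℕ.+ i)))) - ∑< n (λ i → f (suc (i ℕ.+ i)) + f (suc (suc (i ℕ.+ i))))
    ≡⟨ cong₂ _-_ (trans (∑-*ˡ (downFrom n) (+ 2) (λ i → f (suc (suc (i ℕ.+ i))))) (cong (+ 2 *_) (trans (∑-ext (downFrom n) (λ i → cong (λ k → f (suc k)) (sym (ℕ.+-suc i i)))) (sym (∑-map (downFrom n) suc (λ k → f (k ℕ.+ k)))))))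
         (trans (sym (∑<-double n (f ∘ suc))) (sym (∑-map (downFrom (n ℕ.+ n)) suc f))) ⟩
  + 2 * ∑ (1⋯ n) (λ k → f (k ℕ.+ k)) - ∑ (1⋯ (n ℕ.+ n)) f ∎
  where
  open ≡-Reasoning
  lemma : ∀ x y → -1ℤ * x + + 1 * y ≡ + 2 * y - (x + y)
  lemma = solve-∀

∑-even : ∀ B (G : ℕ → ℤ) → (∀ d → B ℕ.< d → G d ≡ + 0) → ∑ (1⋯ B) (λ d → (+ 1 + sgn (+ d)) * G d) ≡ + 2 * ∑ (1⋯ B) (λ d → G (2 ℕ.* d))
∑-even B G vanish = trans (∑-ext (1⋯ B) (λ d → trans (cong (_* G d) (indicator d)) (ℤ.*-assoc (+ 2) (𝟙 (2 ℕ.∣? d)) (G d))))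
  (trans (∑-*ˡ (1⋯ B) (+ 2) (λ d → 𝟙 (2 ℕ.∣? d) * G d)) (cong (+ 2 *_) (∑-multiples B 2 G vanish)))
  where
  indicator : ∀ d → + 1 + sgn (+ d) ≡ + 2 * 𝟙 (2 ℕ.∣? d)
  indicator d = cases (parity-ℕ d)
    where
    cases : _ → + 1 + sgn (+ d) ≡ + 2 * 𝟙 (2 ℕ.∣? d)
    cases (inj₁ (k , refl)) = trans (cong (_+_ (+ 1)) (sgn-double k)) (sym (cong (+ 2 *_) (𝟙-yes (2 ℕ.∣? (k ℕ.+ k)) (ℕ.divides k (n+n≡n*2 k)))))
    cases (inj₂ (k , refl)) = trans (cong (_+_ (+ 1)) (sgn-double⁺ k)) (sym (cong (+ 2 *_) (𝟙-no (2 ℕ.∣? suc (k ℕ.+ k)) (2∤1+n+n k))))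

∑-regroup : ∀ Y (K : ℕ → ℕ → ℕ) (v : ℕ → ℕ → ℤ) (w : ℕ → ℤ) → (∀ n → Y ℕ.< n → w n ≡ + 0) → (∀ {x y} → 1 ℕ.≤ x → 1 ℕ.≤ y → 1 ℕ.≤ K x y) →
  ∑ (1⋯ Y) (λ x → ∑ (1⋯ Y) (λ y → v x y * w (K x y))) ≡ ∑ (1⋯ Y) (λ n → w n * PairSums.pairSum Y K v n)
∑-regroup Y K v w vanish positive = begin
  ∑ (1⋯ Y) (λ x → ∑ (1⋯ Y) (λ y → v x y * w (K x y)))
    ≡⟨ ∑-cong (1⋯ Y) (λ {x} x∈ → ∑-cong (1⋯ Y) (λ {y} y∈ → spread x y (positive (∈1⋯-≥1 x∈) (∈1⋯-≥1 y∈)))) ⟩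
  ∑ (1⋯ Y) (λ x → ∑ (1⋯ Y) (λ y → ∑ (1⋯ Y) (λ n → 𝟙 (K x y ℕ.≟ n) * (v x y * w n))))
    ≡⟨ trans (∑-ext (1⋯ Y) (λ x → ∑-swap (1⋯ Y) (1⋯ Y) (λ y n → 𝟙 (K x y ℕ.≟ n) * (v x y * w n)))) (∑-swap (1⋯ Y) (1⋯ Y) (λ x n → ∑ (1⋯ Y) (λ y → 𝟙 (K x y ℕ.≟ n) * (v x y * w n)))) ⟩
  ∑ (1⋯ Y) (λ n → ∑ (1⋯ Y) (λ x → ∑ (1⋯ Y) (λ y → 𝟙 (K x y ℕ.≟ n) * (v x y * w n))))
    ≡⟨ ∑-ext (1⋯ Y) (λ n → trans (∑-ext (1⋯ Y) (λ x → trans (∑-ext (1⋯ Y) (λ y → lemma (𝟙 (K x y ℕ.≟ n)) (v x y) (w n))) (∑-*ˡ (1⋯ Y) (w n) (λ y → 𝟙 (K x y ℕ.≟ n) * v x y))))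
         (∑-*ˡ (1⋯ Y) (w n) (λ x → ∑ (1⋯ Y) (λ y → 𝟙 (K x y ℕ.≟ n) * v x y)))) ⟩
  ∑ (1⋯ Y) (λ n → w n * PairSums.pairSum Y K v n) ∎
  where
  open ≡-Reasoning
  lemma : ∀ i v w → i * (v * w) ≡ w * (i * v)
  lemma = solve-∀
  spread : ∀ x y → 1 ℕ.≤ K x y → v x y * w (K x y) ≡ ∑ (1⋯ Y) (λ n → 𝟙 (K x y ℕ.≟ n) * (v x y * w n))
  spread x y 1≤ with K x y ℕ.≤? Y
  ... | yes le = sym (∑-𝟙-* (λ n → K x y ℕ.≟ n) (λ n → v x y * w n) (1⋯-unique Y) (∈1⋯ 1≤ le) refl (λ _ → sym))
  ... | no nle = trans (trans (cong (v x y *_) (vanish (K x y) (ℕ.≰⇒> nle))) (ℤ.*-zeroʳ (v x y)))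
                   (sym (∑-𝟙-*-none {xs = 1⋯ Y} (λ n → K x y ℕ.≟ n) (λ n → v x y * w n) (λ { {n} n∈ eq → nle (ℕ.≤-trans (ℕ.≤-reflexive eq) (∈1⋯-≤ n∈)) })))

fin-bound : ∀ {h} (C : Fin h → ℕ) → ∃[ B ] ∀ j → C j ℕ.≤ B
fin-bound {zero}  C = 0 , λ ()
fin-bound {suc h} C = C Fin.zero ℕ.+ proj₁ rest , λ
  { Fin.zero    → ℕ.m≤m+n (C Fin.zero) (proj₁ rest)
  ; (Fin.suc j) → ℕ.≤-trans (proj₂ rest j) (ℕ.m≤n+m (proj₁ rest) (C Fin.zero)) }
  where
  rest = fin-bound (C ∘ Fin.suc)

growth : ∀ X C → (∀ k₀ → let k = suc k₀ in ∣ X * (+ k * + k * (+ k * + k)) ∣ ℕ.≤ C ℕ.* (k ℕ.* k ℕ.* k)) → X ≡ + 0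
growth X C small = ℤ.∣i∣≡0⇒i≡0 (zero-abs ∣ X ∣ (subst (ℕ._≤ C ℕ.* (k ℕ.* k ℕ.* k)) (trans (ℤ.abs-* X (+ k * + k * (+ k * + k))) refl) (small C)))
  where
  k = suc C
  lemma : ∀ n k → suc n ℕ.* (k ℕ.* k ℕ.* (k ℕ.* k)) ≡ k ℕ.* (k ℕ.* k ℕ.* k) ℕ.+ n ℕ.* (k ℕ.* k ℕ.* (k ℕ.* k))
  lemma = ℕ-solve-∀
  zero-abs : ∀ n → n ℕ.* (k ℕ.* k ℕ.* (k ℕ.* k)) ℕ.≤ C ℕ.* (k ℕ.* k ℕ.* k) → n ≡ 0
  zero-abs zero    _  = refl
  zero-abs (suc n) le = contradiction (ℕ.*-cancelʳ-≤ k C (k ℕ.* k ℕ.* k) (ℕ.≤-trans (ℕ.m≤m+n (k ℕ.* (k ℕ.* k ℕ.* k)) (n ℕ.* (k ℕ.* k ℕ.* (k ℕ.* k)))) (ℕ.≤-trans (ℕ.≤-reflexive (sym (lemma n k))) le))) (ℕ.<⇒≱ (ℕ.n<1+n C))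

self-negative : ∀ {z} → z ≡ - z → z ≡ + 0
self-negative {z} eq = ∣-cancel {+ 2} {+ 0} z (λ ()) (trans (lemma z) (trans (cong (_+_ z) eq) (ℤ.+-inverseʳ z)))
  where
  lemma : ∀ z → + 2 * z ≡ z + z
  lemma = solve-∀

module CharacterSums {c : ℕ} {χ : ℤ → ℤ} (char : QuadraticCharacter c χ) where

  open QuadraticCharacter char

  N : ℕ
  N = conductor c

  χ-+N : ∀ q x → χ (+ (q ℕ.* N ℕ.+ x)) ≡ χ (+ x)
  χ-+N q x = χ-cong (≈-by (divides (+ q) (trans (cong (_- + x) (trans (ℤ.pos-+ (q ℕ.* N) x) (cong (_+ + x) (ℤ.pos-* q N)))) (lemma (+ q) (+ N) (+ x)))))
    where
    lemma : ∀ q n x → q * n + x - x ≡ q * n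
    lemma = solve-∀

  χ-0 : χ (+ 0) ≡ + 0
  χ-0 = self-negative (χ-neg (+ 0))

  χ-N : χ (+ N) ≡ + 0
  χ-N = trans (cong (λ n → χ (+ n)) (sym (trans (ℕ.+-identityʳ (1 ℕ.* N)) (ℕ.*-identityˡ N)))) (trans (χ-+N 1 0) χ-0)

  χ-reflect : ∀ x → x ℕ.≤ N → χ (+ (N ℕ.∸ x)) ≡ - χ (+ x)
  χ-reflect x x≤N = trans (χ-cong (≈-by (divides (+ 1) (trans (cong (_- - + x) (sym (trans (ℤ.m-n≡m⊖n N x) (ℤ.⊖-≥ x≤N)))) (lemma (+ N) (+ x)))))) (χ-neg (+ x))
    where
    lemma : ∀ n x → n - x - - x ≡ + 1 * n
    lemma = solve-∀

  χ-double : ∀ k → χ (+ (k ℕ.+ k)) ≡ χ (+ 2) * χ (+ k)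
  χ-double k = trans (cong χ (trans (ℤ.pos-+ k k) (lemma (+ k)))) (χ-* (+ 2) (+ k))
    where
    lemma : ∀ k → k + k ≡ + 2 * k
    lemma = solve-∀

  χ-sum : ∑ (1⋯ N) (λ x → χ (+ x)) ≡ + 0
  χ-sum = self-negative (trans (∑-1⋯-shift N (λ x → χ (+ x)) (trans χ-0 (sym χ-N))) (trans (∑<-reverse N (λ x → χ (+ x)))
    (trans (∑<-cong N (λ {i} i<N → χ-reflect (suc i) i<N)) (trans (∑-neg (downFrom N) (λ i → χ (+ suc i))) (cong -_ (sym (∑-map (downFrom N) suc (λ x → χ (+ x)))))))))

  firstMoment : ℤ
  firstMoment = ∑< N (λ x → + x * χ (+ x))

  moment-1⋯ : ∑ (1⋯ N) (λ x → χ (+ x) * + x) ≡ firstMoment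
  moment-1⋯ = trans (∑-1⋯-shift N (λ x → χ (+ x) * + x) (trans (cong (_* + 0) χ-0) (sym (cong (_* + N) χ-N)))) (∑-ext (downFrom N) (λ x → ℤ.*-comm (χ (+ x)) (+ x)))

  χ-sum₂ : ∑ (1⋯ (N ℕ.+ N)) (λ x → χ (+ x)) ≡ + 0
  χ-sum₂ = trans (∑-1⋯-split N N (λ x → χ (+ x))) (cong₂ _+_ χ-sum (trans (∑-ext (1⋯ N) χ-shift) χ-sum))
    where
    χ-shift : ∀ e → χ (+ (N ℕ.+ e)) ≡ χ (+ e)
    χ-shift e = trans (cong (λ n → χ (+ (n ℕ.+ e))) (sym (ℕ.*-identityˡ N))) (χ-+N 1 e)

  moment₂N : ∑ (1⋯ (N ℕ.+ N)) (λ x → χ (+ x) * + x) ≡ + 2 * firstMoment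
  moment₂N = trans (∑-1⋯-split N N (λ x → χ (+ x) * + x)) (trans (cong₂ _+_ moment-1⋯ (trans (∑-ext (1⋯ N) shift) (trans (∑-+ (1⋯ N) (λ e → + N * χ (+ e)) (λ e → χ (+ e) * + e))
      (cong₂ _+_ (trans (∑-*ˡ (1⋯ N) (+ N) (λ e → χ (+ e))) (trans (cong (+ N *_) χ-sum) (ℤ.*-zeroʳ (+ N)))) moment-1⋯)))) (lemma firstMoment))
    where
    lemma : ∀ x → x + (+ 0 + x) ≡ + 2 * x
    lemma = solve-∀
    lemma′ : ∀ x n e → x * (n + e) ≡ n * x + x * e
    lemma′ = solve-∀
    shift : ∀ e → χ (+ (N ℕ.+ e)) * + (N ℕ.+ e) ≡ + N * χ (+ e) + χ (+ e) * + e
    shift e = trans (cong₂ _*_ (trans (cong (λ n → χ (+ (n ℕ.+ e))) (sym (ℕ.*-identityˡ N))) (χ-+N 1 e)) (ℤ.pos-+ N e)) (lemma′ (χ (+ e)) (+ N) (+ e))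

  s : ℤ
  s = sgn (+ c)

  -- With ε = χ(2) = - s, the weight χ(d) ε for even d and χ(d) (2 + ε) for odd d.
  twisted : ℕ → ℤ
  twisted d = χ (+ d) * (+ 1 - s - sgn (+ d))

  twisted-expand : ∀ d → twisted d ≡ (+ 1 - s) * χ (+ d) - sgn (+ d) * χ (+ d)
  twisted-expand d = lemma (χ (+ d)) s (sgn (+ d))
    where
    lemma : ∀ x s t → x * (+ 1 - s - t) ≡ (+ 1 - s) * x - t * x
    lemma = solve-∀

  P : ℕ
  P = N ℕ.+ N

  private
    block-double : ∀ q e → q ℕ.* P ℕ.+ e ≡ (q ℕ.* N ℕ.+ q ℕ.* N) ℕ.+ e
    block-double q e = cong (ℕ._+ e) (ℕ.*-distribˡ-+ q N N)

    sgn-periodic : ∀ q e → sgn (+ (q ℕ.* P ℕ.+ e)) ≡ sgn (+ e)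
    sgn-periodic q e = trans (cong (λ n → sgn (+ n)) (block-double q e)) (trans (cong sgn (ℤ.pos-+ (q ℕ.* N ℕ.+ q ℕ.* N) e)) (trans (sgn-+ (+ (q ℕ.* N ℕ.+ q ℕ.* N)) (+ e)) (trans (cong (_* sgn (+ e)) (sgn-double (q ℕ.* N))) (ℤ.*-identityˡ (sgn (+ e))))))

    χ-periodic : ∀ q e → χ (+ (q ℕ.* P ℕ.+ e)) ≡ χ (+ e)
    χ-periodic q e = trans (cong (λ n → χ (+ n)) (trans (block-double q e) (cong (ℕ._+ e) (sym (ℕ.*-distribʳ-+ N q q))))) (χ-+N (q ℕ.+ q) e)

    sgn-bound : ∀ {z} → Unit z → ∣ z ∣ ℕ.≤ 1
    sgn-bound (inj₁ refl) = ℕ.≤-refl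
    sgn-bound (inj₂ refl) = ℕ.≤-refl

    ternary-bound : ∀ {z} → Ternary z → ∣ z ∣ ℕ.≤ 1
    ternary-bound neg1 = ℕ.≤-refl
    ternary-bound zer0 = z≤n
    ternary-bound pos1 = ℕ.≤-refl

  sgn-Balanced : Balanced P (λ e → sgn (+ e))
  sgn-Balanced = record
    { bound    = 1
    ; bounded  = λ e → sgn-bound (sgn-unit (+ e))
    ; periodic = sgn-periodic
    ; balanced = trans (∑-ext (1⋯ P) (λ e → sym (ℤ.*-identityʳ (sgn (+ e))))) (trans (∑-sgn N (λ _ → + 1))
        (trans (cong (λ z → + 2 * ∑ (1⋯ N) (λ _ → + 1) - z) (∑-1⋯-split N N (λ _ → + 1))) (lemma (∑ (1⋯ N) (λ _ → + 1)))))
    }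
    where
    lemma : ∀ x → + 2 * x - (x + x) ≡ + 0
    lemma = solve-∀

  twisted-Balanced : Balanced P twisted
  twisted-Balanced = record
    { bound    = 3
    ; bounded  = λ d → abs-*-≤ (χ (+ d)) (+ 1 - s - sgn (+ d)) (ternary-bound (χ-ternary (+ d)))
                   (abs-+-≤ (+ 1 - s) (- sgn (+ d)) {2} {1} (abs-+-≤ (+ 1) (- s) {1} {1} ℕ.≤-refl (abs-neg-≤ s (sgn-bound (sgn-unit (+ c))))) (abs-neg-≤ (sgn (+ d)) (sgn-bound (sgn-unit (+ d)))))
    ; periodic = λ q e → cong₂ (λ x t → x * (+ 1 - s - t)) (χ-periodic q e) (sgn-periodic q e)
    ; balanced = trans (∑-ext (1⋯ P) twisted-expand) (trans (∑-- (1⋯ P) (λ d → (+ 1 - s) * χ (+ d)) (λ d → sgn (+ d) * χ (+ d))) (cong₂ _-_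
        (trans (∑-*ˡ (1⋯ P) (+ 1 - s) (λ d → χ (+ d))) (trans (cong ((+ 1 - s) *_) χ-sum₂) (ℤ.*-zeroʳ (+ 1 - s))))
        (trans (∑-sgn N (λ d → χ (+ d))) (cong₂ (λ x y → + 2 * x - y) (trans (∑-ext (1⋯ N) χ-double) (trans (∑-*ˡ (1⋯ N) (χ (+ 2)) (λ k → χ (+ k))) (trans (cong (χ (+ 2) *_) χ-sum) (ℤ.*-zeroʳ (χ (+ 2)))))) χ-sum₂))))
    }

  sgn-moment : Balanced.moment₁ sgn-Balanced ≡ + N
  sgn-moment = trans (∑-sgn N (λ e → + e)) (trans (cong₂ (λ x y → + 2 * x - y) (trans (∑-ext (1⋯ N) (λ k → trans (ℤ.pos-+ k k) (lemma (+ k)))) (∑-*ˡ (1⋯ N) (+ 2) (λ k → + k))) second) (lemma′ (∑ (1⋯ N) (λ k → + k)) (+ N) (∑-1 N)))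
    where
    lemma : ∀ k → k + k ≡ + 2 * k
    lemma = solve-∀
    second : ∑ (1⋯ P) (λ e → + e) ≡ ∑ (1⋯ N) (λ k → + k) + (+ N * + N + ∑ (1⋯ N) (λ k → + k))
    second = trans (∑-1⋯-split N N (λ e → + e)) (cong (_+_ (∑ (1⋯ N) (λ k → + k))) (trans (∑-ext (1⋯ N) (λ e → ℤ.pos-+ N e)) (trans (∑-+ (1⋯ N) (λ _ → + N) (λ k → + k)) (cong (_+ ∑ (1⋯ N) (λ k → + k)) (constant N (+ N))))))
      where
      constant : ∀ n z → ∑ (1⋯ n) (λ _ → z) ≡ + n * z
      constant zero    z = refl
      constant (suc n) z = trans (cong (_+_ z) (constant n z)) (trans (lemma″ (+ n) z) (cong (_* z) (sym (ℤ.pos-+ 1 n))))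
        where
        lemma″ : ∀ n z → z + n * z ≡ (+ 1 + n) * z
        lemma″ = solve-∀
    ∑-1 : ∀ n → + 2 * ∑ (1⋯ n) (λ k → + k) ≡ + n * + n + + n
    ∑-1 zero    = refl
    ∑-1 (suc n) = trans (ℤ.*-distribˡ-+ (+ 2) (+ suc n) (∑ (1⋯ n) (λ k → + k))) (trans (cong (_+_ (+ 2 * + suc n)) (∑-1 n)) (trans (cong (λ z → + 2 * z + (+ n * + n + + n)) (ℤ.pos-+ 1 n)) (trans (lemma″ (+ n)) (cong (λ z → z * z + z) (sym (ℤ.pos-+ 1 n))))))
      where
      lemma″ : ∀ n → + 2 * (+ 1 + n) + (n * n + n) ≡ (+ 1 + n) * (+ 1 + n) + (+ 1 + n)
      lemma″ = solve-∀
    lemma′ : ∀ x n → + 2 * x ≡ n * n + n → + 2 * (+ 2 * x) - (x + (n * n + x)) ≡ n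
    lemma′ x n eq = trans (lemma₁ x n) (trans (cong (_- n * n) eq) (lemma₂ n))
      where
      lemma₁ : ∀ x n → + 2 * (+ 2 * x) - (x + (n * n + x)) ≡ + 2 * x - n * n
      lemma₁ = solve-∀
      lemma₂ : ∀ n → n * n + n - n * n ≡ n
      lemma₂ = solve-∀

  twisted-moment : Balanced.moment₁ twisted-Balanced ≡ + 2 * (+ 2 + s) * firstMoment
  twisted-moment = trans (∑-ext (1⋯ P) (λ d → lemma₁ (χ (+ d)) s (sgn (+ d)) (+ d))) (trans (∑-- (1⋯ P) (λ d → (+ 1 - s) * (χ (+ d) * + d)) (λ d → sgn (+ d) * (χ (+ d) * + d)))
    (trans (cong₂ _-_ (trans (∑-*ˡ (1⋯ P) (+ 1 - s) (λ d → χ (+ d) * + d)) (cong ((+ 1 - s) *_) moment₂N)) (trans (∑-sgn N (λ d → χ (+ d) * + d)) (cong₂ (λ x y → + 2 * x - y) doubled moment₂N))) (lemma₃ s firstMoment)))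
    where
    lemma₁ : ∀ x s t d → x * (+ 1 - s - t) * d ≡ (+ 1 - s) * (x * d) - t * (x * d)
    lemma₁ = solve-∀
    lemma₂ : ∀ s x k → - s * x * (k + k) ≡ + 2 * - s * (x * k)
    lemma₂ = solve-∀
    lemma₃ : ∀ s m → (+ 1 - s) * (+ 2 * m) - (+ 2 * (+ 2 * - s * m) - + 2 * m) ≡ + 2 * (+ 2 + s) * m
    lemma₃ = solve-∀
    doubled : ∑ (1⋯ N) (λ k → χ (+ (k ℕ.+ k)) * + (k ℕ.+ k)) ≡ + 2 * - s * firstMoment
    doubled = trans (∑-ext (1⋯ N) (λ k → trans (cong₂ _*_ (trans (χ-double k) (cong (_* χ (+ k)) χ-two)) (ℤ.pos-+ k k)) (lemma₂ s (χ (+ k)) (+ k)))) (trans (∑-*ˡ (1⋯ N) (+ 2 * - s) (λ k → χ (+ k) * + k)) (cong (+ 2 * - s *_) moment-1⋯))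

  open Lattice {c} using (weight; sgn-*)

  -- χ(d) weight(de) exceeds twisted(d) sgn(e) by χ(d) (1 + sgn(d) - ε (1 + sgn(e))); substituting d ↦ 2d in the first part
  -- and e ↦ 2e in the second, the excess sums to zero.
  weight-sum : ∀ Y (f : ℕ → ℤ) → (∀ n → Y ℕ.< n → f n ≡ + 0) →
    ∑ (1⋯ Y) (λ d → ∑ (1⋯ Y) (λ e → χ (+ d) * (weight (d ℕ.* e) * f (d ℕ.* e)))) ≡ ∑ (1⋯ Y) (λ d → ∑ (1⋯ Y) (λ e → twisted d * (sgn (+ e) * f (d ℕ.* e))))
  weight-sum Y f vanish = begin
    ∑ (1⋯ Y) (λ d → ∑ (1⋯ Y) (λ e → χ (+ d) * (weight (d ℕ.* e) * f (d ℕ.* e))))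
      ≡⟨ ∑-ext (1⋯ Y) (λ d → trans (∑-ext (1⋯ Y) (λ e → trans (cong (λ z → χ (+ d) * ((z + s) * f (d ℕ.* e))) (trans (cong (λ z → + 2 * sgn z) (ℤ.pos-* d e)) (sgn-* (+ d) (+ e)))) (lemma (χ (+ d)) s (sgn (+ d)) (sgn (+ e)) (f (d ℕ.* e)))))
           (trans (∑-+ (1⋯ Y) (λ e → twisted d * (sgn (+ e) * f (d ℕ.* e))) (λ e → (+ 1 + sgn (+ d)) * (χ (+ d) * f (d ℕ.* e)) + s * ((+ 1 + sgn (+ e)) * (χ (+ d) * f (d ℕ.* e)))))
             (cong (_+_ (T d)) (trans (∑-+ (1⋯ Y) (λ e → (+ 1 + sgn (+ d)) * (χ (+ d) * f (d ℕ.* e))) (λ e → s * ((+ 1 + sgn (+ e)) * (χ (+ d) * f (d ℕ.* e)))))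
               (cong₂ _+_ (∑-*ˡ (1⋯ Y) (+ 1 + sgn (+ d)) (λ e → χ (+ d) * f (d ℕ.* e))) (∑-*ˡ (1⋯ Y) s (λ e → (+ 1 + sgn (+ e)) * (χ (+ d) * f (d ℕ.* e))))))))) ⟩
    ∑ (1⋯ Y) (λ d → T d + (U d + s * V d))
      ≡⟨ trans (∑-+ (1⋯ Y) T (λ d → U d + s * V d)) (cong (_+_ (∑ (1⋯ Y) T)) (trans (∑-+ (1⋯ Y) U (λ d → s * V d)) (cong (_+_ (∑ (1⋯ Y) U)) (∑-*ˡ (1⋯ Y) s V)))) ⟩
    ∑ (1⋯ Y) T + (∑ (1⋯ Y) U + s * ∑ (1⋯ Y) V)
      ≡⟨ cong₂ (λ u v → ∑ (1⋯ Y) T + (u + s * v)) even-d even-e ⟩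
    ∑ (1⋯ Y) T + (+ 2 * (- s * Z) + s * (+ 2 * Z))
      ≡⟨ lemma′ (∑ (1⋯ Y) T) s Z ⟩
    ∑ (1⋯ Y) T ∎
    where
    open ≡-Reasoning
    T U V : ℕ → ℤ
    T d = ∑ (1⋯ Y) (λ e → twisted d * (sgn (+ e) * f (d ℕ.* e)))
    U d = (+ 1 + sgn (+ d)) * ∑ (1⋯ Y) (λ e → χ (+ d) * f (d ℕ.* e))
    V d = ∑ (1⋯ Y) (λ e → (+ 1 + sgn (+ e)) * (χ (+ d) * f (d ℕ.* e)))
    Z : ℤ
    Z = ∑ (1⋯ Y) (λ d → ∑ (1⋯ Y) (λ e → χ (+ d) * f (2 ℕ.* (d ℕ.* e))))
    lemma : ∀ x s t u f → x * ((+ 1 + t + u - t * u + s) * f) ≡ x * (+ 1 - s - t) * (u * f) + ((+ 1 + t) * (x * f) + s * ((+ 1 + u) * (x * f)))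
    lemma = solve-∀
    lemma′ : ∀ t s z → t + (+ 2 * (- s * z) + s * (+ 2 * z)) ≡ t
    lemma′ = solve-∀
    even-d : ∑ (1⋯ Y) U ≡ + 2 * (- s * Z)
    even-d = trans (∑-even Y (λ d → ∑ (1⋯ Y) (λ e → χ (+ d) * f (d ℕ.* e)))
        (λ d Y<d → ∑-zero (1⋯ Y) (λ {e} e∈ → trans (cong (χ (+ d) *_) (vanish (d ℕ.* e) (ℕ.<-≤-trans Y<d (subst (ℕ._≤ d ℕ.* e) (ℕ.*-identityʳ d) (ℕ.*-monoʳ-≤ d (∈1⋯-≥1 e∈)))))) (ℤ.*-zeroʳ (χ (+ d))))))
      (cong (+ 2 *_) (trans (∑-ext (1⋯ Y) (λ d → trans (∑-ext (1⋯ Y) (λ e → trans (cong₂ _*_ (trans (cong χ (ℤ.pos-* 2 d)) (trans (χ-* (+ 2) (+ d)) (cong (_* χ (+ d)) χ-two))) (cong f (ℕ.*-assoc 2 d e))) (ℤ.*-assoc (- s) (χ (+ d)) (f (2 ℕ.* (d ℕ.* e))))))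
          (∑-*ˡ (1⋯ Y) (- s) (λ e → χ (+ d) * f (2 ℕ.* (d ℕ.* e)))))) (∑-*ˡ (1⋯ Y) (- s) (λ d → ∑ (1⋯ Y) (λ e → χ (+ d) * f (2 ℕ.* (d ℕ.* e)))))))
    even-e : ∑ (1⋯ Y) V ≡ + 2 * Z
    even-e = trans (∑-cong (1⋯ Y) (λ {d} d∈ → trans (∑-even Y (λ e → χ (+ d) * f (d ℕ.* e))
        (λ e Y<e → trans (cong (χ (+ d) *_) (vanish (d ℕ.* e) (ℕ.<-≤-trans Y<e (subst (ℕ._≤ d ℕ.* e) (ℕ.*-identityˡ e) (ℕ.*-monoˡ-≤ e (∈1⋯-≥1 d∈)))))) (ℤ.*-zeroʳ (χ (+ d)))))
        (cong (+ 2 *_) (∑-ext (1⋯ Y) (λ e → cong (λ n → χ (+ d) * f n) (reassoc d e))))))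
      (∑-*ˡ (1⋯ Y) (+ 2) (λ d → ∑ (1⋯ Y) (λ e → χ (+ d) * f (2 ℕ.* (d ℕ.* e)))))
      where
      reassoc : ∀ d e → d ℕ.* (2 ℕ.* e) ≡ 2 ℕ.* (d ℕ.* e)
      reassoc = ℕ-solve-∀

module ClassNumberFormula {c : ℕ} {χ : ℤ → ℤ} (char : QuadraticCharacter c χ) (squareFree : ∀ d → d ℕ.* d ℕ.∣ conductor c → d ≡ 1) (1≤c : 1 ℕ.≤ c)
  (h : ℕ) (F : Fin h → Form c)
  (represented : ∀ (G : Form c) → ∃[ j ] ∃[ x ] ∃[ y ] Match (F j) x y (suc (Form.lead G)) (Form.shift G))
  (inequivalent : ∀ (G : Form c) {i j x y x′ y′} → Match (F i) x y (suc (Form.lead G)) (Form.shift G) → Match (F j) x′ y′ (suc (Form.lead G)) (Form.shift G) → i ≡ j)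
  where

  open CharacterSums char
  open Lattice {c}
  open Representatives squareFree 1≤c h F represented inequivalent

  private
    p₀ : ℕ
    p₀ = suc (c ℕ.+ c) ℕ.+ suc (c ℕ.+ c) ℕ.+ N

    open Hyperbola p₀ using (hyperbola; hyperbolaError)

    α β : ℤ
    α = Balanced.moment₁ twisted-Balanced
    β = Balanced.moment₁ sgn-Balanced

    C : ℕ
    C = proj₁ (fin-bound (λ j → proj₁ (lattice-bound (F j))))

    H : ℕ
    H = hyperbolaError twisted-Balanced sgn-Balanced

    X : ℤ
    X = + h * (+ 2 + s) * (+ P * + P * (+ P * + P)) + + 2 * (+ P * + P * (α * β))

    module _ (k₀ : ℕ) where

      k m M Y : ℕ
      k = suc k₀
      m = p₀ ℕ.+ k₀ ℕ.* P
      M = suc m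
      Y = M ℕ.* M

      w : ℕ → ℤ
      w n = weight n * cutoff Y n

      w-vanishes : ∀ n → Y ℕ.< n → w n ≡ + 0
      w-vanishes n Y<n = trans (cong (weight n *_) (cutoff-zero (ℕ.<⇒≤ Y<n))) (ℤ.*-zeroʳ (weight n))

      S T : ℤ
      S = ∑ (allFin h) (λ j → ∑ (box (radius (F j) m)) (λ v → w ∣ FormValues.value (F j) (proj₁ v) (proj₂ v) ∣))
      T = ∑ (1⋯ Y) (λ d → ∑ (1⋯ Y) (λ e → twisted d * (sgn (+ e) * cutoff Y (d ℕ.* e))))

      S≤ : ∣ S ∣ ℕ.≤ h ℕ.* (C ℕ.* (M ℕ.^ 3))
      S≤ = subst (λ l → ∣ S ∣ ℕ.≤ l ℕ.* (C ℕ.* (M ℕ.^ 3))) (length-tabulate {n = h} (λ i → i))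
        (∑-abs-≤ (allFin h) (λ j → ∑ (box (radius (F j) m)) (λ v → w ∣ FormValues.value (F j) (proj₁ v) (proj₂ v) ∣)) (C ℕ.* (M ℕ.^ 3))
          (λ {j} _ → ℕ.≤-trans (proj₂ (lattice-bound (F j)) m) (ℕ.*-monoˡ-≤ (M ℕ.^ 3) (proj₂ (fin-bound (λ j → proj₁ (lattice-bound (F j)))) j))))

      ideals : ∑ (1⋯ Y) (λ m → ∑ (1⋯ Y) (λ b → rootCount c b * w (m ℕ.* m ℕ.* b))) ≡ T
      ideals = trans (∑-regroup Y (λ m b → m ℕ.* m ℕ.* b) (λ _ b → rootCount c b) w w-vanishes (λ p q → ℕ.*-mono-≤ (ℕ.*-mono-≤ p p) q))
        (trans (∑-cong (1⋯ Y) (λ {n} n∈ → cong (w n *_) (IdealCount.idealCount≡divisorSum char squareFree Y n (∈1⋯-≥1 n∈) (∈1⋯-≤ n∈))))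
          (trans (sym (∑-regroup Y ℕ._*_ (λ d _ → χ (+ d)) w w-vanishes ℕ.*-mono-≤)) (weight-sum Y (cutoff Y) (λ n Y<n → cutoff-zero (ℕ.<⇒≤ Y<n)))))

      S≡ : S ≡ + h * ((+ 2 + s) * (+ Y * + Y)) + + 2 * T
      S≡ = trans (representation-sum Y w w-vanishes (λ j → radius (F j) m) (λ j x y → radius-large (F j) m x y))
        (cong₂ (λ x y → + h * x + + 2 * y) (cong ((+ 2 + s) *_) (ℤ.pos-* Y Y)) ideals)

      Yℤ : + Y ≡ + k * + P * (+ k * + P)
      Yℤ = trans (ℤ.pos-* M M) (cong (λ z → z * z) (ℤ.pos-* k P))

      K⁴ : ℤ
      K⁴ = + k * + k * (+ k * + k)

      T-main : ℤ
      T-main = T - + P * + P * (α * β) * K⁴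

      X≡ : X * K⁴ ≡ S + - (+ 2 * T-main)
      X≡ = trans (lemma (+ h) (+ 2 + s) (+ k) (+ P) α β T) (cong (λ z → z + - (+ 2 * T-main)) (trans (cong (λ y → + h * ((+ 2 + s) * (y * y)) + + 2 * T) (sym Yℤ)) (sym S≡)))
        where
        lemma : ∀ h r k p α β t → (h * r * (p * p * (p * p)) + + 2 * (p * p * (α * β))) * (k * k * (k * k)) ≡
          h * (r * (k * p * (k * p) * (k * p * (k * p)))) + + 2 * t + - (+ 2 * (t - p * p * (α * β) * (k * k * (k * k))))
        lemma = solve-∀

      X≤ : ∣ X * K⁴ ∣ ℕ.≤ (h ℕ.* (C ℕ.* (P ℕ.* P ℕ.* P)) ℕ.+ 2 ℕ.* H) ℕ.* (k ℕ.* k ℕ.* k)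
      X≤ = subst (λ z → ∣ z ∣ ℕ.≤ (h ℕ.* (C ℕ.* (P ℕ.* P ℕ.* P)) ℕ.+ 2 ℕ.* H) ℕ.* (k ℕ.* k ℕ.* k)) (sym X≡)
        (ℕ.≤-trans (abs-+-≤ S (- (+ 2 * T-main)) S≤ (abs-neg-≤ (+ 2 * T-main) (abs-*-≤ (+ 2) T-main ℕ.≤-refl (hyperbola twisted-Balanced sgn-Balanced k₀))))
          (ℕ.≤-reflexive (lemma h C H k P)))
        where
        lemma : ∀ h c e k p → h ℕ.* (c ℕ.* (k ℕ.* p ℕ.* (k ℕ.* p ℕ.* (k ℕ.* p ℕ.* 1)))) ℕ.+ 2 ℕ.* (e ℕ.* (k ℕ.* k ℕ.* k)) ≡ (h ℕ.* (c ℕ.* (p ℕ.* p ℕ.* p)) ℕ.+ 2 ℕ.* e) ℕ.* (k ℕ.* k ℕ.* k)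
        lemma = ℕ-solve-∀

    X≡0 : X ≡ + 0
    X≡0 = growth X (h ℕ.* (C ℕ.* (P ℕ.* P ℕ.* P)) ℕ.+ 2 ℕ.* H) X≤

  class-number-formula : + h * + N ≡ - firstMoment
  class-number-formula = ∣-cancel {+ 2 * (+ P * + P * + P) * (+ 2 + s)} {x = - firstMoment} (+ h * + N) nonzero (trans (lemma (+ h) s (+ N) (+ P) firstMoment Pℤ)
      (trans (cong (_+ + 2 * (+ P * + P * + P) * (+ 2 + s) * - firstMoment) (trans (cong₂ (λ x y → + h * (+ 2 + s) * (+ P * + P * (+ P * + P)) + + 2 * (+ P * + P * (x * y))) (sym twisted-moment) (sym sgn-moment)) X≡0)) (ℤ.+-identityˡ _)))
    where
    Pℤ : + P ≡ + N + + N
    Pℤ = ℤ.pos-+ N N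
    lemma : ∀ h s n p f → p ≡ n + n → + 2 * (p * p * p) * (+ 2 + s) * (h * n) ≡
      h * (+ 2 + s) * (p * p * (p * p)) + + 2 * (p * p * (+ 2 * (+ 2 + s) * f * n)) + + 2 * (p * p * p) * (+ 2 + s) * - f
    lemma h s n _ f refl = lemma′ h s n f
      where
      lemma′ : ∀ h s n f → + 2 * ((n + n) * (n + n) * (n + n)) * (+ 2 + s) * (h * n) ≡
        h * (+ 2 + s) * ((n + n) * (n + n) * ((n + n) * (n + n))) + + 2 * ((n + n) * (n + n) * (+ 2 * (+ 2 + s) * f * n)) + + 2 * ((n + n) * (n + n) * (n + n)) * (+ 2 + s) * - f
      lemma′ = solve-∀
    nonzero : + 2 * (+ P * + P * + P) * (+ 2 + s) ≢ + 0
    nonzero = go (sgn-unit (+ c))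
      where
      go : ∀ {s} → Unit s → + 2 * (+ P * + P * + P) * (+ 2 + s) ≢ + 0
      go (inj₁ refl) ()
      go (inj₂ refl) ()

-- Forms representing the ideal classes

module ClassNumber (D : ℤ) (c : ℕ) (D≡-N : D ≡ - + conductor c) (squareFree : ∀ d → d ℕ.* d ℕ.∣ conductor c → d ≡ 1) (1≤c : 1 ℕ.≤ c)
  (h : ℕ) (classes : IsClassNumber D h) where

  open Integers D c D≡-N
  open Ideals D c D≡-N
  open IdealClasses D c D≡-N
  open Bijection classes using (to; injective; strictlySurjective)

  private
    ideal-form : ∀ I → Σ (Form c) λ F → Shape I (FormValues.a F) (FormValues.t F)
    ideal-form I = go (ideal-shape squareFree I)
      where
      go : ∃[ a ] ∃[ t ] + suc a ∣ₛ norm c t × Shape I (+ suc a) t → Σ (Form c) λ F → Shape I (FormValues.a F) (FormValues.t F)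
      go (a , t , divides k eq , shape) = record { lead = a ; shift = t ; last = k ; norm≡ = eq } , shape

    form-ideal : Form c → FractionalIdeal
    form-ideal G = standardIdeal squareFree (FormValues.a G) (FormValues.t G)

    form-ideal-shape : ∀ G → Shape (form-ideal G) (FormValues.a G) (FormValues.t G)
    form-ideal-shape G = standardIdeal-shape squareFree (FormValues.a G) (FormValues.t G) (divides (Form.last G) (Form.norm≡ G))

  classForm : Fin h → Form c
  classForm j = proj₁ (ideal-form (to j))

  private
    classForm-shape : ∀ j → Shape (to j) (FormValues.a (classForm j)) (FormValues.t (classForm j))
    classForm-shape j = proj₂ (ideal-form (to j))

  represented : ∀ (G : Form c) → ∃[ j ] ∃[ x ] ∃[ y ] Match (classForm j) x y (suc (Form.lead G)) (Form.shift G)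
  represented G = proj₁ surj , equivalent⇒match (form-ideal G) (to (proj₁ surj)) G (classForm (proj₁ surj)) (form-ideal-shape G) (classForm-shape (proj₁ surj))
      (∼-sym {to (proj₁ surj)} {form-ideal G} (proj₂ surj))
    where
    surj = strictlySurjective (form-ideal G)

  inequivalent : ∀ (G : Form c) {i j x y x′ y′} → Match (classForm i) x y (suc (Form.lead G)) (Form.shift G) →
                 Match (classForm j) x′ y′ (suc (Form.lead G)) (Form.shift G) → i ≡ j
  inequivalent G {i} {j} mt mt′ = injective (∼-trans {to i} {form-ideal G} {to j} (∼-sym {form-ideal G} {to i} (equivalent i mt)) (equivalent j mt′))
    where
    equivalent : ∀ j {x y} → Match (classForm j) x y (suc (Form.lead G)) (Form.shift G) → form-ideal G ∼ to j
    equivalent j mt = match⇒equivalent G (classForm j) mt (form-ideal G) (to j) (form-ideal-shape G) (classForm-shape j)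

  class-number : + h * + conductor c ≡ - ∑< (conductor c) (λ x → + x * Jacobi.χ c (+ x))
  class-number = ClassNumberFormula.class-number-formula (Jacobi.isQuadraticCharacter c) squareFree 1≤c h classForm represented inequivalent

discriminant : ∀ D → D < - + 4 → D ℤ.%ℕ 4 ≡ 1 → ∃[ c ] 1 ℕ.≤ c × D ≡ - + conductor c
discriminant D D<-4 D≡1 = go (D ℤ./ℕ 4) (trans (ℤ.a≡a%ℕn+[a/ℕn]*n D 4) (cong (λ r → + r + D ℤ./ℕ 4 * + 4) D≡1))
  where
  go : ∀ q → D ≡ + 1 + q * + 4 → ∃[ c ] 1 ℕ.≤ c × D ≡ - + conductor c
  go (+ k) eq = contradiction D<-4 (ℤ.<-asym (subst (- + 4 <_) (sym (trans eq (trans (cong (_+_ (+ 1)) (sym (ℤ.pos-* k 4))) (sym (ℤ.pos-+ 1 (k ℕ.* 4)))))) -<+))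
  go -[1+ zero ] eq = contradiction D<-4 (ℤ.<-asym (subst (- + 4 <_) (sym eq) (ℤ.-<- (s≤s (s≤s (s≤s z≤n))))))
  go -[1+ suc c ] eq = suc c , s≤s z≤n , trans eq (trans (cong (λ z → + 1 + - z * + 4) (ℤ.pos-+ 1 (suc c))) (trans (lemma (+ suc c)) (cong -_ (sym (conductor-ℤ (suc c))))))
    where
    lemma : ∀ c → + 1 + - (+ 1 + c) * + 4 ≡ - (+ 4 * c + + 3)
    lemma = solve-∀

-- The sums over twelfths

/-unique : ∀ a n k .{{_ : NonZero n}} → k ℕ.* n ℕ.≤ a → a ℕ.< suc k ℕ.* n → a ℕ./ n ≡ k
/-unique a n k lower upper = ℕ.≤-antisym (ℕ.≤-pred (ℕ.m<n*o⇒m/o<n {a} {suc k} upper)) (subst (ℕ._≤ a ℕ./ n) (ℕ.m*n/n≡m k n) (ℕ./-monoˡ-≤ n lower))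

module Twelfths {c : ℕ} {χ : ℤ → ℤ} (char : QuadraticCharacter c χ) (coprime-12 : Coprime 12 (conductor c))
  (h : ℤ) (formula : h * + conductor c ≡ - CharacterSums.firstMoment char) where

  open QuadraticCharacter char
  open CharacterSums char

  floor-sum : ∀ m → m ℕ.∣ 12 → ∑< N (λ x → + (m ℕ.* x ℕ./ N) * χ (+ x)) ≡ - ((+ m - χ (+ m)) * h)
  floor-sum m m∣12 = ∣-cancel {+ N} G (λ ()) (trans (lemma₁ R (+ N * G)) (trans (cong₂ _-_ (sym total) remainders)
      (trans (lemma₂ (+ m) (χ (+ m)) firstMoment) (trans (cong ((+ m - χ (+ m)) *_) moment≡) (lemma₃ (+ m - χ (+ m)) h (+ N))))))
    where
    G R : ℤ
    G = ∑< N (λ x → + (m ℕ.* x ℕ./ N) * χ (+ x))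
    R = ∑< N (λ x → + (m ℕ.* x % N) * χ (+ x))
    coprime : Coprime m N
    coprime (d∣m , d∣N) = coprime-12 (ℕ.∣-trans d∣m m∣12 , d∣N)
    moment≡ : firstMoment ≡ - (h * + N)
    moment≡ = trans (sym (ℤ.neg-involutive firstMoment)) (cong -_ (sym formula))
    lemma₁ : ∀ a b → b ≡ a + b - a
    lemma₁ = solve-∀
    lemma₂ : ∀ m x f → m * f - x * f ≡ (m - x) * f
    lemma₂ = solve-∀
    lemma₃ : ∀ d h n → d * - (h * n) ≡ n * - (d * h)
    lemma₃ = solve-∀
    total : + m * firstMoment ≡ R + + N * G
    total = trans (sym (∑-*ˡ (downFrom N) (+ m) (λ x → + x * χ (+ x)))) (trans (∑-ext (downFrom N) pointwise)
      (trans (∑-+ (downFrom N) (λ x → + (m ℕ.* x % N) * χ (+ x)) (λ x → + N * (+ (m ℕ.* x ℕ./ N) * χ (+ x)))) (cong (_+_ R) (∑-*ˡ (downFrom N) (+ N) (λ x → + (m ℕ.* x ℕ./ N) * χ (+ x))))))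
      where
      lemma : ∀ r q n x → (r + q * n) * x ≡ r * x + n * (q * x)
      lemma = solve-∀
      pointwise : ∀ x → + m * (+ x * χ (+ x)) ≡ + (m ℕ.* x % N) * χ (+ x) + + N * (+ (m ℕ.* x ℕ./ N) * χ (+ x))
      pointwise x = trans (sym (ℤ.*-assoc (+ m) (+ x) (χ (+ x)))) (trans (cong (_* χ (+ x)) (trans (sym (ℤ.pos-* m x)) (trans (cong +_ (m≡m%n+[m/n]*n (m ℕ.* x) N))
        (trans (ℤ.pos-+ (m ℕ.* x % N) (m ℕ.* x ℕ./ N ℕ.* N)) (cong (_+_ (+ (m ℕ.* x % N))) (ℤ.pos-* (m ℕ.* x ℕ./ N) N)))))) (lemma (+ (m ℕ.* x % N)) (+ (m ℕ.* x ℕ./ N)) (+ N) (χ (+ x))))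
    remainders : R ≡ χ (+ m) * firstMoment
    remainders = trans (∑-ext (downFrom N) pointwise) (trans (∑-*ˡ (downFrom N) (χ (+ m)) (λ x → f ((+ 0 + + m * + x) ℤ.%ℕ N))) (cong (χ (+ m) *_) (∑<-affine N (+ 0) f coprime)))
      where
      f : ℕ → ℤ
      f r = + r * χ (+ r)
      lemma : ∀ u r x → r * x * (u * u) ≡ u * (r * (u * x))
      lemma = solve-∀
      reduced : ∀ x → (+ 0 + + m * + x) ℤ.%ℕ N ≡ m ℕ.* x % N
      reduced x = cong (ℤ._%ℕ N) (trans (ℤ.+-identityˡ (+ m * + x)) (sym (ℤ.pos-* m x)))
      pointwise : ∀ x → + (m ℕ.* x % N) * χ (+ x) ≡ χ (+ m) * f ((+ 0 + + m * + x) ℤ.%ℕ N)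
      pointwise x = trans (sym (trans (cong (+ (m ℕ.* x % N) * χ (+ x) *_) (unit-square (χ-unit m coprime))) (ℤ.*-identityʳ (+ (m ℕ.* x % N) * χ (+ x)))))
        (trans (lemma (χ (+ m)) (+ (m ℕ.* x % N)) (χ (+ x))) (cong (χ (+ m) *_) (trans (cong (+ (m ℕ.* x % N) *_) (trans (sym (χ-* (+ m) (+ x))) (χ-cong (≈-trans (≈-reflexive (sym (ℤ.pos-* m x))) (≈-sym (%ℕ-≈ (+ (m ℕ.* x)) N))))))
          (cong f (sym (reduced x))))))

  twelfth : ℕ → ℕ
  twelfth x = 12 ℕ.* x ℕ./ N

  e : ℕ → ℤ
  e k = ∑< N (λ x → 𝟙 (twelfth x ℕ.≟ k) * χ (+ x))

  twelfth<12 : ∀ {x} → x ℕ.< N → twelfth x ℕ.< 12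
  twelfth<12 {x} x<N = ℕ.m<n*o⇒m/o<n {12 ℕ.* x} {12} (ℕ.*-monoʳ-< 12 x<N)

  twelfth-lower : ∀ {x} → 0 ℕ.< x → x ℕ.< N → twelfth x ℕ.* N ℕ.< 12 ℕ.* x
  twelfth-lower {x} 0<x x<N = ℕ.≤∧≢⇒< (ℕ.m/n*n≤m (12 ℕ.* x) N) (λ eq → ℕ.<⇒≱ x<N (ℕ.∣⇒≤ {{ℕ.>-nonZero 0<x}} (Coprimality.coprime-divisor (Coprimality.sym coprime-12) (ℕ.divides (twelfth x) (sym eq)))))

  twelfth-upper : ∀ x → 12 ℕ.* x ℕ.< suc (twelfth x) ℕ.* N
  twelfth-upper x = ℕ.≤-trans (ℕ.≤-reflexive (cong suc (m≡m%n+[m/n]*n (12 ℕ.* x) N))) (ℕ.+-monoˡ-< (twelfth x ℕ.* N) (m%n<n (12 ℕ.* x) N))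

  twelfth-reflect : ∀ {x j} → 0 ℕ.< x → x ℕ.< N → twelfth x ℕ.+ j ≡ 11 → twelfth (N ℕ.∸ x) ≡ j
  twelfth-reflect {x} {j} 0<x x<N q+j = /-unique (12 ℕ.* y) N j lower upper
    where
    y = N ℕ.∸ x
    q = twelfth x
    total : 12 ℕ.* x ℕ.+ 12 ℕ.* y ≡ q ℕ.* N ℕ.+ suc j ℕ.* N
    total = trans (sym (ℕ.*-distribˡ-+ 12 x y)) (trans (cong (12 ℕ.*_) (ℕ.m+[n∸m]≡n (ℕ.<⇒≤ x<N))) (trans (cong (ℕ._* N) (sym (trans (ℕ.+-suc q j) (cong suc q+j)))) (ℕ.*-distribʳ-+ N q (suc j))))
    lemma : ∀ q j n → suc q ℕ.* n ℕ.+ j ℕ.* n ≡ q ℕ.* n ℕ.+ suc j ℕ.* n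
    lemma = ℕ-solve-∀
    lower : j ℕ.* N ℕ.≤ 12 ℕ.* y
    lower = ℕ.+-cancelˡ-≤ (12 ℕ.* x) (j ℕ.* N) (12 ℕ.* y) (ℕ.≤-trans (ℕ.+-monoˡ-≤ (j ℕ.* N) (ℕ.<⇒≤ (twelfth-upper x))) (ℕ.≤-reflexive (trans (lemma q j N) (sym total))))
    upper : 12 ℕ.* y ℕ.< suc j ℕ.* N
    upper = ℕ.+-cancelˡ-< (q ℕ.* N) (12 ℕ.* y) (suc j ℕ.* N) (ℕ.<-≤-trans (ℕ.+-monoˡ-< (12 ℕ.* y) (twelfth-lower 0<x x<N)) (ℕ.≤-reflexive total))

  e-reflect : ∀ k j → k ℕ.+ j ≡ 11 → e j ≡ - e k
  e-reflect k j k+j = trans (∑<-reverse N (f j)) (trans (∑<-cong N (λ {i} → pointwise i)) (trans (∑-neg (downFrom N) (f k ∘ suc)) (cong -_ (trans (sym (∑-map (downFrom N) suc (f k))) (∑-1⋯-shift N (f k) (trans (vanish k 0 χ-0) (sym (vanish k N χ-N))))))))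
    where
    f : ℕ → ℕ → ℤ
    f k x = 𝟙 (twelfth x ℕ.≟ k) * χ (+ x)
    vanish : ∀ k x → χ (+ x) ≡ + 0 → f k x ≡ + 0
    vanish k x eq = trans (cong (𝟙 (twelfth x ℕ.≟ k) *_) eq) (ℤ.*-zeroʳ (𝟙 (twelfth x ℕ.≟ k)))
    interior : ∀ x → 0 ℕ.< x → x ℕ.< N → f j (N ℕ.∸ x) ≡ - f k x
    interior x 0<x x<N = trans (cong₂ _*_ (𝟙-⇔ (twelfth (N ℕ.∸ x) ℕ.≟ j) (twelfth x ℕ.≟ k) to from) (χ-reflect x (ℕ.<⇒≤ x<N))) (sym (ℤ.neg-distribʳ-* (𝟙 (twelfth x ℕ.≟ k)) (χ (+ x))))
      where
      q≤11 : twelfth x ℕ.≤ 11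
      q≤11 = ℕ.≤-pred (twelfth<12 x<N)
      reflected : twelfth (N ℕ.∸ x) ≡ 11 ℕ.∸ twelfth x
      reflected = twelfth-reflect 0<x x<N (ℕ.m+[n∸m]≡n q≤11)
      to : twelfth (N ℕ.∸ x) ≡ j → twelfth x ≡ k
      to eq = ℕ.+-cancelʳ-≡ j (twelfth x) k (trans (trans (cong (twelfth x ℕ.+_) (trans (sym eq) reflected)) (ℕ.m+[n∸m]≡n q≤11)) (sym k+j))
      from : twelfth x ≡ k → twelfth (N ℕ.∸ x) ≡ j
      from refl = twelfth-reflect 0<x x<N k+j
    pointwise : ∀ i → i ℕ.< N → f j (N ℕ.∸ suc i) ≡ - f k (suc i)
    pointwise i i<N with ℕ.m≤n⇒m<n∨m≡n i<N
    ... | inj₁ lt = interior (suc i) (s≤s z≤n) lt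
    ... | inj₂ eq = trans (vanish j (N ℕ.∸ suc i) (trans (cong (λ n → χ (+ n)) (trans (cong (N ℕ.∸_) eq) (ℕ.n∸n≡0 N))) χ-0)) (sym (cong -_ (vanish k (suc i) (trans (cong (λ n → χ (+ n)) eq) χ-N))))

  collect : ∀ (φ : ℕ → ℤ) → ∑< N (λ x → φ (twelfth x) * χ (+ x)) ≡ ∑< 12 (λ k → φ k * e k)
  collect φ = begin
    ∑< N (λ x → φ (twelfth x) * χ (+ x))
      ≡⟨ ∑<-cong N (λ {x} x<N → sym (∑-𝟙-* (λ k → twelfth x ℕ.≟ k) (λ k → φ k * χ (+ x)) (Unique.downFrom⁺ 12) (∈-downFrom⁺ (twelfth<12 x<N)) refl (λ _ → sym))) ⟩
    ∑< N (λ x → ∑< 12 (λ k → 𝟙 (twelfth x ℕ.≟ k) * (φ k * χ (+ x))))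
      ≡⟨ ∑-swap (downFrom N) (downFrom 12) (λ x k → 𝟙 (twelfth x ℕ.≟ k) * (φ k * χ (+ x))) ⟩
    ∑< 12 (λ k → ∑< N (λ x → 𝟙 (twelfth x ℕ.≟ k) * (φ k * χ (+ x))))
      ≡⟨ ∑-ext (downFrom 12) (λ k → trans (∑-ext (downFrom N) (λ x → lemma (𝟙 (twelfth x ℕ.≟ k)) (φ k) (χ (+ x)))) (∑-*ˡ (downFrom N) (φ k) (λ x → 𝟙 (twelfth x ℕ.≟ k) * χ (+ x)))) ⟩
    ∑< 12 (λ k → φ k * e k) ∎
    where
    open ≡-Reasoning
    lemma : ∀ i p x → i * (p * x) ≡ p * (i * x)
    lemma = solve-∀

  weighted : (ℕ → ℤ) → ℤ
  weighted φ = (φ 0 - φ 11) * e 0 + (φ 1 - φ 10) * e 1 + (φ 2 - φ 9) * e 2 + (φ 3 - φ 8) * e 3 + (φ 4 - φ 7) * e 4 + (φ 5 - φ 6) * e 5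

  fold : ∀ (φ : ℕ → ℤ) → ∑< 12 (λ k → φ k * e k) ≡ weighted φ
  fold φ = trans (halves (φ 11 * e 11) (φ 10 * e 10) (φ 9 * e 9) (φ 8 * e 8) (φ 7 * e 7) (φ 6 * e 6) (φ 5 * e 5) (φ 4 * e 4) (φ 3 * e 3) (φ 2 * e 2) (φ 1 * e 1) (φ 0 * e 0))
    (cong₂ _+_ (cong₂ _+_ (cong₂ _+_ (cong₂ _+_ (cong₂ _+_ (pair 0 11 refl) (pair 1 10 refl)) (pair 2 9 refl)) (pair 3 8 refl)) (pair 4 7 refl)) (pair 5 6 refl))
    where
    halves : ∀ a b c d e f g h i j k l → a + (b + (c + (d + (e + (f + (g + (h + (i + (j + (k + (l + + 0))))))))))) ≡ l + a + (k + b) + (j + c) + (i + d) + (h + e) + (g + f)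
    halves = solve-∀
    lemma : ∀ p q x → p * x + q * - x ≡ (p - q) * x
    lemma = solve-∀
    pair : ∀ k j → k ℕ.+ j ≡ 11 → φ k * e k + φ j * e j ≡ (φ k - φ j) * e k
    pair k j eq = trans (cong (λ z → φ k * e k + φ j * z) (e-reflect k j eq)) (lemma (φ k) (φ j) (e k))

  relation : ∀ d m .{{_ : NonZero d}} → m ℕ.* d ≡ 12 → weighted (λ k → + (k ℕ./ d)) ≡ - ((+ m - χ (+ m)) * h)
  relation d m md = trans (sym (fold (λ k → + (k ℕ./ d)))) (trans (sym (collect (λ k → + (k ℕ./ d)))) (trans (∑-ext (downFrom N) (λ x → cong (λ k → + k * χ (+ x)) (coarsen x))) (floor-sum m (ℕ.divides d (trans (sym md) (ℕ.*-comm m d))))))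
    where
    instance
      dN≢0 : NonZero (d ℕ.* N)
      dN≢0 = ℕ.m*n≢0 d N
      Nd≢0 : NonZero (N ℕ.* d)
      Nd≢0 = ℕ.m*n≢0 N d
    coarsen : ∀ x → twelfth x ℕ./ d ≡ m ℕ.* x ℕ./ N
    coarsen x = trans (ℕ.m/n/o≡m/[n*o] (12 ℕ.* x) N d) (trans (cong (ℕ._/ (N ℕ.* d)) (trans (cong (ℕ._* x) (sym md)) (lemma m d x))) (ℕ.m*n/o*n≡m/o (m ℕ.* x) d N))
      where
      lemma : ∀ m d x → m ℕ.* d ℕ.* x ≡ m ℕ.* x ℕ.* d
      lemma = ℕ-solve-∀

  private
    ε τ : ℤ
    ε = χ (+ 2)
    τ = χ (+ 3)

    χ-4 : χ (+ 4) ≡ + 1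
    χ-4 = trans (χ-* (+ 2) (+ 2)) (unit-square (χ-unit 2 (λ (d∣2 , d∣N) → coprime-12 (ℕ.∣-trans d∣2 (ℕ.divides 6 refl) , d∣N))))

    χ-12 : χ (+ 12) ≡ τ
    χ-12 = trans (χ-* (+ 4) (+ 3)) (trans (cong (_* τ) χ-4) (ℤ.*-identityˡ τ))

    S₂ S₃ S₄ S₆ S₁₂ : ℤ
    S₂  = weighted (λ k → + (k ℕ./ 6))
    S₃  = weighted (λ k → + (k ℕ./ 4))
    S₄  = weighted (λ k → + (k ℕ./ 3))
    S₆  = weighted (λ k → + (k ℕ./ 2))
    S₁₂ = weighted (λ k → + (k ℕ./ 1))

    eliminate : ∀ (f : ℤ → ℤ → ℤ → ℤ → ℤ → ℤ) → f S₂ S₃ S₄ S₆ S₁₂ ≡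
      f (- ((+ 2 - ε) * h)) (- ((+ 3 - τ) * h)) (- ((+ 4 - + 1) * h)) (- ((+ 6 - ε * τ) * h)) (- ((+ 12 - τ) * h))
    eliminate f = cong₅ (relation 6 2 refl) (relation 4 3 refl) (trans (relation 3 4 refl) (cong (λ x → - ((+ 4 - x) * h)) χ-4))
      (trans (relation 2 6 refl) (cong (λ x → - ((+ 6 - x) * h)) (χ-* (+ 2) (+ 3)))) (trans (relation 1 12 refl) (cong (λ x → - ((+ 12 - x) * h)) χ-12))
      where
      cong₅ : ∀ {a b c d e a′ b′ c′ d′ e′} → a ≡ a′ → b ≡ b′ → c ≡ c′ → d ≡ d′ → e ≡ e′ → f a b c d e ≡ f a′ b′ c′ d′ e′
      cong₅ refl refl refl refl refl = refl


    double₁ : + 2 * e 1 ≡ (+ 1 + τ + ε - ε * τ) * h - + 2 * e 0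
    double₁ = trans (lemma (e 0) (e 1) (e 2) (e 3) (e 4) (e 5)) (trans (eliminate (λ a b c d f → a + b - d - + 2 * e 0)) (lemma′ ε τ h (e 0)))
      where
      lemma : ∀ a b c d e f → + 2 * b ≡
        ((+ 0 - + 1) * a + (+ 0 - + 1) * b + (+ 0 - + 1) * c + (+ 0 - + 1) * d + (+ 0 - + 1) * e + (+ 0 - + 1) * f)
        + ((+ 0 - + 2) * a + (+ 0 - + 2) * b + (+ 0 - + 2) * c + (+ 0 - + 2) * d + (+ 1 - + 1) * e + (+ 1 - + 1) * f)
        - ((+ 0 - + 5) * a + (+ 0 - + 5) * b + (+ 1 - + 4) * c + (+ 1 - + 4) * d + (+ 2 - + 3) * e + (+ 2 - + 3) * f)
        - + 2 * a
      lemma = solve-∀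
      lemma′ : ∀ ε τ h a → - ((+ 2 - ε) * h) + - ((+ 3 - τ) * h) - - ((+ 6 - ε * τ) * h) - + 2 * a ≡ (+ 1 + τ + ε - ε * τ) * h - + 2 * a
      lemma′ = solve-∀

    double₂ : + 2 * e 2 ≡ (ε * τ - τ) * h
    double₂ = trans (lemma (e 0) (e 1) (e 2) (e 3) (e 4) (e 5)) (trans (eliminate (λ a b c d f → d - c - b)) (lemma′ ε τ h))
      where
      lemma : ∀ a b c d e f → + 2 * c ≡
        ((+ 0 - + 5) * a + (+ 0 - + 5) * b + (+ 1 - + 4) * c + (+ 1 - + 4) * d + (+ 2 - + 3) * e + (+ 2 - + 3) * f)
        - ((+ 0 - + 3) * a + (+ 0 - + 3) * b + (+ 0 - + 3) * c + (+ 1 - + 2) * d + (+ 1 - + 2) * e + (+ 1 - + 2) * f)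
        - ((+ 0 - + 2) * a + (+ 0 - + 2) * b + (+ 0 - + 2) * c + (+ 0 - + 2) * d + (+ 1 - + 1) * e + (+ 1 - + 1) * f)
      lemma = solve-∀
      lemma′ : ∀ ε τ h → - ((+ 6 - ε * τ) * h) - - ((+ 4 - + 1) * h) - - ((+ 3 - τ) * h) ≡ (ε * τ - τ) * h
      lemma′ = solve-∀

    double₃ : + 2 * e 3 ≡ (+ 2 - τ - ε) * h
    double₃ = trans (lemma (e 0) (e 1) (e 2) (e 3) (e 4) (e 5)) (trans (eliminate (λ a b c d f → c - b - a)) (lemma′ ε τ h))
      where
      lemma : ∀ a b c d e f → + 2 * d ≡
        ((+ 0 - + 3) * a + (+ 0 - + 3) * b + (+ 0 - + 3) * c + (+ 1 - + 2) * d + (+ 1 - + 2) * e + (+ 1 - + 2) * f)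
        - ((+ 0 - + 2) * a + (+ 0 - + 2) * b + (+ 0 - + 2) * c + (+ 0 - + 2) * d + (+ 1 - + 1) * e + (+ 1 - + 1) * f)
        - ((+ 0 - + 1) * a + (+ 0 - + 1) * b + (+ 0 - + 1) * c + (+ 0 - + 1) * d + (+ 0 - + 1) * e + (+ 0 - + 1) * f)
      lemma = solve-∀
      lemma′ : ∀ ε τ h → - ((+ 4 - + 1) * h) - - ((+ 3 - τ) * h) - - ((+ 2 - ε) * h) ≡ (+ 2 - τ - ε) * h
      lemma′ = solve-∀

    double₄ : + 2 * e 4 ≡ (+ 2 - ε + ε * τ) * h - + 2 * e 0
    double₄ = trans (lemma (e 0) (e 1) (e 2) (e 3) (e 4) (e 5)) (trans (eliminate (λ a b c d f → b + c + d - f - a - + 2 * e 0)) (lemma′ ε τ h (e 0)))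
      where
      lemma : ∀ a b c d e f → + 2 * e ≡
        ((+ 0 - + 2) * a + (+ 0 - + 2) * b + (+ 0 - + 2) * c + (+ 0 - + 2) * d + (+ 1 - + 1) * e + (+ 1 - + 1) * f)
        + ((+ 0 - + 3) * a + (+ 0 - + 3) * b + (+ 0 - + 3) * c + (+ 1 - + 2) * d + (+ 1 - + 2) * e + (+ 1 - + 2) * f)
        + ((+ 0 - + 5) * a + (+ 0 - + 5) * b + (+ 1 - + 4) * c + (+ 1 - + 4) * d + (+ 2 - + 3) * e + (+ 2 - + 3) * f)
        - ((+ 0 - + 11) * a + (+ 1 - + 10) * b + (+ 2 - + 9) * c + (+ 3 - + 8) * d + (+ 4 - + 7) * e + (+ 5 - + 6) * f)
        - ((+ 0 - + 1) * a + (+ 0 - + 1) * b + (+ 0 - + 1) * c + (+ 0 - + 1) * d + (+ 0 - + 1) * e + (+ 0 - + 1) * f)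
        - + 2 * a
      lemma = solve-∀
      lemma′ : ∀ ε τ h a → - ((+ 3 - τ) * h) + - ((+ 4 - + 1) * h) + - ((+ 6 - ε * τ) * h) - - ((+ 12 - τ) * h) - - ((+ 2 - ε) * h) - + 2 * a ≡ (+ 2 - ε + ε * τ) * h - + 2 * a
      lemma′ = solve-∀

    double₅ : + 2 * e 5 ≡ (- + 1 - ε + τ - ε * τ) * h + + 2 * e 0
    double₅ = trans (lemma (e 0) (e 1) (e 2) (e 3) (e 4) (e 5)) (trans (eliminate (λ a b c d f → f - a - c - d + + 2 * e 0)) (lemma′ ε τ h (e 0)))
      where
      lemma : ∀ a b c d e f → + 2 * f ≡
        ((+ 0 - + 11) * a + (+ 1 - + 10) * b + (+ 2 - + 9) * c + (+ 3 - + 8) * d + (+ 4 - + 7) * e + (+ 5 - + 6) * f)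
        - ((+ 0 - + 1) * a + (+ 0 - + 1) * b + (+ 0 - + 1) * c + (+ 0 - + 1) * d + (+ 0 - + 1) * e + (+ 0 - + 1) * f)
        - ((+ 0 - + 3) * a + (+ 0 - + 3) * b + (+ 0 - + 3) * c + (+ 1 - + 2) * d + (+ 1 - + 2) * e + (+ 1 - + 2) * f)
        - ((+ 0 - + 5) * a + (+ 0 - + 5) * b + (+ 1 - + 4) * c + (+ 1 - + 4) * d + (+ 2 - + 3) * e + (+ 2 - + 3) * f)
        + + 2 * a
      lemma = solve-∀
      lemma′ : ∀ ε τ h a → - ((+ 12 - τ) * h) - - ((+ 2 - ε) * h) - - ((+ 4 - + 1) * h) - - ((+ 6 - ε * τ) * h) + + 2 * a ≡ (- + 1 - ε + τ - ε * τ) * h + + 2 * a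
      lemma′ = solve-∀

    halve : ∀ x y → + 2 * x ≡ + 2 * y → x ≡ y
    halve x y = ∣-cancel {+ 2} {y} x (λ ())

  solution : ∀ {ε′ τ′} → χ (+ 2) ≡ ε′ → χ (+ 3) ≡ τ′ → ∀ a₁ a₂ a₃ a₄ a₅ →
    + 1 + τ′ + ε′ - ε′ * τ′ ≡ + 2 * a₁ → ε′ * τ′ - τ′ ≡ + 2 * a₂ → + 2 - τ′ - ε′ ≡ + 2 * a₃ → + 2 - ε′ + ε′ * τ′ ≡ + 2 * a₄ → - + 1 - ε′ + τ′ - ε′ * τ′ ≡ + 2 * a₅ →
    e 1 ≡ a₁ * h - e 0 × e 2 ≡ a₂ * h × e 3 ≡ a₃ * h × e 4 ≡ a₄ * h - e 0 × e 5 ≡ a₅ * h + e 0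
  solution refl refl a₁ a₂ a₃ a₄ a₅ eq₁ eq₂ eq₃ eq₄ eq₅ =
    halve (e 1) (a₁ * h - e 0) (trans double₁ (trans (cong (λ z → z * h - + 2 * e 0) eq₁) (minus a₁ h (e 0)))) ,
    halve (e 2) (a₂ * h) (trans double₂ (trans (cong (_* h) eq₂) (ℤ.*-assoc (+ 2) a₂ h))) ,
    halve (e 3) (a₃ * h) (trans double₃ (trans (cong (_* h) eq₃) (ℤ.*-assoc (+ 2) a₃ h))) ,
    halve (e 4) (a₄ * h - e 0) (trans double₄ (trans (cong (λ z → z * h - + 2 * e 0) eq₄) (minus a₄ h (e 0)))) ,
    halve (e 5) (a₅ * h + e 0) (trans double₅ (trans (cong (λ z → z * h + + 2 * e 0) eq₅) (plus a₅ h (e 0))))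
    where
    minus : ∀ a h x → + 2 * a * h - + 2 * x ≡ + 2 * (a * h - x)
    minus = solve-∀
    plus : ∀ a h x → + 2 * a * h + + 2 * x ≡ + 2 * (a * h + x)
    plus = solve-∀

∑-filter : ∀ {A : Set} {P : A → Set} (P? : ∀ x → Dec (P x)) (f : A → ℤ) xs → sumℤ (map f (filter P? xs)) ≡ ∑ xs (λ x → 𝟙 (P? x) * f x)
∑-filter P? f [] = refl
∑-filter P? f (x ∷ xs) with P? x
... | yes p = cong₂ _+_ (sym (trans (cong (_* f x) (𝟙-yes (yes p) p)) (ℤ.*-identityˡ (f x)))) (∑-filter P? f xs)
... | no ¬p = trans (∑-filter P? f xs) (sym (trans (cong (λ z → z * f x + ∑ xs (λ x → 𝟙 (P? x) * f x)) (𝟙-no (no ¬p) ¬p)) (ℤ.+-identityˡ (∑ xs (λ x → 𝟙 (P? x) * f x)))))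

∑-applyUpTo : ∀ {A : Set} n (g : ℕ → A) (f : A → ℤ) → ∑ (applyUpTo g n) f ≡ ∑< n (f ∘ g)
∑-applyUpTo zero    g f = refl
∑-applyUpTo (suc n) g f = trans (cong (_+_ (f (g 0))) (∑-applyUpTo n (g ∘ suc) f)) (sym (∑<-head n (f ∘ g)))

prime-3 : Prime 3
prime-3 = toWitness {a? = Primality.prime? 3} tt

module Theorem (c : ℕ) (1≤c : 1 ℕ.≤ c) (squareFree : SquareFree (- + conductor c)) (3∤N : ¬ + 3 ∣ - + conductor c)
  (n : ℕ) (classes : IsClassNumber (- + conductor c) n) where

  open Jacobi c using (χ; χ-ℕ; isQuadraticCharacter)
  open QuadraticCharacter isQuadraticCharacter
  open CharacterSums isQuadraticCharacter using (N; χ-0; χ-N)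

  h : ℤ
  h = + n

  coprime-12 : Coprime 12 N
  coprime-12 = Coprimality.sym {N} (coprime-* {N} {4} {3} (coprime-* {N} {2} {2} coprime-2 coprime-2) (prime-∤⇒coprime prime-3 3∤N))
    where
    coprime-2 : Coprime N 2
    coprime-2 = prime-∤⇒coprime Primality.prime[2] (2∤1+n+n (suc (c ℕ.+ c)))

  open Twelfths isQuadraticCharacter coprime-12 h (ClassNumber.class-number (- + conductor c) c refl squareFree 1≤c n classes) using (e; solution; twelfth; twelfth-lower; twelfth-upper)

  E≡e : ∀ k → E (- + conductor c) 12 k ≡ e k
  E≡e k = begin
    E (- + conductor c) 12 k
      ≡⟨ ∑-filter inside? (λ x → jacobi x N) (map suc (upTo N)) ⟩
    ∑ (map suc (upTo N)) (λ x → 𝟙 (inside? x) * jacobi x N)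
      ≡⟨ trans (∑-map (upTo N) suc (λ x → 𝟙 (inside? x) * jacobi x N)) (trans (∑-applyUpTo N id (λ i → 𝟙 (inside? (suc i)) * jacobi (suc i) N)) (∑-ext (downFrom N) (λ i → cong (𝟙 (inside? (suc i)) *_) (sym (χ-ℕ (suc i)))))) ⟩
    ∑< N (λ i → 𝟙 (inside? (suc i)) * χ (+ suc i))
      ≡⟨ trans (sym (∑-map (downFrom N) suc f)) (∑-1⋯-shift N f (trans (vanish 0 χ-0) (sym (vanish N χ-N)))) ⟩
    ∑< N f
      ≡⟨ ∑<-cong N (λ {x} x<N → agree x x<N (coprime? x N)) ⟩
    e k ∎
    where
    open ≡-Reasoning
    Inside-twelfth : ℕ → Set
    Inside-twelfth x = Coprime x N × (k ℕ.* N ℕ.< 12 ℕ.* x) × (12 ℕ.* x ℕ.< suc k ℕ.* N)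
    inside? : ∀ x → Dec (Inside-twelfth x)
    inside? x = coprime? x N ×-dec (k ℕ.* N ℕ.<? 12 ℕ.* x) ×-dec (12 ℕ.* x ℕ.<? suc k ℕ.* N)
    f : ℕ → ℤ
    f x = 𝟙 (inside? x) * χ (+ x)
    vanish : ∀ x → χ (+ x) ≡ + 0 → f x ≡ + 0
    vanish x eq = trans (cong (𝟙 (inside? x) *_) eq) (ℤ.*-zeroʳ (𝟙 (inside? x)))
    agree : ∀ x → x ℕ.< N → Dec (Coprime x N) → f x ≡ 𝟙 (twelfth x ℕ.≟ k) * χ (+ x)
    agree x x<N (no ¬cop) = trans (vanish x (χ-zero x ¬cop)) (sym (trans (cong (𝟙 (twelfth x ℕ.≟ k) *_) (χ-zero x ¬cop)) (ℤ.*-zeroʳ (𝟙 (twelfth x ℕ.≟ k)))))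
    agree zero x<N (yes cop) = contradiction (Coprimality.0-coprimeTo-m⇒m≡1 cop) (λ ())
    agree x@(suc _) x<N (yes cop) = cong (_* χ (+ x)) (𝟙-⇔ (inside? x) (twelfth x ℕ.≟ k)
      (λ (_ , lower , upper) → /-unique (12 ℕ.* x) N k (ℕ.<⇒≤ lower) upper)
      (λ { refl → cop , twelfth-lower (s≤s z≤n) x<N , twelfth-upper x }))

  residue : ∀ a → N % 24 ≡ 4 ℕ.* a ℕ.+ 3 → ∃[ t ] + c ≡ + a + + 6 * t
  residue a eq = + (N ℕ./ 24) , ∣-cancel {+ 4} {+ a + + 6 * + (N ℕ./ 24)} (+ c) (λ ()) (trans (lemma₁ (+ c)) (trans (cong (_- + 3) (trans (sym (conductor-ℤ c)) (trans (cong +_ (m≡m%n+[m/n]*n N 24))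
      (trans (ℤ.pos-+ (N % 24) (N ℕ./ 24 ℕ.* 24)) (cong₂ _+_ (trans (cong +_ eq) (trans (ℤ.pos-+ (4 ℕ.* a) 3) (cong (_+ + 3) (ℤ.pos-* 4 a)))) (ℤ.pos-* (N ℕ./ 24) 24)))))) (lemma₂ (+ a) (+ (N ℕ./ 24)))))
    where
    lemma₁ : ∀ c → + 4 * c ≡ + 4 * c + + 3 - + 3
    lemma₁ = solve-∀
    lemma₂ : ∀ a t → + 4 * a + + 3 + t * + 24 - + 3 ≡ + 4 * (a + + 6 * t)
    lemma₂ = solve-∀

  χ-2 : ∀ a t → + c ≡ + a + + 6 * t → χ (+ 2) ≡ - sgn (+ a)
  χ-2 a t eq = trans χ-two (cong -_ (trans (cong sgn (trans eq (lemma (+ a) t))) (trans (sgn-+ (+ a) (+ 3 * t + + 3 * t)) (trans (cong (sgn (+ a) *_) (sgn-even (+ 3 * t))) (ℤ.*-identityʳ (sgn (+ a)))))))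
    where
    lemma : ∀ a t → a + + 6 * t ≡ a + (+ 3 * t + + 3 * t)
    lemma = solve-∀

  χ-3 : ∀ a t → + c ≡ + a + + 6 * t → ∀ y b → + y + (+ 4 * + a + + 3) ≡ b * + 3 → χ (+ 3) ≡ legendre y 3
  χ-3 a t eq y b yb = χ-prime {1} prime-3 y (≈-by (divides (b + + 8 * t) (trans (cong (λ z → + y - - z) (trans (conductor-ℤ c) (cong (λ z → + 4 * z + + 3) eq)))
      (trans (lemma (+ y) (+ a) t) (trans (cong (_+ + 8 * t * + 3) yb) (sym (ℤ.*-distribʳ-+ (+ 3) b (+ 8 * t))))))))
    where
    lemma : ∀ y a t → y - - (+ 4 * (a + + 6 * t) + + 3) ≡ y + (+ 4 * a + + 3) + + 8 * t * + 3
    lemma = solve-∀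

  private
    E₀ E₁ E₂ E₃ E₄ E₅ : ℤ
    E₀ = E (- + conductor c) 12 0
    E₁ = E (- + conductor c) 12 1
    E₂ = E (- + conductor c) 12 2
    E₃ = E (- + conductor c) 12 3
    E₄ = E (- + conductor c) 12 4
    E₅ = E (- + conductor c) 12 5

    1*h : + 1 * h ≡ h
    1*h = ℤ.*-identityˡ h

    -1*h : -1ℤ * h ≡ - h
    -1*h = ℤ.-1*i≡-i h

    transfer : ∀ a₁ a₂ a₃ a₄ a₅ {b₁ b₂ b₃ b₄ b₅} →
      e 1 ≡ a₁ * h - e 0 × e 2 ≡ a₂ * h × e 3 ≡ a₃ * h × e 4 ≡ a₄ * h - e 0 × e 5 ≡ a₅ * h + e 0 →
      a₁ * h ≡ b₁ → a₂ * h ≡ b₂ → a₃ * h ≡ b₃ → a₄ * h ≡ b₄ → a₅ * h ≡ b₅ →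
      E₁ ≡ b₁ - E₀ × E₂ ≡ b₂ × E₃ ≡ b₃ × E₄ ≡ b₄ - E₀ × E₅ ≡ b₅ + E₀
    transfer a₁ a₂ a₃ a₄ a₅ (p₁ , p₂ , p₃ , p₄ , p₅) q₁ q₂ q₃ q₄ q₅ =
      trans (E≡e 1) (trans p₁ (cong₂ _-_ q₁ (sym (E≡e 0)))) ,
      trans (E≡e 2) (trans p₂ q₂) ,
      trans (E≡e 3) (trans p₃ q₃) ,
      trans (E≡e 4) (trans p₄ (cong₂ _-_ q₄ (sym (E≡e 0)))) ,
      trans (E≡e 5) (trans p₅ (cong₂ _+_ q₅ (sym (E≡e 0))))

  case-23 : N % 24 ≡ 23 → E₁ ≡ h - E₀ × E₂ ≡ + 0 × E₃ ≡ + 0 × E₄ ≡ h - E₀ × E₅ ≡ - h + E₀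
  case-23 eq = transfer (+ 1) (+ 0) (+ 0) (+ 1) -1ℤ (solution (χ-2 5 t c≡) (χ-3 5 t c≡ 1 (+ 8) refl) (+ 1) (+ 0) (+ 0) (+ 1) -1ℤ refl refl refl refl refl)
      1*h (ℤ.*-zeroˡ h) (ℤ.*-zeroˡ h) 1*h -1*h
    where
    t = proj₁ (residue 5 eq)
    c≡ = proj₂ (residue 5 eq)

  case-11 : N % 24 ≡ 11 → E₁ ≡ h - E₀ × E₂ ≡ - h × E₃ ≡ h × E₄ ≡ h - E₀ × E₅ ≡ h + E₀
  case-11 eq = transfer (+ 1) -1ℤ (+ 1) (+ 1) (+ 1) (solution (χ-2 2 t c≡) (χ-3 2 t c≡ 1 (+ 4) refl) (+ 1) -1ℤ (+ 1) (+ 1) (+ 1) refl refl refl refl refl)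
      1*h -1*h 1*h 1*h 1*h
    where
    t = proj₁ (residue 2 eq)
    c≡ = proj₂ (residue 2 eq)

  case-7 : N % 24 ≡ 7 → E₁ ≡ h - E₀ × E₂ ≡ + 0 × E₃ ≡ h × E₄ ≡ - E₀ × E₅ ≡ - h + E₀
  case-7 eq = (λ (p₁ , p₂ , p₃ , p₄ , p₅) → p₁ , p₂ , p₃ , trans p₄ (ℤ.+-identityˡ (- E₀)) , p₅)
      (transfer (+ 1) (+ 0) (+ 1) (+ 0) -1ℤ (solution (χ-2 1 t c≡) (χ-3 1 t c≡ 2 (+ 3) refl) (+ 1) (+ 0) (+ 1) (+ 0) -1ℤ refl refl refl refl refl)
        1*h (ℤ.*-zeroˡ h) 1*h (ℤ.*-zeroˡ h) -1*h)
    where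
    t = proj₁ (residue 1 eq)
    c≡ = proj₂ (residue 1 eq)

  case-19 : N % 24 ≡ 19 → E₁ ≡ - h - E₀ × E₂ ≡ h × E₃ ≡ + 2 * h × E₄ ≡ + 2 * h - E₀ × E₅ ≡ - h + E₀
  case-19 eq = transfer -1ℤ (+ 1) (+ 2) (+ 2) -1ℤ (solution (χ-2 4 t c≡) (χ-3 4 t c≡ 2 (+ 7) refl) -1ℤ (+ 1) (+ 2) (+ 2) -1ℤ refl refl refl refl refl)
      -1*h 1*h refl refl -1*h
    where
    t = proj₁ (residue 4 eq)
    c≡ = proj₂ (residue 4 eq)

theorem4p4 :
  ∀ (D : ℤ) → D < - (+ 4) → SquareFree D → D %ℕ 4 ≡ 1 → ¬ (+ 3 ∣ D) →
  ∀ (n : ℕ) → IsClassNumber D n →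
  let N = ∣ D ∣
      h = + n
      E₀ = E D 12 0
      E₁ = E D 12 1
      E₂ = E D 12 2
      E₃ = E D 12 3
      E₄ = E D 12 4
      E₅ = E D 12 5
  in
    (N % 24 ≡ 23 →
      E₁ ≡ h - E₀ × E₂ ≡ + 0 × E₃ ≡ + 0 × E₄ ≡ h - E₀ × E₅ ≡ - h + E₀)
    ×
    (N % 24 ≡ 11 →
      E₁ ≡ h - E₀ × E₂ ≡ - h × E₃ ≡ h × E₄ ≡ h - E₀ × E₅ ≡ h + E₀)
    ×
    (N % 24 ≡ 7 →
      E₁ ≡ h - E₀ × E₂ ≡ + 0 × E₃ ≡ h × E₄ ≡ - E₀ × E₅ ≡ - h + E₀)
    ×
    (N % 24 ≡ 19 →
      E₁ ≡ - h - E₀ × E₂ ≡ h × E₃ ≡ + 2 * h × E₄ ≡ + 2 * h - E₀ × E₅ ≡ - h + E₀)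
theorem4p4 D D<-4 squareFree D≡1 3∤D n classes = go (discriminant D D<-4 D≡1) squareFree 3∤D classes
  where
  go : ∃[ c ] 1 ℕ.≤ c × D ≡ - + conductor c → SquareFree D → ¬ + 3 ∣ D → IsClassNumber D n → _
  go (c , 1≤c , refl) squareFree 3∤D classes = case-23 , case-11 , case-7 , case-19
    where open Theorem c 1≤c squareFree 3∤D n classes
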